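{- Let $d\ge 1$ be an integer and let $\Delta=\operatorname{conv}(v_1,\ldots,v_{2d})\subset\mathbb{R}^{2d-1}$ be a $(2d-1)$-dimensional lattice simplex (with respect to $\mathbb{Z}^{2d-1}$) all of whose codimension-$1$ facets are basic lattice simplices. Then the following statements are equivalent: (1) for all $k=1,\ldots,d-1$ there are no lattice points in the interior of $k\Delta$, i.e. $\mathrm{Int}(k\Delta)\cap\mathbb{Z}^{2d-1}=\emptyset$; (2) $\Delta\cong\Delta_1*\cdots*\Delta_d$ for some $1$-dimensional lattice simplices (lattice segments) $\Delta_1,\ldots,\Delta_d\subset\mathbb{R}^d$.
   Context: A $k$-dimensional lattice simplex $\operatorname{conv}(w_1,\ldots,w_{k+1})\subset\mathbb{R}^m$ (vertices in $\mathbb{Z}^m$, affinely independent) is called basic if $w_1-w_{k+1},\ldots,w_k-w_{k+1}$ is part of a lattice basis of $\mathbb{Z}^m$ (equivalently, it is mapped onto $\operatorname{conv}(0,e_1,\ldots,e_k)$ by an affine unimodular isomorphism of $\mathbb{R}^m$). Cayley polytope: for lattice polytopes $\Sigma_1,\ldots,\Sigma_r\subset\mathbb{R}^d$ ($r\le d$), $\Sigma_1*\cdots*\Sigma_r$ is the convex hull of $e_1\times\Sigma_1,\ldots,e_r\times\Sigma_r$ in $\mathbb{R}^{r+d}=\mathbb{R}^r\times\mathbb{R}^d$, where $e_i$ are the standard basis vectors of $\mathbb{R}^r$; it lies in the affine hyperplane $H=\{x\in\mathbb{R}^{r+d}:x_1+\cdots+x_r=1\}$, which carries the affine lattice $H\cap\mathbb{Z}^{r+d}$.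 Here $\Delta\cong P$ for $P\subset H$ (with $r=d$, so $H$ has dimension $2d-1$) means there is an affine isomorphism $\varphi:\mathbb{R}^{2d-1}\to H$ with $\varphi(\mathbb{Z}^{2d-1})=H\cap\mathbb{Z}^{2d}$ and $\varphi(\Delta)=P$. -}

module Defs where

open import Data.Nat using (ℕ; zero; suc; _+_)
open import Data.Fin using (Fin; zero; suc; inject₁; fromℕ; punchIn; _↑ˡ_)
open import Data.Fin.Properties using () renaming (_≟_ to _≟ᶠ_)
open import Data.Integer using (ℤ; +_) renaming (_+_ to _+ℤ_; _*_ to _*ℤ_; _-_ to _-ℤ_)
open import Data.Rational using (ℚ; 0ℚ; 1ℚ; _/_; _≤_; _<_) renaming (_+_ to _+ℚ_; _*_ to _*ℚ_)
open import Data.Vec.Functional using (_++_)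
open import Data.Product using (Σ; _×_; ∃)
open import Data.Bool using (if_then_else_)
open import Relation.Nullary using (¬_; does)
open import Relation.Binary.PropositionalEquality using (_≡_)
open import Function.Definitions using (Injective)

Pt : ℕ → Set
Pt m = Fin m → ℤ

QPt : ℕ → Set
QPt m = Fin m → ℚ

ℤ→ℚ : ℤ → ℚ
ℤ→ℚ z = z / 1

ℕ→ℚ : ℕ → ℚ
ℕ→ℚ k = (+ k) / 1

toQ : ∀ {m} → Pt m → QPt m
toQ x t = ℤ→ℚ (x t)

_≋ℤ_ : ∀ {m} → Pt m → Pt m → Set
x ≋ℤ y = ∀ t → x t ≡ y t

_≋ℚ_ : ∀ {m} → QPt m → QPt m → Set
x ≋ℚ y = ∀ t → x t ≡ y t

sumℤ : ∀ {n} → (Fin n → ℤ) → ℤ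
sumℤ {zero} f = + 0
sumℤ {suc n} f = f zero +ℤ sumℤ (λ i → f (suc i))

sumℚ : ∀ {n} → (Fin n → ℚ) → ℚ
sumℚ {zero} f = 0ℚ
sumℚ {suc n} f = f zero +ℚ sumℚ (λ i → f (suc i))

combℤ : ∀ {n m} → (Fin n → ℤ) → (Fin n → Pt m) → Pt m
combℤ a p t = sumℤ (λ i → a i *ℤ p i t)

combℚ : ∀ {n m} → (Fin n → ℚ) → (Fin n → QPt m) → QPt m
combℚ a p t = sumℚ (λ i → a i *ℚ p i t)

AffIndep : ∀ {n m} → (Fin n → Pt m) → Set
AffIndep {n} {m} p =
  (λs : Fin n → ℚ) → sumℚ λs ≡ 0ℚ → combℚ λs (λ i → toQ (p i)) ≋ℚ (λ _ → 0ℚ) →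
  ∀ i → λs i ≡ 0ℚ

IsLatticeBasis : ∀ {m} → (Fin m → Pt m) → Set
IsLatticeBasis {m} b =
  ((z : Pt m) → ∃ λ (a : Fin m → ℤ) → combℤ a b ≋ℤ z) ×
  ((a : Fin m → ℤ) → combℤ a b ≋ℤ (λ _ → + 0) → ∀ i → a i ≡ + 0)

PartOfLatticeBasis : ∀ {k m} → (Fin k → Pt m) → Set
PartOfLatticeBasis {k} {m} u =
  Σ (Fin m → Pt m) λ b → Σ (Fin k → Fin m) λ ι →
    Injective _≡_ _≡_ ι × IsLatticeBasis b × (∀ i → b (ι i) ≡ u i)

IsBasic : ∀ {k m} → (Fin (suc k) → Pt m) → Set
IsBasic {k} {m} w =
  AffIndep w ×
  PartOfLatticeBasis (λ (i : Fin k) → λ t → w (inject₁ i) t -ℤ w (fromℕ k) t)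

InConv : ∀ {N m} → (Fin N → QPt m) → QPt m → Set
InConv {N} {m} p x =
  Σ (Fin N → ℚ) λ λs → (∀ i → 0ℚ ≤ λs i) × sumℚ λs ≡ 1ℚ × combℚ λs p ≋ℚ x

-- x ∈ Int(k Δ) for the full-dimensional simplex Δ = conv(v_1,…,v_{m+1}) ⊂ ℝ^m:
-- x = k·y with y in the interior of Δ, i.e. with all barycentric coordinates > 0.
InIntMultiple : ∀ {m} → ℕ → (Fin (suc m) → Pt m) → Pt m → Set
InIntMultiple {m} k v x =
  Σ (Fin (suc m) → ℚ) λ λs → (∀ i → 0ℚ < λs i) × sumℚ λs ≡ 1ℚ ×
    ((λ t → ℕ→ℚ k *ℚ combℚ λs (λ i → toQ (v i)) t) ≋ℚ toQ x)

-- Affine maps ℝ^m → ℝ^M, x ↦ c + A x, with integral c and A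
-- (any affine map sending ℤ^m into ℤ^M has this form).
record AffMap (m M : ℕ) : Set where
  field
    c : Pt M
    A : Fin M → Fin m → ℤ

applyℤ : ∀ {m M} → AffMap m M → Pt m → Pt M
applyℤ φ x t = AffMap.c φ t +ℤ sumℤ (λ j → AffMap.A φ t j *ℤ x j)

applyℚ : ∀ {m M} → AffMap m M → QPt m → QPt M
applyℚ φ x t = ℤ→ℚ (AffMap.c φ t) +ℚ sumℚ (λ j → ℤ→ℚ (AffMap.A φ t j) *ℚ x j)

InH : ∀ r {d} → QPt (r + d) → Set
InH r {d} y = sumℚ (λ (i : Fin r) → y (i ↑ˡ d)) ≡ 1ℚ

IsLatticeIsoOntoH : ∀ m r d → AffMap m (r + d) → Set
IsLatticeIsoOntoH m r d φ =
  -- φ maps ℝ^m into H (checked on ℚ^m; affine, so equivalent)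
  ((x : QPt m) → InH r (applyℚ φ x)) ×
  -- φ is injective (hence, dim H = m being assumed, a bijection ℝ^m → H)
  ((x y : QPt m) → applyℚ φ x ≋ℚ applyℚ φ y → x ≋ℚ y) ×
  ((y : Pt (r + d)) → InH r (toQ y) → ∃ λ (x : Pt m) → applyℤ φ x ≋ℤ y)

unitVec : ∀ {r} → Fin r → Pt r
unitVec i t = if does (i ≟ᶠ t) then + 1 else + 0

-- vertex family of the Cayley polytope Δ_1 * ⋯ * Δ_r of segments
-- Δ_i = conv(a_i, b_i) ⊂ ℝ^d : points e_i × a_i and e_i × b_i in ℝ^{r+d}
cayleyVerts : ∀ {r d} → (Fin r → Pt d) → (Fin r → Pt d) → Fin (r + r) → Pt (r + d)
cayleyVerts a b = (λ i → unitVec i ++ a i) ++ (λ i → unitVec i ++ b i)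

seg : ∀ {d} → Pt d → Pt d → Fin 2 → Pt d
seg p q zero = p
seg p q (suc _) = q

MapsOnto : ∀ {m M N K} → AffMap m M → (Fin N → Pt m) → (Fin K → Pt M) → Set
MapsOnto {m} {M} φ v w =
  (y : QPt M) →
    (InConv (λ j → toQ (w j)) y → ∃ λ (x : QPt m) → InConv (λ i → toQ (v i)) x × applyℚ φ x ≋ℚ y) ×
    ((x : QPt m) → InConv (λ i → toQ (v i)) x → applyℚ φ x ≋ℚ y → InConv (λ j → toQ (w j)) y)

-- Statement (1): no lattice points in Int(kΔ) for k = 1, …, d-1  (here d = suc e)
NoInteriorPoints : ∀ e {m} → (Fin (suc m) → Pt m) → Set
NoInteriorPoints e {m} v =
  (k : ℕ) → 1 Data.Nat.≤ k → k Data.Nat.≤ e → (x : Pt m) → ¬ InIntMultiple k v x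

IsCayleyOfSegments : ∀ d {m} → (Fin (suc m) → Pt m) → Set
IsCayleyOfSegments d {m} v =
  Σ (Fin d → Pt d) λ a → Σ (Fin d → Pt d) λ b →
    (∀ i → AffIndep (seg (a i) (b i))) ×
    Σ (AffMap m (d + d)) λ φ →
      IsLatticeIsoOntoH m d d φ × MapsOnto φ v (cayleyVerts a b)

{-# OPTIONS --safe #-}
-- Since the facets are basic, ℤ^(2d-1) modulo the lattice of the vertices v₀, …, v₂ₑ₊₁ (e = d - 1) is cyclic of some
-- order n, generated by a vector Γ with nΓ = Σ aᵢ vᵢ, Σ aᵢ = 0 and all aᵢ units mod n.  For r ≢ 0 the numbers r aᵢ mod n
-- are the barycentric coordinates, scaled by n, of a lattice point in Int(kΔ), where kn is their sum; so (1), for r and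
-- for -r, says that Σ (r aᵢ mod n) = dn for every r ≢ 0.
--
-- The arithmetic heart is that such aᵢ fall into d pairs with aᵢ + aⱼ ≡ 0 (mod n); given the pairs, the sums of the
-- barycentric coordinates over the pairs are the first d coordinates of the isomorphism in (2).  For the pairing one
-- must show that the odd function h(m) = #{i : aᵢ m ≡ 1} - #{i : aᵢ m ≡ -1} vanishes; this is equivalent to L(1, χ) ≠ 0
-- for all odd characters χ.  The sums being constant, the finite Fourier transform (sawtooth to cotangent) gives
-- Σ_{m ≤ x} h(km)/m = O(1/x) for every k, i.e. the series Σ h(km)/m vanish.  Let χ₀ be the indicator of the units mod n
-- and E(N) = Σ h(km) h(km′) χ₀(a) χ₀(b), over all k mod n and all mam′b = N.  By Ingham's identity E(N) is a sum of
-- squares of divisor sums when N is prime to n, and E(D²) ≥ Σ h(k)²; hence the average of E grows unless h = 0, whereas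
-- the bounds above keep it small.
--
-- All analysis is done over ℚ: cos and sin are replaced by the real and imaginary parts P, Q of (1 + √-y)ᵐ, and the
-- value y = tan²(π/M) with Q = 0 by a sequence of rational approximations.
--
-- For (2) ⇒ (1), the first d coordinates of the isomorphism are integral and positive on Int(kΔ) and add up to k.
module Submission where

-- The Fourier identity is used at level M = nL with L free. Summing the cotangents over a residue
-- class mod n removes every frequency except those of level n, so only the sums of r aᵢ mod n
-- survive; but at level M the cotangent of πm/M is nearly proportional to 1/m for small m, and a
-- large L therefore turns a finite identity into a bound for the series. The second obstacle is
-- that E is quadratic in h while the bounds are linear: for fixed k they control A(i) = Σ h(km)
-- χ₀(a) w(ma/qⁱ) with a continuous cutoff w. The sum of A(i) A(I - i) over k and over the scales i
-- carries the weight Σ w(M/qⁱ) w(M′/q^(I - i)) at M = ma, M′ = m′b. When q is close to 1 this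
-- depends, up to a small error, on MM′ only, so the sum is an average of E with nonnegative
-- weights. The final count needs no logarithms: V³ squares contribute to the average, while the
-- harmonic sums in the bound for A(i) are O(V) by a crude estimate, and V³ outgrows V².

-- Sums over initial segments of ℕ in a commutative ring.

module Sums where

  open import Algebra.Bundles using (CommutativeRing)
  open import Data.Fin.Base as Fin using (Fin; toℕ; fromℕ<)
  import Data.Fin.Properties as Fin
  open import Data.Fin.Permutation using (Permutation; permutation)
  open import Data.Nat.Base as ℕ using (ℕ; zero; suc; _∸_; s≤s; z≤n)
  import Data.Nat.Properties as ℕ
  open import Function.Base using (_∘_)
  open import Level using (0ℓ)
  open import Relation.Binary.PropositionalEquality as ≡ using (_≡_; _≢_)

  module RangeSum (R : CommutativeRing 0ℓ 0ℓ) where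
    open CommutativeRing R hiding (zero)
    open import Algebra.Properties.CommutativeMonoid.Sum +-commutativeMonoid using (sum; sum-permute; sum-cong-≋)
    open import Algebra.Properties.CommutativeSemigroup +-commutativeSemigroup using (interchange)
    open import Relation.Binary.Reasoning.Setoid setoid

    ∑ : ℕ → (ℕ → Carrier) → Carrier
    ∑ zero    f = 0#
    ∑ (suc N) f = f zero + ∑ N (λ i → f (suc i))

    private
      ∑≡sum : ∀ N f → ∑ N f ≡ sum {N} (λ i → f (toℕ i))
      ∑≡sum zero    f = ≡.refl
      ∑≡sum (suc N) f = ≡.cong (f zero +_) (∑≡sum N (λ i → f (suc i)))

    ∑-cong : ∀ N {f g} → (∀ i → i ℕ.< N → f i ≈ g i) → ∑ N f ≈ ∑ N g
    ∑-cong zero    eq = refl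
    ∑-cong (suc N) eq = +-cong (eq zero (s≤s z≤n)) (∑-cong N (λ i i<N → eq (suc i) (s≤s i<N)))

    ∑-cong′ : ∀ N {f g} → (∀ i → f i ≈ g i) → ∑ N f ≈ ∑ N g
    ∑-cong′ N eq = ∑-cong N (λ i _ → eq i)

    ∑-zero : ∀ N {f} → (∀ i → i ℕ.< N → f i ≈ 0#) → ∑ N f ≈ 0#
    ∑-zero zero    eq = refl
    ∑-zero (suc N) eq = trans (+-cong (eq zero (s≤s z≤n)) (∑-zero N (λ i i<N → eq (suc i) (s≤s i<N)))) (+-identityˡ 0#)

    ∑-+ : ∀ N f g → ∑ N (λ i → f i + g i) ≈ ∑ N f + ∑ N g
    ∑-+ zero    f g = sym (+-identityˡ 0#)
    ∑-+ (suc N) f g = trans (+-congˡ (∑-+ N _ _)) (interchange _ _ _ _)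

    ∑-swap : ∀ M N (f : ℕ → ℕ → Carrier) →
             ∑ M (λ i → ∑ N (f i)) ≈ ∑ N (λ j → ∑ M (λ i → f i j))
    ∑-swap zero    N f = sym (∑-zero N λ _ _ → refl)
    ∑-swap (suc M) N f = trans (+-congˡ (∑-swap M N (λ i → f (suc i)))) (sym (∑-+ N _ _))

    ∑-*ˡ : ∀ N x f → x * ∑ N f ≈ ∑ N (λ i → x * f i)
    ∑-*ˡ zero    x f = zeroʳ x
    ∑-*ˡ (suc N) x f = trans (distribˡ x _ _) (+-congˡ (∑-*ˡ N x _))

    ∑-*ʳ : ∀ N x f → ∑ N f * x ≈ ∑ N (λ i → f i * x)
    ∑-*ʳ zero    x f = zeroˡ x
    ∑-*ʳ (suc N) x f = trans (distribʳ x _ _) (+-congˡ (∑-*ʳ N x _))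

    ∑-split : ∀ M N f → ∑ (M ℕ.+ N) f ≈ ∑ M f + ∑ N (λ i → f (M ℕ.+ i))
    ∑-split zero    N f = sym (+-identityˡ _)
    ∑-split (suc M) N f = trans (+-congˡ (∑-split M N (f ∘ suc))) (sym (+-assoc _ _ _))

    ∑-last : ∀ N f → ∑ (suc N) f ≈ ∑ N f + f N
    ∑-last zero    f = trans (+-identityʳ _) (sym (+-identityˡ _))
    ∑-last (suc N) f = trans (+-congˡ (∑-last N (f ∘ suc))) (sym (+-assoc _ _ _))

    ∑-blocks : ∀ L n f → ∑ (L ℕ.* n) f ≈ ∑ L (λ l → ∑ n (λ r → f (l ℕ.* n ℕ.+ r)))
    ∑-blocks zero    n f = refl
    ∑-blocks (suc L) n f = begin
      ∑ (n ℕ.+ L ℕ.* n) f                                             ≈⟨ ∑-split n (L ℕ.* n) f ⟩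
      ∑ n f + ∑ (L ℕ.* n) (λ i → f (n ℕ.+ i))                         ≈⟨ +-congˡ (∑-blocks L n _) ⟩
      ∑ n f + ∑ L (λ l → ∑ n (λ r → f (n ℕ.+ (l ℕ.* n ℕ.+ r))))       ≈⟨ +-congˡ (∑-cong′ L λ l → ∑-cong′ n λ r →
                                                                          reflexive (≡.cong f (≡.sym (ℕ.+-assoc n (l ℕ.* n) r)))) ⟩
      ∑ n f + ∑ L (λ l → ∑ n (λ r → f (suc l ℕ.* n ℕ.+ r)))           ∎

    ∑-δ : ∀ N {f} i₀ → i₀ ℕ.< N → (∀ i → i ℕ.< N → i ≢ i₀ → f i ≈ 0#) → ∑ N f ≈ f i₀
    ∑-δ (suc N) zero _ off =
      trans (+-congˡ (∑-zero N λ i i<N → off (suc i) (s≤s i<N) λ ())) (+-identityʳ _)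
    ∑-δ (suc N) (suc i₀) (s≤s i₀<N) off =
      trans (+-cong (off zero (s≤s z≤n) λ ())
                    (∑-δ N i₀ i₀<N λ i i<N i≢ → off (suc i) (s≤s i<N) (i≢ ∘ ℕ.suc-injective)))
            (+-identityˡ _)

    ∑-extend : ∀ {M N} f → M ℕ.≤ N → (∀ i → M ℕ.≤ i → f i ≈ 0#) → ∑ N f ≈ ∑ M f
    ∑-extend {M} {N} f M≤N off = begin
      ∑ N f                                      ≡⟨ ≡.cong (λ k → ∑ k f) (≡.sym (ℕ.m+[n∸m]≡n M≤N)) ⟩
      ∑ (M ℕ.+ (N ∸ M)) f                        ≈⟨ ∑-split M (N ∸ M) f ⟩
      ∑ M f + ∑ (N ∸ M) (λ i → f (M ℕ.+ i))      ≈⟨ +-congˡ (∑-zero (N ∸ M) λ i _ → off _ (ℕ.m≤m+n M i)) ⟩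
      ∑ M f + 0#                                 ≈⟨ +-identityʳ _ ⟩
      ∑ M f                                      ∎

    ∑-permute : ∀ N f (π π⁻¹ : ℕ → ℕ) →
                (∀ i → i ℕ.< N → π i ℕ.< N) → (∀ i → i ℕ.< N → π⁻¹ i ℕ.< N) →
                (∀ i → i ℕ.< N → π (π⁻¹ i) ≡ i) → (∀ i → i ℕ.< N → π⁻¹ (π i) ≡ i) →
                ∑ N f ≈ ∑ N (f ∘ π)
    ∑-permute N f π π⁻¹ π< π⁻¹< ππ⁻¹ π⁻¹π = begin
      ∑ N f                                   ≡⟨ ∑≡sum N f ⟩
      sum {N} (λ i → f (toℕ i))               ≈⟨ sum-permute (λ i → f (toℕ i)) perm ⟩
      sum {N} (λ i → f (toℕ (to i)))          ≈⟨ sum-cong-≋ {N} (λ i → reflexive (≡.cong f (Fin.toℕ-fromℕ< _))) ⟩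
      sum {N} (λ i → f (π (toℕ i)))           ≡⟨ ≡.sym (∑≡sum N (f ∘ π)) ⟩
      ∑ N (f ∘ π)                             ∎
      where
      to from : Fin N → Fin N
      to   i = fromℕ< (π< (toℕ i) (Fin.toℕ<n i))
      from i = fromℕ< (π⁻¹< (toℕ i) (Fin.toℕ<n i))
      perm : Permutation N N
      perm = permutation to from
        (λ i → Fin.toℕ-injective (≡.trans (Fin.toℕ-fromℕ< _)
                 (≡.trans (≡.cong π (Fin.toℕ-fromℕ< _)) (ππ⁻¹ _ (Fin.toℕ<n i)))))
        (λ i → Fin.toℕ-injective (≡.trans (Fin.toℕ-fromℕ< _)
                 (≡.trans (≡.cong π⁻¹ (Fin.toℕ-fromℕ< _)) (π⁻¹π _ (Fin.toℕ<n i)))))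

  ℕ∑ : ℕ → (ℕ → ℕ) → ℕ
  ℕ∑ zero    f = 0
  ℕ∑ (suc N) f = f zero ℕ.+ ℕ∑ N (λ i → f (suc i))

-- Ordered-field tools for ℚ, indicators and summation by parts.

module Kit where

  open import Data.Empty using (⊥-elim)
  open import Data.Integer.Base as ℤ using (ℤ; +_; -[1+_])
  import Data.Integer.Properties as ℤ
  open import Data.Maybe.Base using (Maybe; just; nothing)
  open import Data.Nat.Base as ℕ using (ℕ; zero; suc; s≤s; z≤n)
  import Data.Nat.Properties as ℕ
  open import Data.Product using (∃; _,_)
  open import Data.Rational
  open import Data.Rational.Properties
  open import Data.Rational.Unnormalised.Base as ℚᵘ using (mkℚᵘ; *≡*; *≤*)
  import Data.Rational.Unnormalised.Properties as ℚᵘ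
  open import Data.Sum using (inj₁; inj₂)
  open import Level using (0ℓ)
  open import Relation.Binary.PropositionalEquality using (_≡_; _≢_; refl; sym; trans; cong; cong₂; subst; subst₂)
  open import Relation.Nullary using (Dec; yes; no; ¬_)
  open import Tactic.RingSolver using (solve-∀)
  import Tactic.RingSolver.Core.AlmostCommutativeRing as ACR
  open Sums

  private
    0≟ : (x : ℚ) → Maybe (0ℚ ≡ x)
    0≟ x with 0ℚ ≟ x
    ... | yes p = just p
    ... | no _  = nothing

  ringℚ : ACR.AlmostCommutativeRing 0ℓ 0ℓ
  ringℚ = ACR.fromCommutativeRing +-*-commutativeRing 0≟

  private
    toℚᵘ-/1 : ∀ i → toℚᵘ (i / 1) ℚᵘ.≃ mkℚᵘ i 0
    toℚᵘ-/1 i = toℚᵘ-fromℚᵘ (mkℚᵘ i 0)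

  -- Sealed: otherwise unification tries to invert the normalisation of fractions.
  abstract
    fromℤ : ℤ → ℚ
    fromℤ i = i / 1

    fromℤ≡/1 : ∀ i → fromℤ i ≡ i / 1
    fromℤ≡/1 i = refl

    fromℤ-0 : fromℤ (+ 0) ≡ 0ℚ
    fromℤ-0 = refl

    fromℤ-1 : fromℤ (+ 1) ≡ 1ℚ
    fromℤ-1 = refl

    fromℤ-+ : ∀ i j → fromℤ (i ℤ.+ j) ≡ fromℤ i + fromℤ j
    fromℤ-+ i j = toℚᵘ-injective (ℚᵘ.≃-trans (toℚᵘ-/1 (i ℤ.+ j)) (ℚᵘ.≃-sym
      (ℚᵘ.≃-trans (toℚᵘ-homo-+ (i / 1) (j / 1))
        (ℚᵘ.≃-trans (ℚᵘ.+-cong (toℚᵘ-/1 i) (toℚᵘ-/1 j))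
          (*≡* (cong (ℤ._* + 1) (cong₂ ℤ._+_ (ℤ.*-identityʳ i) (ℤ.*-identityʳ j))))))))

    fromℤ-* : ∀ i j → fromℤ (i ℤ.* j) ≡ fromℤ i * fromℤ j
    fromℤ-* i j = toℚᵘ-injective (ℚᵘ.≃-trans (toℚᵘ-/1 (i ℤ.* j)) (ℚᵘ.≃-sym
      (ℚᵘ.≃-trans (toℚᵘ-homo-* (i / 1) (j / 1)) (ℚᵘ.*-cong (toℚᵘ-/1 i) (toℚᵘ-/1 j)))))

    fromℤ-mono : ∀ {i j} → i ℤ.≤ j → fromℤ i ≤ fromℤ j
    fromℤ-mono {i} {j} i≤j = toℚᵘ-cancel-≤ (ℚᵘ.≤-respˡ-≃ (ℚᵘ.≃-sym (toℚᵘ-/1 i))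
      (ℚᵘ.≤-respʳ-≃ (ℚᵘ.≃-sym (toℚᵘ-/1 j))
        (*≤* (subst₂ ℤ._≤_ (sym (ℤ.*-identityʳ i)) (sym (ℤ.*-identityʳ j)) i≤j))))

    fromℤ-injective : ∀ {i j} → fromℤ i ≡ fromℤ j → i ≡ j
    fromℤ-injective {i} {j} eq
      with ℚᵘ.≃-trans (ℚᵘ.≃-sym (toℚᵘ-/1 i)) (ℚᵘ.≃-trans (toℚᵘ-cong eq) (toℚᵘ-/1 j))
    ... | *≡* e = trans (sym (ℤ.*-identityʳ i)) (trans e (ℤ.*-identityʳ j))

  ι : ℕ → ℚ
  ι n = fromℤ (+ n)

  ι-+ : ∀ m n → ι (m ℕ.+ n) ≡ ι m + ι n
  ι-+ m n = fromℤ-+ (+ m) (+ n)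

  ι-* : ∀ m n → ι (m ℕ.* n) ≡ ι m * ι n
  ι-* m n = trans (cong fromℤ (ℤ.pos-* m n)) (fromℤ-* (+ m) (+ n))

  ι-suc : ∀ n → ι (suc n) ≡ 1ℚ + ι n
  ι-suc n = trans (ι-+ 1 n) (cong (_+ ι n) fromℤ-1)

  ι-mono : ∀ {m n} → m ℕ.≤ n → ι m ≤ ι n
  ι-mono m≤n = fromℤ-mono (ℤ.+≤+ m≤n)

  ι≥0 : ∀ n → 0ℚ ≤ ι n
  ι≥0 n = subst (_≤ ι n) fromℤ-0 (ι-mono z≤n)

  ι≥1 : ∀ n → 1ℚ ≤ ι (suc n)
  ι≥1 n = subst (_≤ ι (suc n)) fromℤ-1 (ι-mono (s≤s z≤n))

  0<1 : 0ℚ < 1ℚ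
  0<1 = positive⁻¹ 1ℚ

  0≤1 : 0ℚ ≤ 1ℚ
  0≤1 = <⇒≤ 0<1

  ι>0 : ∀ n → 0ℚ < ι (suc n)
  ι>0 n = <-≤-trans 0<1 (ι≥1 n)

  fromℤ≥1 : ∀ {i} → 0ℚ < fromℤ i → + 1 ℤ.≤ i
  fromℤ≥1 {+ zero}    lt = ⊥-elim (<-irrefl (sym fromℤ-0) lt)
  fromℤ≥1 {+ suc i}   lt = ℤ.+≤+ (s≤s z≤n)
  fromℤ≥1 { -[1+ i ]} lt = ⊥-elim (<-irrefl (sym fromℤ-0) (<-≤-trans lt (fromℤ-mono { -[1+ i ]} {+ 0} ℤ.-≤+)))

  diff : ∀ {x y} → x ≤ y → 0ℚ ≤ y - x
  diff {x} {y} x≤y = subst (_≤ y - x) (+-inverseʳ x) (+-monoˡ-≤ (- x) x≤y)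

  ≤-by : ∀ {x y} e → 0ℚ ≤ e → x + e ≡ y → x ≤ y
  ≤-by {x} e 0≤e refl = subst (_≤ x + e) (+-identityʳ x) (+-monoʳ-≤ x 0≤e)

  <-by : ∀ {x y} e → 0ℚ < e → x + e ≡ y → x < y
  <-by {x} e 0<e refl = subst (_< x + e) (+-identityʳ x) (+-monoʳ-< x 0<e)

  +≥0 : ∀ {x y} → 0ℚ ≤ x → 0ℚ ≤ y → 0ℚ ≤ x + y
  +≥0 = +-mono-≤

  *≥0 : ∀ {x y} → 0ℚ ≤ x → 0ℚ ≤ y → 0ℚ ≤ x * y
  *≥0 {x} {y} 0≤x 0≤y = nonNegative⁻¹ _ {{nonNeg*nonNeg⇒nonNeg x {{nonNegative 0≤x}} y {{nonNegative 0≤y}}}}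

  *>0 : ∀ {x y} → 0ℚ < x → 0ℚ < y → 0ℚ < x * y
  *>0 {x} {y} 0<x 0<y = positive⁻¹ _ {{pos*pos⇒pos x {{positive 0<x}} y {{positive 0<y}}}}

  *-monoˡ : ∀ {z x y} → 0ℚ ≤ z → x ≤ y → z * x ≤ z * y
  *-monoˡ {z} 0≤z = *-monoˡ-≤-nonNeg z {{nonNegative 0≤z}}

  *-monoʳ : ∀ {z x y} → 0ℚ ≤ z → x ≤ y → x * z ≤ y * z
  *-monoʳ {z} 0≤z = *-monoʳ-≤-nonNeg z {{nonNegative 0≤z}}

  *-mono : ∀ {x y x′ y′} → 0ℚ ≤ x → x ≤ x′ → 0ℚ ≤ y → y ≤ y′ → x * y ≤ x′ * y′
  *-mono 0≤x x≤x′ 0≤y y≤y′ = ≤-trans (*-monoʳ 0≤y x≤x′) (*-monoˡ (≤-trans 0≤x x≤x′) y≤y′)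

  *-cancelˡ-≤ : ∀ {z x y} → 0ℚ < z → z * x ≤ z * y → x ≤ y
  *-cancelˡ-≤ {z} 0<z = *-cancelˡ-≤-pos z {{positive 0<z}}

  *-cancelˡ-≡ : ∀ {z x y} → 0ℚ < z → z * x ≡ z * y → x ≡ y
  *-cancelˡ-≡ 0<z eq = ≤-antisym (*-cancelˡ-≤ 0<z (≤-reflexive eq)) (*-cancelˡ-≤ 0<z (≤-reflexive (sym eq)))

  sq≥0 : ∀ x → 0ℚ ≤ x * x
  sq≥0 x with ≤-total 0ℚ x
  ... | inj₁ 0≤x = *≥0 0≤x 0≤x
  ... | inj₂ x≤0 = subst (0ℚ ≤_) (neg-sq x) (*≥0 (neg-antimono-≤ x≤0) (neg-antimono-≤ x≤0))
    where
    neg-sq : ∀ x → (- x) * (- x) ≡ x * x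
    neg-sq = solve-∀ ringℚ

  <⇒≱ : ∀ {x y} → x < y → ¬ y ≤ x
  <⇒≱ x<y y≤x = <-irrefl refl (<-≤-trans x<y y≤x)

  -- Total, with the junk value inv 0 = 0.
  abstract
    inv : ℚ → ℚ
    inv x with x ≟ 0ℚ
    ... | yes _  = 0ℚ
    ... | no x≢0 = (1/ x) {{≢-nonZero x≢0}}

    *-inv : ∀ {x} → x ≢ 0ℚ → x * inv x ≡ 1ℚ
    *-inv {x} x≢0 with x ≟ 0ℚ
    ... | yes x≡0 = ⊥-elim (x≢0 x≡0)
    ... | no x≢0  = *-inverseʳ x {{≢-nonZero x≢0}}

  0<⇒≢0 : ∀ {x} → 0ℚ < x → x ≢ 0ℚ
  0<⇒≢0 0<x refl = <-irrefl refl 0<x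

  *-inv⁺ : ∀ {x} → 0ℚ < x → x * inv x ≡ 1ℚ
  *-inv⁺ 0<x = *-inv (0<⇒≢0 0<x)

  inv>0 : ∀ {x} → 0ℚ < x → 0ℚ < inv x
  inv>0 {x} 0<x with 0ℚ <? inv x
  ... | yes p = p
  ... | no ¬p = ⊥-elim (<⇒≱ 0<1 (subst (_≤ 0ℚ) (*-inv⁺ 0<x)
                  (subst (x * inv x ≤_) (*-zeroʳ x) (*-monoˡ (<⇒≤ 0<x) (≮⇒≥ ¬p)))))

  inv≥0 : ∀ {x} → 0ℚ < x → 0ℚ ≤ inv x
  inv≥0 0<x = <⇒≤ (inv>0 0<x)

  inv-unique : ∀ {x y} → 0ℚ < x → x * y ≡ 1ℚ → y ≡ inv x
  inv-unique 0<x eq = *-cancelˡ-≡ 0<x (trans eq (sym (*-inv⁺ 0<x)))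

  inv-anti : ∀ {x y} → 0ℚ < x → x ≤ y → inv y ≤ inv x
  inv-anti {x} {y} 0<x x≤y = *-cancelˡ-≤ (*>0 0<x 0<y)
    (subst₂ _≤_ (trans (trans (sym (*-identityʳ x)) (cong (x *_) (sym (*-inv⁺ 0<y)))) (sym (*-assoc x y (inv y))))
                (trans (trans (sym (*-identityˡ y)) (cong (_* y) (sym (*-inv⁺ 0<x)))) (swap x (inv x) y)) x≤y)
    where
    0<y = <-≤-trans 0<x x≤y
    swap : ∀ a b c → a * b * c ≡ a * c * b
    swap = solve-∀ ringℚ

  ≤-inv : ∀ {x y z} → 0ℚ < z → z * x ≤ y → x ≤ y * inv z
  ≤-inv {x} {y} {z} 0<z le = *-cancelˡ-≤ 0<z (≤-trans le (≤-reflexive (sym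
    (trans (rearrange z y (inv z)) (trans (cong (y *_) (*-inv⁺ 0<z)) (*-identityʳ y))))))
    where
    rearrange : ∀ z y i → z * (y * i) ≡ y * (z * i)
    rearrange = solve-∀ ringℚ

  x≤∣x∣ : ∀ x → x ≤ ∣ x ∣
  x≤∣x∣ x with ≤-total 0ℚ x
  ... | inj₁ 0≤x = ≤-reflexive (sym (0≤p⇒∣p∣≡p 0≤x))
  ... | inj₂ x≤0 = ≤-trans x≤0 (0≤∣p∣ x)

  -x≤∣x∣ : ∀ x → - x ≤ ∣ x ∣
  -x≤∣x∣ x = subst (- x ≤_) (∣-p∣≡∣p∣ x) (x≤∣x∣ (- x))

  ∣∣≤ : ∀ {x b} → x ≤ b → - x ≤ b → ∣ x ∣ ≤ b
  ∣∣≤ {x} x≤b -x≤b with ∣p∣≡p∨∣p∣≡-p x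
  ... | inj₁ eq = subst (_≤ _) (sym eq) x≤b
  ... | inj₂ eq = subst (_≤ _) (sym eq) -x≤b

  ∣∣-+ : ∀ {x y a b} → ∣ x ∣ ≤ a → ∣ y ∣ ≤ b → ∣ x + y ∣ ≤ a + b
  ∣∣-+ {x} {y} p q = ≤-trans (∣p+q∣≤∣p∣+∣q∣ x y) (+-mono-≤ p q)

  ∣∣-- : ∀ {x y a b} → ∣ x ∣ ≤ a → ∣ y ∣ ≤ b → ∣ x - y ∣ ≤ a + b
  ∣∣-- {x} {y} p q = ≤-trans (∣p-q∣≤∣p∣+∣q∣ x y) (+-mono-≤ p q)

  ∣∣-* : ∀ {x y a b} → ∣ x ∣ ≤ a → ∣ y ∣ ≤ b → ∣ x * y ∣ ≤ a * b
  ∣∣-* {x} {y} p q = subst (_≤ _) (sym (∣p*q∣≡∣p∣*∣q∣ x y)) (*-mono (0≤∣p∣ x) p (0≤∣p∣ y) q)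

  ∣∣-nonNeg : ∀ {x y} → 0ℚ ≤ x → x ≤ y → ∣ x ∣ ≤ y
  ∣∣-nonNeg 0≤x x≤y = subst (_≤ _) (sym (0≤p⇒∣p∣≡p 0≤x)) x≤y

  archimedean : ∀ x → ∃ λ N → x ≤ ι N
  archimedean x = ℤ.∣ ↥ x ∣ , toℚᵘ-cancel-≤ (ℚᵘ.≤-respʳ-≃ (ℚᵘ.≃-sym (ℚᵘ.≃-trans (toℚᵘ-cong (fromℤ≡/1 _)) (toℚᵘ-/1 (+ ℤ.∣ ↥ x ∣)))) (lemma x))
    where
    i≤∣i∣ : ∀ i → i ℤ.≤ + ℤ.∣ i ∣
    i≤∣i∣ (+ n)    = ℤ.≤-refl
    i≤∣i∣ -[1+ n ] = ℤ.-≤+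
    lemma : ∀ x → toℚᵘ x ℚᵘ.≤ mkℚᵘ (+ ℤ.∣ ↥ x ∣) 0
    lemma (mkℚ i d _) = *≤* (subst (ℤ._≤ + ℤ.∣ i ∣ ℤ.* + suc d) (sym (ℤ.*-identityʳ i))
      (ℤ.≤-trans (i≤∣i∣ i) (subst (+ ℤ.∣ i ∣ ℤ.≤_) (ℤ.pos-* ℤ.∣ i ∣ (suc d))
        (ℤ.+≤+ (ℕ.m≤m*n ℤ.∣ i ∣ (suc d))))))

  ≤0-by-archimedean : ∀ {x} C → (∀ N → ι N * x ≤ C) → x ≤ 0ℚ
  ≤0-by-archimedean {x} C bound with x ≤? 0ℚ
  ... | yes p = p
  ... | no ¬p with archimedean (C * inv x)
  -- With N ≥ C/x the next multiple is already too large: (N + 1)x ≥ C + x > C.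
  ...   | N , le = ⊥-elim (<⇒≱ (<-by x 0<x refl) (≤-trans contra (bound (suc N))))
    where
    0<x = ≰⇒> ¬p
    expand : ∀ i x → (1ℚ + i) * x ≡ i * x + x
    expand = solve-∀ ringℚ
    rearrange : ∀ c i x → c * i * x ≡ c * (x * i)
    rearrange = solve-∀ ringℚ
    contra : C + x ≤ ι (suc N) * x
    contra = subst₂ _≤_
      (cong (_+ x) (trans (rearrange C (inv x) x) (trans (cong (C *_) (*-inv⁺ 0<x)) (*-identityʳ C))))
      (sym (trans (cong (_* x) (ι-suc N)) (expand (ι N) x)))
      (+-monoˡ-≤ x (*-monoʳ (<⇒≤ 0<x) le))

  open RangeSum +-*-commutativeRing public

  ∑-mono : ∀ N {f g} → (∀ i → i ℕ.< N → f i ≤ g i) → ∑ N f ≤ ∑ N g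
  ∑-mono zero    le = ≤-refl
  ∑-mono (suc N) le = +-mono-≤ (le zero (s≤s z≤n)) (∑-mono N λ i i<N → le (suc i) (s≤s i<N))

  ∑-nonNeg : ∀ N {f} → (∀ i → i ℕ.< N → 0ℚ ≤ f i) → 0ℚ ≤ ∑ N f
  ∑-nonNeg zero    le = ≤-refl
  ∑-nonNeg (suc N) le = +≥0 (le zero (s≤s z≤n)) (∑-nonNeg N λ i i<N → le (suc i) (s≤s i<N))

  term≤∑ : ∀ N {f} i₀ → i₀ ℕ.< N → (∀ i → i ℕ.< N → 0ℚ ≤ f i) → f i₀ ≤ ∑ N f
  term≤∑ (suc N) {f} zero     _          le =
    ≤-by _ (∑-nonNeg N λ i i<N → le (suc i) (s≤s i<N)) refl
  term≤∑ (suc N) {f} (suc i₀) (s≤s i₀<N) le = ≤-trans (term≤∑ N i₀ i₀<N λ i i<N → le (suc i) (s≤s i<N))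
    (≤-by (f zero) (le zero (s≤s z≤n)) (+-comm _ (f zero)))

  ∑-abs : ∀ N {f g} → (∀ i → i ℕ.< N → ∣ f i ∣ ≤ g i) → ∣ ∑ N f ∣ ≤ ∑ N g
  ∑-abs zero    le = ≤-refl
  ∑-abs (suc N) le = ∣∣-+ (le zero (s≤s z≤n)) (∑-abs N λ i i<N → le (suc i) (s≤s i<N))

  ∑-const : ∀ N x → ∑ N (λ _ → x) ≡ ι N * x
  ∑-const zero    x = sym (trans (cong (_* x) fromℤ-0) (*-zeroˡ x))
  ∑-const (suc N) x = trans (cong (λ z → x + z) (∑-const N x))
    (trans (lemma (ι N) x) (cong (_* x) (sym (ι-suc N))))
    where
    lemma : ∀ i x → x + i * x ≡ (1ℚ + i) * x
    lemma = solve-∀ ringℚ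

  ∑-neg : ∀ N f → ∑ N (λ i → - f i) ≡ - ∑ N f
  ∑-neg zero    f = refl
  ∑-neg (suc N) f = trans (cong (λ z → - f zero + z) (∑-neg N _)) (sym (neg-distrib-+ (f zero) _))

  ∑-- : ∀ N f g → ∑ N (λ i → f i - g i) ≡ ∑ N f - ∑ N g
  ∑-- N f g = trans (∑-+ N f (λ i → - g i)) (cong (λ z → ∑ N f + z) (∑-neg N g))

  ⟦_⟧ : ∀ {P : Set} → Dec P → ℚ
  ⟦ yes _ ⟧ = 1ℚ
  ⟦ no _  ⟧ = 0ℚ

  ⟦⟧-yes : ∀ {P : Set} (d : Dec P) → P → ⟦ d ⟧ ≡ 1ℚ
  ⟦⟧-yes (yes _) p = refl
  ⟦⟧-yes (no ¬p) p = ⊥-elim (¬p p)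

  ⟦⟧-no : ∀ {P : Set} (d : Dec P) → ¬ P → ⟦ d ⟧ ≡ 0ℚ
  ⟦⟧-no (yes p) ¬p = ⊥-elim (¬p p)
  ⟦⟧-no (no _)  ¬p = refl

  ⟦⟧-cong : ∀ {P Q : Set} (d : Dec P) (e : Dec Q) → (P → Q) → (Q → P) → ⟦ d ⟧ ≡ ⟦ e ⟧
  ⟦⟧-cong (yes p) e f g = sym (⟦⟧-yes e (f p))
  ⟦⟧-cong (no ¬p) e f g = sym (⟦⟧-no e (λ q → ¬p (g q)))

  ⟦⟧≥0 : ∀ {P : Set} (d : Dec P) → 0ℚ ≤ ⟦ d ⟧
  ⟦⟧≥0 (yes _) = 0≤1
  ⟦⟧≥0 (no _)  = ≤-refl

  ⟦⟧≤1 : ∀ {P : Set} (d : Dec P) → ⟦ d ⟧ ≤ 1ℚ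
  ⟦⟧≤1 (yes _) = ≤-refl
  ⟦⟧≤1 (no _)  = 0≤1

  abel : ∀ N (f g : ℕ → ℚ) → ∑ (suc N) (λ i → f i * g i)
       ≡ ∑ (suc N) f * g N + ∑ N (λ i → ∑ (suc i) f * (g i - g (suc i)))
  abel zero    f g = lemma (f 0) (g 0)
    where
    lemma : ∀ x y → x * y + 0ℚ ≡ (x + 0ℚ) * y + 0ℚ
    lemma = solve-∀ ringℚ
  abel (suc N) f g = begin-equality
    ∑ (suc (suc N)) (λ i → f i * g i)
      ≡⟨ ∑-last (suc N) (λ i → f i * g i) ⟩
    ∑ (suc N) (λ i → f i * g i) + f (suc N) * g (suc N)
      ≡⟨ cong (_+ f (suc N) * g (suc N)) (abel N f g) ⟩
    F * g N + S + f (suc N) * g (suc N)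
      ≡⟨ lemma F (g N) S (f (suc N)) (g (suc N)) ⟩
    (F + f (suc N)) * g (suc N) + (S + F * (g N - g (suc N)))
      ≡⟨ cong₂ (λ u v → u * g (suc N) + v) (sym (∑-last (suc N) f))
           (sym (∑-last N (λ i → ∑ (suc i) f * (g i - g (suc i))))) ⟩
    ∑ (suc (suc N)) f * g (suc N) + ∑ (suc N) (λ i → ∑ (suc i) f * (g i - g (suc i)))
      ∎
    where
    open ≤-Reasoning
    F = ∑ (suc N) f
    S = ∑ N (λ i → ∑ (suc i) f * (g i - g (suc i)))
    lemma : ∀ F g S f g′ → F * g + S + f * g′ ≡ (F + f) * g′ + (S + F * (g - g′))
    lemma = solve-∀ ringℚ

  -- The cancellation in `f` is kept inside its partial sums, so only the last value and the
  -- variation of `g` are paid for. The majorant `v` is left free: in one use it is an estimate, in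
  -- another it telescopes because `g` is monotone.
  abel-bound : ∀ N (f g v : ℕ → ℚ) C → 0ℚ ≤ C → (∀ i → ∣ ∑ i f ∣ ≤ C) →
               (∀ i → i ℕ.< N → ∣ g i - g (suc i) ∣ ≤ v i) →
               ∣ ∑ (suc N) (λ i → f i * g i) ∣ ≤ C * (∣ g N ∣ + ∑ N v)
  abel-bound N f g v C 0≤C partial var = begin
    ∣ ∑ (suc N) (λ i → f i * g i) ∣     ≡⟨ cong ∣_∣ (abel N f g) ⟩
    _                                    ≤⟨ ∣∣-+ (∣∣-* (partial (suc N)) ≤-refl)
                                              (∑-abs N λ i i<N → ∣∣-* (partial (suc i)) (var i i<N)) ⟩
    C * ∣ g N ∣ + ∑ N (λ i → C * v i)    ≡⟨ cong (λ z → C * ∣ g N ∣ + z) (sym (∑-*ˡ N C v)) ⟩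
    C * ∣ g N ∣ + C * ∑ N v              ≡⟨ sym (*-distribˡ-+ C _ _) ⟩
    C * (∣ g N ∣ + ∑ N v)                ∎
    where open ≤-Reasoning

-- Congruences and units modulo n.

module Mod where

  open import Data.Nat.Base using (ℕ; suc; _+_; _*_; _∸_; _<_; NonZero)
  open import Data.Nat.Coprimality using (Coprime; coprime-Bézout)
  open import Data.Nat.Divisibility using (_∣_)
  open import Data.Nat.DivMod hiding (_mod_)
  open import Data.Nat.GCD using (module Bézout)
  open import Data.Nat.Properties
  open import Data.Nat.Tactic.RingSolver using (solve-∀)
  open import Data.Product using (∃; _,_)
  open import Relation.Binary.PropositionalEquality using (_≡_; refl; sym; trans; cong; cong₂; subst)

  infix 4 _≡_mod_

  _≡_mod_ : ℕ → ℕ → (n : ℕ) .{{_ : NonZero n}} → Set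
  a ≡ b mod n = a % n ≡ b % n

  module _ (n : ℕ) .{{_ : NonZero n}} where

    %-mod : ∀ a → a % n ≡ a mod n
    %-mod a = m%n%n≡m%n a n

    +-mod : ∀ {a b c d} → a ≡ b mod n → c ≡ d mod n → a + c ≡ b + d mod n
    +-mod {a} {b} {c} {d} p q = trans (%-distribˡ-+ a c n)
      (trans (cong₂ (λ x y → (x + y) % n) p q) (sym (%-distribˡ-+ b d n)))

    *-mod : ∀ {a b c d} → a ≡ b mod n → c ≡ d mod n → a * c ≡ b * d mod n
    *-mod {a} {b} {c} {d} p q = trans (%-distribˡ-* a c n)
      (trans (cong₂ (λ x y → (x * y) % n) p q) (sym (%-distribˡ-* b d n)))

    coprime⇒invertible : ∀ {g} → Coprime g n → ∃ λ g′ → g * g′ ≡ 1 mod n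
    coprime⇒invertible {g} cop with coprime-Bézout cop
    ... | Bézout.+- x y eq = x , trans (cong (_% n) (trans (*-comm g x) (sym eq))) ([m+kn]%n≡m%n 1 y n)
    -- Here 1 + xg = yn, so the inverse of g is -x; it is represented by (n - 1)x to stay within ℕ.
    ... | Bézout.-+ x y eq = (n ∸ 1) * x , (begin
        (g * ((n ∸ 1) * x)) % n               ≡⟨ sym ([m+kn]%n≡m%n _ y n) ⟩
        (g * ((n ∸ 1) * x) + y * n) % n       ≡⟨ cong (λ z → (g * ((n ∸ 1) * x) + z) % n) (sym eq) ⟩
        (g * ((n ∸ 1) * x) + (1 + x * g)) % n ≡⟨ cong (_% n) (expand g (n ∸ 1) x) ⟩
        (1 + x * g * suc (n ∸ 1)) % n         ≡⟨ cong (λ z → (1 + x * g * z) % n) (m+[n∸m]≡n (>-nonZero⁻¹ n)) ⟩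
        (1 + x * g * n) % n                   ≡⟨ [m+kn]%n≡m%n 1 (x * g) n ⟩
        1 % n                                 ∎)
      where
      open Relation.Binary.PropositionalEquality.≡-Reasoning
      >-nonZero⁻¹ : ∀ m .{{_ : NonZero m}} → 0 < m
      >-nonZero⁻¹ (suc m) = Data.Nat.Base.z<s
      expand : ∀ g p x → g * (p * x) + (1 + x * g) ≡ 1 + x * g * (1 + p)
      expand = solve-∀

    invertible⇒coprime : ∀ {g g′} → g * g′ ≡ 1 mod n → Coprime g n
    invertible⇒coprime {g} {g′} eq {d} (d∣g , d∣n) =
      Data.Nat.Divisibility.∣1⇒≡1 (Data.Nat.Divisibility.∣n∣m%n⇒∣m d∣n
        (subst (d ∣_) eq (Data.Nat.Divisibility.%-presˡ-∣ (Data.Nat.Divisibility.∣m⇒∣m*n g′ d∣g) d∣n)))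

    -- Applied to both orders of `g` and `g′`, this makes multiplication by a unit a permutation of
    -- 0, ..., n - 1.
    scale-inverse : ∀ {g g′} → g * g′ ≡ 1 mod n → ∀ k → k < n → ((k * g % n) * g′) % n ≡ k
    scale-inverse {g} {g′} inv k k<n = begin
      ((k * g % n) * g′) % n ≡⟨ *-mod {c = g′} (%-mod (k * g)) refl ⟩
      (k * g * g′) % n       ≡⟨ cong (_% n) (*-assoc k g g′) ⟩
      (k * (g * g′)) % n     ≡⟨ *-mod {k} refl inv ⟩
      (k * 1) % n            ≡⟨ cong (_% n) (*-identityʳ k) ⟩
      k % n                  ≡⟨ m<n⇒m%n≡m k<n ⟩
      k                      ∎
      where open Relation.Binary.PropositionalEquality.≡-Reasoning

-- Sorting pairs of numbers by their greatest common divisor.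

module Arith where

  open import Data.Empty using (⊥-elim)
  open import Data.Nat.Base as ℕ using (ℕ; zero; suc; s≤s; z≤n; NonZero)
  open import Data.Nat.Coprimality as Cop using (Coprime; coprime?; coprime⇒gcd≡1; gcd≡1⇒coprime; coprime-divisor)
  open import Data.Nat.Divisibility
  open import Data.Nat.GCD
  import Data.Nat.Properties as ℕ
  open import Data.Product using (_×_; _,_)
  open import Data.Rational hiding (NonZero; ≢-nonZero; >-nonZero)
  open import Data.Rational.Properties
  open import Data.Sum using (inj₁)
  open import Relation.Binary.PropositionalEquality using (_≡_; refl; sym; trans; cong; cong₂; subst; module ≡-Reasoning)
  open import Relation.Nullary using (yes; no; ¬_)
  open import Tactic.RingSolver using (solve-∀)
  open Kit
  open Mod

  ∑∑-cong : ∀ M N {f g : ℕ → ℕ → ℚ} → (∀ i → i ℕ.< M → ∀ j → j ℕ.< N → f i j ≡ g i j) →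
            ∑ M (λ i → ∑ N (f i)) ≡ ∑ M (λ i → ∑ N (g i))
  ∑∑-cong M N eq = ∑-cong M λ i i<M → ∑-cong N λ j j<N → eq i i<M j j<N

  -- Write N = kuq. Cancelling k in kv ∣ kuq leaves v ∣ uq, and v is coprime to u, so v ∣ q.
  coprime-products : ∀ {k u v N} → k ℕ.* u ∣ N → k ℕ.* v ∣ N → Coprime u v → .{{_ : NonZero N}} → k ℕ.* u ℕ.* v ∣ N
  coprime-products {zero}  0∣N _ _ {{N≢0}} = 0∣N
  coprime-products {suc k} {u} {v} (divides q eq) kv∣N cop with coprime-divisor (Cop.sym cop) (*-cancelˡ-∣ (suc k) (subst (suc k ℕ.* v ∣_) N≡ kv∣N))
    where
    N≡ = trans eq (trans (ℕ.*-comm q (suc k ℕ.* u)) (ℕ.*-assoc (suc k) u q))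
  ... | v∣q = subst (suc k ℕ.* u ℕ.* v ∣_) (sym (trans eq (ℕ.*-comm q _))) (*-monoʳ-∣ (suc k ℕ.* u) v∣q)

  module _ (Z : ℕ) where

    private
      gcd-factor : ∀ {m m′ g u v} → Coprime u v → m ≡ g ℕ.* u → m′ ≡ g ℕ.* v → g ≡ gcd m m′
      gcd-factor {g = g} {u} {v} cop refl refl = sym (trans (sym (c*gcd[m,n]≡gcd[cm,cn] g u v))
        (trans (cong (g ℕ.*_) (coprime⇒gcd≡1 cop)) (ℕ.*-identityʳ g)))

      χ : ℕ → ℕ → ℕ → ℕ → ℕ → ℚ
      χ m m′ g u v = ⟦ coprime? u v ⟧ * (⟦ m ℕ.≟ g ℕ.* u ⟧ * ⟦ m′ ℕ.≟ g ℕ.* v ⟧)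

      χ-no : ∀ m m′ g u v → ¬ (Coprime u v × m ≡ g ℕ.* u × m′ ≡ g ℕ.* v) → χ m m′ g u v ≡ 0ℚ
      χ-no m m′ g u v ¬p with coprime? u v | m ℕ.≟ g ℕ.* u | m′ ℕ.≟ g ℕ.* v
      ... | yes a | yes b | yes c = ⊥-elim (¬p (a , b , c))
      ... | yes a | yes b | no _  = refl
      ... | yes a | no _  | c     = trans (*-identityˡ _) (*-zeroˡ ⟦ c ⟧)
      ... | no _  | b     | c     = *-zeroˡ (⟦ b ⟧ * ⟦ c ⟧)

      -- A factorisation m = gu, m′ = gv with u, v coprime forces g = gcd m m′. Since m is positive,
      -- g can be cancelled, which determines u and v.
      χ-count : ∀ m m′ → 0 ℕ.< m → m ℕ.< Z → 0 ℕ.< m′ → m′ ℕ.< Z →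
                ∑ Z (λ g → ∑ Z (λ u → ∑ Z (λ v → χ m m′ g u v))) ≡ 1ℚ
      χ-count m m′ 0<m m<Z 0<m′ m′<Z = begin
        ∑ Z (λ g → ∑ Z (λ u → ∑ Z (λ v → χ m m′ g u v)))
          ≡⟨ ∑-δ Z G (ℕ.≤-<-trans (∣⇒≤ {{ℕ.>-nonZero 0<m}} (gcd[m,n]∣m m m′)) m<Z)
               (λ g _ g≢G → ∑-zero Z λ u _ → ∑-zero Z λ v _ → χ-no m m′ g u v λ (c , p , q) → g≢G (gcd-factor {m} {m′} {g} {u} {v} c p q)) ⟩
        ∑ Z (λ u → ∑ Z (λ v → χ m m′ G u v))
          ≡⟨ ∑-δ Z U (ℕ.≤-<-trans (∣⇒≤ {{ℕ.>-nonZero 0<m}} (divides G m≡GU)) m<Z)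
               (λ u _ u≢U → ∑-zero Z λ v _ → χ-no m m′ G u v λ (_ , p , _) → u≢U (ℕ.*-cancelˡ-≡ u U G (trans (sym p) m≡GU))) ⟩
        ∑ Z (λ v → χ m m′ G U v)
          ≡⟨ ∑-δ Z V (ℕ.≤-<-trans (∣⇒≤ {{ℕ.>-nonZero 0<m′}} (divides G m′≡GV)) m′<Z)
               (λ v _ v≢V → χ-no m m′ G U v λ (_ , _ , p) → v≢V (ℕ.*-cancelˡ-≡ v V G (trans (sym p) m′≡GV))) ⟩
        χ m m′ G U V
          ≡⟨ cong₂ _*_ (⟦⟧-yes (coprime? U V) cop) (cong₂ _*_ (⟦⟧-yes (m ℕ.≟ G ℕ.* U) m≡GU) (⟦⟧-yes (m′ ℕ.≟ G ℕ.* V) m′≡GV)) ⟩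
        1ℚ ∎
        where
        open ≡-Reasoning
        G = gcd m m′
        instance
          G≢0 : NonZero G
          G≢0 = ℕ.≢-nonZero (gcd[m,n]≢0 m m′ (inj₁ λ m≡0 → ℕ.<-irrefl (sym m≡0) 0<m))
        U = quotient (gcd[m,n]∣m m m′)
        V = quotient (gcd[m,n]∣n m m′)
        m≡GU : m ≡ G ℕ.* U
        m≡GU = m∣n⇒n≡m*quotient (gcd[m,n]∣m m m′)
        m′≡GV : m′ ≡ G ℕ.* V
        m′≡GV = m∣n⇒n≡m*quotient (gcd[m,n]∣n m m′)
        cop : Coprime U V
        cop = gcd≡1⇒coprime (ℕ.*-cancelˡ-≡ (gcd U V) 1 G (begin
          G ℕ.* gcd U V            ≡⟨ c*gcd[m,n]≡gcd[cm,cn] G U V ⟩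
          gcd (G ℕ.* U) (G ℕ.* V)  ≡⟨ cong₂ gcd (sym m≡GU) (sym m′≡GV) ⟩
          G                        ≡⟨ sym (ℕ.*-identityʳ G) ⟩
          G ℕ.* 1                  ∎))

      select : ∀ (f : ℕ → ℚ) k → (Z ℕ.≤ k → f k ≡ 0ℚ) → ∑ Z (λ m → ⟦ m ℕ.≟ k ⟧ * f m) ≡ f k
      select f k out with k ℕ.<? Z
      ... | yes k<Z = trans (∑-δ Z k k<Z λ m _ m≢k → trans (cong (_* f m) (⟦⟧-no (m ℕ.≟ k) m≢k)) (*-zeroˡ (f m)))
                            (trans (cong (_* f k) (⟦⟧-yes (k ℕ.≟ k) refl)) (*-identityˡ (f k)))
      ... | no k≮Z  = trans (∑-zero Z λ m m<Z → trans (cong (_* f m) (⟦⟧-no (m ℕ.≟ k) λ m≡k → k≮Z (subst (ℕ._< Z) m≡k m<Z)))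
                                                      (*-zeroˡ (f m)))
                            (sym (out (ℕ.≮⇒≥ k≮Z)))

    -- A positive pair is (gu, gv) with u, v coprime in exactly one way. `Φ` must vanish at 0, where
    -- that form is not unique, and from `Z` on, since gu and gv leave the range of summation.
    ∑-by-gcd : (Φ : ℕ → ℕ → ℚ) →
               (∀ m → Φ 0 m ≡ 0ℚ) → (∀ m → Φ m 0 ≡ 0ℚ) →
               (∀ m m′ → Z ℕ.≤ m → Φ m m′ ≡ 0ℚ) → (∀ m m′ → Z ℕ.≤ m′ → Φ m m′ ≡ 0ℚ) →
               ∑ Z (λ m → ∑ Z (λ m′ → Φ m m′)) ≡
               ∑ Z (λ g → ∑ Z (λ u → ∑ Z (λ v → ⟦ coprime? u v ⟧ * Φ (g ℕ.* u) (g ℕ.* v))))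
    ∑-by-gcd Φ z₁ z₂ o₁ o₂ = begin
      ∑ Z (λ m → ∑ Z (λ m′ → Φ m m′))
        ≡⟨ ∑∑-cong Z Z (λ m m<Z m′ m′<Z → sym (weight m m<Z m′ m′<Z)) ⟩
      ∑ Z (λ m → ∑ Z (λ m′ → ∑ Z (λ g → ∑ Z (λ u → ∑ Z (λ v → χ m m′ g u v))) * Φ m m′))
        ≡⟨ ∑∑-cong Z Z (λ m _ m′ _ → push m m′) ⟩
      ∑ Z (λ m → ∑ Z (λ m′ → ∑ Z (λ g → ∑ Z (λ u → ∑ Z (λ v → χ m m′ g u v * Φ m m′)))))
        ≡⟨ ∑-cong′ Z (λ m → trans (∑-swap Z Z _) (∑-cong′ Z λ g → trans (∑-swap Z Z _) (∑-cong′ Z λ u → ∑-swap Z Z _))) ⟩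
      ∑ Z (λ m → ∑ Z (λ g → ∑ Z (λ u → ∑ Z (λ v → ∑ Z (λ m′ → χ m m′ g u v * Φ m m′)))))
        ≡⟨ trans (∑-swap Z Z _) (∑-cong′ Z λ g → trans (∑-swap Z Z _) (∑-cong′ Z λ u → ∑-swap Z Z _)) ⟩
      ∑ Z (λ g → ∑ Z (λ u → ∑ Z (λ v → ∑ Z (λ m → ∑ Z (λ m′ → χ m m′ g u v * Φ m m′)))))
        ≡⟨ ∑-cong′ Z (λ g → ∑∑-cong Z Z λ u _ v _ → collapse g u v) ⟩
      ∑ Z (λ g → ∑ Z (λ u → ∑ Z (λ v → ⟦ coprime? u v ⟧ * Φ (g ℕ.* u) (g ℕ.* v)))) ∎
      where
      open ≡-Reasoning
      zero-factor : ∀ x {y} → y ≡ 0ℚ → x * y ≡ y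
      zero-factor x refl = *-zeroʳ x
      weight : ∀ m → m ℕ.< Z → ∀ m′ → m′ ℕ.< Z →
               ∑ Z (λ g → ∑ Z (λ u → ∑ Z (λ v → χ m m′ g u v))) * Φ m m′ ≡ Φ m m′
      weight zero _ m′ _ = zero-factor (∑ Z (λ g → ∑ Z (λ u → ∑ Z (λ v → χ 0 m′ g u v)))) (z₁ m′)
      weight (suc m) _ zero _ = zero-factor (∑ Z (λ g → ∑ Z (λ u → ∑ Z (λ v → χ (suc m) 0 g u v)))) (z₂ (suc m))
      weight (suc m) lt (suc m′) lt′ = trans (cong (_* Φ (suc m) (suc m′)) (χ-count (suc m) (suc m′) (s≤s z≤n) lt (s≤s z≤n) lt′))
                                             (*-identityˡ _)
      push : ∀ m m′ → ∑ Z (λ g → ∑ Z (λ u → ∑ Z (λ v → χ m m′ g u v))) * Φ m m′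
                    ≡ ∑ Z (λ g → ∑ Z (λ u → ∑ Z (λ v → χ m m′ g u v * Φ m m′)))
      push m m′ = trans (∑-*ʳ Z (Φ m m′) _) (∑-cong′ Z λ g → trans (∑-*ʳ Z (Φ m m′) _) (∑-cong′ Z λ u → ∑-*ʳ Z (Φ m m′) _))
      regroup : ∀ c p q φ → c * (p * q) * φ ≡ c * (p * (q * φ))
      regroup = solve-∀ ringℚ
      collapse : ∀ g u v → ∑ Z (λ m → ∑ Z (λ m′ → χ m m′ g u v * Φ m m′)) ≡ ⟦ coprime? u v ⟧ * Φ (g ℕ.* u) (g ℕ.* v)
      collapse g u v = begin
        ∑ Z (λ m → ∑ Z (λ m′ → χ m m′ g u v * Φ m m′))
          ≡⟨ ∑-cong′ Z (λ m → begin
               ∑ Z (λ m′ → χ m m′ g u v * Φ m m′)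
                 ≡⟨ ∑-cong′ Z (λ m′ → regroup ⟦ coprime? u v ⟧ ⟦ m ℕ.≟ g ℕ.* u ⟧ ⟦ m′ ℕ.≟ g ℕ.* v ⟧ (Φ m m′)) ⟩
               ∑ Z (λ m′ → ⟦ coprime? u v ⟧ * (⟦ m ℕ.≟ g ℕ.* u ⟧ * (⟦ m′ ℕ.≟ g ℕ.* v ⟧ * Φ m m′)))
                 ≡⟨ sym (trans (cong (⟦ coprime? u v ⟧ *_) (∑-*ˡ Z ⟦ m ℕ.≟ g ℕ.* u ⟧ _)) (∑-*ˡ Z ⟦ coprime? u v ⟧ _)) ⟩
               ⟦ coprime? u v ⟧ * (⟦ m ℕ.≟ g ℕ.* u ⟧ * ∑ Z (λ m′ → ⟦ m′ ℕ.≟ g ℕ.* v ⟧ * Φ m m′))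
                 ≡⟨ cong (λ z → ⟦ coprime? u v ⟧ * (⟦ m ℕ.≟ g ℕ.* u ⟧ * z)) (select (Φ m) (g ℕ.* v) (o₂ m (g ℕ.* v))) ⟩
               ⟦ coprime? u v ⟧ * (⟦ m ℕ.≟ g ℕ.* u ⟧ * Φ m (g ℕ.* v)) ∎) ⟩
        ∑ Z (λ m → ⟦ coprime? u v ⟧ * (⟦ m ℕ.≟ g ℕ.* u ⟧ * Φ m (g ℕ.* v)))
          ≡⟨ sym (∑-*ˡ Z ⟦ coprime? u v ⟧ _) ⟩
        ⟦ coprime? u v ⟧ * ∑ Z (λ m → ⟦ m ℕ.≟ g ℕ.* u ⟧ * Φ m (g ℕ.* v))
          ≡⟨ cong (⟦ coprime? u v ⟧ *_) (select (λ m → Φ m (g ℕ.* v)) (g ℕ.* u) (o₁ (g ℕ.* u) (g ℕ.* v))) ⟩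
        ⟦ coprime? u v ⟧ * Φ (g ℕ.* u) (g ℕ.* v) ∎

-- The Gram matrix of the dilates of h, and Ingham's identity.

module Gram where

  open import Data.Empty using (⊥-elim)
  open import Data.Nat.Base as ℕ using (ℕ; s≤s; NonZero; _%_)
  open import Data.Nat.Coprimality as Cop using (Coprime; coprime?; 0-coprimeTo-m⇒m≡1)
  open import Data.Nat.Divisibility
  open import Data.Nat.DivMod using (m%n<n)
  import Data.Nat.Properties as ℕ
  import Data.Nat.Tactic.RingSolver as ℕR
  open import Data.Product using (_,_)
  open import Data.Rational hiding (NonZero; ≢-nonZero; >-nonZero)
  open import Data.Rational.Properties
  open import Relation.Binary.PropositionalEquality using (_≡_; refl; sym; trans; cong; cong₂; subst; module ≡-Reasoning)
  open import Relation.Nullary using (Dec; yes; no; ¬_)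
  open import Tactic.RingSolver using (solve-∀)
  open Kit
  open Mod
  open Arith

  module GramMatrix (n : ℕ) {{_ : NonZero n}} (1<n : 1 ℕ.< n) (h : ℕ → ℚ)
    (periodic : ∀ m → h (m % n) ≡ h m) (support : ∀ m → ¬ Coprime m n → h m ≡ 0ℚ) where

    -- Inner product of the functions k ↦ h(km) and k ↦ h(km′) on ℤ/n, whence its quadratic forms
    -- are sums of squares.
    R : ℕ → ℕ → ℚ
    R m m′ = ∑ n (λ k → h (k ℕ.* m) * h (k ℕ.* m′))

    h-mod : ∀ {a b} → a ≡ b mod n → h a ≡ h b
    h-mod {a} {b} eq = trans (sym (periodic a)) (trans (cong h eq) (periodic b))

    h-0 : h 0 ≡ 0ℚ
    h-0 = support 0 λ cop → ℕ.<-irrefl (sym (0-coprimeTo-m⇒m≡1 cop)) 1<n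

    R-0ˡ : ∀ m → R 0 m ≡ 0ℚ
    R-0ˡ m = ∑-zero n λ k _ → trans (cong (_* h (k ℕ.* m)) (trans (cong h (ℕ.*-zeroʳ k)) h-0)) (*-zeroˡ (h (k ℕ.* m)))

    R-0ʳ : ∀ m → R m 0 ≡ 0ℚ
    R-0ʳ m = ∑-zero n λ k _ → trans (cong (h (k ℕ.* m) *_) (trans (cong h (ℕ.*-zeroʳ k)) h-0)) (*-zeroʳ (h (k ℕ.* m)))

    ∑-rescale : ∀ {g} → Coprime g n → (f : ℕ → ℚ) → (∀ a b → a ≡ b mod n → f a ≡ f b) →
                ∑ n (λ k → f (k ℕ.* g)) ≡ ∑ n f
    ∑-rescale {g} cop f f-mod with coprime⇒invertible n cop
    ... | g′ , gg′≡1 = begin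
      ∑ n (λ k → f (k ℕ.* g))        ≡⟨ ∑-cong′ n (λ k → f-mod _ _ (sym (%-mod n (k ℕ.* g)))) ⟩
      ∑ n (λ k → f (k ℕ.* g % n))    ≡⟨ sym (∑-permute n f (λ k → k ℕ.* g % n) (λ k → k ℕ.* g′ % n)
                                          (λ k _ → m%n<n (k ℕ.* g) n) (λ k _ → m%n<n (k ℕ.* g′) n)
                                          (scale-inverse n (trans (cong (_% n) (ℕ.*-comm g′ g)) gg′≡1))
                                          (scale-inverse n gg′≡1)) ⟩
      ∑ n f                          ∎
      where open ≡-Reasoning

    -- The substitution k ↦ kg permutes the residues mod n.
    R-scale : ∀ {g} → Coprime g n → ∀ u v → R (g ℕ.* u) (g ℕ.* v) ≡ R u v
    R-scale {g} cop u v = trans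
      (∑-cong′ n λ k → cong₂ (λ a b → h a * h b) (sym (ℕ.*-assoc k g u)) (sym (ℕ.*-assoc k g v)))
      (∑-rescale cop (λ k → h (k ℕ.* u) * h (k ℕ.* v))
        (λ a b eq → cong₂ _*_ (h-mod (*-mod n {c = u} eq refl)) (h-mod (*-mod n {c = v} eq refl))))

    squares : ∀ Z (α : ℕ → ℚ) →
              ∑ Z (λ x → ∑ Z (λ y → α x * α y * R x y)) ≡
              ∑ n (λ k → ∑ Z (λ x → α x * h (k ℕ.* x)) * ∑ Z (λ x → α x * h (k ℕ.* x)))
    squares Z α = begin
      ∑ Z (λ x → ∑ Z (λ y → α x * α y * R x y))
        ≡⟨ ∑∑-cong Z Z (λ x _ y _ → ∑-*ˡ n (α x * α y) _) ⟩
      ∑ Z (λ x → ∑ Z (λ y → ∑ n (λ k → α x * α y * (h (k ℕ.* x) * h (k ℕ.* y)))))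
        ≡⟨ trans (∑-cong′ Z (λ x → ∑-swap Z n _)) (∑-swap Z n _) ⟩
      ∑ n (λ k → ∑ Z (λ x → ∑ Z (λ y → α x * α y * (h (k ℕ.* x) * h (k ℕ.* y)))))
        ≡⟨ ∑-cong′ n (λ k → ∑∑-cong Z Z λ x _ y _ → interchange (α x) (α y) (h (k ℕ.* x)) (h (k ℕ.* y))) ⟩
      ∑ n (λ k → ∑ Z (λ x → ∑ Z (λ y → α x * h (k ℕ.* x) * (α y * h (k ℕ.* y)))))
        ≡⟨ ∑-cong′ n (λ k → trans (∑-cong′ Z λ x → sym (∑-*ˡ Z (α x * h (k ℕ.* x)) _))
                                   (sym (∑-*ʳ Z (∑ Z (λ y → α y * h (k ℕ.* y))) _))) ⟩
      ∑ n (λ k → ∑ Z (λ x → α x * h (k ℕ.* x)) * ∑ Z (λ x → α x * h (k ℕ.* x))) ∎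
      where
      open ≡-Reasoning
      interchange : ∀ a b c d → a * b * (c * d) ≡ a * c * (b * d)
      interchange = solve-∀ ringℚ

    module _ (Z N : ℕ) {{_ : NonZero N}} (N<Z : N ℕ.< Z) (N⊥n : Coprime N n) where

      -- In N = mam′b the factor b is determined by the others, hence the divisibility. The factors
      -- χ₀(a) χ₀(b) are 1, because divisors of N are prime to n.
      E : ℚ
      E = ∑ Z (λ m → ∑ Z (λ m′ → ∑ Z (λ a → ⟦ m ℕ.* m′ ℕ.* a ∣? N ⟧) * R m m′))

      -- The quadratic form of `R` at the vector x ↦ [d²x ∣ N].
      C : ℕ → ℚ
      C d = ∑ Z (λ x → ∑ Z (λ y → ⟦ d ℕ.* d ℕ.* x ∣? N ⟧ * ⟦ d ℕ.* d ℕ.* y ∣? N ⟧ * R x y))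

      private
        ∣⇒<Z : ∀ {m} → m ∣ N → ¬ Z ℕ.≤ m
        ∣⇒<Z m∣N Z≤m = ℕ.<-irrefl refl (ℕ.<-≤-trans N<Z (ℕ.≤-trans Z≤m (∣⇒≤ m∣N)))

        divisor-coprime : ∀ {g} → g ∣ N → Coprime g n
        divisor-coprime g∣N (d∣g , d∣n) = N⊥n (∣-trans d∣g g∣N , d∣n)

        kill : ∀ {x} y → x ≡ 0ℚ → x * y ≡ 0ℚ
        kill y refl = *-zeroˡ y

        kill′ : ∀ x {y} → y ≡ 0ℚ → x * y ≡ 0ℚ
        kill′ x refl = *-zeroʳ x

        -- For coprime u and v, the conditions g²au ∣ N and g²av ∣ N together amount to g²auv ∣ N.
        -- In that case g and a divide N, so they are units mod n, and both entries of `R` reduce to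
        -- R u v.
        termwise : ∀ g u v a →
          ⟦ coprime? u v ⟧ * (⟦ (g ℕ.* u) ℕ.* (g ℕ.* v) ℕ.* a ∣? N ⟧ * R (g ℕ.* u) (g ℕ.* v)) ≡
          ⟦ coprime? u v ⟧ * (⟦ g ℕ.* g ℕ.* (a ℕ.* u) ∣? N ⟧ * ⟦ g ℕ.* g ℕ.* (a ℕ.* v) ∣? N ⟧ * R (a ℕ.* u) (a ℕ.* v))
        termwise g u v a with coprime? u v
        ... | no _    = trans (*-zeroˡ (⟦ (g ℕ.* u) ℕ.* (g ℕ.* v) ℕ.* a ∣? N ⟧ * R (g ℕ.* u) (g ℕ.* v)))
          (sym (*-zeroˡ (⟦ g ℕ.* g ℕ.* (a ℕ.* u) ∣? N ⟧ * ⟦ g ℕ.* g ℕ.* (a ℕ.* v) ∣? N ⟧ * R (a ℕ.* u) (a ℕ.* v))))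
        ... | yes cop = cong (1ℚ *_) (body ((g ℕ.* u) ℕ.* (g ℕ.* v) ℕ.* a ∣? N) (g ℕ.* g ℕ.* (a ℕ.* u) ∣? N) (g ℕ.* g ℕ.* (a ℕ.* v) ∣? N))
          where
          eu : ∀ g u v a → (g ℕ.* u) ℕ.* (g ℕ.* v) ℕ.* a ≡ g ℕ.* g ℕ.* (a ℕ.* u) ℕ.* v
          eu = ℕR.solve-∀
          ev : ∀ g u v a → (g ℕ.* u) ℕ.* (g ℕ.* v) ℕ.* a ≡ g ℕ.* g ℕ.* (a ℕ.* v) ℕ.* u
          ev = ℕR.solve-∀
          ek : ∀ g a u → g ℕ.* g ℕ.* (a ℕ.* u) ≡ g ℕ.* g ℕ.* a ℕ.* u
          ek = ℕR.solve-∀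
          ew : ∀ g u v a → g ℕ.* g ℕ.* a ℕ.* u ℕ.* v ≡ (g ℕ.* u) ℕ.* (g ℕ.* v) ℕ.* a
          ew = ℕR.solve-∀
          body : (d : Dec ((g ℕ.* u) ℕ.* (g ℕ.* v) ℕ.* a ∣ N)) (p : Dec (g ℕ.* g ℕ.* (a ℕ.* u) ∣ N)) (q : Dec (g ℕ.* g ℕ.* (a ℕ.* v) ∣ N)) →
                 ⟦ d ⟧ * R (g ℕ.* u) (g ℕ.* v) ≡ ⟦ p ⟧ * ⟦ q ⟧ * R (a ℕ.* u) (a ℕ.* v)
          body (yes d) (yes p) (yes q) = begin
            1ℚ * R (g ℕ.* u) (g ℕ.* v)        ≡⟨ *-identityˡ (R (g ℕ.* u) (g ℕ.* v)) ⟩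
            R (g ℕ.* u) (g ℕ.* v) ≡⟨ R-scale (divisor-coprime (m*n∣⇒m∣ g u (m*n∣⇒m∣ (g ℕ.* u) (g ℕ.* v) (m*n∣⇒m∣ (g ℕ.* u ℕ.* (g ℕ.* v)) a d)))) u v ⟩
            R u v                             ≡⟨ sym (R-scale (divisor-coprime (m*n∣⇒n∣ (g ℕ.* u ℕ.* (g ℕ.* v)) a d)) u v) ⟩
            R (a ℕ.* u) (a ℕ.* v)             ≡⟨ sym (*-identityˡ (R (a ℕ.* u) (a ℕ.* v))) ⟩
            1ℚ * R (a ℕ.* u) (a ℕ.* v)        ∎
            where open ≡-Reasoning
          body (yes d) (no ¬p) q = ⊥-elim (¬p (m*n∣⇒m∣ (g ℕ.* g ℕ.* (a ℕ.* u)) v (subst (_∣ N) (eu g u v a) d)))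
          body (yes d) (yes p) (no ¬q) = ⊥-elim (¬q (m*n∣⇒m∣ (g ℕ.* g ℕ.* (a ℕ.* v)) u (subst (_∣ N) (ev g u v a) d)))
          body (no ¬d) (yes p) (yes q) = ⊥-elim (¬d (subst (_∣ N) (ew g u v a)
            (coprime-products {g ℕ.* g ℕ.* a} {u} {v} (subst (_∣ N) (ek g a u) p) (subst (_∣ N) (ek g a v) q) cop)))
          body (no _) (no _) q = trans (*-zeroˡ (R (g ℕ.* u) (g ℕ.* v))) (sym (kill (R (a ℕ.* u) (a ℕ.* v)) (*-zeroˡ ⟦ q ⟧)))
          body (no _) (yes _) (no _) = trans (*-zeroˡ (R (g ℕ.* u) (g ℕ.* v))) (sym (*-zeroˡ (R (a ℕ.* u) (a ℕ.* v))))

      -- Ingham's identity: both sides sum R u v over coprime u, v and all g, a with g²auv ∣ N,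
      -- once after writing (m, m′) = (gu, gv) and once after writing (x, y) = (au, av), d = g.
      E≡∑C : E ≡ ∑ Z C
      E≡∑C = begin
        E
          ≡⟨ ∑-by-gcd Z (λ m m′ → ∑ Z (λ a → ⟦ m ℕ.* m′ ℕ.* a ∣? N ⟧) * R m m′)
               (λ m → kill′ (∑ Z (λ a → ⟦ 0 ℕ.* m ℕ.* a ∣? N ⟧)) (R-0ˡ m))
               (λ m → kill′ (∑ Z (λ a → ⟦ m ℕ.* 0 ℕ.* a ∣? N ⟧)) (R-0ʳ m))
               (λ m m′ Z≤m → kill (R m m′) (∑-zero Z λ a _ → ⟦⟧-no (m ℕ.* m′ ℕ.* a ∣? N) λ d → ∣⇒<Z (m*n∣⇒m∣ m m′ (m*n∣⇒m∣ (m ℕ.* m′) a d)) Z≤m))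
               (λ m m′ Z≤m′ → kill (R m m′) (∑-zero Z λ a _ → ⟦⟧-no (m ℕ.* m′ ℕ.* a ∣? N) λ d → ∣⇒<Z (m*n∣⇒n∣ m m′ (m*n∣⇒m∣ (m ℕ.* m′) a d)) Z≤m′)) ⟩
        ∑ Z (λ g → ∑ Z (λ u → ∑ Z (λ v → ⟦ coprime? u v ⟧ * (∑ Z (λ a → ⟦ (g ℕ.* u) ℕ.* (g ℕ.* v) ℕ.* a ∣? N ⟧) * R (g ℕ.* u) (g ℕ.* v)))))
          ≡⟨ ∑-cong′ Z (λ g → ∑∑-cong Z Z λ u _ v _ →
               trans (cong (⟦ coprime? u v ⟧ *_) (∑-*ʳ Z (R (g ℕ.* u) (g ℕ.* v)) _)) (trans (∑-*ˡ Z ⟦ coprime? u v ⟧ _)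
                     (∑-cong′ Z (termwise g u v)))) ⟩
        ∑ Z (λ g → ∑ Z (λ u → ∑ Z (λ v → ∑ Z (λ a → ψ g a u v))))
          ≡⟨ ∑-cong′ Z (λ g → trans (∑-cong′ Z λ u → ∑-swap Z Z _) (∑-swap Z Z _)) ⟩
        ∑ Z (λ g → ∑ Z (λ a → ∑ Z (λ u → ∑ Z (λ v → ψ g a u v))))
          ≡⟨ ∑-cong′ Z (λ d → sym (∑-by-gcd Z (λ x y → ⟦ d ℕ.* d ℕ.* x ∣? N ⟧ * ⟦ d ℕ.* d ℕ.* y ∣? N ⟧ * R x y)
               (λ m → kill′ (⟦ d ℕ.* d ℕ.* 0 ∣? N ⟧ * ⟦ d ℕ.* d ℕ.* m ∣? N ⟧) (R-0ˡ m))
               (λ m → kill′ (⟦ d ℕ.* d ℕ.* m ∣? N ⟧ * ⟦ d ℕ.* d ℕ.* 0 ∣? N ⟧) (R-0ʳ m))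
               (λ m m′ Z≤m → kill (R m m′) (kill ⟦ d ℕ.* d ℕ.* m′ ∣? N ⟧ (⟦⟧-no (d ℕ.* d ℕ.* m ∣? N) λ p → ∣⇒<Z (m*n∣⇒n∣ (d ℕ.* d) m p) Z≤m)))
               (λ m m′ Z≤m′ → kill (R m m′) (kill′ ⟦ d ℕ.* d ℕ.* m ∣? N ⟧ (⟦⟧-no (d ℕ.* d ℕ.* m′ ∣? N) λ p → ∣⇒<Z (m*n∣⇒n∣ (d ℕ.* d) m′ p) Z≤m′))))) ⟩
        ∑ Z C ∎
        where
        open ≡-Reasoning
        ψ : ℕ → ℕ → ℕ → ℕ → ℚ
        ψ g a u v = ⟦ coprime? u v ⟧ * (⟦ g ℕ.* g ℕ.* (a ℕ.* u) ∣? N ⟧ * ⟦ g ℕ.* g ℕ.* (a ℕ.* v) ∣? N ⟧ * R (a ℕ.* u) (a ℕ.* v))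

      C≥0 : ∀ d → 0ℚ ≤ C d
      C≥0 d = subst (0ℚ ≤_) (sym (squares Z (λ x → ⟦ d ℕ.* d ℕ.* x ∣? N ⟧))) (∑-nonNeg n λ k _ → sq≥0 (∑ Z (λ x → ⟦ d ℕ.* d ℕ.* x ∣? N ⟧ * h (k ℕ.* x))))

      E≥0 : 0ℚ ≤ E
      E≥0 = subst (0ℚ ≤_) (sym E≡∑C) (∑-nonNeg Z λ d _ → C≥0 d)

      -- In `C D` the condition D²x ∣ D² leaves only x = 1, so this single nonnegative term of
      -- Ingham's sum is already R 1 1.
      E-square : ∀ D → D ℕ.* D ≡ N → R 1 1 ≤ E
      E-square D D²≡N = subst₂′ (term≤∑ Z D (ℕ.≤∧≢⇒< (ℕ.≮⇒≥ λ Z<D → ∣⇒<Z D∣N (ℕ.<⇒≤ Z<D)) λ D≡Z → ∣⇒<Z D∣N (ℕ.≤-reflexive (sym D≡Z))) (λ d _ → C≥0 d))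
        where
        D∣N : D ∣ N
        D∣N = divides D (sym D²≡N)
        only-one : ∀ k → ∑ Z (λ x → ⟦ D ℕ.* D ℕ.* x ∣? N ⟧ * h (k ℕ.* x)) ≡ h (k ℕ.* 1)
        only-one k = trans
          (∑-δ Z 1 (ℕ.≤-trans (s≤s (ℕ.>-nonZero⁻¹ N)) N<Z) λ x _ x≢1 →
            kill (h (k ℕ.* x)) (⟦⟧-no (D ℕ.* D ℕ.* x ∣? N) λ p →
              x≢1 (∣1⇒≡1 (*-cancelˡ-∣ N (subst (λ z → z ∣ N ℕ.* 1) (cong (ℕ._* x) D²≡N)
                     (subst (D ℕ.* D ℕ.* x ∣_) (sym (ℕ.*-identityʳ N)) p))))))
          (trans (cong (_* h (k ℕ.* 1)) (⟦⟧-yes (D ℕ.* D ℕ.* 1 ∣? N)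
                   (subst (_∣ N) (trans (sym D²≡N) (sym (ℕ.*-identityʳ (D ℕ.* D)))) ∣-refl)))
                 (*-identityˡ (h (k ℕ.* 1))))
        C-D : C D ≡ R 1 1
        C-D = trans (squares Z (λ x → ⟦ D ℕ.* D ℕ.* x ∣? N ⟧)) (∑-cong′ n λ k → cong₂ _*_ (only-one k) (only-one k))
        subst₂′ : C D ≤ ∑ Z C → R 1 1 ≤ E
        subst₂′ le = subst (R 1 1 ≤_) (sym E≡∑C) (subst (_≤ ∑ Z C) C-D le)

-- The function θ(1 - θ) of the fractional part θ.

module Sawtooth where

  open import Data.Empty using (⊥-elim)
  open import Data.Nat.Base as ℕ using (ℕ; zero; suc; s≤s)
  import Data.Nat.Properties as ℕ
  open import Data.Product using (∃; _×_; _,_)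
  open import Data.Rational hiding (NonZero; ≢-nonZero; >-nonZero)
  open import Data.Rational.Properties
  open import Relation.Binary.PropositionalEquality using (_≡_; refl; sym; trans; cong; cong₂; subst; subst₂)
  open import Relation.Nullary using (yes; no)
  open import Tactic.RingSolver using (solve-∀)
  open Kit

  infix 8 _⁺

  _⁺ : ℚ → ℚ
  x ⁺ = 0ℚ ⊔ x

  ⁺-pos : ∀ {x} → 0ℚ ≤ x → x ⁺ ≡ x
  ⁺-pos = p≤q⇒p⊔q≡q

  ⁺-neg : ∀ {x} → x ≤ 0ℚ → x ⁺ ≡ 0ℚ
  ⁺-neg = p≥q⇒p⊔q≡p

  ⁺≥0 : ∀ x → 0ℚ ≤ x ⁺
  ⁺≥0 x = p≤p⊔q 0ℚ x

  ⁺-scale : ∀ {c} → 0ℚ ≤ c → ∀ x → c * x ⁺ ≡ (c * x) ⁺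
  ⁺-scale {c} 0≤c x = trans (*-distribˡ-⊔-nonNeg c {{nonNegative 0≤c}} 0ℚ x) (cong (_⊔ (c * x)) (*-zeroʳ c))

  floor-ℕ : ∀ Y → 0ℚ ≤ Y → ∃ λ J → ι J ≤ Y × Y < ι (suc J)
  floor-ℕ Y 0≤Y with archimedean (Y + 1ℚ)
  ... | N , le = search N (<-≤-trans (<-by 1ℚ 0<1 refl) le)
    where
    search : ∀ N → Y < ι N → ∃ λ J → ι J ≤ Y × Y < ι (suc J)
    search zero    lt = ⊥-elim (<⇒≱ lt (subst (_≤ Y) (sym fromℤ-0) 0≤Y))
    search (suc N) lt with ι N ≤? Y
    ... | yes le = N , le , lt
    ... | no ¬le = search N (≰⇒> ¬le)

  2ℚ : ℚ
  2ℚ = 1ℚ + 1ℚ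

  -- sawtooth Z Y is θ(1 − θ) with θ the fractional part of Y, provided Y ≤ Z.
  sawtooth : ℕ → ℚ → ℚ
  sawtooth Z Y = 2ℚ * ∑ Z (λ a → (Y - ι (suc a)) ⁺) - Y * Y + Y

  private
    arith : ∀ Y J → 2ℚ * ∑ J (λ a → Y - ι (suc a)) ≡ ι J * (Y + Y - ι J - 1ℚ)
    arith Y zero    = sym (trans (cong (_* (Y + Y - ι 0 - 1ℚ)) fromℤ-0) (*-zeroˡ (Y + Y - ι 0 - 1ℚ)))
    arith Y (suc J) = begin-equality
      2ℚ * ∑ (suc J) f                                   ≡⟨ cong (2ℚ *_) (∑-last J f) ⟩
      2ℚ * (∑ J f + f J)                                 ≡⟨ *-distribˡ-+ 2ℚ (∑ J f) (f J) ⟩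
      2ℚ * ∑ J f + 2ℚ * f J                              ≡⟨ cong₂ _+_ (arith Y J) (cong (λ z → 2ℚ * (Y - z)) (ι-suc J)) ⟩
      ι J * (Y + Y - ι J - 1ℚ) + 2ℚ * (Y - (1ℚ + ι J))   ≡⟨ lemma (ι J) Y ⟩
      (1ℚ + ι J) * (Y + Y - (1ℚ + ι J) - 1ℚ)             ≡⟨ cong (λ z → z * (Y + Y - z - 1ℚ)) (sym (ι-suc J)) ⟩
      ι (suc J) * (Y + Y - ι (suc J) - 1ℚ)               ∎
      where
      open ≤-Reasoning
      f = λ a → Y - ι (suc a)
      lemma : ∀ j y → j * (y + y - j - 1ℚ) + (1ℚ + 1ℚ) * (y - (1ℚ + j)) ≡ (1ℚ + j) * (y + y - (1ℚ + j) - 1ℚ)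
      lemma = solve-∀ ringℚ

  sawtooth-floor : ∀ Z Y J → J ℕ.≤ Z → ι J ≤ Y → Y < ι (suc J) → sawtooth Z Y ≡ (Y - ι J) * (1ℚ - (Y - ι J))
  sawtooth-floor Z Y J J≤Z J≤Y Y<J+1 = begin-equality
    2ℚ * ∑ Z f - Y * Y + Y                            ≡⟨ cong (λ s → 2ℚ * s - Y * Y + Y) (∑-extend f J≤Z outside) ⟩
    2ℚ * ∑ J f - Y * Y + Y                            ≡⟨ cong (λ s → 2ℚ * s - Y * Y + Y) (∑-cong J inside) ⟩
    2ℚ * ∑ J (λ a → Y - ι (suc a)) - Y * Y + Y        ≡⟨ cong (λ s → s - Y * Y + Y) (arith Y J) ⟩
    ι J * (Y + Y - ι J - 1ℚ) - Y * Y + Y              ≡⟨ lemma (ι J) Y ⟩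
    (Y - ι J) * (1ℚ - (Y - ι J))                      ∎
    where
    open ≤-Reasoning
    f = λ a → (Y - ι (suc a)) ⁺
    lemma : ∀ j y → j * (y + y - j - 1ℚ) - y * y + y ≡ (y - j) * (1ℚ - (y - j))
    lemma = solve-∀ ringℚ
    inside : ∀ a → a ℕ.< J → f a ≡ Y - ι (suc a)
    inside a a<J = ⁺-pos (diff (≤-trans (ι-mono a<J) J≤Y))
    outside : ∀ a → J ℕ.≤ a → f a ≡ 0ℚ
    outside a J≤a = ⁺-neg {Y - ι (suc a)} (≤-by (ι (suc a) - Y) (diff (≤-trans (<⇒≤ Y<J+1) (ι-mono (s≤s J≤a)))) (cancel Y (ι (suc a))))
      where
      cancel : ∀ y a → (y - a) + (a - y) ≡ 0ℚ
      cancel = solve-∀ ringℚ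

  module _ (Z : ℕ) where

    private
      record Split (Y : ℚ) : Set where
        field
          J    : ℕ
          0≤θ  : 0ℚ ≤ Y - ι J
          0≤1θ : 0ℚ ≤ 1ℚ - (Y - ι J)
          saw  : sawtooth Z Y ≡ (Y - ι J) * (1ℚ - (Y - ι J))
          J≤Y  : ι J ≤ Y
          Y<J  : Y < ι (suc J)

      split : ∀ Y → 0ℚ ≤ Y → Y ≤ ι Z → Split Y
      split Y 0≤Y Y≤Z with floor-ℕ Y 0≤Y
      ... | J , J≤Y , Y<J = record
        { J = J ; J≤Y = J≤Y ; Y<J = Y<J
        ; 0≤θ = diff J≤Y
        ; 0≤1θ = subst (0ℚ ≤_) (trans (cong (_- Y) (ι-suc J)) (lemma (ι J) Y)) (diff (<⇒≤ Y<J))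
        ; saw = sawtooth-floor Z Y J (ℕ.≮⇒≥ λ Z<J → <⇒≱ (<-≤-trans (<-by 1ℚ 0<1 (trans (+-comm (ι Z) 1ℚ) (sym (ι-suc Z)))) (ι-mono Z<J)) (≤-trans J≤Y Y≤Z)) J≤Y Y<J }
        where
        lemma : ∀ j y → 1ℚ + j - y ≡ 1ℚ - (y - j)
        lemma = solve-∀ ringℚ

    sawtooth≥0 : ∀ Y → 0ℚ ≤ Y → Y ≤ ι Z → 0ℚ ≤ sawtooth Z Y
    sawtooth≥0 Y 0≤Y Y≤Z = subst (0ℚ ≤_) (sym saw) (*≥0 0≤θ 0≤1θ)
      where open Split (split Y 0≤Y Y≤Z)

    sawtooth≤ : ∀ Y → 0ℚ ≤ Y → Y ≤ ι Z → sawtooth Z Y ≤ Y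
    sawtooth≤ Y 0≤Y Y≤Z = subst (_≤ Y) (sym saw)
      (≤-by ((Y - ι J) * (Y - ι J) + ι J) (+≥0 (*≥0 0≤θ 0≤θ) (ι≥0 J)) (lemma (ι J) Y))
      where
      open Split (split Y 0≤Y Y≤Z)
      lemma : ∀ j y → (y - j) * (1ℚ - (y - j)) + ((y - j) * (y - j) + j) ≡ y
      lemma = solve-∀ ringℚ

    -- The slope of θ(1 - θ) lies between -1 and 1 on each unit interval, and the function is
    -- continuous, with value 0 at the integers.
    sawtooth-Lipschitz : ∀ Y Y′ → 0ℚ ≤ Y′ → Y′ ≤ Y → Y ≤ ι Z → ∣ sawtooth Z Y - sawtooth Z Y′ ∣ ≤ Y - Y′
    sawtooth-Lipschitz Y Y′ 0≤Y′ Y′≤Y Y≤Z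
      with split Y (≤-trans 0≤Y′ Y′≤Y) Y≤Z | split Y′ 0≤Y′ (≤-trans Y′≤Y Y≤Z)
    ... | s | s′ = subst₂ (λ a b → ∣ a - b ∣ ≤ Y - Y′) (sym S.saw) (sym S′.saw) (cases (ℕ.<-cmp S′.J S.J))
      where
      module S = Split s
      module S′ = Split s′
      open import Relation.Binary.Definitions using (tri<; tri≈; tri>)
      t = Y - ι S.J
      t′ = Y′ - ι S′.J
      cases : _ → ∣ t * (1ℚ - t) - t′ * (1ℚ - t′) ∣ ≤ Y - Y′
      cases (tri> _ _ J<J′) = ⊥-elim (<⇒≱ S.Y<J (≤-trans (ι-mono J<J′) (≤-trans S′.J≤Y Y′≤Y)))
      cases (tri≈ _ J′≡J _) = ∣∣≤
        (≤-by ((Y - Y′) * (t + t′)) (*≥0 (diff Y′≤Y) (+≥0 S.0≤θ S′.0≤θ))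
          (subst (λ J → t * (1ℚ - t) - (Y′ - ι J) * (1ℚ - (Y′ - ι J)) + (Y - Y′) * (t + (Y′ - ι J)) ≡ Y - Y′) (sym J′≡J) (up Y Y′ (ι S.J))))
        (≤-by ((Y - Y′) * ((1ℚ - t) + (1ℚ - t′))) (*≥0 (diff Y′≤Y) (+≥0 S.0≤1θ S′.0≤1θ))
          (subst (λ J → - (t * (1ℚ - t) - (Y′ - ι J) * (1ℚ - (Y′ - ι J))) + (Y - Y′) * ((1ℚ - t) + (1ℚ - (Y′ - ι J))) ≡ Y - Y′) (sym J′≡J) (down Y Y′ (ι S.J))))
        where
        up : ∀ y y′ j → (y - j) * (1ℚ - (y - j)) - (y′ - j) * (1ℚ - (y′ - j)) + (y - y′) * ((y - j) + (y′ - j)) ≡ y - y′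
        up = solve-∀ ringℚ
        down : ∀ y y′ j → - ((y - j) * (1ℚ - (y - j)) - (y′ - j) * (1ℚ - (y′ - j))) + (y - y′) * ((1ℚ - (y - j)) + (1ℚ - (y′ - j))) ≡ y - y′
        down = solve-∀ ringℚ
      -- Here Y - Y′ = g + t + (1 - t′), where g ≥ 0 is the length of the full unit intervals in
      -- between. The two bounds come from t(1 - t) ≤ t and t′(1 - t′) ≤ 1 - t′.
      cases (tri< J′<J _ _) = ∣∣≤
        (≤-by (g + t * t + (1ℚ - t′) + t′ * (1ℚ - t′)) (+≥0 (+≥0 (+≥0 g≥0 (*≥0 S.0≤θ S.0≤θ)) S′.0≤1θ) (*≥0 S′.0≤θ S′.0≤1θ)) (up Y Y′ (ι S.J) (ι S′.J)))
        (≤-by (g + t + (1ℚ - t′) * (1ℚ - t′) + t * (1ℚ - t)) (+≥0 (+≥0 (+≥0 g≥0 S.0≤θ) (*≥0 S′.0≤1θ S′.0≤1θ)) (*≥0 S.0≤θ S.0≤1θ)) (down Y Y′ (ι S.J) (ι S′.J)))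
        where
        g = ι S.J - (1ℚ + ι S′.J)
        g≥0 : 0ℚ ≤ g
        g≥0 = diff (subst (_≤ ι S.J) (ι-suc S′.J) (ι-mono J′<J))
        up : ∀ y y′ j j′ → (y - j) * (1ℚ - (y - j)) - (y′ - j′) * (1ℚ - (y′ - j′))
           + ((j - (1ℚ + j′)) + (y - j) * (y - j) + (1ℚ - (y′ - j′)) + (y′ - j′) * (1ℚ - (y′ - j′))) ≡ y - y′
        up = solve-∀ ringℚ
        down : ∀ y y′ j j′ → - ((y - j) * (1ℚ - (y - j)) - (y′ - j′) * (1ℚ - (y′ - j′)))
           + ((j - (1ℚ + j′)) + (y - j) + (1ℚ - (y′ - j′)) * (1ℚ - (y′ - j′)) + (y - j) * (1ℚ - (y - j))) ≡ y - y′
        down = solve-∀ ringℚ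

-- Smoothly cut off sums over products ma with a prime to n.

module Mean where

  open import Data.Empty using (⊥-elim)
  open import Data.Nat.Base as ℕ using (ℕ; zero; suc; s≤s; z≤n; NonZero)
  open import Data.Nat.Coprimality as Cop using (coprime?; coprime⇒gcd≡1; gcd≡1⇒coprime)
  open import Data.Nat.Divisibility
  open import Data.Nat.GCD
  import Data.Nat.Properties as ℕ
  open import Data.Product using (∃; _,_; proj₁; proj₂)
  open import Data.Rational hiding (NonZero; ≢-nonZero; >-nonZero)
  open import Data.Rational.Properties
  open import Data.Sum using (inj₁; inj₂)
  open import Relation.Binary.PropositionalEquality using (_≡_; refl; sym; trans; cong; cong₂; subst; subst₂)
  open import Relation.Nullary using (yes; no)
  open import Tactic.RingSolver using (solve-∀)
  open Kit
  open Sawtooth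

  -- The cutoff is continuous on purpose: a sharp one would put the fractional part, with its jumps,
  -- in place of the continuous θ(1 - θ) in `smooth-sum`.
  w : ℚ → ℚ
  w s = (1ℚ - s) ⁺

  harmonic : ℕ → ℚ
  harmonic N = ∑ N (λ i → inv (ι (suc i)))

  module Kernel (Z : ℕ) (z : ℚ) (0<z : 0ℚ < z) (1≤Zz : 1ℚ ≤ ι Z * z) where

    module _ (m : ℕ) where
      u Y : ℚ
      u = ι (suc m) * z
      Y = inv u

      0<u : 0ℚ < u
      0<u = *>0 (ι>0 m) 0<z

      0≤Y : 0ℚ ≤ Y
      0≤Y = inv≥0 0<u

      uY≡1 : u * Y ≡ 1ℚ
      uY≡1 = *-inv⁺ 0<u

      Y≤Z : Y ≤ ι Z
      Y≤Z = *-cancelˡ-≤ 0<u (subst (_≤ u * ι Z) (sym uY≡1)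
        (≤-trans 1≤Zz (≤-trans (≤-reflexive (*-comm (ι Z) z))
          (*-monoʳ (ι≥0 Z) (≤-trans (≤-reflexive (sym (*-identityˡ z))) (*-monoʳ (<⇒≤ 0<z) (ι≥1 m)))))))

      ρ : ℚ
      ρ = u * sawtooth Z Y

      -- Since u(Y - a) = 1 - ua for Y = 1/u, the sum over a is the one inside `sawtooth`. What
      -- remains is the main term 1/u, the constant -1 and the remainder ρ. Throughout, the index m
      -- stands for the number m + 1, and likewise a.
      smooth-sum : 2ℚ * ∑ Z (λ a → w (ι (suc m) * ι (suc a) * z)) ≡ Y - 1ℚ + ρ
      smooth-sum = begin-equality
        2ℚ * ∑ Z (λ a → w (ι (suc m) * ι (suc a) * z))   ≡⟨ cong (2ℚ *_) (∑-cong′ Z λ a → sym (term a)) ⟩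
        2ℚ * ∑ Z (λ a → u * (Y - ι (suc a)) ⁺)           ≡⟨ cong (2ℚ *_) (sym (∑-*ˡ Z u _)) ⟩
        2ℚ * (u * S)                                     ≡⟨ lemma u Y S ⟩
        Y * (u * Y) - u * Y + u * (2ℚ * S - Y * Y + Y)   ≡⟨ cong (λ o → Y * o - o + ρ) uY≡1 ⟩
        Y * 1ℚ - 1ℚ + ρ                                  ≡⟨ cong (λ y → y - 1ℚ + ρ) (*-identityʳ Y) ⟩
        Y - 1ℚ + ρ                                       ∎
        where
        open ≤-Reasoning
        S = ∑ Z (λ a → (Y - ι (suc a)) ⁺)
        lemma : ∀ u y s → (1ℚ + 1ℚ) * (u * s) ≡ y * (u * y) - u * y + u * ((1ℚ + 1ℚ) * s - y * y + y)
        lemma = solve-∀ ringℚ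
        expand : ∀ i z y a → i * z * (y - a) ≡ i * z * y - i * a * z
        expand = solve-∀ ringℚ
        term : ∀ a → u * (Y - ι (suc a)) ⁺ ≡ w (ι (suc m) * ι (suc a) * z)
        term a = trans (⁺-scale (<⇒≤ 0<u) (Y - ι (suc a)))
          (cong _⁺ (trans (expand (ι (suc m)) z Y (ι (suc a))) (cong (_- ι (suc m) * ι (suc a) * z) uY≡1)))

      ρ≥0 : 0ℚ ≤ ρ
      ρ≥0 = *≥0 (<⇒≤ 0<u) (sawtooth≥0 Z Y 0≤Y Y≤Z)

      ρ≤1 : ρ ≤ 1ℚ
      ρ≤1 = subst (ρ ≤_) uY≡1 (*-monoˡ (<⇒≤ 0<u) (sawtooth≤ Z Y 0≤Y Y≤Z))

    -- In u₁T₁ - u₂T₂ = u₁(T₁ - T₂) - (u₂ - u₁)T₂ each part is at most 1/(m + 2): the first by the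
    -- Lipschitz bound, as u₁(Y₁ - Y₂) = 1/(m + 2), the second by T₂ ≤ Y₂, as u₂ - u₁ = z and zY₂ =
    -- 1/(m + 2). The total variation is therefore a harmonic sum.
    ρ-variation : ∀ m → ∣ ρ m - ρ (suc m) ∣ ≤ 2ℚ * inv (ι (suc (suc m)))
    ρ-variation m = begin
      ∣ u₁ * T₁ - u₂ * T₂ ∣             ≡⟨ cong ∣_∣ (split u₁ u₂ T₁ T₂) ⟩
      ∣ u₁ * (T₁ - T₂) - (u₂ - u₁) * T₂ ∣ ≤⟨ ∣∣-- (∣∣-* (∣∣-nonNeg (<⇒≤ (0<u m)) ≤-refl) lip) (∣∣-nonNeg (*≥0 0≤Δ (sawtooth≥0 Z Y₂ (0≤Y (suc m)) (Y≤Z (suc m)))) (*-monoˡ 0≤Δ (sawtooth≤ Z Y₂ (0≤Y (suc m)) (Y≤Z (suc m))))) ⟩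
      u₁ * (Y₁ - Y₂) + (u₂ - u₁) * Y₂ ≡⟨ cong₂ _+_ (trans (expand u₁ Y₁ Y₂) (trans (cong₂ _-_ (uY≡1 m) (u₁Y₂)) (shrink k))) (trans (cong (_* Y₂) Δ≡z) zY₂) ⟩
      inv k + inv k                     ≡⟨ double (inv k) ⟩
      2ℚ * inv k                        ∎
      where
      open ≤-Reasoning
      u₁ = u m ; u₂ = u (suc m) ; Y₁ = Y m ; Y₂ = Y (suc m) ; T₁ = sawtooth Z Y₁ ; T₂ = sawtooth Z Y₂
      k = ι (suc (suc m))
      0<k = ι>0 (suc m)
      split : ∀ a b s t → a * s - b * t ≡ a * (s - t) - (b - a) * t
      split = solve-∀ ringℚ
      expand : ∀ a s t → a * (s - t) ≡ a * s - a * t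
      expand = solve-∀ ringℚ
      double : ∀ x → x + x ≡ (1ℚ + 1ℚ) * x
      double = solve-∀ ringℚ
      Δ≡z : u₂ - u₁ ≡ z
      Δ≡z = trans (cong (λ i → i * z - u₁) (ι-suc (suc m))) (lemma (ι (suc m)) z)
        where
        lemma : ∀ i z → (1ℚ + i) * z - i * z ≡ z
        lemma = solve-∀ ringℚ
      0≤Δ : 0ℚ ≤ u₂ - u₁
      0≤Δ = subst (0ℚ ≤_) (sym Δ≡z) (<⇒≤ 0<z)
      zY₂ : z * Y₂ ≡ inv k
      zY₂ = inv-unique 0<k (trans (sym (*-assoc k z Y₂)) (uY≡1 (suc m)))
      u₁Y₂ : u₁ * Y₂ ≡ 1ℚ - inv k
      u₁Y₂ = trans (lemma u₁ u₂ Y₂) (cong₂ _-_ (uY≡1 (suc m)) (trans (cong (_* Y₂) Δ≡z) zY₂))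
        where
        lemma : ∀ a b y → a * y ≡ b * y - (b - a) * y
        lemma = solve-∀ ringℚ
      shrink : ∀ k → 1ℚ - (1ℚ - inv k) ≡ inv k
      shrink k = lemma (inv k)
        where
        lemma : ∀ x → 1ℚ - (1ℚ - x) ≡ x
        lemma = solve-∀ ringℚ
      lip : ∣ T₁ - T₂ ∣ ≤ Y₁ - Y₂
      lip = sawtooth-Lipschitz Z Y₁ Y₂ (0≤Y (suc m)) (inv-anti (0<u m) (≤-by (u₂ - u₁) 0≤Δ (lemma u₁ u₂))) (Y≤Z m)
        where
        lemma : ∀ a b → a + (b - a) ≡ b
        lemma = solve-∀ ringℚ

    -- The main term Σ f(m)/(mz) is small by the hypothesis on Σ f(m)/m; the remainder ρ has bounded variation.
    free-bound : ∀ (f : ℕ → ℚ) C → 0ℚ ≤ C → (∀ i → ∣ ∑ i f ∣ ≤ C) →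
                 ι Z * ∣ ∑ Z (λ m → f m * inv (ι (suc m))) ∣ ≤ C →
                 ∣ ∑ Z (λ m → f m * ∑ Z (λ a → w (ι (suc m) * ι (suc a) * z))) ∣ ≤ C * (2ℚ + 2ℚ + 2ℚ * harmonic (suc Z))
    free-bound f C 0≤C partial mean = ≤-trans halve double
      where
      S = ∑ Z (λ m → f m * ∑ Z (λ a → w (ι (suc m) * ι (suc a) * z)))
      P = ∑ Z (λ m → f m * Y m)
      Q = ∑ Z (λ m → f m * ρ m)
      H = harmonic (suc Z)
      halve : ∣ S ∣ ≤ ∣ 2ℚ * S ∣
      halve = subst (∣ S ∣ ≤_) (sym (trans (∣p*q∣≡∣p∣*∣q∣ 2ℚ S) (two ∣ S ∣))) (≤-by ∣ S ∣ (0≤∣p∣ S) refl)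
        where
        two : ∀ x → (1ℚ + 1ℚ) * x ≡ x + x
        two = solve-∀ ringℚ
      2S : 2ℚ * S ≡ P - ∑ Z f + Q
      2S = begin-equality
        2ℚ * S                                       ≡⟨ ∑-*ˡ Z 2ℚ _ ⟩
        ∑ Z (λ m → 2ℚ * (f m * W m)) ≡⟨ ∑-cong′ Z (λ m → trans (swap 2ℚ (f m) (W m)) (trans (cong (f m *_) (smooth-sum m)) (dist (f m) (Y m) (ρ m)))) ⟩
        ∑ Z (λ m → f m * Y m - f m + f m * ρ m)      ≡⟨ ∑-+ Z (λ m → f m * Y m - f m) (λ m → f m * ρ m) ⟩
        ∑ Z (λ m → f m * Y m - f m) + Q              ≡⟨ cong (_+ Q) (∑-- Z (λ m → f m * Y m) f) ⟩
        P - ∑ Z f + Q                                ∎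
        where
        open ≤-Reasoning
        W : ℕ → ℚ
        W m = ∑ Z (λ a → w (ι (suc m) * ι (suc a) * z))
        swap : ∀ a b c → a * (b * c) ≡ b * (a * c)
        swap = solve-∀ ringℚ
        dist : ∀ f y r → f * (y - 1ℚ + r) ≡ f * y - f + f * r
        dist = solve-∀ ringℚ
      P-bound : ∣ P ∣ ≤ C
      P-bound = begin
        ∣ P ∣                                                       ≡⟨ cong ∣_∣ P≡ ⟩
        ∣ inv z * ∑ Z (λ m → f m * inv (ι (suc m))) ∣               ≡⟨ ∣p*q∣≡∣p∣*∣q∣ (inv z) (∑ Z (λ m → f m * inv (ι (suc m)))) ⟩
        ∣ inv z ∣ * ∣ ∑ Z (λ m → f m * inv (ι (suc m))) ∣ ≤⟨ *-monoʳ (0≤∣p∣ (∑ Z (λ m → f m * inv (ι (suc m))))) (∣∣-nonNeg (inv≥0 0<z) inv≤Z) ⟩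
        ι Z * ∣ ∑ Z (λ m → f m * inv (ι (suc m))) ∣                 ≤⟨ mean ⟩
        C                                                           ∎
        where
        open ≤-Reasoning
        inv≤Z : inv z ≤ ι Z
        inv≤Z = *-cancelˡ-≤ 0<z (subst₂ _≤_ (sym (*-inv⁺ 0<z)) (*-comm (ι Z) z) 1≤Zz)
        Y≡ : ∀ m → Y m ≡ inv z * inv (ι (suc m))
        Y≡ m = sym (inv-unique (0<u m) (trans (rearrange (ι (suc m)) z (inv z) (inv (ι (suc m))))
          (trans (cong₂ _*_ (*-inv⁺ (ι>0 m)) (*-inv⁺ 0<z)) refl)))
          where
          rearrange : ∀ a b c d → a * b * (c * d) ≡ (a * d) * (b * c)
          rearrange = solve-∀ ringℚ
        P≡ : P ≡ inv z * ∑ Z (λ m → f m * inv (ι (suc m)))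
        P≡ = trans (∑-cong′ Z λ m → trans (cong (f m *_) (Y≡ m)) (swap (f m) (inv z) (inv (ι (suc m))))) (sym (∑-*ˡ Z (inv z) _))
          where
          swap : ∀ a b c → a * (b * c) ≡ b * (a * c)
          swap = solve-∀ ringℚ
      Q-bound : ∣ Q ∣ ≤ C * (1ℚ + 2ℚ * H)
      Q-bound = go Z refl
        where
        go : ∀ N → N ≡ Z → ∣ ∑ N (λ m → f m * ρ m) ∣ ≤ C * (1ℚ + 2ℚ * H)
        go zero    refl = *≥0 0≤C (+≥0 0≤1 (*≥0 (+≥0 0≤1 0≤1) (∑-nonNeg (suc Z) λ i _ → inv≥0 (ι>0 i))))
        go (suc N) refl = ≤-trans (abel-bound N f ρ (λ i → 2ℚ * inv (ι (suc (suc i)))) C 0≤C partial (λ i _ → ρ-variation i))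
          (*-monoˡ 0≤C (+-mono-≤ (∣∣-nonNeg (ρ≥0 N) (ρ≤1 N))
            (subst (_≤ 2ℚ * H) (∑-*ˡ N 2ℚ (λ i → inv (ι (suc (suc i))))) (*-monoˡ (+≥0 0≤1 0≤1) tail≤H))))
          where
          g : ℕ → ℚ
          g i = inv (ι (suc i))
          tail≤H : ∑ N (λ i → g (suc i)) ≤ H
          tail≤H = ≤-trans (≤-by (g 0) (inv≥0 (ι>0 0)) (+-comm (∑ N (λ i → g (suc i))) (g 0)))
            (≤-by (g (suc N)) (inv≥0 (ι>0 (suc N))) (sym (∑-last (suc N) g)))
      double : ∣ 2ℚ * S ∣ ≤ C * (2ℚ + 2ℚ + 2ℚ * H)
      double = begin
        ∣ 2ℚ * S ∣                 ≡⟨ cong ∣_∣ 2S ⟩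
        ∣ P - ∑ Z f + Q ∣          ≤⟨ ∣∣-+ (∣∣-- P-bound (partial Z)) Q-bound ⟩
        C + C + C * (1ℚ + 2ℚ * H)  ≤⟨ ≤-by C 0≤C (lemma C (2ℚ * H)) ⟩
        C * (2ℚ + 2ℚ + 2ℚ * H)     ∎
        where
        open ≤-Reasoning
        lemma : ∀ c x → c + c + c * (1ℚ + x) + c ≡ c * ((1ℚ + 1ℚ) + (1ℚ + 1ℚ) + x)
        lemma = solve-∀ ringℚ

  -- The Möbius function up to G, obtained by solving a triangular system: the value at `suc G` is
  -- read off from the equation for g = suc G and does not enter the equations for smaller g.
  möbius : ∀ G → ∃ λ (μ : ℕ → ℚ) → ∀ g → 0 ℕ.< g → g ℕ.≤ G → ∑ (suc G) (λ δ → ⟦ δ ∣? g ⟧ * μ δ) ≡ ⟦ g ℕ.≟ 1 ⟧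
  möbius zero = (λ _ → 0ℚ) , λ { g 0<g g≤0 → ⊥-elim (ℕ.<-irrefl refl (ℕ.<-≤-trans 0<g g≤0)) }
  möbius (suc G) with möbius G
  ... | μ , inverse = μ′ , inverse′
    where
    v = ⟦ suc G ℕ.≟ 1 ⟧ - ∑ (suc G) (λ δ → ⟦ δ ∣? suc G ⟧ * μ δ)
    μ′ : ℕ → ℚ
    μ′ δ with δ ℕ.≟ suc G
    ... | yes _ = v
    ... | no _  = μ δ
    μ′-old : ∀ δ → δ ℕ.< suc G → μ′ δ ≡ μ δ
    μ′-old δ lt with δ ℕ.≟ suc G
    ... | yes refl = ⊥-elim (ℕ.<-irrefl refl lt)
    ... | no _     = refl
    μ′-new : μ′ (suc G) ≡ v
    μ′-new with suc G ℕ.≟ suc G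
    ... | yes _ = refl
    ... | no ¬p = ⊥-elim (¬p refl)
    step : ∀ g → ∑ (suc (suc G)) (λ δ → ⟦ δ ∣? g ⟧ * μ′ δ) ≡ ∑ (suc G) (λ δ → ⟦ δ ∣? g ⟧ * μ δ) + ⟦ suc G ∣? g ⟧ * v
    step g = trans (∑-last (suc G) (λ δ → ⟦ δ ∣? g ⟧ * μ′ δ))
      (cong₂ _+_ (∑-cong (suc G) λ δ lt → cong (⟦ δ ∣? g ⟧ *_) (μ′-old δ lt)) (cong (⟦ suc G ∣? g ⟧ *_) μ′-new))
    inverse′ : ∀ g → 0 ℕ.< g → g ℕ.≤ suc G → ∑ (suc (suc G)) (λ δ → ⟦ δ ∣? g ⟧ * μ′ δ) ≡ ⟦ g ℕ.≟ 1 ⟧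
    inverse′ g 0<g g≤ with ℕ.m≤n⇒m<n∨m≡n g≤
    ... | inj₁ (s≤s g≤G) = trans (step g) (trans (cong₂ _+_ (inverse g 0<g g≤G)
            (trans (cong (_* v) (⟦⟧-no (suc G ∣? g) λ d → ℕ.<-irrefl refl (ℕ.<-≤-trans (s≤s g≤G) (∣⇒≤ {{ℕ.>-nonZero 0<g}} d)))) (*-zeroˡ v)))
            (+-identityʳ ⟦ g ℕ.≟ 1 ⟧))
    ... | inj₂ refl = trans (step (suc G)) (trans (cong (λ o → X + o * v) (⟦⟧-yes (suc G ∣? suc G) ∣-refl)) (lemma X ⟦ suc G ℕ.≟ 1 ⟧))
      where
      X = ∑ (suc G) (λ δ → ⟦ δ ∣? suc G ⟧ * μ δ)
      lemma : ∀ x o → x + 1ℚ * (o - x) ≡ o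
      lemma = solve-∀ ringℚ

  -- The substitution a + 1 = δ(b + 1). It reaches beyond `Z`, where φ has to vanish.
  ∑-multiples : ∀ Z δ (φ : ℕ → ℚ) → 0 ℕ.< δ → (∀ j → Z ℕ.< j → φ j ≡ 0ℚ) →
                ∑ Z (λ a → ⟦ δ ∣? suc a ⟧ * φ (suc a)) ≡ ∑ Z (λ b → φ (δ ℕ.* suc b))
  ∑-multiples Z δ@(suc δ′) φ 0<δ out = begin-equality
    ∑ Z (λ a → ⟦ δ ∣? suc a ⟧ * φ (suc a))
      ≡⟨ ∑-cong Z (λ a a<Z → cong (_* φ (suc a)) (sym (count a a<Z))) ⟩
    ∑ Z (λ a → ∑ Z (λ b → ⟦ suc a ℕ.≟ δ ℕ.* suc b ⟧) * φ (suc a))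
      ≡⟨ ∑-cong′ Z (λ a → ∑-*ʳ Z (φ (suc a)) (λ b → ⟦ suc a ℕ.≟ δ ℕ.* suc b ⟧)) ⟩
    ∑ Z (λ a → ∑ Z (λ b → ⟦ suc a ℕ.≟ δ ℕ.* suc b ⟧ * φ (suc a)))
      ≡⟨ ∑-swap Z Z _ ⟩
    ∑ Z (λ b → ∑ Z (λ a → ⟦ suc a ℕ.≟ δ ℕ.* suc b ⟧ * φ (suc a)))
      ≡⟨ ∑-cong′ Z pick ⟩
    ∑ Z (λ b → φ (δ ℕ.* suc b)) ∎
    where
    open ≤-Reasoning
    zero* : ∀ {x} y → x ≡ 0ℚ → x * y ≡ 0ℚ
    zero* y refl = *-zeroˡ y
    count : ∀ a → a ℕ.< Z → ∑ Z (λ b → ⟦ suc a ℕ.≟ δ ℕ.* suc b ⟧) ≡ ⟦ δ ∣? suc a ⟧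
    count a a<Z with δ ∣? suc a
    ... | no ¬d = ∑-zero Z λ b _ → ⟦⟧-no (suc a ℕ.≟ δ ℕ.* suc b) λ eq → ¬d (divides (suc b) (trans eq (ℕ.*-comm δ (suc b))))
    ... | yes (divides zero ())
    ... | yes (divides (suc b₀) eq) = trans
      (∑-δ Z b₀ (ℕ.≤-trans (ℕ.≤-trans (ℕ.m≤m*n (suc b₀) δ) (ℕ.≤-reflexive (sym eq))) a<Z)
        (λ b _ b≢ → ⟦⟧-no (suc a ℕ.≟ δ ℕ.* suc b) λ eq′ → b≢ (ℕ.suc-injective (ℕ.*-cancelˡ-≡ (suc b) (suc b₀) δ
          (trans (sym eq′) (trans eq (ℕ.*-comm (suc b₀) δ)))))))
      (⟦⟧-yes (suc a ℕ.≟ δ ℕ.* suc b₀) (trans eq (ℕ.*-comm (suc b₀) δ)))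
    pick : ∀ b → ∑ Z (λ a → ⟦ suc a ℕ.≟ δ ℕ.* suc b ⟧ * φ (suc a)) ≡ φ (δ ℕ.* suc b)
    pick b with δ ℕ.* suc b ℕ.≤? Z
    ... | yes le = trans (∑-δ Z (ℕ.pred (δ ℕ.* suc b)) le λ a _ a≢ → zero* (φ (suc a)) (⟦⟧-no (suc a ℕ.≟ δ ℕ.* suc b) λ eq → a≢ (cong ℕ.pred eq)))
                         (trans (cong (_* φ (δ ℕ.* suc b)) (⟦⟧-yes (δ ℕ.* suc b ℕ.≟ δ ℕ.* suc b) refl)) (*-identityˡ (φ (δ ℕ.* suc b))))
    ... | no ¬le = trans (∑-zero Z λ a a<Z → zero* (φ (suc a)) (⟦⟧-no (suc a ℕ.≟ δ ℕ.* suc b) λ eq → ¬le (subst (ℕ._≤ Z) eq a<Z)))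
                         (sym (out _ (ℕ.≰⇒> ¬le)))

  w-zero : ∀ {s} → 1ℚ ≤ s → w s ≡ 0ℚ
  w-zero {s} 1≤s = ⁺-neg {1ℚ - s} (≤-by (s - 1ℚ) (diff 1≤s) (lemma s))
    where
    lemma : ∀ s → 1ℚ - s + (s - 1ℚ) ≡ 0ℚ
    lemma = solve-∀ ringℚ

  ∑-kill : ∀ {x} y → x ≡ 0ℚ → x * y ≡ 0ℚ
  ∑-kill y refl = *-zeroˡ y

  module CoprimeMean (n : ℕ) {{_ : NonZero n}} where

    μ : ℕ → ℚ
    μ = proj₁ (möbius n)

    Mμ : ℚ
    Mμ = ∑ (suc n) (λ δ → ∣ μ δ ∣)

    coprime-möbius : ∀ a → ⟦ coprime? a n ⟧ ≡ ∑ (suc n) (λ δ → ⟦ δ ∣? a ⟧ * (⟦ δ ∣? n ⟧ * μ δ))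
    coprime-möbius a = begin-equality
      ⟦ coprime? a n ⟧                                     ≡⟨ ⟦⟧-cong (coprime? a n) (gcd a n ℕ.≟ 1) coprime⇒gcd≡1 gcd≡1⇒coprime ⟩
      ⟦ gcd a n ℕ.≟ 1 ⟧                                    ≡⟨ sym (proj₂ (möbius n) (gcd a n)
                                                                 (ℕ.n≢0⇒n>0 (gcd[m,n]≢0 a n (inj₂ (ℕ.≢-nonZero⁻¹ n)))) (gcd[m,n]≤n a n)) ⟩
      ∑ (suc n) (λ δ → ⟦ δ ∣? gcd a n ⟧ * μ δ) ≡⟨ ∑-cong′ (suc n) (λ δ → trans (cong (_* μ δ) (both δ)) (*-assoc ⟦ δ ∣? a ⟧ ⟦ δ ∣? n ⟧ (μ δ))) ⟩
      ∑ (suc n) (λ δ → ⟦ δ ∣? a ⟧ * (⟦ δ ∣? n ⟧ * μ δ))    ∎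
      where
      open ≤-Reasoning
      both : ∀ δ → ⟦ δ ∣? gcd a n ⟧ ≡ ⟦ δ ∣? a ⟧ * ⟦ δ ∣? n ⟧
      both δ with δ ∣? a | δ ∣? n
      ... | yes p | yes q = ⟦⟧-yes (δ ∣? gcd a n) (gcd-greatest p q)
      ... | yes p | no ¬q = ⟦⟧-no (δ ∣? gcd a n) λ d → ¬q (∣-trans d (gcd[m,n]∣n a n))
      ... | no ¬p | q     = trans (⟦⟧-no (δ ∣? gcd a n) λ d → ¬p (∣-trans d (gcd[m,n]∣m a n))) (sym (*-zeroˡ ⟦ q ⟧))

    module _ (Z : ℕ) (z : ℚ) (0<z : 0ℚ < z) (1≤Zz : 1ℚ ≤ ι Z * z) where

      -- Möbius inversion replaces the condition that a be prime to n by a combination, over δ ∣ n,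
      -- of sums over the multiples of δ. Each of these is an unrestricted sum with δz in place of
      -- z, and `free-bound` applies to it with the same constant.
      coprime-bound : ∀ (f : ℕ → ℚ) C → 0ℚ ≤ C → (∀ i → ∣ ∑ i f ∣ ≤ C) →
        ι Z * ∣ ∑ Z (λ m → f m * inv (ι (suc m))) ∣ ≤ C →
        ∣ ∑ Z (λ m → f m * ∑ Z (λ a → ⟦ coprime? (suc a) n ⟧ * w (ι (suc m) * ι (suc a) * z))) ∣
          ≤ Mμ * (C * (2ℚ + 2ℚ + 2ℚ * harmonic (suc Z)))
      coprime-bound f C 0≤C partial mean = begin
        ∣ ∑ Z (λ m → f m * ∑ Z (λ a → ⟦ coprime? (suc a) n ⟧ * W m (ι (suc a)))) ∣
          ≡⟨ cong ∣_∣ (trans (∑-cong′ Z λ m → trans (cong (f m *_) (inner m)) (∑-*ˡ (suc n) (f m) (λ δ → κ δ * V δ m))) (∑-swap Z (suc n) (λ m δ → f m * (κ δ * V δ m)))) ⟩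
        ∣ ∑ (suc n) (λ δ → ∑ Z (λ m → f m * (κ δ * V δ m))) ∣
          ≤⟨ ∑-abs (suc n) (λ δ _ → each δ) ⟩
        ∑ (suc n) (λ δ → ∣ μ δ ∣ * K)
          ≡⟨ sym (∑-*ʳ (suc n) K (λ δ → ∣ μ δ ∣)) ⟩
        Mμ * K ∎
        where
        open ≤-Reasoning
        K = C * (2ℚ + 2ℚ + 2ℚ * harmonic (suc Z))
        W : ℕ → ℚ → ℚ
        W m x = w (ι (suc m) * x * z)
        κ : ℕ → ℚ
        κ δ = ⟦ δ ∣? n ⟧ * μ δ
        V : ℕ → ℕ → ℚ
        V δ m = ∑ Z (λ a → ⟦ δ ∣? suc a ⟧ * W m (ι (suc a)))
        inner : ∀ m → ∑ Z (λ a → ⟦ coprime? (suc a) n ⟧ * W m (ι (suc a))) ≡ ∑ (suc n) (λ δ → κ δ * V δ m)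
        inner m = begin-equality
          ∑ Z (λ a → ⟦ coprime? (suc a) n ⟧ * W m (ι (suc a)))
            ≡⟨ ∑-cong′ Z (λ a → trans (cong (_* W m (ι (suc a))) (coprime-möbius (suc a))) (∑-*ʳ (suc n) (W m (ι (suc a))) (λ δ → ⟦ δ ∣? suc a ⟧ * κ δ))) ⟩
          ∑ Z (λ a → ∑ (suc n) (λ δ → ⟦ δ ∣? suc a ⟧ * κ δ * W m (ι (suc a))))
            ≡⟨ ∑-swap Z (suc n) (λ a δ → ⟦ δ ∣? suc a ⟧ * κ δ * W m (ι (suc a))) ⟩
          ∑ (suc n) (λ δ → ∑ Z (λ a → ⟦ δ ∣? suc a ⟧ * κ δ * W m (ι (suc a))))
            ≡⟨ ∑-cong′ (suc n) (λ δ → trans (∑-cong′ Z λ a → swap ⟦ δ ∣? suc a ⟧ (κ δ) (W m (ι (suc a)))) (sym (∑-*ˡ Z (κ δ) _))) ⟩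
          ∑ (suc n) (λ δ → κ δ * V δ m) ∎
          where
          swap : ∀ a b c → a * b * c ≡ b * (a * c)
          swap = solve-∀ ringℚ
        0≤K : 0ℚ ≤ K
        0≤K = *≥0 0≤C (+≥0 (+≥0 (+≥0 0≤1 0≤1) (+≥0 0≤1 0≤1)) (*≥0 (+≥0 0≤1 0≤1) (∑-nonNeg (suc Z) λ i _ → inv≥0 (ι>0 i))))
        pull : ∀ δ → ∑ Z (λ m → f m * (κ δ * V δ m)) ≡ κ δ * ∑ Z (λ m → f m * V δ m)
        pull δ = trans (∑-cong′ Z λ m → swap (f m) (κ δ) (V δ m)) (sym (∑-*ˡ Z (κ δ) _))
          where
          swap : ∀ a b c → a * (b * c) ≡ b * (a * c)
          swap = solve-∀ ringℚ
        each : ∀ δ → ∣ ∑ Z (λ m → f m * (κ δ * V δ m)) ∣ ≤ ∣ μ δ ∣ * K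
        -- The range of δ begins at 0, which does not divide n.
        each zero = subst (_≤ ∣ μ 0 ∣ * K) (sym (cong ∣_∣ (trans (pull 0) (∑-kill (∑ Z (λ m → f m * V 0 m))
          (∑-kill (μ 0) (⟦⟧-no (0 ∣? n) λ d → ℕ.≢-nonZero⁻¹ n (0∣⇒≡0 d)))))))
          (*≥0 (0≤∣p∣ (μ 0)) 0≤K)
        each δ@(suc δ′) = subst (_≤ ∣ μ δ ∣ * K) (cong ∣_∣ (sym (pull δ))) (∣∣-* κ-bound
          (subst (λ S → ∣ S ∣ ≤ K) (∑-cong′ Z λ m → cong (f m *_) (sym (V≡ m)))
            (Kernel.free-bound Z (ι δ * z) (*>0 (ι>0 δ′) 0<z) 1≤Zδz f C 0≤C partial mean)))
          where
          κ-bound : ∣ κ δ ∣ ≤ ∣ μ δ ∣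
          κ-bound = subst (_≤ ∣ μ δ ∣) (sym (∣p*q∣≡∣p∣*∣q∣ ⟦ δ ∣? n ⟧ (μ δ)))
            (≤-trans (*-monoʳ (0≤∣p∣ (μ δ)) (∣∣-nonNeg (⟦⟧≥0 (δ ∣? n)) (⟦⟧≤1 (δ ∣? n)))) (≤-reflexive (*-identityˡ ∣ μ δ ∣)))
          z≤δz : z ≤ ι δ * z
          z≤δz = subst (_≤ ι δ * z) (*-identityˡ z) (*-monoʳ (<⇒≤ 0<z) (ι≥1 δ′))
          1≤Zδz : 1ℚ ≤ ι Z * (ι δ * z)
          1≤Zδz = ≤-trans 1≤Zz (*-monoˡ (ι≥0 Z) z≤δz)
          V≡ : ∀ m → V δ m ≡ ∑ Z (λ b → w (ι (suc m) * ι (suc b) * (ι δ * z)))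
          V≡ m = trans (∑-multiples Z δ (λ j → W m (ι j)) (s≤s z≤n) out)
            (∑-cong′ Z λ b → cong w (trans (cong (λ x → ι (suc m) * x * z) (ι-* δ (suc b))) (rearrange (ι (suc m)) (ι δ) (ι (suc b)) z)))
            where
            rearrange : ∀ m d b z → m * (d * b) * z ≡ m * b * (d * z)
            rearrange = solve-∀ ringℚ
            out : ∀ j → Z ℕ.< j → W m (ι j) ≡ 0ℚ
            out j Z<j = w-zero (≤-trans 1≤Zz (*-monoʳ (<⇒≤ 0<z) (≤-trans (ι-mono (ℕ.<⇒≤ Z<j))
              (subst (_≤ ι (suc m) * ι j) (*-identityˡ (ι j)) (*-monoʳ (ι≥0 j) (ι≥1 m))))))

-- Cutoffs on a geometric mesh of scales and their convolution.

module Mesh where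

  open import Data.Empty using (⊥-elim)
  open import Data.Nat.Base as ℕ using (ℕ; zero; suc; s≤s; _∸_)
  import Data.Nat.Properties as ℕ
  open import Data.Product using (∃₂; _×_; _,_)
  open import Data.Rational hiding (NonZero; ≢-nonZero; >-nonZero)
  open import Data.Rational.Properties
  open import Data.Sum using (inj₁; inj₂)
  open import Relation.Binary.PropositionalEquality using (_≡_; refl; sym; trans; cong; cong₂; subst; subst₂)
  open import Relation.Nullary using (yes; no)
  open import Tactic.RingSolver using (solve-∀)
  open Kit
  open Sawtooth
  open Mean

  infixr 8 _^_

  _^_ : ℚ → ℕ → ℚ
  x ^ zero  = 1ℚ
  x ^ suc i = x * x ^ i

  ^-+ : ∀ x i j → x ^ (i ℕ.+ j) ≡ x ^ i * x ^ j
  ^-+ x zero    j = sym (*-identityˡ (x ^ j))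
  ^-+ x (suc i) j = trans (cong (x *_) (^-+ x i j)) (sym (*-assoc x (x ^ i) (x ^ j)))

  ^>0 : ∀ {x} → 0ℚ < x → ∀ i → 0ℚ < x ^ i
  ^>0 0<x zero    = 0<1
  ^>0 0<x (suc i) = *>0 0<x (^>0 0<x i)

  ^≤1 : ∀ {x} → 0ℚ < x → x ≤ 1ℚ → ∀ i → x ^ i ≤ 1ℚ
  ^≤1 0<x x≤1 zero    = ≤-refl
  ^≤1 0<x x≤1 (suc i) = *-mono (<⇒≤ 0<x) x≤1 (<⇒≤ (^>0 0<x i)) (^≤1 0<x x≤1 i)

  ^-anti : ∀ {x} → 0ℚ < x → x ≤ 1ℚ → ∀ {i j} → i ℕ.≤ j → x ^ j ≤ x ^ i
  ^-anti {x} 0<x x≤1 {i} {j} i≤j = subst₂ _≤_ (trans (sym (^-+ x i (j ∸ i))) (cong (x ^_) (ℕ.m+[n∸m]≡n i≤j))) (*-identityʳ (x ^ i))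
    (*-monoˡ (<⇒≤ (^>0 0<x i)) (^≤1 0<x x≤1 (j ∸ i)))

  w≥0 : ∀ s → 0ℚ ≤ w s
  w≥0 s = ⁺≥0 (1ℚ - s)

  w≤1 : ∀ {s} → 0ℚ ≤ s → w s ≤ 1ℚ
  w≤1 {s} 0≤s = subst (w s ≤_) (⁺-pos 0≤1) (⊔-monoʳ-≤ 0ℚ {1ℚ} {1ℚ - s} (≤-by s 0≤s (lemma s)))
    where
    lemma : ∀ s → 1ℚ - s + s ≡ 1ℚ
    lemma = solve-∀ ringℚ

  -- For x ≥ 1 both values are 0. For x ≤ 1 the argument moves by (ρ - 1)x ≤ η, and `w` is
  -- 1-Lipschitz.
  w-dilate : ∀ {ρ η x} → 1ℚ ≤ ρ → ρ - 1ℚ ≤ η → 0ℚ ≤ x → ∣ w (ρ * x) - w x ∣ ≤ η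
  w-dilate {ρ} {η} {x} 1≤ρ ρ≤ 0≤x with ≤-total 1ℚ x
  ... | inj₁ 1≤x = subst (λ d → ∣ d ∣ ≤ η) (sym (cong₂ _-_ (w-zero (≤-trans 1≤x x≤ρx)) (w-zero 1≤x))) (≤-trans (diff 1≤ρ) ρ≤)
    where
    x≤ρx = subst (_≤ ρ * x) (*-identityˡ x) (*-monoʳ 0≤x 1≤ρ)
  ... | inj₂ x≤1 = ∣∣≤ (≤-by (η + (w x - w (ρ * x))) (+≥0 0≤η (diff anti)) (lemma₁ (w (ρ * x)) (w x) η)) upper
    where
    0≤η = ≤-trans (diff 1≤ρ) ρ≤
    anti : w (ρ * x) ≤ w x
    anti = ⊔-monoʳ-≤ 0ℚ {1ℚ - x} {1ℚ - ρ * x} (≤-by ((ρ - 1ℚ) * x) (*≥0 (diff 1≤ρ) 0≤x) (lemma ρ x))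
      where
      lemma : ∀ r x → 1ℚ - r * x + (r - 1ℚ) * x ≡ 1ℚ - x
      lemma = solve-∀ ringℚ
    lemma₁ : ∀ a b e → a - b + (e + (b - a)) ≡ e
    lemma₁ = solve-∀ ringℚ
    upper : - (w (ρ * x) - w x) ≤ η
    upper = ≤-trans (≤-by ((w (ρ * x) - (1ℚ - ρ * x)) + (ρ - 1ℚ) * (1ℚ - x))
        (+≥0 (diff (p≤q⊔p 0ℚ (1ℚ - ρ * x))) (*≥0 (diff 1≤ρ) (diff x≤1)))
        (trans (cong (λ v → - (w (ρ * x) - v) + ((w (ρ * x) - (1ℚ - ρ * x)) + (ρ - 1ℚ) * (1ℚ - x))) (⁺-pos (diff x≤1)))
               (lemma (w (ρ * x)) ρ x))) ρ≤
      where
      lemma : ∀ v r x → - (v - (1ℚ - x)) + ((v - (1ℚ - r * x)) + (r - 1ℚ) * (1ℚ - x)) ≡ r - 1ℚ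
      lemma = solve-∀ ringℚ

  module Scales (p η : ℚ) (0<p : 0ℚ < p) (p≤1 : p ≤ 1ℚ) (pq≡1 : p * (1ℚ + η) ≡ 1ℚ) (0≤η : 0ℚ ≤ η) where

    -- Cuts off at M = qⁱ, where q = 1 + η = 1/p.
    t : ℕ → ℕ → ℚ
    t i M = w (ι M * p ^ i)

    private
      0≤ιp : ∀ i M → 0ℚ ≤ ι M * p ^ i
      0≤ιp i M = *≥0 (ι≥0 M) (<⇒≤ (^>0 0<p i))

    t≥0 : ∀ i M → 0ℚ ≤ t i M
    t≥0 i M = w≥0 (ι M * p ^ i)

    t≤1 : ∀ i M → t i M ≤ 1ℚ
    t≤1 i M = w≤1 (0≤ιp i M)

    ∣t∣≤1 : ∀ i M → ∣ t i M ∣ ≤ 1ℚ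
    ∣t∣≤1 i M = ∣∣-nonNeg (t≥0 i M) (t≤1 i M)

    t-zero : ∀ i M → 1ℚ ≤ ι M * p ^ i → t i M ≡ 0ℚ
    t-zero i M = w-zero

    -- A multiplicative convolution of the cutoff with itself: the two scales qⁱ and q^(I - i)
    -- always have the product q^I.
    ω : ℕ → ℕ → ℕ → ℚ
    ω I M M′ = ∑ (suc I) (λ i → t i M * t (I ∸ i) M′)

    Ω : ℕ → ℕ → ℚ
    Ω I = ω I 1

    Ω≥0 : ∀ I N → 0ℚ ≤ Ω I N
    Ω≥0 I N = ∑-nonNeg (suc I) λ i _ → *≥0 (t≥0 i 1) (t≥0 (I ∸ i) N)

    Ω-zero : ∀ I N → 1ℚ ≤ ι N * p ^ I → Ω I N ≡ 0ℚ
    Ω-zero I N le = ∑-zero (suc I) λ i _ → trans (cong (t i 1 *_) (t-zero (I ∸ i) N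
      (≤-trans le (*-monoˡ (ι≥0 N) (^-anti 0<p p≤1 (ℕ.m∸n≤m I i)))))) (*-zeroʳ (t i 1))

    private
      -- The position of M in the mesh: q^s ≤ M < q^(s + 1).
      crossing : ∀ M I → 1ℚ ≤ ι M → ι M * p ^ I < 1ℚ →
                 ∃₂ λ s L → s ℕ.+ L ≡ I × 1ℚ ≤ ι M * p ^ s × ι M * p ^ suc s < 1ℚ
      crossing M zero    1≤M lt = ⊥-elim (<⇒≱ lt (subst (1ℚ ≤_) (sym (*-identityʳ (ι M))) 1≤M))
      crossing M (suc I) 1≤M lt with 1ℚ ≤? ι M * p ^ I
      ... | yes le = I , 1 , ℕ.+-comm I 1 , le , lt
      ... | no ¬le with crossing M I 1≤M (≰⇒> ¬le)
      ...   | s , L , eq , a , b = s , suc L , trans (ℕ.+-suc s L) (cong suc eq) , a , b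

      product-diff : ∀ {a b c d e} → ∣ a - b ∣ ≤ e → ∣ c - d ∣ ≤ e → ∣ a ∣ ≤ 1ℚ → ∣ d ∣ ≤ 1ℚ → ∣ a * c - b * d ∣ ≤ e + e
      product-diff {a} {b} {c} {d} {e} ab cd a≤1 d≤1 = subst₂ (λ x y → ∣ x ∣ ≤ y) (sym (lemma a b c d)) (cong₂ _+_ (*-identityˡ e) (*-identityʳ e))
        (∣∣-+ (∣∣-* a≤1 cd) (∣∣-* ab d≤1))
        where
        lemma : ∀ a b c d → a * c - b * d ≡ a * (c - d) + (a - b) * d
        lemma = solve-∀ ringℚ

    -- Invariance of the convolution under a shift along the mesh. If q^s ≤ M < q^(s + 1), the terms
    -- with i < s vanish. For i = s + j the arguments Mp^(s + j) and pʲ differ by a factor between 1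
    -- and 1 + η, and so do the arguments for MM′ at scale s + L - j and for M′ at scale L - j. By
    -- `w-dilate` each factor moves by at most η, so each term moves by at most 2η.
    ω≈Ω : ∀ I M M′ → 0 ℕ.< M → 0 ℕ.< M′ → ∣ ω I M M′ - Ω I (M ℕ.* M′) ∣ ≤ ι (suc I) * (η + η)
    ω≈Ω I M@(suc M₁) M′@(suc M₁′) _ _ with 1ℚ ≤? ι M * p ^ I
    ... | yes le = subst (λ x → ∣ x ∣ ≤ ι (suc I) * (η + η)) (sym (cong₂ _-_ ω≡0 (Ω-zero I (M ℕ.* M′) le′)))
                     (*≥0 (ι≥0 (suc I)) (+≥0 0≤η 0≤η))
      where
      ω≡0 : ω I M M′ ≡ 0ℚ
      ω≡0 = ∑-zero (suc I) λ { i (s≤s i≤I) → ∑-kill (t (I ∸ i) M′) (t-zero i M (≤-trans le (*-monoˡ (ι≥0 M) (^-anti 0<p p≤1 i≤I)))) }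
      le′ : 1ℚ ≤ ι (M ℕ.* M′) * p ^ I
      le′ = ≤-trans le (*-monoʳ (<⇒≤ (^>0 0<p I)) (ι-mono (ℕ.m≤m*n M M′)))
    ... | no ¬le with crossing M I (ι≥1 M₁) (≰⇒> ¬le)
    ...   | s , L , refl , 1≤ρ , lt = begin
      ∣ ω (s ℕ.+ L) M M′ - Ω (s ℕ.+ L) (M ℕ.* M′) ∣     ≡⟨ cong ∣_∣ (cong₂ _-_ ω≡ Ω≡) ⟩
      ∣ ∑ (suc L) F - ∑ (suc L) G ∣                     ≡⟨ cong ∣_∣ (sym (∑-- (suc L) F G)) ⟩
      ∣ ∑ (suc L) (λ j → F j - G j) ∣                   ≤⟨ ∑-abs (suc L) close ⟩
      ∑ (suc L) (λ _ → η + η)                           ≡⟨ ∑-const (suc L) (η + η) ⟩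
      ι (suc L) * (η + η)                               ≤⟨ *-monoʳ (+≥0 0≤η 0≤η) (ι-mono (s≤s (ℕ.m≤n+m L s))) ⟩
      ι (suc (s ℕ.+ L)) * (η + η)                       ∎
      where
      open ≤-Reasoning
      ρ = ι M * p ^ s
      F G : ℕ → ℚ
      F j = t (s ℕ.+ j) M * t (L ∸ j) M′
      G j = t j 1 * t (s ℕ.+ (L ∸ j)) (M ℕ.* M′)
      ρ-1≤η : ρ - 1ℚ ≤ η
      ρ-1≤η = ≤-by ((1ℚ - ι M * p ^ suc s) * (1ℚ + η)) (*≥0 (diff (<⇒≤ lt)) (+≥0 0≤1 0≤η))
        (trans (lemma (ι M) (p ^ s) p η) (trans (cong (λ o → ρ - 1ℚ + (1ℚ + η - ι M * p ^ s * o)) pq≡1) (lemma′ ρ η)))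
        where
        lemma : ∀ m x p e → m * x - 1ℚ + (1ℚ - m * (p * x)) * (1ℚ + e) ≡ m * x - 1ℚ + (1ℚ + e - m * x * (p * (1ℚ + e)))
        lemma = solve-∀ ringℚ
        lemma′ : ∀ r e → r - 1ℚ + (1ℚ + e - r * 1ℚ) ≡ e
        lemma′ = solve-∀ ringℚ
      ω≡ : ω (s ℕ.+ L) M M′ ≡ ∑ (suc L) F
      ω≡ = trans (cong (λ N → ∑ N f) (sym (ℕ.+-suc s L))) (trans (∑-split s (suc L) f)
        (trans (cong₂ _+_ (∑-zero s λ i i<s → ∑-kill (t (s ℕ.+ L ∸ i) M′) (t-zero i M (≤-trans 1≤ρ (*-monoˡ (ι≥0 M) (^-anti 0<p p≤1 (ℕ.<⇒≤ i<s))))))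
          (∑-cong′ (suc L) λ j → cong (λ k → t (s ℕ.+ j) M * t k M′) (ℕ.[m+n]∸[m+o]≡n∸o s L j))) (+-identityˡ (∑ (suc L) F))))
        where f = λ i → t i M * t (s ℕ.+ L ∸ i) M′
      Ω≡ : Ω (s ℕ.+ L) (M ℕ.* M′) ≡ ∑ (suc L) G
      -- The scales j > L of Ω contribute nothing: there MM′ is cut off at a scale of at most q^s,
      -- which is no more than M.
      Ω≡ = trans (cong (λ N → ∑ N f) (cong suc (ℕ.+-comm s L))) (trans (∑-split (suc L) s f)
        (trans (cong₂ _+_ (∑-cong (suc L) λ { j (s≤s j≤L) → cong (λ k → t j 1 * t k (M ℕ.* M′)) (ℕ.+-∸-assoc s j≤L) })
          (∑-zero s λ j j<s → trans (cong (t (suc L ℕ.+ j) 1 *_) (t-zero (s ℕ.+ L ∸ (suc L ℕ.+ j)) (M ℕ.* M′) (big j j<s))) (*-zeroʳ (t (suc L ℕ.+ j) 1))))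
          (+-identityʳ (∑ (suc L) G))))
        where
        f = λ j → t j 1 * t (s ℕ.+ L ∸ j) (M ℕ.* M′)
        big : ∀ j → j ℕ.< s → 1ℚ ≤ ι (M ℕ.* M′) * p ^ (s ℕ.+ L ∸ (suc L ℕ.+ j))
        big j j<s = ≤-trans 1≤ρ (*-mono (ι≥0 M) (ι-mono (ℕ.m≤m*n M M′)) (<⇒≤ (^>0 0<p s)) (^-anti 0<p p≤1 le))
          where
          le : s ℕ.+ L ∸ (suc L ℕ.+ j) ℕ.≤ s
          le = ℕ.≤-trans (ℕ.∸-monoʳ-≤ (s ℕ.+ L) (ℕ.≤-trans (ℕ.n≤1+n L) (ℕ.m≤m+n (suc L) j))) (ℕ.≤-reflexive (ℕ.m+n∸n≡m s L))
      close : ∀ j → j ℕ.< suc L → ∣ F j - G j ∣ ≤ η + η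
      close j _ = product-diff first second (∣t∣≤1 (s ℕ.+ j) M) (∣t∣≤1 (s ℕ.+ (L ∸ j)) (M ℕ.* M′))
        where
        first : ∣ t (s ℕ.+ j) M - t j 1 ∣ ≤ η
        first = subst₂ (λ x y → ∣ w x - w y ∣ ≤ η)
          (trans (*-assoc (ι M) (p ^ s) (p ^ j)) (cong (ι M *_) (sym (^-+ p s j))))
          (trans (sym (*-identityˡ (p ^ j))) (cong (_* p ^ j) (sym fromℤ-1)))
          (w-dilate 1≤ρ ρ-1≤η (<⇒≤ (^>0 0<p j)))
        second : ∣ t (L ∸ j) M′ - t (s ℕ.+ (L ∸ j)) (M ℕ.* M′) ∣ ≤ η
        second = subst (_≤ η) (trans (sym (∣-p∣≡∣p∣ (w (ρ * (ι M′ * p ^ (L ∸ j))) - w (ι M′ * p ^ (L ∸ j)))))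
            (cong ∣_∣ (trans (flip (w (ρ * (ι M′ * p ^ (L ∸ j)))) (w (ι M′ * p ^ (L ∸ j)))) (cong (λ x → t (L ∸ j) M′ - w x) arg))))
          (w-dilate 1≤ρ ρ-1≤η (0≤ιp (L ∸ j) M′))
          where
          flip : ∀ a b → - (a - b) ≡ b - a
          flip = solve-∀ ringℚ
          shuffle : ∀ a b c d → a * b * (c * d) ≡ a * c * (b * d)
          shuffle = solve-∀ ringℚ
          arg : ρ * (ι M′ * p ^ (L ∸ j)) ≡ ι (M ℕ.* M′) * p ^ (s ℕ.+ (L ∸ j))
          arg = trans (shuffle (ι M) (p ^ s) (ι M′) (p ^ (L ∸ j))) (cong₂ _*_ (sym (ι-* M M′)) (sym (^-+ p s (L ∸ j))))

-- Upper and lower bounds for the weighted average of E.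

module Ingham where

  open import Data.Empty using (⊥-elim)
  open import Data.Nat.Base as ℕ using (ℕ; zero; suc; s≤s; NonZero; _∸_; _%_)
  open import Data.Nat.Coprimality as Cop using (Coprime; coprime?; coprime-divisor; 0-coprimeTo-m⇒m≡1)
  open import Data.Nat.Divisibility
  import Data.Nat.Properties as ℕ
  import Data.Nat.Tactic.RingSolver as ℕR
  open import Data.Product using (_×_; _,_)
  open import Data.Rational hiding (NonZero; ≢-nonZero; >-nonZero)
  open import Data.Rational.Properties
  open import Relation.Binary.PropositionalEquality using (_≡_; refl; sym; trans; cong; cong₂; subst)
  open import Relation.Nullary using (Dec; yes; no; ¬_)
  open import Tactic.RingSolver using (solve-∀)
  open Kit
  open Mod
  open Arith
  open Gram
  open Sawtooth
  open Mean
  open Mesh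

  coprime-* : ∀ {a b n} → Coprime a n → Coprime b n → Coprime (a ℕ.* b) n
  coprime-* {a} {b} {n} ca cb {d} (d∣ab , d∣n) =
    cb (coprime-divisor {d} {a} {b} (λ (e∣d , e∣a) → ca (e∣a , ∣-trans e∣d d∣n)) d∣ab , d∣n)

  module Quad (Z : ℕ) where

    quad : (ℕ → ℕ → ℕ → ℕ → ℚ) → ℚ
    quad f = ∑ Z λ m → ∑ Z λ a → ∑ Z λ m′ → ∑ Z λ b → f m a m′ b

    quad-cong : ∀ {f g} → (∀ m a m′ b → f m a m′ b ≡ g m a m′ b) → quad f ≡ quad g
    quad-cong eq = ∑-cong′ Z λ m → ∑-cong′ Z λ a → ∑-cong′ Z λ m′ → ∑-cong′ Z λ b → eq m a m′ b

    quad-∑ : ∀ N (f : ℕ → ℕ → ℕ → ℕ → ℕ → ℚ) →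
             ∑ N (λ k → quad (f k)) ≡ quad (λ m a m′ b → ∑ N (λ k → f k m a m′ b))
    quad-∑ N f = trans (∑-swap N Z _) (∑-cong′ Z λ m → trans (∑-swap N Z _) (∑-cong′ Z λ a →
                 trans (∑-swap N Z _) (∑-cong′ Z λ m′ → ∑-swap N Z _)))

    quad-abs : ∀ f c → (∀ m a m′ b → ∣ f m a m′ b ∣ ≤ c) → ∣ quad f ∣ ≤ ι Z * (ι Z * (ι Z * (ι Z * c)))
    quad-abs f c le = ≤-trans (∑-abs Z λ m _ → ∑-abs Z λ a _ → ∑-abs Z λ m′ _ → ∑-abs Z λ b _ → le m a m′ b)
      (≤-reflexive (trans (∑-cong′ Z λ m → trans (∑-cong′ Z λ a → trans (∑-cong′ Z λ m′ → ∑-const Z c) (∑-const Z (ι Z * c))) (∑-const Z (ι Z * (ι Z * c)))) (∑-const Z (ι Z * (ι Z * (ι Z * c))))))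

    quad-- : ∀ f g → quad f - quad g ≡ quad (λ m a m′ b → f m a m′ b - g m a m′ b)
    quad-- f g = sym (trans (∑-cong′ Z λ m → trans (∑-cong′ Z λ a → trans (∑-cong′ Z λ m′ → ∑-- Z _ _) (∑-- Z _ _)) (∑-- Z _ _)) (∑-- Z _ _))

    quad-* : ∀ (F G : ℕ → ℕ → ℚ) → (∑ Z λ m → ∑ Z λ a → F m a) * (∑ Z λ m → ∑ Z λ a → G m a) ≡ quad (λ m a m′ b → F m a * G m′ b)
    quad-* F G = trans (∑-*ʳ Z g _) (∑-cong′ Z λ m → trans (∑-*ʳ Z g _) (∑-cong′ Z λ a →
      trans (∑-*ˡ Z (F m a) _) (∑-cong′ Z λ m′ → ∑-*ˡ Z (F m a) _)))
      where g = ∑ Z λ m → ∑ Z λ a → G m a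

  -- By strict growth an index is hit at most once, and the terms that are not hit are nonnegative.
  increasing≤∑ : ∀ Z (F : ℕ → ℚ) (N : ℕ → ℕ) W → (∀ i → i ℕ.< Z → 0ℚ ≤ F i) →
                 (∀ {i j} → i ℕ.< j → N i ℕ.< N j) → (∀ j → j ℕ.< W → N j ℕ.< Z) →
                 ∑ W (λ j → F (N j)) ≤ ∑ Z F
  increasing≤∑ Z F N W F≥0 inc N<Z = begin
    ∑ W (λ j → F (N j))                          ≡⟨ ∑-cong W (λ j j<W → sym (pick (N j) (N<Z j j<W))) ⟩
    ∑ W (λ j → ∑ Z (λ i → ⟦ i ℕ.≟ N j ⟧ * F i))  ≡⟨ ∑-swap W Z _ ⟩
    ∑ Z (λ i → ∑ W (λ j → ⟦ i ℕ.≟ N j ⟧ * F i))  ≡⟨ ∑-cong′ Z (λ i → sym (∑-*ʳ W (F i) _)) ⟩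
    ∑ Z (λ i → ∑ W (λ j → ⟦ i ℕ.≟ N j ⟧) * F i) ≤⟨ ∑-mono Z (λ i i<Z → subst (∑ W (λ j → ⟦ i ℕ.≟ N j ⟧) * F i ≤_) (*-identityˡ (F i)) (*-monoʳ (F≥0 i i<Z) (count W i))) ⟩
    ∑ Z F                                        ∎
    where
    open ≤-Reasoning
    pick : ∀ k → k ℕ.< Z → ∑ Z (λ i → ⟦ i ℕ.≟ k ⟧ * F i) ≡ F k
    pick k k<Z = trans (∑-δ Z k k<Z λ i _ i≢k → ∑-kill (F i) (⟦⟧-no (i ℕ.≟ k) i≢k))
      (trans (cong (_* F k) (⟦⟧-yes (k ℕ.≟ k) refl)) (*-identityˡ (F k)))
    count : ∀ W i → ∑ W (λ j → ⟦ i ℕ.≟ N j ⟧) ≤ 1ℚ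
    count zero    i = 0≤1
    count (suc W) i with i ℕ.≟ N W
    ... | yes refl = ≤-reflexive (trans (∑-δ (suc W) {λ j → ⟦ N W ℕ.≟ N j ⟧} W ℕ.≤-refl λ { j (s≤s j≤W) j≢W → ⟦⟧-no (N W ℕ.≟ N j) λ eq → ℕ.<-irrefl (sym eq) (inc (ℕ.≤∧≢⇒< j≤W j≢W)) }) (⟦⟧-yes (N W ℕ.≟ N W) refl))
    ... | no ¬p = subst (_≤ 1ℚ) (sym (trans (∑-last W (λ j → ⟦ i ℕ.≟ N j ⟧)) (trans (cong (λ z → ∑ W (λ j → ⟦ i ℕ.≟ N j ⟧) + z) (⟦⟧-no (i ℕ.≟ N W) ¬p)) (+-identityʳ (∑ W (λ j → ⟦ i ℕ.≟ N j ⟧)))))) (count W i)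

  ½≥0 : 0ℚ ≤ ½
  ½≥0 = nonNegative⁻¹ ½

  ½≤w : ∀ {s} → s ≤ ½ → ½ ≤ w s
  ½≤w {s} s≤½ = ≤-trans (≤-by (½ - s) (diff s≤½) (lemma s)) (p≤q⊔p 0ℚ (1ℚ - s))
    where
    lemma : ∀ s → ½ + (½ - s) ≡ 1ℚ - s
    lemma = solve-∀ ringℚ

  module Bounds (n : ℕ) {{_ : NonZero n}} (1<n : 1 ℕ.< n) (h : ℕ → ℚ)
    (periodic : ∀ m → h (m % n) ≡ h m) (support : ∀ m → ¬ Coprime m n → h m ≡ 0ℚ)
    (C : ℚ) (0≤C : 0ℚ ≤ C) (partial : ∀ k i → ∣ ∑ i (λ m → h (k ℕ.* m)) ∣ ≤ C)
    (mean : ∀ k x → ι x * ∣ ∑ x (λ m → h (k ℕ.* suc m) * inv (ι (suc m))) ∣ ≤ C) where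

    open GramMatrix n 1<n h periodic support public using (R; h-0; R-0ˡ; R-0ʳ; E; E≥0; E-square)
    open CoprimeMean n public using (Mμ; coprime-bound)

    χ : ℕ → ℚ
    χ a = ⟦ coprime? a n ⟧

    χ-0 : χ 0 ≡ 0ℚ
    χ-0 = ⟦⟧-no (coprime? 0 n) λ cop → ℕ.<-irrefl (sym (0-coprimeTo-m⇒m≡1 cop)) 1<n

    Rmax : ℚ
    Rmax = ι n * ((C + C) * (C + C))

    -- A value is the difference of two consecutive partial sums.
    h≤ : ∀ k m → ∣ h (k ℕ.* m) ∣ ≤ C + C
    h≤ k m = subst (λ x → ∣ x ∣ ≤ C + C) (trans (cong (_- ∑ m f) (∑-last m f)) (lemma (∑ m f) (f m))) (∣∣-- (partial k (suc m)) (partial k m))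
      where
      f = λ m → h (k ℕ.* m)
      lemma : ∀ x y → x + y - x ≡ y
      lemma = solve-∀ ringℚ

    R≤ : ∀ m m′ → ∣ R m m′ ∣ ≤ Rmax
    R≤ m m′ = ≤-trans (∑-abs n λ k _ → ∣∣-* (h≤ k m) (h≤ k m′)) (≤-reflexive (∑-const n ((C + C) * (C + C))))

    R-support : ∀ m m′ → ¬ (Coprime m n × Coprime m′ n) → R m m′ ≡ 0ℚ
    R-support m m′ ¬c with coprime? m n
    ... | no ¬p = ∑-zero n λ k _ → ∑-kill (h (k ℕ.* m′)) (support (k ℕ.* m) λ c → ¬p λ (d∣m , d∣n) → c (∣n⇒∣m*n k d∣m , d∣n))
    ... | yes p = ∑-zero n λ k _ → trans (cong (h (k ℕ.* m) *_) (support (k ℕ.* m′) λ c → ¬c (p , λ (d∣m , d∣n) → c (∣n⇒∣m*n k d∣m , d∣n)))) (*-zeroʳ (h (k ℕ.* m)))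

    module Compare (p η : ℚ) (0<p : 0ℚ < p) (p≤1 : p ≤ 1ℚ) (pq≡1 : p * (1ℚ + η) ≡ 1ℚ) (0≤η : 0ℚ ≤ η)
      (Z Z′ I : ℕ) (Z≡ : Z ≡ suc Z′) (large : 1ℚ ≤ ι Z′ * p ^ I) where

      open Scales p η 0<p p≤1 pq≡1 0≤η
      open Quad Z

      K : ℚ
      K = Mμ * (C * (2ℚ + 2ℚ + 2ℚ * harmonic (suc Z′)))

      A : ℕ → ℕ → ℚ
      A k i = ∑ Z λ m → ∑ Z λ a → h (k ℕ.* m) * (χ a * t i (m ℕ.* a))

      -- This is `coprime-bound` at z = pⁱ. The row m = 0 and the column a = 0 drop out, since h and
      -- χ vanish at 0; this accounts for the shift from `Z` to `Z′`.
      A-bound : ∀ k i → i ℕ.≤ I → ∣ A k i ∣ ≤ K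
      A-bound k i i≤I = subst (λ x → ∣ x ∣ ≤ K) (sym A≡) (coprime-bound Z′ (p ^ i) (^>0 0<p i)
          (≤-trans large (*-monoˡ (ι≥0 Z′) (^-anti 0<p p≤1 i≤I))) f C 0≤C
          (λ j → subst (λ x → ∣ x ∣ ≤ C) (trans (cong (_+ ∑ j f) hk0) (+-identityˡ (∑ j f))) (partial k (suc j)))
          (mean k Z′))
        where
        open ≤-Reasoning
        f : ℕ → ℚ
        f m = h (k ℕ.* suc m)
        hk0 : h (k ℕ.* 0) ≡ 0ℚ
        hk0 = trans (cong h (ℕ.*-zeroʳ k)) h-0
        inner : ∀ m → ∑ (suc Z′) (λ a → χ a * t i (suc m ℕ.* a)) ≡ ∑ Z′ (λ a → χ (suc a) * w (ι (suc m) * ι (suc a) * p ^ i))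
        inner m = trans (cong (_+ ∑ Z′ (λ a → χ (suc a) * t i (suc m ℕ.* suc a))) (∑-kill (t i (suc m ℕ.* 0)) χ-0))
          (trans (+-identityˡ (∑ Z′ (λ a → χ (suc a) * t i (suc m ℕ.* suc a))))
            (∑-cong′ Z′ λ a → cong (λ x → χ (suc a) * w (x * p ^ i)) (ι-* (suc m) (suc a))))
        A≡ : A k i ≡ ∑ Z′ (λ m → f m * ∑ Z′ (λ a → χ (suc a) * w (ι (suc m) * ι (suc a) * p ^ i)))
        A≡ = begin-equality
          A k i
            ≡⟨ cong (λ Z → ∑ Z λ m → ∑ Z λ a → h (k ℕ.* m) * (χ a * t i (m ℕ.* a))) Z≡ ⟩
          ∑ (suc Z′) (λ m → ∑ (suc Z′) λ a → h (k ℕ.* m) * (χ a * t i (m ℕ.* a)))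
            ≡⟨ cong₂ _+_ (∑-zero (suc Z′) λ a _ → ∑-kill (χ a * t i 0) hk0)
                 (∑-cong′ Z′ λ m → trans (sym (∑-*ˡ (suc Z′) (f m) (λ a → χ a * t i (suc m ℕ.* a)))) (cong (f m *_) (inner m))) ⟩
          0ℚ + ∑ Z′ (λ m → f m * ∑ Z′ (λ a → χ (suc a) * w (ι (suc m) * ι (suc a) * p ^ i)))
            ≡⟨ +-identityˡ (∑ Z′ (λ m → f m * ∑ Z′ (λ a → χ (suc a) * w (ι (suc m) * ι (suc a) * p ^ i)))) ⟩
          ∑ Z′ (λ m → f m * ∑ Z′ (λ a → χ (suc a) * w (ι (suc m) * ι (suc a) * p ^ i))) ∎

      -- `B` is what the linear bounds control. In `B′` the weight depends only on the product
      -- mam′b, so `B′` is an average of E.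
      B B′ : ℚ
      B  = ∑ n (λ k → ∑ (suc I) (λ i → A k i * A k (I ∸ i)))
      B′ = quad (λ m a m′ b → R m m′ * (χ a * χ b) * Ω I (m ℕ.* a ℕ.* (m′ ℕ.* b)))

      B-bound : ∣ B ∣ ≤ ι n * (ι (suc I) * (K * K))
      B-bound = ≤-trans (∑-abs n λ k _ → ∑-abs (suc I) {g = λ _ → K * K} λ { i (s≤s i≤I) → ∣∣-* (A-bound k i i≤I) (A-bound k (I ∸ i) (ℕ.m∸n≤m I i)) })
        (≤-reflexive (trans (∑-cong′ n λ _ → ∑-const (suc I) (K * K)) (∑-const n (ι (suc I) * (K * K)))))

      B≡quad : B ≡ quad (λ m a m′ b → R m m′ * (χ a * χ b) * ω I (m ℕ.* a) (m′ ℕ.* b))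
      B≡quad = begin-equality
        B ≡⟨ ∑-cong′ n (λ k → ∑-cong′ (suc I) λ i → quad-* (λ m a → h (k ℕ.* m) * (χ a * t i (m ℕ.* a))) (λ m a → h (k ℕ.* m) * (χ a * t (I ∸ i) (m ℕ.* a)))) ⟩
        ∑ n (λ k → ∑ (suc I) (λ i → quad (λ m a m′ b → term k i m a m′ b)))
          ≡⟨ ∑-cong′ n (λ k → quad-∑ (suc I) (λ i m a m′ b → term k i m a m′ b)) ⟩
        ∑ n (λ k → quad (λ m a m′ b → ∑ (suc I) (λ i → term k i m a m′ b)))
          ≡⟨ quad-∑ n _ ⟩
        quad (λ m a m′ b → ∑ n (λ k → ∑ (suc I) (λ i → term k i m a m′ b)))
          ≡⟨ quad-cong collect ⟩
        quad (λ m a m′ b → R m m′ * (χ a * χ b) * ω I (m ℕ.* a) (m′ ℕ.* b)) ∎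
        where
        open ≤-Reasoning
        term : ℕ → ℕ → ℕ → ℕ → ℕ → ℕ → ℚ
        term k i m a m′ b = h (k ℕ.* m) * (χ a * t i (m ℕ.* a)) * (h (k ℕ.* m′) * (χ b * t (I ∸ i) (m′ ℕ.* b)))
        shuffle : ∀ x c u y d v → x * (c * u) * (y * (d * v)) ≡ x * y * (c * d) * (u * v)
        shuffle = solve-∀ ringℚ
        collect : ∀ m a m′ b → ∑ n (λ k → ∑ (suc I) (λ i → term k i m a m′ b)) ≡ R m m′ * (χ a * χ b) * ω I (m ℕ.* a) (m′ ℕ.* b)
        collect m a m′ b = begin-equality
          ∑ n (λ k → ∑ (suc I) (λ i → term k i m a m′ b))
            ≡⟨ ∑-cong′ n (λ k → trans (∑-cong′ (suc I) λ i → shuffle (h (k ℕ.* m)) (χ a) (t i (m ℕ.* a)) (h (k ℕ.* m′)) (χ b) (t (I ∸ i) (m′ ℕ.* b)))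
                 (sym (∑-*ˡ (suc I) (h (k ℕ.* m) * h (k ℕ.* m′) * (χ a * χ b)) (λ i → t i (m ℕ.* a) * t (I ∸ i) (m′ ℕ.* b))))) ⟩
          ∑ n (λ k → h (k ℕ.* m) * h (k ℕ.* m′) * (χ a * χ b) * ω I (m ℕ.* a) (m′ ℕ.* b))
            ≡⟨ trans (sym (∑-*ʳ n (ω I (m ℕ.* a) (m′ ℕ.* b)) (λ k → h (k ℕ.* m) * h (k ℕ.* m′) * (χ a * χ b)))) (cong (_* ω I (m ℕ.* a) (m′ ℕ.* b)) (sym (∑-*ʳ n (χ a * χ b) (λ k → h (k ℕ.* m) * h (k ℕ.* m′))))) ⟩
          R m m′ * (χ a * χ b) * ω I (m ℕ.* a) (m′ ℕ.* b) ∎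

      private
        -- Handles the terms to which `ω≈Ω` does not apply, its arguments having to be positive.
        weight-zero : ∀ m a m′ b → m ℕ.* a ℕ.* (m′ ℕ.* b) ≡ 0 → R m m′ * (χ a * χ b) ≡ 0ℚ
        weight-zero zero a m′ b _ = ∑-kill (χ a * χ b) (R-0ˡ m′)
        weight-zero m zero m′ b _ = trans (cong (R m m′ *_) (∑-kill (χ b) χ-0)) (*-zeroʳ (R m m′))
        weight-zero m a zero b _ = ∑-kill (χ a * χ b) (R-0ʳ m)
        weight-zero m a m′ zero _ = trans (cong (R m m′ *_) (trans (cong (χ a *_) χ-0) (*-zeroʳ (χ a)))) (*-zeroʳ (R m m′))
        weight-zero (suc m) (suc a) (suc m′) (suc b) ()

        ε = ι (suc I) * (η + η)
        ε≥0 : 0ℚ ≤ ε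
        ε≥0 = *≥0 (ι≥0 (suc I)) (+≥0 0≤η 0≤η)
        Rmax≥0 : 0ℚ ≤ Rmax
        Rmax≥0 = *≥0 (ι≥0 n) (*≥0 (+≥0 0≤C 0≤C) (+≥0 0≤C 0≤C))

      -- Crude on purpose: the number Z⁴ of terms times the error of one. The mesh width η can be
      -- chosen after Z, so the factor Z⁴ does no harm.
      B≈B′ : ∣ B - B′ ∣ ≤ ι Z * (ι Z * (ι Z * (ι Z * (Rmax * ε))))
      B≈B′ = subst (λ x → ∣ x ∣ ≤ ι Z * (ι Z * (ι Z * (ι Z * (Rmax * ε))))) (sym (trans (cong (_- B′) B≡quad) (quad-- _ _)))
        (quad-abs _ (Rmax * ε) close)
        where
        factor : ∀ x u v → x * u - x * v ≡ x * (u - v)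
        factor = solve-∀ ringℚ
        close : ∀ m a m′ b → ∣ R m m′ * (χ a * χ b) * ω I (m ℕ.* a) (m′ ℕ.* b) - R m m′ * (χ a * χ b) * Ω I (m ℕ.* a ℕ.* (m′ ℕ.* b)) ∣ ≤ Rmax * ε
        close m a m′ b = subst (λ x → ∣ x ∣ ≤ Rmax * ε) (sym (factor (R m m′ * (χ a * χ b)) (ω I (m ℕ.* a) (m′ ℕ.* b)) (Ω I (m ℕ.* a ℕ.* (m′ ℕ.* b))))) (go (m ℕ.* a ℕ.* (m′ ℕ.* b) ℕ.≟ 0))
          where
          Δ = ω I (m ℕ.* a) (m′ ℕ.* b) - Ω I (m ℕ.* a ℕ.* (m′ ℕ.* b))
          go : Dec (m ℕ.* a ℕ.* (m′ ℕ.* b) ≡ 0) → ∣ R m m′ * (χ a * χ b) * Δ ∣ ≤ Rmax * ε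
          go (yes eq) = subst (λ x → ∣ x ∣ ≤ Rmax * ε) (sym (∑-kill Δ (weight-zero m a m′ b eq))) (*≥0 Rmax≥0 ε≥0)
          go (no ne) = ∣∣-* (subst (∣ R m m′ * (χ a * χ b) ∣ ≤_) (*-identityʳ Rmax)
              (∣∣-* (R≤ m m′) (∣∣-nonNeg (*≥0 (⟦⟧≥0 (coprime? a n)) (⟦⟧≥0 (coprime? b n)))
                 (*-mono (⟦⟧≥0 (coprime? a n)) (⟦⟧≤1 (coprime? a n)) (⟦⟧≥0 (coprime? b n)) (⟦⟧≤1 (coprime? b n))))))
            (ω≈Ω I (m ℕ.* a) (m′ ℕ.* b) (ℕ.n≢0⇒n>0 λ e → ne (cong (ℕ._* (m′ ℕ.* b)) e))
              (ℕ.n≢0⇒n>0 λ e → ne (trans (cong (m ℕ.* a ℕ.*_) e) (ℕ.*-zeroʳ (m ℕ.* a)))))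

      E′ : ℕ → ℚ
      E′ N = quad (λ m a m′ b → ⟦ m ℕ.* a ℕ.* (m′ ℕ.* b) ℕ.≟ N ⟧ * (R m m′ * (χ a * χ b)))

      Ω-large : ∀ N → Z ℕ.≤ N → Ω I N ≡ 0ℚ
      Ω-large N Z≤N = Ω-zero I N (≤-trans large (*-monoʳ (<⇒≤ (^>0 0<p I)) (ι-mono (ℕ.≤-trans (ℕ.n≤1+n Z′) (subst (ℕ._≤ N) Z≡ Z≤N)))))

      B′≡ : B′ ≡ ∑ Z (λ N → Ω I N * E′ N)
      B′≡ = sym (trans (∑-cong′ Z λ N → push N) (trans (quad-∑ Z _) (quad-cong λ m a m′ b →
        trans (∑-cong′ Z λ N → shuffle (Ω I N) ⟦ m ℕ.* a ℕ.* (m′ ℕ.* b) ℕ.≟ N ⟧ (R m m′ * (χ a * χ b)))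
          (trans (sym (∑-*ˡ Z (R m m′ * (χ a * χ b)) (λ N → ⟦ m ℕ.* a ℕ.* (m′ ℕ.* b) ℕ.≟ N ⟧ * Ω I N))) (cong (R m m′ * (χ a * χ b) *_) (pick (m ℕ.* a ℕ.* (m′ ℕ.* b))))))))
        where
        shuffle : ∀ o d r → o * (d * r) ≡ r * (d * o)
        shuffle = solve-∀ ringℚ
        push : ∀ N → Ω I N * E′ N ≡ quad (λ m a m′ b → Ω I N * (⟦ m ℕ.* a ℕ.* (m′ ℕ.* b) ℕ.≟ N ⟧ * (R m m′ * (χ a * χ b))))
        push N = trans (∑-*ˡ Z (Ω I N) _) (∑-cong′ Z λ m → trans (∑-*ˡ Z (Ω I N) _) (∑-cong′ Z λ a → trans (∑-*ˡ Z (Ω I N) _) (∑-cong′ Z λ m′ → ∑-*ˡ Z (Ω I N) _)))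
        pick : ∀ P → ∑ Z (λ N → ⟦ P ℕ.≟ N ⟧ * Ω I N) ≡ Ω I P
        pick P with P ℕ.<? Z
        ... | yes P<Z = trans (∑-δ Z P P<Z λ N _ N≢P → ∑-kill (Ω I N) (⟦⟧-no (P ℕ.≟ N) λ e → N≢P (sym e)))
                          (trans (cong (_* Ω I P) (⟦⟧-yes (P ℕ.≟ P) refl)) (*-identityˡ (Ω I P)))
        ... | no P≮Z = trans (∑-zero Z λ N N<Z → ∑-kill (Ω I N) (⟦⟧-no (P ℕ.≟ N) λ e → P≮Z (subst (ℕ._< Z) (sym e) N<Z))) (sym (Ω-large P (ℕ.≮⇒≥ P≮Z)))

      -- Given m, m′ and a, at most one b completes the product to N, and it exists exactly when
      -- mm′a ∣ N. All four factors then divide N, so χ is 1 at a and b.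
      E′≡E : ∀ N {{_ : NonZero N}} (N<Z : N ℕ.< Z) (N⊥n : Coprime N n) → E′ N ≡ E Z N N<Z N⊥n
      E′≡E N N<Z N⊥n = ∑-cong′ Z λ m → trans (∑-swap Z Z _) (∑-cong′ Z λ m′ → begin-equality
        ∑ Z (λ a → ∑ Z (λ b → ⟦ m ℕ.* a ℕ.* (m′ ℕ.* b) ℕ.≟ N ⟧ * (R m m′ * (χ a * χ b))))
          ≡⟨ ∑-cong′ Z (λ a → trans (∑-cong′ Z λ b → shuffle ⟦ m ℕ.* a ℕ.* (m′ ℕ.* b) ℕ.≟ N ⟧ (R m m′) (χ a * χ b))
               (trans (sym (∑-*ʳ Z (R m m′) (λ b → ⟦ m ℕ.* a ℕ.* (m′ ℕ.* b) ℕ.≟ N ⟧ * (χ a * χ b)))) (cong (_* R m m′) (count m m′ a)))) ⟩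
        ∑ Z (λ a → ⟦ m ℕ.* m′ ℕ.* a ∣? N ⟧ * R m m′)
          ≡⟨ sym (∑-*ʳ Z (R m m′) _) ⟩
        ∑ Z (λ a → ⟦ m ℕ.* m′ ℕ.* a ∣? N ⟧) * R m m′ ∎)
        where
        open ≤-Reasoning
        shuffle : ∀ d r c → d * (r * c) ≡ d * c * r
        shuffle = solve-∀ ringℚ
        reorder : ∀ m a m′ b → m ℕ.* a ℕ.* (m′ ℕ.* b) ≡ b ℕ.* (m ℕ.* m′ ℕ.* a)
        reorder = ℕR.solve-∀
        divisor-coprime : ∀ {g} → g ∣ N → Coprime g n
        divisor-coprime g∣N (d∣g , d∣n) = N⊥n (∣-trans d∣g g∣N , d∣n)
        count : ∀ m m′ a → ∑ Z (λ b → ⟦ m ℕ.* a ℕ.* (m′ ℕ.* b) ℕ.≟ N ⟧ * (χ a * χ b)) ≡ ⟦ m ℕ.* m′ ℕ.* a ∣? N ⟧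
        count m m′ a with m ℕ.* m′ ℕ.* a ∣? N
        ... | no ¬d = ∑-zero Z λ b _ → ∑-kill (χ a * χ b) (⟦⟧-no (m ℕ.* a ℕ.* (m′ ℕ.* b) ℕ.≟ N) λ e → ¬d (divides b (trans (sym e) (reorder m a m′ b))))
        ... | yes d@(divides b₀ eq) = trans
          (∑-δ Z b₀ (ℕ.≤-<-trans (∣⇒≤ b₀∣N) N<Z) λ b _ b≢ → ∑-kill (χ a * χ b) (⟦⟧-no (m ℕ.* a ℕ.* (m′ ℕ.* b) ℕ.≟ N)
            λ e → b≢ (ℕ.*-cancelʳ-≡ b b₀ (m ℕ.* m′ ℕ.* a) {{nz}} (trans (trans (sym (reorder m a m′ b)) e) eq))))
          (trans (cong₂ _*_ (⟦⟧-yes (m ℕ.* a ℕ.* (m′ ℕ.* b₀) ℕ.≟ N) (trans (reorder m a m′ b₀) (sym eq)))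
            (cong₂ _*_ (⟦⟧-yes (coprime? a n) (divisor-coprime (m*n∣⇒n∣ (m ℕ.* m′) a d))) (⟦⟧-yes (coprime? b₀ n) (divisor-coprime b₀∣N)))) refl)
          where
          b₀∣N : b₀ ∣ N
          b₀∣N = divides (m ℕ.* m′ ℕ.* a) (trans eq (ℕ.*-comm b₀ (m ℕ.* m′ ℕ.* a)))
          nz : NonZero (m ℕ.* m′ ℕ.* a)
          nz = ℕ.≢-nonZero λ e → ℕ.≢-nonZero⁻¹ N (trans eq (trans (cong (b₀ ℕ.*_) e) (ℕ.*-zeroʳ b₀)))

      -- For N prime to n this is Ingham's identity. Otherwise one of the four factors shares a
      -- divisor with n, and the term is killed by χ or by the support of h; for N = 0 some factor
      -- is 0.
      E′≥0 : ∀ N → N ℕ.< Z → 0ℚ ≤ E′ N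
      E′≥0 N N<Z with N ℕ.≟ 0 | coprime? N n
      ... | no N≢0 | yes cop = subst (0ℚ ≤_) (sym (E′≡E N {{ℕ.≢-nonZero N≢0}} N<Z cop)) (E≥0 Z N {{ℕ.≢-nonZero N≢0}} N<Z cop)
      ... | yes refl | _ = ≤-reflexive (sym (trans (quad-cong λ m a m′ b → vanish m a m′ b (m ℕ.* a ℕ.* (m′ ℕ.* b) ℕ.≟ 0)) zeros))
        where
        vanish : ∀ m a m′ b (d : Dec (m ℕ.* a ℕ.* (m′ ℕ.* b) ≡ 0)) → ⟦ d ⟧ * (R m m′ * (χ a * χ b)) ≡ 0ℚ
        vanish m a m′ b (yes e) = trans (cong (1ℚ *_) (weight-zero m a m′ b e)) refl
        vanish m a m′ b (no _) = *-zeroˡ (R m m′ * (χ a * χ b))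
        zeros : quad (λ _ _ _ _ → 0ℚ) ≡ 0ℚ
        zeros = ∑-zero Z λ _ _ → ∑-zero Z λ _ _ → ∑-zero Z λ _ _ → ∑-zero Z λ _ _ → refl
      ... | no _ | no ¬cop = ≤-reflexive (sym (trans (quad-cong λ m a m′ b → vanish m a m′ b (m ℕ.* a ℕ.* (m′ ℕ.* b) ℕ.≟ N)) zeros))
        where
        weight : ∀ m a m′ b → m ℕ.* a ℕ.* (m′ ℕ.* b) ≡ N → R m m′ * (χ a * χ b) ≡ 0ℚ
        weight m a m′ b e with coprime? a n | coprime? b n | coprime? m n | coprime? m′ n
        ... | no _ | cb | _ | _ = trans (cong (R m m′ *_) (*-zeroˡ ⟦ cb ⟧)) (*-zeroʳ (R m m′))
        ... | yes _ | no _ | _ | _ = *-zeroʳ (R m m′)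
        ... | yes ca | yes cb | no ¬cm | _ = ∑-kill (1ℚ * 1ℚ) (R-support m m′ λ (p , _) → ¬cm p)
        ... | yes ca | yes cb | yes cm | no ¬cm′ = ∑-kill (1ℚ * 1ℚ) (R-support m m′ λ (_ , p) → ¬cm′ p)
        ... | yes ca | yes cb | yes cm | yes cm′ = ⊥-elim (¬cop (subst (λ x → Coprime x n) e (coprime-* {m ℕ.* a} {m′ ℕ.* b} (coprime-* {m} {a} cm ca) (coprime-* {m′} {b} cm′ cb))))
        vanish : ∀ m a m′ b (d : Dec (m ℕ.* a ℕ.* (m′ ℕ.* b) ≡ N)) → ⟦ d ⟧ * (R m m′ * (χ a * χ b)) ≡ 0ℚ
        vanish m a m′ b (yes e) = trans (cong (1ℚ *_) (weight m a m′ b e)) refl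
        vanish m a m′ b (no _) = *-zeroˡ (R m m′ * (χ a * χ b))
        zeros : quad (λ _ _ _ _ → 0ℚ) ≡ 0ℚ
        zeros = ∑-zero Z λ _ _ → ∑-zero Z λ _ _ → ∑-zero Z λ _ _ → ∑-zero Z λ _ _ → refl

      -- The squares of D = 1 + nj are coprime to n, and E′ is at least R 1 1 there.
      B′-lower : ∀ W c → 0ℚ ≤ c → (∀ j → j ℕ.< W → (1 ℕ.+ n ℕ.* j) ℕ.* (1 ℕ.+ n ℕ.* j) ℕ.< Z) →
                 (∀ j → j ℕ.< W → c ≤ Ω I ((1 ℕ.+ n ℕ.* j) ℕ.* (1 ℕ.+ n ℕ.* j))) → 0ℚ ≤ R 1 1 →
                 ι W * (c * R 1 1) ≤ B′
      B′-lower W c 0≤c D²<Z c≤ R≥0 = begin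
        ι W * (c * R 1 1)                        ≡⟨ sym (∑-const W (c * R 1 1)) ⟩
        ∑ W (λ _ → c * R 1 1)                    ≤⟨ ∑-mono W (λ j j<W → *-mono 0≤c (c≤ j j<W) R≥0 (R≤E′ j j<W)) ⟩
        ∑ W (λ j → Ω I (D j ℕ.* D j) * E′ (D j ℕ.* D j)) ≤⟨ increasing≤∑ Z (λ N → Ω I N * E′ N) (λ j → D j ℕ.* D j) W (λ N N<Z → *≥0 (Ω≥0 I N) (E′≥0 N N<Z)) (λ i<j → ℕ.*-mono-< (D-mono i<j) (D-mono i<j)) D²<Z ⟩
        ∑ Z (λ N → Ω I N * E′ N)                 ≡⟨ sym B′≡ ⟩
        B′                                       ∎
        where
        open ≤-Reasoning
        D : ℕ → ℕ
        D j = 1 ℕ.+ n ℕ.* j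
        D-mono : ∀ {i j} → i ℕ.< j → D i ℕ.< D j
        D-mono i<j = s≤s (ℕ.*-monoʳ-< n i<j)
        D⊥n : ∀ j → Coprime (D j) n
        D⊥n j {d} (d∣D , d∣n) = ∣1⇒≡1 (∣m+n∣m⇒∣n (subst (d ∣_) (ℕ.+-comm 1 (n ℕ.* j)) d∣D) (∣m⇒∣m*n j d∣n))
        R≤E′ : ∀ j → j ℕ.< W → R 1 1 ≤ E′ (D j ℕ.* D j)
        R≤E′ j j<W = subst (R 1 1 ≤_) (sym (E′≡E (D j ℕ.* D j) (D²<Z j j<W) cop)) (E-square Z (D j ℕ.* D j) (D²<Z j j<W) cop (D j) refl)
          where cop = coprime-* {D j} {D j} (D⊥n j) (D⊥n j)

-- Choice of parameters: the average of E grows unless h vanishes.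

module Vanish where

  open import Data.Empty using (⊥-elim)
  open import Data.Nat.Base as ℕ using (ℕ; zero; suc; s≤s; z≤n; NonZero; _∸_; _%_)
  open import Data.Nat.Coprimality as Cop using (Coprime)
  open import Data.Nat.DivMod using (m%n<n)
  import Data.Nat.Properties as ℕ
  import Data.Nat.Tactic.RingSolver as ℕR
  open import Data.Product using (∃; _×_; _,_; proj₁; proj₂)
  open import Data.Rational hiding (NonZero; ≢-nonZero; >-nonZero)
  open import Data.Rational.Properties
  open import Relation.Binary.PropositionalEquality using (_≡_; refl; sym; trans; cong; cong₂; subst; subst₂)
  open import Relation.Nullary using (yes; no; ¬_)
  open import Tactic.RingSolver using (solve-∀)
  open Kit
  open Sawtooth
  open Mean
  open Mesh
  open Ingham

  ^-* : ∀ x k J → x ^ (k ℕ.* J) ≡ (x ^ J) ^ k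
  ^-* x zero    J = refl
  ^-* x (suc k) J = trans (^-+ x J (k ℕ.* J)) (cong (x ^ J *_) (^-* x k J))

  ^-distrib : ∀ x y k → (x * y) ^ k ≡ x ^ k * y ^ k
  ^-distrib x y zero    = refl
  ^-distrib x y (suc k) = trans (cong (x * y *_) (^-distrib x y k)) (lemma x y (x ^ k) (y ^ k))
    where
    lemma : ∀ x y a b → x * y * (a * b) ≡ x * a * (y * b)
    lemma = solve-∀ ringℚ

  ι-^ : ∀ B k → ι (B ℕ.^ k) ≡ ι B ^ k
  ι-^ B zero    = fromℤ-1
  ι-^ B (suc k) = trans (ι-* B (B ℕ.^ k)) (cong (ι B *_) (ι-^ B k))

  1≤^ : ∀ {x} → 1ℚ ≤ x → ∀ k → 1ℚ ≤ x ^ k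
  1≤^ 1≤x zero    = ≤-refl
  1≤^ {x} 1≤x (suc k) = ≤-trans (1≤^ 1≤x k) (subst (_≤ x * x ^ k) (*-identityˡ (x ^ k)) (*-monoʳ (≤-trans 0≤1 (1≤^ 1≤x k)) 1≤x))

  inv-1 : inv 1ℚ ≡ 1ℚ
  inv-1 = sym (inv-unique {1ℚ} {1ℚ} 0<1 refl)

  bernoulli : ∀ η → 0ℚ ≤ η → ∀ i → 1ℚ + ι i * η ≤ (1ℚ + η) ^ i
  bernoulli η 0≤η zero    = ≤-reflexive (trans (cong (λ z → 1ℚ + z * η) fromℤ-0) (trans (cong (λ z → 1ℚ + z) (*-zeroˡ η)) (+-identityʳ 1ℚ)))
  bernoulli η 0≤η (suc i) = ≤-trans (≤-by (ι i * (η * η)) (*≥0 (ι≥0 i) (*≥0 0≤η 0≤η)) (trans (cong (λ z → 1ℚ + z * η + ι i * (η * η)) (ι-suc i)) (lemma (ι i) η)))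
    (*-monoˡ (+≥0 0≤1 0≤η) (bernoulli η 0≤η i))
    where
    lemma : ∀ i e → 1ℚ + (1ℚ + i) * e + i * (e * e) ≡ (1ℚ + e) * (1ℚ + i * e)
    lemma = solve-∀ ringℚ

  harmonic-+ : ∀ N M → harmonic (N ℕ.+ M) ≤ harmonic N + ι M * inv (ι (suc N))
  harmonic-+ N M = begin
    harmonic (N ℕ.+ M)                                    ≡⟨ ∑-split N M _ ⟩
    harmonic N + ∑ M (λ i → inv (ι (suc (N ℕ.+ i)))) ≤⟨ +-monoʳ-≤ (harmonic N) (∑-mono M λ i _ → inv-anti (ι>0 N) (ι-mono (s≤s (ℕ.m≤m+n N i)))) ⟩
    harmonic N + ∑ M (λ i → inv (ι (suc N)))              ≡⟨ cong (λ z → harmonic N + z) (∑-const M (inv (ι (suc N)))) ⟩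
    harmonic N + ι M * inv (ι (suc N))                    ∎
    where open ≤-Reasoning

  -- The block from N to (B + 1)N has BN terms, each at most 1/(N + 1), so it adds less than B. For
  -- a fixed exponent k the bound is linear in B, which suffices against the cubic number of
  -- squares.
  harmonic-^ : ∀ B k → harmonic (suc B ℕ.^ k) ≤ 1ℚ + ι k * ι B
  harmonic-^ B zero    = ≤-reflexive (trans (cong (_+ 0ℚ) (sym (inv-unique (ι>0 0) (trans (*-identityʳ (ι 1)) fromℤ-1))))
    (sym (cong (λ z → 1ℚ + z) (trans (cong (_* ι B) fromℤ-0) (*-zeroˡ (ι B))))))
  harmonic-^ B (suc k) = begin
    harmonic (N ℕ.+ B ℕ.* N)                  ≤⟨ harmonic-+ N (B ℕ.* N) ⟩
    harmonic N + ι (B ℕ.* N) * inv (ι (suc N)) ≤⟨ +-mono-≤ (harmonic-^ B k) block ⟩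
    1ℚ + ι k * ι B + ι B                      ≡⟨ trans (lemma (ι k) (ι B)) (cong (λ z → 1ℚ + z * ι B) (sym (ι-suc k))) ⟩
    1ℚ + ι (suc k) * ι B                      ∎
    where
    open ≤-Reasoning
    N = suc B ℕ.^ k
    lemma : ∀ k b → 1ℚ + k * b + b ≡ 1ℚ + (1ℚ + k) * b
    lemma = solve-∀ ringℚ
    block : ι (B ℕ.* N) * inv (ι (suc N)) ≤ ι B
    block = begin
      ι (B ℕ.* N) * inv (ι (suc N))     ≤⟨ *-monoʳ (inv≥0 (ι>0 N)) (ι-mono (ℕ.*-monoʳ-≤ B (ℕ.n≤1+n N))) ⟩
      ι (B ℕ.* suc N) * inv (ι (suc N)) ≡⟨ trans (cong (_* inv (ι (suc N))) (ι-* B (suc N))) (*-assoc (ι B) (ι (suc N)) (inv (ι (suc N)))) ⟩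
      ι B * (ι (suc N) * inv (ι (suc N))) ≡⟨ trans (cong (ι B *_) (*-inv⁺ (ι>0 N))) (*-identityʳ (ι B)) ⟩
      ι B                               ∎

  first-power : ∀ q X → 1ℚ < X → ∀ i → X ≤ q ^ i → ∃ λ J → X ≤ q ^ suc J × q ^ J < X
  first-power q X 1<X zero    le = ⊥-elim (<⇒≱ 1<X le)
  first-power q X 1<X (suc i) le with X ≤? q ^ i
  ... | yes le′ = first-power q X 1<X i le′
  ... | no ¬le  = i , le , ≰⇒> ¬le

  module NonVanishing (n : ℕ) {{_ : NonZero n}} (1<n : 1 ℕ.< n) (h : ℕ → ℚ)
    (periodic : ∀ m → h (m % n) ≡ h m) (support : ∀ m → ¬ Coprime m n → h m ≡ 0ℚ)
    (C : ℚ) (0≤C : 0ℚ ≤ C) (partial : ∀ k i → ∣ ∑ i (λ m → h (k ℕ.* m)) ∣ ≤ C)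
    (mean : ∀ k x → ι x * ∣ ∑ x (λ m → h (k ℕ.* suc m) * inv (ι (suc m))) ∣ ≤ C) where

    open Bounds n 1<n h periodic support C 0≤C partial mean

    R≥0 : 0ℚ ≤ R 1 1
    R≥0 = ∑-nonNeg n λ k _ → sq≥0 (h (k ℕ.* 1))

    κ D : ℚ
    κ = Mμ * (C * (ι 8 + ι 64 * ι n))
    D = ι 36 * (ι n * (κ * κ) + 2ℚ * Rmax)

    private
      Mμ≥0 : 0ℚ ≤ Mμ
      Mμ≥0 = ∑-nonNeg (suc n) λ δ _ → 0≤∣p∣ (CoprimeMean.μ n δ)
      Rmax≥0 : 0ℚ ≤ Rmax
      Rmax≥0 = *≥0 (ι≥0 n) (*≥0 (+≥0 0≤C 0≤C) (+≥0 0≤C 0≤C))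
      κ≥0 : 0ℚ ≤ κ
      κ≥0 = *≥0 Mμ≥0 (*≥0 0≤C (+≥0 (ι≥0 8) (*≥0 (ι≥0 64) (ι≥0 n))))
      D≥0 : 0ℚ ≤ D
      D≥0 = *≥0 (ι≥0 36) (+≥0 (*≥0 (ι≥0 n) (*≥0 κ≥0 κ≥0)) (*≥0 (+≥0 0≤1 0≤1) Rmax≥0))

    module Choice (V-1 : ℕ) where
      -- `V` is the free parameter and `W` = V³ the number of squares D², D = 1 + nj. As D ≤ nV³,
      -- one has 2D² ≤ X⁶. The mesh has 8J steps, where q^J lies between `X` and `B` = 2X, so `Z′` =
      -- B⁸ is beyond the last cutoff. Of the exponent 8, six are spent on D² and the other two
      -- leave room for J scales at which both cutoffs are at least one half.
      V X B Z′ Z W : ℕ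
      V  = suc V-1
      X  = 2 ℕ.* (n ℕ.* V)
      B  = 2 ℕ.* X
      Z′ = B ℕ.^ 8
      Z  = suc Z′
      W  = V ℕ.* V ℕ.* V

      private
        instance
          nV≢0 : NonZero (n ℕ.* V)
          nV≢0 = ℕ.m*n≢0 n V

      2≤X : 2 ℕ.≤ X
      2≤X = ℕ.m≤m*n 2 (n ℕ.* V)

      1<ιX : 1ℚ < ι X
      1<ιX = <-≤-trans (<-by 1ℚ 0<1 (sym (trans (ι-suc 1) (cong (λ z → 1ℚ + z) fromℤ-1)))) (ι-mono 2≤X)

      Z⁴ : ℚ
      Z⁴ = ι Z * (ι Z * (ι Z * ι Z))

      Z⁴>0 : 0ℚ < Z⁴
      Z⁴>0 = *>0 (ι>0 Z′) (*>0 (ι>0 Z′) (*>0 (ι>0 Z′) (ι>0 Z′)))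

      -- The value 1/Z⁴ offsets the number of terms in `B≈B′`; the error left is a constant times
      -- the number of scales.
      η q p : ℚ
      η = inv Z⁴
      q = 1ℚ + η
      p = inv q

      η>0 : 0ℚ < η
      η>0 = inv>0 Z⁴>0

      1≤q : 1ℚ ≤ q
      1≤q = ≤-by η (<⇒≤ η>0) refl

      0<q : 0ℚ < q
      0<q = <-≤-trans 0<1 1≤q

      0<p : 0ℚ < p
      0<p = inv>0 0<q

      pq≡1 : p * (1ℚ + η) ≡ 1ℚ
      pq≡1 = trans (*-comm p q) (*-inv⁺ 0<q)

      p≤1 : p ≤ 1ℚ
      p≤1 = subst₂ _≤_ (*-identityʳ p) pq≡1 (*-monoˡ (<⇒≤ 0<p) 1≤q)

      q≤2 : q ≤ 2ℚ
      q≤2 = +-monoʳ-≤ 1ℚ {η} {1ℚ} η≤1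
        where
        1≤Z⁴ : 1ℚ ≤ Z⁴
        1≤Z⁴ = *-mono 0≤1 (ι≥1 Z′) 0≤1 (*-mono 0≤1 (ι≥1 Z′) 0≤1 (*-mono 0≤1 (ι≥1 Z′) 0≤1 (ι≥1 Z′)))
        η≤1 : η ≤ 1ℚ
        η≤1 = ≤-trans (inv-anti 0<1 1≤Z⁴) (≤-reflexive inv-1)

      power : ∃ λ J → ι X ≤ q ^ suc J × q ^ J < ι X
      -- By Bernoulli's inequality the power of q with exponent XZ⁴ is at least 1 + XZ⁴η = 1 + X, so
      -- the search has a starting point.
      power = first-power q (ι X) 1<ιX (X ℕ.* (Z ℕ.* (Z ℕ.* (Z ℕ.* Z))))
        (≤-trans (≤-by 1ℚ 0≤1 (trans (+-comm (ι X) 1ℚ) (cong (λ z → 1ℚ + z) (sym cancel)))) (bernoulli η (<⇒≤ η>0) (X ℕ.* (Z ℕ.* (Z ℕ.* (Z ℕ.* Z))))))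
        where
        cancel : ι (X ℕ.* (Z ℕ.* (Z ℕ.* (Z ℕ.* Z)))) * η ≡ ι X
        cancel = trans (cong (_* η) (trans (ι-* X (Z ℕ.* (Z ℕ.* (Z ℕ.* Z)))) (cong (ι X *_) (trans (ι-* Z (Z ℕ.* (Z ℕ.* Z))) (cong (ι Z *_) (trans (ι-* Z (Z ℕ.* Z)) (cong (ι Z *_) (ι-* Z Z))))))))
          (trans (*-assoc (ι X) Z⁴ η) (trans (cong (ι X *_) (*-inv⁺ Z⁴>0)) (*-identityʳ (ι X))))

      J I : ℕ
      J = suc (proj₁ power)
      I = 8 ℕ.* J

      u : ℚ
      u = p ^ J

      0<u : 0ℚ < u
      0<u = ^>0 0<p J

      uq≡1 : u * q ^ J ≡ 1ℚ
      uq≡1 = trans (sym (^-distrib p q J)) (trans (cong (_^ J) pq≡1) (one J))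
        where
        one : ∀ k → 1ℚ ^ k ≡ 1ℚ
        one zero    = refl
        one (suc k) = trans (*-identityˡ (1ℚ ^ k)) (one k)

      uX≤1 : ι X * u ≤ 1ℚ
      uX≤1 = subst (ι X * u ≤_) uq≡1 (subst (_≤ u * q ^ J) (*-comm u (ι X)) (*-monoˡ (<⇒≤ 0<u) (proj₁ (proj₂ power))))

      1≤Bu : 1ℚ ≤ ι B * u
      1≤Bu = subst₂ _≤_ (trans (*-comm (q ^ J) u) uq≡1) refl (*-monoʳ (<⇒≤ 0<u)
        (subst (q ^ J ≤_) (sym (trans (ι-* 2 X) (cong (_* ι X) (trans (ι-suc 1) (cong (λ z → 1ℚ + z) fromℤ-1)))))
          (*-mono (<⇒≤ 0<q) q≤2 (<⇒≤ (^>0 0<q (proj₁ power))) (<⇒≤ (proj₂ (proj₂ power))))))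

      large : 1ℚ ≤ ι Z′ * p ^ I
      large = subst (1ℚ ≤_) (trans (^-distrib (ι B) u 8) (cong₂ _*_ (sym (ι-^ B 8)) (sym (^-* p 8 J)))) (1≤^ 1≤Bu 8)

      open Compare p η 0<p p≤1 pq≡1 (<⇒≤ η>0) Z Z′ I refl large renaming (B to B₀; B′ to B₀′)
      open Scales p η 0<p p≤1 pq≡1 (<⇒≤ η>0) using (t; t≥0; Ω)

      u≤½ : u ≤ ½
      u≤½ = *-cancelˡ-≤ (<-trans 0<1 1<ιX) (≤-trans uX≤1 (≤-trans (≤-reflexive two½) (*-monoʳ ½≥0 (ι-mono 2≤X))))
        where
        two½ : 1ℚ ≡ ι 2 * ½
        two½ = sym (trans (cong (_* ½) (trans (ι-suc 1) (cong (λ z → 1ℚ + z) fromℤ-1))) refl)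

      -- Only the scales i from J to 2J - 1 are kept. There pⁱ ≤ u ≤ ½, and I - i ≥ 6J gives Np^(I -
      -- i) ≤ Nu⁶ ≤ ½, so both cutoffs are at least ½.
      Ω-lower : ∀ N → ι N * u ^ 6 ≤ ½ → ι J * (½ * ½) ≤ Ω I N
      Ω-lower N small = begin
        ι J * (½ * ½)                                      ≡⟨ sym (∑-const J (½ * ½)) ⟩
        ∑ J (λ _ → ½ * ½) ≤⟨ ∑-mono J {λ _ → ½ * ½} {λ j → f (J ℕ.+ j)} (λ j j<J → *-mono ½≥0 (½≤w (first j)) ½≥0 (½≤w (second j j<J))) ⟩
        ∑ J (λ j → f (J ℕ.+ j)) ≤⟨ ≤-by (∑ J f + ∑ (suc (6 ℕ.* J)) g) (+≥0 (∑-nonNeg J {f} λ j _ → f≥0 j) (∑-nonNeg (suc (6 ℕ.* J)) {g} λ j _ → f≥0 (J ℕ.+ (J ℕ.+ j)))) (rearrange (∑ J (λ j → f (J ℕ.+ j))) (∑ J f) (∑ (suc (6 ℕ.* J)) g)) ⟩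
        ∑ J f + (∑ J (λ j → f (J ℕ.+ j)) + ∑ (suc (6 ℕ.* J)) (λ j → f (J ℕ.+ (J ℕ.+ j)))) ≡⟨ sym (trans (∑-split J (J ℕ.+ suc (6 ℕ.* J)) f) (cong (λ z → ∑ J f + z) (∑-split J (suc (6 ℕ.* J)) (λ j → f (J ℕ.+ j))))) ⟩
        ∑ (J ℕ.+ (J ℕ.+ suc (6 ℕ.* J))) f                  ≡⟨ cong (λ N → ∑ N f) (index J) ⟩
        Ω I N                                              ∎
        where
        open ≤-Reasoning
        f : ℕ → ℚ
        f i = t i 1 * t (I ∸ i) N
        g : ℕ → ℚ
        g j = f (J ℕ.+ (J ℕ.+ j))
        f≥0 : ∀ i → 0ℚ ≤ f i
        f≥0 i = *≥0 (t≥0 i 1) (t≥0 (I ∸ i) N)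
        index : ∀ J → J ℕ.+ (J ℕ.+ suc (6 ℕ.* J)) ≡ suc (8 ℕ.* J)
        index = ℕR.solve-∀
        rearrange : ∀ a b c → a + (b + c) ≡ b + (a + c)
        rearrange = solve-∀ ringℚ
        first : ∀ j → ι 1 * p ^ (J ℕ.+ j) ≤ ½
        first j = subst (_≤ ½) (sym (trans (cong (_* p ^ (J ℕ.+ j)) fromℤ-1) (*-identityˡ (p ^ (J ℕ.+ j))))) (≤-trans (^-anti 0<p p≤1 (ℕ.m≤m+n J j)) u≤½)
        second : ∀ j → j ℕ.< J → ι N * p ^ (I ∸ (J ℕ.+ j)) ≤ ½
        second j j<J = ≤-trans (*-monoˡ (ι≥0 N) (≤-trans (^-anti 0<p p≤1 6J≤) (≤-reflexive (^-* p 6 J)))) small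
          where
          eight : ∀ J → 6 ℕ.* J ℕ.+ (J ℕ.+ J) ≡ 8 ℕ.* J
          eight = ℕR.solve-∀
          6J≤ : 6 ℕ.* J ℕ.≤ I ∸ (J ℕ.+ j)
          6J≤ = subst (ℕ._≤ I ∸ (J ℕ.+ j)) (trans (cong (_∸ (J ℕ.+ J)) (sym (eight J))) (ℕ.m+n∸n≡m (6 ℕ.* J) (J ℕ.+ J))) (ℕ.∸-monoʳ-≤ I (ℕ.+-monoʳ-≤ J (ℕ.<⇒≤ j<J)))

      2D²≤X⁶ : ∀ j → j ℕ.< W → 2 ℕ.* ((1 ℕ.+ n ℕ.* j) ℕ.* (1 ℕ.+ n ℕ.* j)) ℕ.≤ X ℕ.^ 6
      -- X⁶ = 64n⁶V⁶ is 2(nW)² times 32n⁴.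
      2D²≤X⁶ j j<W = ℕ.≤-trans (ℕ.*-monoʳ-≤ 2 (ℕ.*-mono-≤ D≤ D≤)) (ℕ.≤-trans (ℕ.m≤m*n (2 ℕ.* ((n ℕ.* W) ℕ.* (n ℕ.* W))) (32 ℕ.* (n ℕ.* n ℕ.* n ℕ.* n)) {{nz}}) (ℕ.≤-reflexive (poly n V)))
        where
        D≤ : 1 ℕ.+ n ℕ.* j ℕ.≤ n ℕ.* W
        D≤ = ℕ.≤-trans (ℕ.+-monoˡ-≤ (n ℕ.* j) (ℕ.>-nonZero⁻¹ n)) (ℕ.≤-trans (ℕ.≤-reflexive (sym (ℕ.*-suc n j))) (ℕ.*-monoʳ-≤ n j<W))
        nz : NonZero (32 ℕ.* (n ℕ.* n ℕ.* n ℕ.* n))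
        nz = ℕ.m*n≢0 32 (n ℕ.* n ℕ.* n ℕ.* n) {{_}} {{ℕ.m*n≢0 (n ℕ.* n ℕ.* n) n {{ℕ.m*n≢0 (n ℕ.* n) n {{ℕ.m*n≢0 n n}}}}}}
        poly : ∀ n V → 2 ℕ.* ((n ℕ.* (V ℕ.* V ℕ.* V)) ℕ.* (n ℕ.* (V ℕ.* V ℕ.* V))) ℕ.* (32 ℕ.* (n ℕ.* n ℕ.* n ℕ.* n)) ≡ (2 ℕ.* (n ℕ.* V)) ℕ.* ((2 ℕ.* (n ℕ.* V)) ℕ.* ((2 ℕ.* (n ℕ.* V)) ℕ.* ((2 ℕ.* (n ℕ.* V)) ℕ.* ((2 ℕ.* (n ℕ.* V)) ℕ.* ((2 ℕ.* (n ℕ.* V)) ℕ.* 1)))))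
        poly = ℕR.solve-∀

      D²<Z : ∀ j → j ℕ.< W → (1 ℕ.+ n ℕ.* j) ℕ.* (1 ℕ.+ n ℕ.* j) ℕ.< Z
      D²<Z j j<W = s≤s (ℕ.≤-trans (ℕ.≤-trans (ℕ.m≤n*m ((1 ℕ.+ n ℕ.* j) ℕ.* (1 ℕ.+ n ℕ.* j)) 2) (2D²≤X⁶ j j<W))
        (ℕ.≤-trans (ℕ.^-monoˡ-≤ 6 (ℕ.m≤n*m X 2)) (ℕ.^-monoʳ-≤ B {{nz}} {6} {8} (s≤s (s≤s (s≤s (s≤s (s≤s (s≤s z≤n)))))))))
        where
        nz : NonZero B
        nz = ℕ.m*n≢0 2 X {{_}} {{ℕ.m*n≢0 2 (n ℕ.* V)}}

      Ω-D² : ∀ j → j ℕ.< W → ι J * (½ * ½) ≤ Ω I ((1 ℕ.+ n ℕ.* j) ℕ.* (1 ℕ.+ n ℕ.* j))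
      Ω-D² j j<W = Ω-lower D² (begin
          ι D² * u ^ 6                  ≡⟨ halve (ι D² * u ^ 6) ⟩
          ½ * (2ℚ * (ι D² * u ^ 6))     ≤⟨ *-monoˡ ½≥0 double ⟩
          ½ * 1ℚ                        ≡⟨ *-identityʳ ½ ⟩
          ½                             ∎)
        where
        open ≤-Reasoning
        D² = (1 ℕ.+ n ℕ.* j) ℕ.* (1 ℕ.+ n ℕ.* j)
        halve : ∀ x → x ≡ ½ * ((1ℚ + 1ℚ) * x)
        halve = solve-∀ ringℚ
        double : 2ℚ * (ι D² * u ^ 6) ≤ 1ℚ
        double = begin
          2ℚ * (ι D² * u ^ 6)     ≡⟨ sym (*-assoc 2ℚ (ι D²) (u ^ 6)) ⟩
          2ℚ * ι D² * u ^ 6       ≡⟨ cong (λ z → z * ι D² * u ^ 6) (sym (trans (ι-suc 1) (cong (λ z → 1ℚ + z) fromℤ-1))) ⟩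
          ι 2 * ι D² * u ^ 6      ≡⟨ cong (_* u ^ 6) (sym (ι-* 2 D²)) ⟩
          ι (2 ℕ.* D²) * u ^ 6    ≤⟨ *-monoʳ (<⇒≤ (^>0 0<u 6)) (ι-mono (2D²≤X⁶ j j<W)) ⟩
          ι (X ℕ.^ 6) * u ^ 6     ≡⟨ trans (cong (_* u ^ 6) (ι-^ X 6)) (sym (^-distrib (ι X) u 6)) ⟩
          (ι X * u) ^ 6           ≤⟨ ^≤1 (*>0 (<-trans 0<1 1<ιX) 0<u) uX≤1 6 ⟩
          1ℚ                      ∎

      -- The harmonic sum up to B⁸ is at most 1 + 8B with B = 4nV, hence linear in V. In `κ`, 64 =
      -- 2·8·4, while 8 collects the constants.
      K≤ : K ≤ ι V * κ
      K≤ = begin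
        Mμ * (C * (2ℚ + 2ℚ + 2ℚ * harmonic (suc Z′)))  ≤⟨ *-monoˡ Mμ≥0 (*-monoˡ 0≤C (begin
          2ℚ + 2ℚ + 2ℚ * harmonic (suc Z′)               ≤⟨ +-monoʳ-≤ (2ℚ + 2ℚ) (*-monoˡ (+≥0 0≤1 0≤1) H≤) ⟩
          2ℚ + 2ℚ + 2ℚ * (1ℚ + (1ℚ + ι 8 * ι B))         ≡⟨ cong (λ b → 2ℚ + 2ℚ + 2ℚ * (1ℚ + (1ℚ + ι 8 * b))) B≡ ⟩
          2ℚ + 2ℚ + 2ℚ * (1ℚ + (1ℚ + ι 8 * (ι 4 * (ι n * ι V)))) ≡⟨ const (ι 8) (ι 4) (ι n) (ι V) ⟩
          2ℚ * (1ℚ + 1ℚ) + (2ℚ + 2ℚ) + (2ℚ * ι 8 * ι 4) * (ι n * ι V)    ≡⟨ cong₂ (λ x y → x + y * (ι n * ι V)) eight sixtyfour ⟩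
          ι 8 + ι 64 * (ι n * ι V) ≤⟨ +-monoˡ-≤ (ι 64 * (ι n * ι V)) (subst (_≤ ι V * ι 8) (*-identityˡ (ι 8)) (*-monoʳ (ι≥0 8) (ι≥1 V-1))) ⟩
          ι V * ι 8 + ι 64 * (ι n * ι V)                 ≡⟨ collect (ι V) (ι 8) (ι 64) (ι n) ⟩
          ι V * (ι 8 + ι 64 * ι n)                       ∎)) ⟩
        Mμ * (C * (ι V * (ι 8 + ι 64 * ι n)))          ≡⟨ pull Mμ C (ι V) (ι 8 + ι 64 * ι n) ⟩
        ι V * κ                                        ∎
        where
        open ≤-Reasoning
        B-1 : ℕ
        B-1 = ℕ.pred B
        B≡suc : suc B-1 ≡ B
        B≡suc = ℕ.suc-pred B {{ℕ.m*n≢0 2 X {{_}} {{ℕ.m*n≢0 2 (n ℕ.* V)}}}}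
        H≤ : harmonic (suc Z′) ≤ 1ℚ + (1ℚ + ι 8 * ι B)
        H≤ = begin
          harmonic (suc Z′)                        ≡⟨ ∑-last Z′ (λ i → inv (ι (suc i))) ⟩
          harmonic Z′ + inv (ι (suc Z′))           ≤⟨ +-mono-≤ bound (subst (inv (ι (suc Z′)) ≤_) inv-1 (inv-anti 0<1 (ι≥1 Z′))) ⟩
          1ℚ + ι 8 * ι B + 1ℚ                      ≡⟨ +-comm (1ℚ + ι 8 * ι B) 1ℚ ⟩
          1ℚ + (1ℚ + ι 8 * ι B)                    ∎
          where
          bound : harmonic Z′ ≤ 1ℚ + ι 8 * ι B
          bound = ≤-trans (subst (λ b → harmonic (b ℕ.^ 8) ≤ 1ℚ + ι 8 * ι B-1) B≡suc (harmonic-^ B-1 8))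
            (+-monoʳ-≤ 1ℚ (*-monoˡ (ι≥0 8) (ι-mono ℕ.pred[n]≤n)))
        four : ∀ n V → 2 ℕ.* (2 ℕ.* (n ℕ.* V)) ≡ 4 ℕ.* (n ℕ.* V)
        four = ℕR.solve-∀
        B≡ : ι B ≡ ι 4 * (ι n * ι V)
        B≡ = trans (cong ι (four n V)) (trans (ι-* 4 (n ℕ.* V)) (cong (ι 4 *_) (ι-* n V)))
        ι2 : 2ℚ ≡ ι 2
        ι2 = sym (trans (ι-suc 1) (cong (λ z → 1ℚ + z) fromℤ-1))
        sixtyfour : 2ℚ * ι 8 * ι 4 ≡ ι 64
        sixtyfour = trans (cong (λ z → z * ι 8 * ι 4) ι2) (sym (trans (ι-* 16 4) (cong (_* ι 4) (ι-* 2 8))))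
        eight : 2ℚ * (1ℚ + 1ℚ) + (2ℚ + 2ℚ) ≡ ι 8
        eight = trans (cong (λ z → z * z + (z + z)) ι2) (sym (trans (ι-+ 4 4) (cong₂ _+_ (ι-* 2 2) (ι-+ 2 2))))
        const : ∀ e f n v → (1ℚ + 1ℚ) + (1ℚ + 1ℚ) + (1ℚ + 1ℚ) * (1ℚ + (1ℚ + e * (f * (n * v)))) ≡ (1ℚ + 1ℚ) * (1ℚ + 1ℚ) + ((1ℚ + 1ℚ) + (1ℚ + 1ℚ)) + ((1ℚ + 1ℚ) * e * f) * (n * v)
        const = solve-∀ ringℚ
        collect : ∀ v e s n → v * e + s * (n * v) ≡ v * (e + s * n)
        collect = solve-∀ ringℚ
        pull : ∀ m c v x → m * (c * (v * x)) ≡ v * (m * (c * x))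
        pull = solve-∀ ringℚ

      K≥0 : 0ℚ ≤ K
      K≥0 = *≥0 Mμ≥0 (*≥0 0≤C (+≥0 (+≥0 (+≥0 0≤1 0≤1) (+≥0 0≤1 0≤1)) (*≥0 (+≥0 0≤1 0≤1) (∑-nonNeg (suc Z′) λ i _ → inv≥0 (ι>0 i)))))

      chain : ι W * (ι J * (½ * ½) * R 1 1) ≤ ι (suc I) * (ι n * (K * K) + 2ℚ * Rmax)
      chain = begin
        ι W * (ι J * (½ * ½) * R 1 1)   ≤⟨ B′-lower W (ι J * (½ * ½)) (*≥0 (ι≥0 J) (*≥0 ½≥0 ½≥0)) D²<Z Ω-D² R≥0 ⟩
        B₀′                             ≡⟨ split B₀′ B₀ ⟩
        B₀ - (B₀ - B₀′)                 ≤⟨ ≤-trans (x≤∣x∣ (B₀ - (B₀ - B₀′))) (∣∣-- B-bound B≈B′) ⟩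
        ι n * (s * (K * K)) + ι Z * (ι Z * (ι Z * (ι Z * (Rmax * (s * (η + η)))))) ≡⟨ rearrange (ι n) s (K * K) (ι Z) Rmax η ⟩
        s * (ι n * (K * K) + 2ℚ * Rmax * (Z⁴ * η)) ≡⟨ cong (λ o → s * (ι n * (K * K) + 2ℚ * Rmax * o)) (*-inv⁺ Z⁴>0) ⟩
        s * (ι n * (K * K) + 2ℚ * Rmax * 1ℚ) ≡⟨ cong (λ o → s * (ι n * (K * K) + o)) (*-identityʳ (2ℚ * Rmax)) ⟩
        s * (ι n * (K * K) + 2ℚ * Rmax) ∎
        where
        open ≤-Reasoning
        s = ι (suc I)
        split : ∀ x y → x ≡ y - (y - x)
        split = solve-∀ ringℚ
        rearrange : ∀ n s k z r e → n * (s * k) + z * (z * (z * (z * (r * (s * (e + e)))))) ≡ s * (n * k + (1ℚ + 1ℚ) * r * (z * (z * (z * z)) * e))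
        rearrange = solve-∀ ringℚ

      -- The squares give V³(J/4) R 1 1 on the left. On the right, I + 1 ≤ 9J and K² ≤ V²κ², so the
      -- bound is at most 9JV² times a constant. Dividing by V²J/4 leaves the factor V, and 36 = 9·4
      -- goes into `D`.
      result : ι V * R 1 1 ≤ D
      result = *-cancelˡ-≤ 0<c (begin
        c * (ι V * R 1 1)                       ≡⟨ shuffle (ι J) (ι V) (R 1 1) ⟩
        ι V * ι V * ι V * (ι J * (½ * ½) * R 1 1) ≡⟨ cong (_* (ι J * (½ * ½) * R 1 1)) (sym (trans (ι-* (V ℕ.* V) V) (cong (_* ι V) (ι-* V V)))) ⟩
        ι W * (ι J * (½ * ½) * R 1 1)           ≤⟨ chain ⟩
        ι (suc I) * (ι n * (K * K) + 2ℚ * Rmax) ≤⟨ *-mono (ι≥0 (suc I)) s≤ (+≥0 (*≥0 (ι≥0 n) (*≥0 K≥0 K≥0)) (*≥0 (+≥0 0≤1 0≤1) Rmax≥0))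
                                                     (+-mono-≤ (*-monoˡ (ι≥0 n) (*-mono K≥0 K≤ K≥0 K≤))
                                                       (subst₂ _≤_ (*-identityˡ (2ℚ * Rmax)) refl (*-monoʳ (*≥0 (+≥0 0≤1 0≤1) Rmax≥0) (*-mono 0≤1 (ι≥1 V-1) 0≤1 (ι≥1 V-1))))) ⟩
        ι 9 * ι J * (ι n * (ι V * κ * (ι V * κ)) + ι V * ι V * (2ℚ * Rmax)) ≡⟨ final (ι 9) (ι J) (ι n) (ι V) κ Rmax ⟩
        c * ((ι 9 * (ℚ4)) * (ι n * (κ * κ) + 2ℚ * Rmax)) ≡⟨ cong (λ z → c * (z * (ι n * (κ * κ) + 2ℚ * Rmax))) thirtysix ⟩
        c * D                                   ∎)
        where
        open ≤-Reasoning
        ℚ4 = 2ℚ * 2ℚ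
        c = ι J * (½ * ½) * (ι V * ι V)
        0<½ : 0ℚ < ½
        0<½ = positive⁻¹ ½
        0<c : 0ℚ < c
        0<c = *>0 (*>0 (ι>0 (proj₁ power)) (*>0 0<½ 0<½)) (*>0 (ι>0 V-1) (ι>0 V-1))
        shuffle : ∀ j v r → j * (½ * ½) * (v * v) * (v * r) ≡ v * v * v * (j * (½ * ½) * r)
        shuffle = solve-∀ ringℚ
        final : ∀ n9 j n v k r → n9 * j * (n * (v * k * (v * k)) + v * v * ((1ℚ + 1ℚ) * r)) ≡ j * (½ * ½) * (v * v) * ((n9 * ((1ℚ + 1ℚ) * (1ℚ + 1ℚ))) * (n * (k * k) + (1ℚ + 1ℚ) * r))
        final = solve-∀ ringℚ
        ι2 : 2ℚ ≡ ι 2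
        ι2 = sym (trans (ι-suc 1) (cong (λ z → 1ℚ + z) fromℤ-1))
        thirtysix : ι 9 * ℚ4 ≡ ι 36
        thirtysix = trans (cong (λ z → ι 9 * (z * z)) ι2) (sym (trans (ι-* 9 4) (cong (ι 9 *_) (ι-* 2 2))))
        nine : ∀ J′ → suc (8 ℕ.* suc J′) ℕ.+ J′ ≡ 9 ℕ.* suc J′
        nine = ℕR.solve-∀
        s≤ : ι (suc I) ≤ ι 9 * ι J
        s≤ = subst (ι (suc I) ≤_) (ι-* 9 J) (ι-mono (ℕ.≤-trans (ℕ.m≤m+n (suc I) (proj₁ power)) (ℕ.≤-reflexive (nine (proj₁ power)))))

    R≤0 : R 1 1 ≤ 0ℚ
    R≤0 = ≤0-by-archimedean D λ where
      zero    → subst (_≤ D) (sym (trans (cong (_* R 1 1) fromℤ-0) (*-zeroˡ (R 1 1)))) D≥0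
      (suc V) → Choice.result V

    -- h(m)² is one of the nonnegative terms of R 1 1, and R 1 1 ≤ 0 because all its multiples are
    -- bounded by `D`.
    vanishing : ∀ m → h m ≡ 0ℚ
    vanishing m = trans (sym (periodic m)) (sq-zero (trans (cong (λ k → h k * h k) (sym (ℕ.*-identityʳ (m % n)))) (≤-antisym
        (≤-trans (term≤∑ n {λ k → h (k ℕ.* 1) * h (k ℕ.* 1)} (m % n) (m%n<n m n) λ k _ → sq≥0 (h (k ℕ.* 1))) R≤0)
        (sq≥0 (h (m % n ℕ.* 1))))))
      where
      sq-zero : ∀ {x} → x * x ≡ 0ℚ → x ≡ 0ℚ
      sq-zero {x} eq with x ≟ 0ℚ
      ... | yes p = p
      ... | no ¬p = trans (sym (*-identityʳ x)) (trans (cong (x *_) (sym (*-inv ¬p))) (trans (sym (*-assoc x x (inv x))) (trans (cong (_* inv x) eq) (*-zeroˡ (inv x)))))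

-- Cotangent sums over an abstract root of unity.

module Fourier where

  open import Algebra.Bundles using (CommutativeRing)
  open import Data.Nat.Base as ℕ using (ℕ; zero; suc; NonZero; _%_; _/_)
  open import Data.Nat.DivMod using (m%n<n; m≡m%n+[m/n]*n)
  import Data.Nat.Properties as ℕ
  import Data.Nat.Tactic.RingSolver as ℕR
  open import Level using (0ℓ)
  open import Relation.Binary.PropositionalEquality as ≡ using (_≡_; _≢_)
  open Sums
  open Mod

  module Geometric (S : CommutativeRing 0ℓ 0ℓ) where
    open CommutativeRing S hiding (zero)
    open RangeSum S
    open import Algebra.Properties.CommutativeSemiring.Exp commutativeSemiring
    open import Algebra.Solver.Ring.NaturalCoefficients.Default commutativeSemiring using (solve; _:+_; _:*_; _:=_; con)
    open import Relation.Binary.Reasoning.Setoid setoid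

    ν : ℕ → Carrier
    ν zero    = 0#
    ν (suc n) = 1# + ν n

    ν-+ : ∀ m n → ν (m ℕ.+ n) ≈ ν m + ν n
    ν-+ zero    n = sym (+-identityˡ _)
    ν-+ (suc m) n = trans (+-congˡ (ν-+ m n)) (sym (+-assoc _ _ _))

    ν-* : ∀ m n → ν (m ℕ.* n) ≈ ν m * ν n
    ν-* zero    n = sym (zeroˡ _)
    ν-* (suc m) n = begin
      ν (n ℕ.+ m ℕ.* n)    ≈⟨ ν-+ n (m ℕ.* n) ⟩
      ν n + ν (m ℕ.* n)    ≈⟨ +-cong (sym (*-identityˡ _)) (ν-* m n) ⟩
      1# * ν n + ν m * ν n ≈⟨ distribʳ _ _ _ ⟨
      (1# + ν m) * ν n     ∎

    ν-∑ : ∀ N (f : ℕ → ℕ) → ∀ {g : ℕ → ℕ} → (≡ℕ : ℕ∑ N f ≡ ℕ∑ N g) → ∑ N (λ i → ν (f i)) ≈ ∑ N (λ i → ν (g i))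
    ν-∑ N f {g} eq = trans (sym (hom N f)) (trans (reflexive (≡.cong ν eq)) (hom N g))
      where
      hom : ∀ N f → ν (ℕ∑ N f) ≈ ∑ N (λ i → ν (f i))
      hom zero    f = refl
      hom (suc N) f = trans (ν-+ (f 0) _) (+-congˡ (hom N _))

    ∑-ν : ∀ N x → ∑ N (λ _ → x) ≈ ν N * x
    ∑-ν zero    x = sym (zeroˡ x)
    ∑-ν (suc N) x = trans (+-cong (sym (*-identityˡ x)) (∑-ν N x)) (sym (distribʳ x 1# (ν N)))

    module _ {X e : Carrier} (X≈1+e : X ≈ 1# + e) where

      -- With e for X - 1 and no subtraction, the identities can be left to a semiring solver.
      geometric : ∀ N → e * ∑ N (X ^_) + 1# ≈ X ^ N
      geometric zero    = trans (+-congʳ (zeroʳ e)) (+-identityˡ 1#)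
      geometric (suc N) = begin
        e * ∑ (suc N) (X ^_) + 1#      ≈⟨ +-congʳ (*-congˡ (∑-last N (X ^_))) ⟩
        e * (∑ N (X ^_) + X ^ N) + 1# ≈⟨ solve 3 (λ e s p → e :* (s :+ p) :+ con 1 := e :* s :+ con 1 :+ e :* p) refl e (∑ N (X ^_)) (X ^ N) ⟩
        e * ∑ N (X ^_) + 1# + e * X ^ N ≈⟨ +-congʳ (geometric N) ⟩
        X ^ N + e * X ^ N              ≈⟨ solve 2 (λ e p → p :+ e :* p := (con 1 :+ e) :* p) refl e (X ^ N) ⟩
        (1# + e) * X ^ N               ≈⟨ *-congʳ (sym X≈1+e) ⟩
        X * X ^ N                      ∎

      arithmetico-geometric : ∀ N → e * ∑ N (λ j → ν j * X ^ j) + X * ∑ N (X ^_) ≈ ν N * X ^ N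
      arithmetico-geometric zero    = trans (+-cong (zeroʳ e) (zeroʳ X)) (trans (+-identityˡ 0#) (sym (zeroˡ _)))
      arithmetico-geometric (suc N) = begin
        e * ∑ (suc N) f + X * ∑ (suc N) (X ^_)          ≈⟨ +-cong (*-congˡ (∑-last N f)) (*-congˡ (∑-last N (X ^_))) ⟩
        e * (∑ N f + ν N * P) + X * (∑ N (X ^_) + P) ≈⟨ solve 6 (λ e s n p x g → e :* (s :+ n :* p) :+ x :* (g :+ p) := e :* s :+ x :* g :+ (e :* (n :* p) :+ x :* p)) refl e (∑ N f) (ν N) P X (∑ N (X ^_)) ⟩
        e * ∑ N f + X * ∑ N (X ^_) + (e * (ν N * P) + X * P) ≈⟨ +-congʳ (arithmetico-geometric N) ⟩
        ν N * P + (e * (ν N * P) + X * P) ≈⟨ solve 4 (λ e n p x → n :* p :+ (e :* (n :* p) :+ x :* p) := x :* p :+ n :* ((con 1 :+ e) :* p)) refl e (ν N) P X ⟩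
        X * P + ν N * ((1# + e) * P)                    ≈⟨ +-congˡ (*-congˡ (*-congʳ (sym X≈1+e))) ⟩
        X * P + ν N * (X * P)                           ≈⟨ solve 2 (λ n y → y :+ n :* y := (con 1 :+ n) :* y) refl (ν N) (X * P) ⟩
        (1# + ν N) * (X * P)                            ∎
        where
        f = λ j → ν j * X ^ j
        P = X ^ N

      module _ {κ : Carrier} (κe≈1 : κ * e ≈ 1#) (N : ℕ) (X^N≈1 : X ^ N ≈ 1#) where

        private
          cancel : ∀ {x y} → e * x ≈ e * y → x ≈ y
          cancel {x} {y} eq = begin
            x            ≈⟨ *-identityˡ x ⟨
            1# * x       ≈⟨ *-congʳ κe≈1 ⟨
            κ * e * x    ≈⟨ *-assoc κ e x ⟩
            κ * (e * x)  ≈⟨ *-congˡ eq ⟩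
            κ * (e * y)  ≈⟨ *-assoc κ e y ⟨
            κ * e * y    ≈⟨ *-congʳ κe≈1 ⟩
            1# * y       ≈⟨ *-identityˡ y ⟩
            y            ∎

          +1-cancel : ∀ {x} → x + 1# ≈ 1# → x ≈ 0#
          +1-cancel {x} eq = begin
            x                 ≈⟨ +-identityʳ x ⟨
            x + 0#            ≈⟨ +-congˡ (-‿inverseʳ 1#) ⟨
            x + (1# - 1#)     ≈⟨ +-assoc x 1# (- 1#) ⟨
            x + 1# - 1#       ≈⟨ +-congʳ eq ⟩
            1# - 1#           ≈⟨ -‿inverseʳ 1# ⟩
            0#                ∎

        geometric-zero : ∑ N (X ^_) ≈ 0#
        geometric-zero = cancel (trans (+1-cancel (trans (geometric N) X^N≈1)) (sym (zeroʳ e)))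

        -- The finite Fourier expansion of I(X + 1)/(X - 1): as the geometric sum vanishes,
        -- `arithmetico-geometric` reduces to e Σ jXʲ = N. An inverse κ of e is supplied because the
        -- ring in question is not a domain.
        cotangent : ∀ {c I} → c * e ≈ I * (X + 1#) → ν N * c ≈ I * (ν N + (∑ N (λ j → ν j * X ^ j) + ∑ N (λ j → ν j * X ^ j)))
        cotangent {c} {I} ce = cancel (begin
          e * (ν N * c)                       ≈⟨ solve 3 (λ e n c → e :* (n :* c) := n :* (c :* e)) refl e (ν N) c ⟩
          ν N * (c * e)                       ≈⟨ *-congˡ (trans ce (*-congˡ (+-congʳ X≈1+e))) ⟩
          ν N * (I * (1# + e + 1#)) ≈⟨ solve 3 (λ n i e → n :* (i :* (con 1 :+ e :+ con 1)) := i :* (n :* e :+ (n :+ n))) refl (ν N) I e ⟩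
          I * (ν N * e + (ν N + ν N))         ≈⟨ *-congˡ (+-congˡ (+-cong (sym eJ) (sym eJ))) ⟩
          I * (ν N * e + (e * J + e * J)) ≈⟨ solve 4 (λ n i e j → i :* (n :* e :+ (e :* j :+ e :* j)) := e :* (i :* (n :+ (j :+ j)))) refl (ν N) I e J ⟩
          e * (I * (ν N + (J + J)))           ∎)
          where
          J = ∑ N (λ j → ν j * X ^ j)
          eJ : e * J ≈ ν N
          eJ = begin
            e * J                   ≈⟨ +-identityʳ _ ⟨
            e * J + 0#              ≈⟨ +-congˡ (trans (*-congˡ geometric-zero) (zeroʳ X)) ⟨
            e * J + X * ∑ N (X ^_)  ≈⟨ arithmetico-geometric N ⟩
            ν N * X ^ N             ≈⟨ trans (*-congˡ X^N≈1) (*-identityʳ (ν N)) ⟩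
            ν N                     ∎

  module RootOfUnity (S : CommutativeRing 0ℓ 0ℓ) where
    open CommutativeRing S hiding (zero)
    open RangeSum S
    open Geometric S
    open import Algebra.Properties.CommutativeSemiring.Exp commutativeSemiring
    open import Relation.Binary.Reasoning.Setoid setoid

    module _ (n L : ℕ) {{_ : NonZero n}} {{_ : NonZero L}} (ζ I : Carrier) (c κ : ℕ → Carrier)
      (ζ^M≈1 : ζ ^ (n ℕ.* L) ≈ 1#)
      (c-eq : ∀ m → 0 ℕ.< m → m ℕ.< n ℕ.* L → c m * (ζ ^ m - 1#) ≈ I * (ζ ^ m + 1#))
      (κ-eq : ∀ m → 0 ℕ.< m → m ℕ.< n ℕ.* L → κ m * (ζ ^ m - 1#) ≈ 1#) where

      private
        M = n ℕ.* L

        1+[x-1] : ∀ x → x ≈ 1# + (x - 1#)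
        1+[x-1] x = begin
          x               ≈⟨ +-identityʳ x ⟨
          x + 0#          ≈⟨ +-congˡ (-‿inverseˡ 1#) ⟨
          x + (- 1# + 1#) ≈⟨ +-assoc _ _ _ ⟨
          x - 1# + 1#     ≈⟨ +-comm _ _ ⟩
          1# + (x - 1#)   ∎

        1^ : ∀ k → 1# ^ k ≈ 1#
        1^ zero    = refl
        1^ (suc k) = trans (*-identityˡ _) (1^ k)

        ζ^[M*]≈1 : ∀ k → ζ ^ (M ℕ.* k) ≈ 1#
        ζ^[M*]≈1 k = trans (sym (^-assocʳ ζ M k)) (trans (^-congˡ k ζ^M≈1) (1^ k))

        ζ^-index : ∀ {a b} → a ≡ b → ζ ^ a ≈ ζ ^ b
        ζ^-index ≡.refl = refl

        drop : ∀ k j → ζ ^ (M ℕ.* k ℕ.+ j) ≈ ζ ^ j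
        drop k j = trans (^-homo-* ζ (M ℕ.* k) j) (trans (*-congʳ (ζ^[M*]≈1 k)) (*-identityˡ _))

        ζ^L-mod : ∀ {A B} → A ≡ B mod n → ζ ^ (A ℕ.* L) ≈ ζ ^ (B ℕ.* L)
        ζ^L-mod {A} {B} eq = trans (reduce A) (trans (ζ^-index (≡.cong (ℕ._* L) eq)) (sym (reduce B)))
          where
          shape : ∀ r q n L → (r ℕ.+ q ℕ.* n) ℕ.* L ≡ n ℕ.* L ℕ.* q ℕ.+ r ℕ.* L
          shape = ℕR.solve-∀
          reduce : ∀ A → ζ ^ (A ℕ.* L) ≈ ζ ^ (A % n ℕ.* L)
          reduce A = trans (ζ^-index (≡.trans (≡.cong (ℕ._* L) (m≡m%n+[m/n]*n A n)) (shape (A % n) (A / n) n L))) (drop (A / n) _)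

      cotangent-sum : ∀ m → 0 ℕ.< m → m ℕ.< M → ν M * c m ≈ I * (ν M + (∑ M (λ j → ν j * ζ ^ (m ℕ.* j)) + ∑ M (λ j → ν j * ζ ^ (m ℕ.* j))))
      cotangent-sum m 0<m m<M = trans
        (cotangent (1+[x-1] (ζ ^ m)) (κ-eq m 0<m m<M) M (trans (^-assocʳ ζ m M) (trans (ζ^-index (ℕ.*-comm m M)) (ζ^[M*]≈1 m))) (c-eq m 0<m m<M))
        (*-congˡ (+-congˡ (+-cong to to)))
        where
        to = ∑-cong′ M λ j → *-congˡ (^-assocʳ ζ m j)

      private
        inner : ℕ → Carrier
        inner j = ∑ L (λ l → ζ ^ (l ℕ.* n ℕ.* j))

        inner-0 : ∀ j′ → inner (j′ ℕ.* L ℕ.+ 0) ≈ ν L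
        inner-0 j′ = trans (∑-cong′ L λ l → trans (ζ^-index (shape l n j′ L)) (ζ^[M*]≈1 (l ℕ.* j′))) (trans (∑-ν L 1#) (*-identityʳ _))
          where
          shape : ∀ l n j L → l ℕ.* n ℕ.* (j ℕ.* L ℕ.+ 0) ≡ n ℕ.* L ℕ.* (l ℕ.* j)
          shape = ℕR.solve-∀

        -- A full geometric sum over the powers of ζ^(nρ), an L-th root of unity for which ζ^(nρ) -
        -- 1 is invertible, since 0 < nρ < M.
        inner-ρ : ∀ j′ ρ → ρ ℕ.< L → ρ ≢ 0 → inner (j′ ℕ.* L ℕ.+ ρ) ≈ 0#
        inner-ρ j′ ρ ρ<L ρ≢0 = trans (∑-cong′ L λ l → trans (ζ^-index (shape l n j′ L ρ)) (trans (drop (l ℕ.* j′) _) (sym (^-assocʳ ζ (n ℕ.* ρ) l))))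
          (geometric-zero (1+[x-1] (ζ ^ (n ℕ.* ρ))) (κ-eq (n ℕ.* ρ) 0<nρ (ℕ.*-monoʳ-< n ρ<L)) L
            (trans (^-assocʳ ζ (n ℕ.* ρ) L) (trans (ζ^-index (shape′ n ρ L)) (ζ^[M*]≈1 ρ))))
          where
          shape : ∀ l n j L ρ → l ℕ.* n ℕ.* (j ℕ.* L ℕ.+ ρ) ≡ n ℕ.* L ℕ.* (l ℕ.* j) ℕ.+ n ℕ.* ρ ℕ.* l
          shape = ℕR.solve-∀
          shape′ : ∀ n ρ L → n ℕ.* ρ ℕ.* L ≡ n ℕ.* L ℕ.* ρ
          shape′ = ℕR.solve-∀
          0<nρ : 0 ℕ.< n ℕ.* ρ
          0<nρ = ℕ.*-mono-< (ℕ.>-nonZero⁻¹ n) (ℕ.n≢0⇒n>0 ρ≢0)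

      -- Summing over the progression m₀ + nℤ kills all frequencies except the multiples of L;
      -- then j = ra mod n turns the inverse m₀ of a into a itself.
      progression : ∀ a m₀ → a ℕ.* m₀ ≡ 1 mod n →
        ∑ L (λ l → ∑ M (λ j → ν j * ζ ^ ((l ℕ.* n ℕ.+ m₀) ℕ.* j))) ≈ ν L * ν L * ∑ n (λ r → ν (r ℕ.* a % n) * ζ ^ (r ℕ.* L))
      progression a m₀ am₀≡1 = begin
        ∑ L (λ l → ∑ M (λ j → ν j * ζ ^ ((l ℕ.* n ℕ.+ m₀) ℕ.* j)))
          ≈⟨ ∑-swap L M _ ⟩
        ∑ M (λ j → ∑ L (λ l → ν j * ζ ^ ((l ℕ.* n ℕ.+ m₀) ℕ.* j)))
          ≈⟨ ∑-cong′ M (λ j → trans (∑-cong′ L λ l → trans (*-congˡ (trans (ζ^-index (ℕ.*-distribʳ-+ j (l ℕ.* n) m₀)) (^-homo-* ζ (l ℕ.* n ℕ.* j) (m₀ ℕ.* j)))) (trans (*-congˡ (*-comm _ _)) (sym (*-assoc (ν j) _ _))))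
               (sym (∑-*ˡ L (ν j * ζ ^ (m₀ ℕ.* j)) _))) ⟩
        ∑ M (λ j → ν j * ζ ^ (m₀ ℕ.* j) * inner j)
          ≈⟨ ∑-blocks n L _ ⟩
        ∑ n (λ j′ → ∑ L (λ ρ → ν (j′ ℕ.* L ℕ.+ ρ) * ζ ^ (m₀ ℕ.* (j′ ℕ.* L ℕ.+ ρ)) * inner (j′ ℕ.* L ℕ.+ ρ)))
          ≈⟨ ∑-cong′ n (λ j′ → ∑-δ L 0 (ℕ.>-nonZero⁻¹ L) λ ρ ρ<L ρ≢0 → trans (*-congˡ (inner-ρ j′ ρ ρ<L ρ≢0)) (zeroʳ _)) ⟩
        ∑ n (λ j′ → ν (j′ ℕ.* L ℕ.+ 0) * ζ ^ (m₀ ℕ.* (j′ ℕ.* L ℕ.+ 0)) * inner (j′ ℕ.* L ℕ.+ 0))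
          ≈⟨ ∑-cong′ n (λ j′ → begin
               ν (j′ ℕ.* L ℕ.+ 0) * ζ ^ (m₀ ℕ.* (j′ ℕ.* L ℕ.+ 0)) * inner (j′ ℕ.* L ℕ.+ 0)
                 ≈⟨ *-cong (*-cong (trans (reflexive (≡.cong ν (ℕ.+-identityʳ (j′ ℕ.* L)))) (ν-* j′ L)) (ζ^-index (shape m₀ j′ L))) (inner-0 j′) ⟩
               ν j′ * ν L * ζ ^ (j′ ℕ.* m₀ ℕ.* L) * ν L
                 ≈⟨ trans (*-comm _ _) (trans (*-congˡ (trans (*-congʳ (*-comm _ _)) (*-assoc _ _ _))) (sym (*-assoc _ _ _))) ⟩
               ν L * ν L * (ν j′ * ζ ^ (j′ ℕ.* m₀ ℕ.* L)) ∎) ⟩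
        ∑ n (λ j′ → ν L * ν L * (ν j′ * ζ ^ (j′ ℕ.* m₀ ℕ.* L)))
          ≈⟨ sym (∑-*ˡ n (ν L * ν L) _) ⟩
        ν L * ν L * ∑ n (λ j′ → ν j′ * ζ ^ (j′ ℕ.* m₀ ℕ.* L))
          ≈⟨ *-congˡ (trans (∑-permute n (λ j′ → ν j′ * ζ ^ (j′ ℕ.* m₀ ℕ.* L)) (λ r → r ℕ.* a % n) (λ j → j ℕ.* m₀ % n)
               (λ r _ → m%n<n (r ℕ.* a) n) (λ j _ → m%n<n (j ℕ.* m₀) n)
               (scale-inverse n (≡.trans (≡.cong (_% n) (ℕ.*-comm m₀ a)) am₀≡1)) (scale-inverse n am₀≡1))
               (∑-cong n λ r r<n → *-congˡ (ζ^L-mod (≡.trans (scale-inverse n am₀≡1 r r<n) (≡.sym (Data.Nat.DivMod.m<n⇒m%n≡m r<n)))))) ⟩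
        ν L * ν L * ∑ n (λ r → ν (r ℕ.* a % n) * ζ ^ (r ℕ.* L)) ∎
        where
        shape : ∀ m j L → m ℕ.* (j ℕ.* L ℕ.+ 0) ≡ j ℕ.* m ℕ.* L
        shape = ℕR.solve-∀

      cotangent-progression : ∀ a m₀ → a ℕ.* m₀ ≡ 1 mod n → 0 ℕ.< m₀ → m₀ ℕ.< n →
        ν M * ∑ L (λ l → c (l ℕ.* n ℕ.+ m₀)) ≈
        I * (ν L * ν M + (ν L * ν L * ∑ n (λ r → ν (r ℕ.* a % n) * ζ ^ (r ℕ.* L)) + ν L * ν L * ∑ n (λ r → ν (r ℕ.* a % n) * ζ ^ (r ℕ.* L))))
      cotangent-progression a m₀ am₀≡1 0<m₀ m₀<n = begin
        ν M * ∑ L (λ l → c (l ℕ.* n ℕ.+ m₀))                    ≈⟨ ∑-*ˡ L (ν M) _ ⟩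
        ∑ L (λ l → ν M * c (l ℕ.* n ℕ.+ m₀)) ≈⟨ ∑-cong L (λ l l<L → cotangent-sum (l ℕ.* n ℕ.+ m₀) (ℕ.<-≤-trans 0<m₀ (ℕ.m≤n+m m₀ (l ℕ.* n))) (bound l l<L)) ⟩
        ∑ L (λ l → I * (ν M + (Jl l + Jl l)))                   ≈⟨ sym (∑-*ˡ L I _) ⟩
        I * ∑ L (λ l → ν M + (Jl l + Jl l)) ≈⟨ *-congˡ (trans (∑-+ L _ _) (+-cong (∑-ν L (ν M)) (trans (∑-+ L Jl Jl) (+-cong (progression a m₀ am₀≡1) (progression a m₀ am₀≡1))))) ⟩
        I * (ν L * ν M + (T + T))                               ∎
        where
        Jl = λ l → ∑ M (λ j → ν j * ζ ^ ((l ℕ.* n ℕ.+ m₀) ℕ.* j))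
        T = ν L * ν L * ∑ n (λ r → ν (r ℕ.* a % n) * ζ ^ (r ℕ.* L))
        bound : ∀ l → l ℕ.< L → l ℕ.* n ℕ.+ m₀ ℕ.< M
        bound l l<L = ℕ.<-≤-trans (ℕ.+-monoʳ-< (l ℕ.* n) m₀<n) (ℕ.≤-trans (ℕ.≤-reflexive (ℕ.+-comm (l ℕ.* n) n)) (ℕ.≤-trans (ℕ.*-monoˡ-≤ n l<L) (ℕ.≤-reflexive (ℕ.*-comm L n))))

      -- By `cotangent-progression` each progression is a fixed linear expression in the residues of
      -- r aᵢ, r < n. Summed over i, only the sums of these residues enter, and they agree by
      -- hypothesis.
      equal-progressions : ∀ N (a a⁻¹ b b⁻¹ : ℕ → ℕ) →
        (∀ i → a i ℕ.* a⁻¹ i ≡ 1 mod n) → (∀ i → 0 ℕ.< a⁻¹ i) → (∀ i → a⁻¹ i ℕ.< n) →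
        (∀ i → b i ℕ.* b⁻¹ i ≡ 1 mod n) → (∀ i → 0 ℕ.< b⁻¹ i) → (∀ i → b⁻¹ i ℕ.< n) →
        (∀ r → r ℕ.< n → ℕ∑ N (λ i → r ℕ.* a i % n) ≡ ℕ∑ N (λ i → r ℕ.* b i % n)) →
        ν M * ∑ N (λ i → ∑ L (λ l → c (l ℕ.* n ℕ.+ a⁻¹ i))) ≈ ν M * ∑ N (λ i → ∑ L (λ l → c (l ℕ.* n ℕ.+ b⁻¹ i)))
      equal-progressions N a a⁻¹ b b⁻¹ a-inv 0<a a<n b-inv 0<b b<n eq =
        trans (expand a a⁻¹ a-inv 0<a a<n) (trans (*-congˡ (+-congˡ (+-cong same same))) (sym (expand b b⁻¹ b-inv 0<b b<n)))
        where
        T : (ℕ → ℕ) → Carrier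
        T a = ∑ N (λ i → ν L * ν L * ∑ n (λ r → ν (r ℕ.* a i % n) * ζ ^ (r ℕ.* L)))
        expand : ∀ a a⁻¹ → (∀ i → a i ℕ.* a⁻¹ i ≡ 1 mod n) → (∀ i → 0 ℕ.< a⁻¹ i) → (∀ i → a⁻¹ i ℕ.< n) →
          ν M * ∑ N (λ i → ∑ L (λ l → c (l ℕ.* n ℕ.+ a⁻¹ i))) ≈ I * (∑ N (λ _ → ν L * ν M) + (T a + T a))
        expand a a⁻¹ a-inv 0<a a<n = trans (∑-*ˡ N (ν M) _) (trans (∑-cong′ N λ i → cotangent-progression (a i) (a⁻¹ i) (a-inv i) (0<a i) (a<n i))
          (trans (sym (∑-*ˡ N I _)) (*-congˡ (trans (∑-+ N _ _) (+-congˡ (∑-+ N _ _))))))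
        collect : ∀ a → T a ≈ ν L * ν L * ∑ n (λ r → ∑ N (λ i → ν (r ℕ.* a i % n)) * ζ ^ (r ℕ.* L))
        collect a = trans (sym (∑-*ˡ N (ν L * ν L) _)) (*-congˡ (trans (∑-swap N n _) (∑-cong′ n λ r → sym (∑-*ʳ N (ζ ^ (r ℕ.* L)) _))))
        same : T a ≈ T b
        same = trans (collect a) (trans (*-congˡ (∑-cong n λ r r<n → *-congʳ (ν-∑ N (λ i → r ℕ.* a i % n) (eq r r<n)))) (sym (collect b)))

      -- The rule cot(π - α) = -cot α: since ζᵐ and ζᵐ′ are mutually inverse, the fraction (ζᵐ +
      -- 1)/(ζᵐ - 1) changes sign. The factor κ cancels ζᵐ - 1.
      antisymmetry : ∀ m m′ → 0 ℕ.< m → m ℕ.< M → 0 ℕ.< m′ → m′ ℕ.< M → m ℕ.+ m′ ≡ M → c m + c m′ ≈ 0#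
      antisymmetry m m′ 0<m m<M 0<m′ m′<M m+m′≡M = begin
        c m + c m′                          ≈⟨ *-identityˡ _ ⟨
        1# * (c m + c m′)                   ≈⟨ *-congʳ (κ-eq m 0<m m<M) ⟨
        κ m * E * (c m + c m′) ≈⟨ solve 4 (λ k e c d → k :* e :* (c :+ d) := k :* (c :* e :+ d :* e)) refl (κ m) E (c m) (c m′) ⟩
        κ m * (c m * E + c m′ * E)          ≈⟨ *-congˡ (+-congʳ same) ⟩
        κ m * (c m′ * (X * E′) + c m′ * E) ≈⟨ solve 4 (λ k c x e → k :* (c :* x :+ c :* e) := k :* (c :* (x :+ e))) refl (κ m) (c m′) (X * E′) E ⟩
        κ m * (c m′ * (X * E′ + E))         ≈⟨ *-congˡ (trans (*-congˡ XE′+E≈0) (zeroʳ (c m′))) ⟩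
        κ m * 0#                            ≈⟨ zeroʳ (κ m) ⟩
        0#                                  ∎
        where
        open import Algebra.Solver.Ring.NaturalCoefficients.Default commutativeSemiring using (solve; _:+_; _:*_; _:=_; con)
        X = ζ ^ m
        X′ = ζ ^ m′
        E = X - 1#
        E′ = X′ - 1#
        XX′≈1 : X * X′ ≈ 1#
        XX′≈1 = trans (sym (^-homo-* ζ m m′)) (trans (ζ^-index m+m′≡M) ζ^M≈1)
        XE′+E≈0 : X * E′ + E ≈ 0#
        XE′+E≈0 = begin
          X * E′ + E                     ≈⟨ +-assoc (X * E′) X (- 1#) ⟨
          X * E′ + X - 1#                ≈⟨ +-congʳ (solve 2 (λ x e → x :* e :+ x := x :* (con 1 :+ e)) refl X E′) ⟩
          X * (1# + E′) - 1#             ≈⟨ +-congʳ (trans (*-congˡ (sym (1+[x-1] X′))) XX′≈1) ⟩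
          1# - 1#                        ≈⟨ -‿inverseʳ 1# ⟩
          0#                             ∎
        same : c m * E ≈ c m′ * (X * E′)
        same = begin
          c m * E                ≈⟨ c-eq m 0<m m<M ⟩
          I * (X + 1#)           ≈⟨ *-congˡ (+-congˡ XX′≈1) ⟨
          I * (X + X * X′)       ≈⟨ solve 3 (λ i x y → i :* (x :+ x :* y) := x :* (i :* (y :+ con 1))) refl I X X′ ⟩
          X * (I * (X′ + 1#))    ≈⟨ *-congˡ (c-eq m′ 0<m′ m′<M) ⟨
          X * (c m′ * E′)        ≈⟨ solve 3 (λ x c e → x :* (c :* e) := c :* (x :* e)) refl X (c m′) E′ ⟩
          c m′ * (X * E′)        ∎

  module Rotation (S : CommutativeRing 0ℓ 0ℓ) where
    open CommutativeRing S hiding (zero)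
    open import Algebra.Properties.CommutativeSemiring.Exp commutativeSemiring
    open import Algebra.Solver.Ring.NaturalCoefficients.Default commutativeSemiring using (solve; _:+_; _:*_; _:=_; con)
    open import Relation.Binary.Reasoning.Setoid setoid

    module _ (w w̄ e : Carrier) (ww̄e≈1 : w * w̄ * e ≈ 1#) where

      -- This is w/w̄, the inverse of w̄ being we.
      rotation : Carrier
      rotation = w * w * e

      private
        ζ^ : ∀ m → rotation ^ m ≈ w ^ m * w ^ m * e ^ m
        ζ^ m = trans (^-distrib-* (w * w) e m) (*-congʳ (^-distrib-* w w m))

        unit : ∀ m → w ^ m * w̄ ^ m * e ^ m ≈ 1#
        unit m = trans (sym (trans (^-distrib-* (w * w̄) e m) (*-congʳ (^-distrib-* w w̄ m)))) (trans (^-congˡ m ww̄e≈1) (ones m))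
          where
          ones : ∀ m → 1# ^ m ≈ 1#
          ones zero    = refl
          ones (suc m) = trans (*-identityˡ _) (ones m)

      module _ (m : ℕ) {B : Carrier} (w≈w̄+B : w ^ m ≈ w̄ ^ m + B) where

        private
          A = w ^ m
          Ā = w̄ ^ m
          E = e ^ m

          ζ≈1+ : rotation ^ m ≈ 1# + A * E * B
          ζ≈1+ = begin
            rotation ^ m                 ≈⟨ ζ^ m ⟩
            A * A * E                    ≈⟨ *-congʳ (*-congˡ w≈w̄+B) ⟩
            A * (Ā + B) * E              ≈⟨ solve 4 (λ a b e d → a :* (b :+ d) :* e := a :* b :* e :+ a :* e :* d) refl A Ā E B ⟩
            A * Ā * E + A * E * B        ≈⟨ +-congʳ (unit m) ⟩
            1# + A * E * B               ∎

          ζ-1 : rotation ^ m - 1# ≈ A * E * B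
          ζ-1 = begin
            rotation ^ m - 1#            ≈⟨ +-congʳ (trans ζ≈1+ (+-comm 1# (A * E * B))) ⟩
            A * E * B + 1# - 1#          ≈⟨ +-assoc (A * E * B) 1# (- 1#) ⟩
            A * E * B + (1# - 1#)        ≈⟨ +-congˡ (-‿inverseʳ 1#) ⟩
            A * E * B + 0#               ≈⟨ +-identityʳ _ ⟩
            A * E * B                    ∎

        -- ζᵐ - 1 and ζᵐ + 1 are wᵐ - w̄ᵐ and wᵐ + w̄ᵐ, both multiplied by wᵐeᵐ.
        rotation-cot : ∀ {c I} → c * B ≈ I * (A + Ā) → c * (rotation ^ m - 1#) ≈ I * (rotation ^ m + 1#)
        rotation-cot {c} {I} cB = begin
          c * (rotation ^ m - 1#)             ≈⟨ *-congˡ ζ-1 ⟩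
          c * (A * E * B)                     ≈⟨ solve 4 (λ c a e b → c :* (a :* e :* b) := a :* e :* (c :* b)) refl c A E B ⟩
          A * E * (c * B)                     ≈⟨ *-congˡ cB ⟩
          A * E * (I * (A + Ā)) ≈⟨ solve 4 (λ a e i b → a :* e :* (i :* (a :+ b)) := i :* (a :* a :* e :+ a :* b :* e)) refl A E I Ā ⟩
          I * (A * A * E + A * Ā * E)         ≈⟨ *-congˡ (+-cong (sym (ζ^ m)) (unit m)) ⟩
          I * (rotation ^ m + 1#)             ∎

        rotation-inverse : ∀ {G} → G * B ≈ 1# → Ā * G * (rotation ^ m - 1#) ≈ 1#
        rotation-inverse {G} GB = begin
          Ā * G * (rotation ^ m - 1#)         ≈⟨ *-congˡ ζ-1 ⟩
          Ā * G * (A * E * B)                 ≈⟨ solve 5 (λ b g a e d → b :* g :* (a :* e :* d) := a :* b :* e :* (g :* d)) refl Ā G A E B ⟩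
          A * Ā * E * (G * B)                 ≈⟨ *-cong (unit m) GB ⟩
          1# * 1#                             ≈⟨ *-identityˡ 1# ⟩
          1#                                  ∎

        rotation-period : B ≈ 0# → rotation ^ m ≈ 1#
        rotation-period B≈0 = trans ζ≈1+ (trans (+-congˡ (trans (*-congˡ B≈0) (zeroʳ _))) (+-identityʳ 1#))

-- Rational approximations to tan²(π/M).

module Root where

  open import Data.Empty using (⊥-elim)
  open import Data.Nat.Base as ℕ using (ℕ; zero; suc; s≤s; z≤n)
  import Data.Nat.Properties as ℕ
  open import Data.Product using (∃; _×_; _,_; proj₂)
  open import Data.Rational hiding (NonZero; ≢-nonZero; >-nonZero)
  open import Data.Rational.Properties
  open import Data.Sum using (_⊎_; inj₁; inj₂)
  open import Relation.Binary.PropositionalEquality using (_≡_; refl; sym; trans; cong; subst; subst₂)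
  open import Relation.Nullary using (yes; no; ¬_)
  open import Tactic.RingSolver using (solve-∀)
  open Kit
  open Sawtooth using (2ℚ)
  open Mesh using (_^_; ^>0; ^-+)
  open Ingham using (½≥0)
  open Vanish using (1≤^; ^-distrib; inv-1)

  -- (1 + √-y)ᵐ = P y m + Q y m √-y.  With y = tan² α this is (cos mα + i sin mα)/cosᵐ α.
  P Q : ℚ → ℕ → ℚ
  P y zero    = 1ℚ
  P y (suc m) = P y m - y * Q y m
  Q y zero    = 0ℚ
  Q y (suc m) = Q y m + P y m

  4ℚ : ℚ
  4ℚ = 2ℚ + 2ℚ

  private
    0≤2 : 0ℚ ≤ 2ℚ
    0≤2 = +≥0 0≤1 0≤1
    0<4 : 0ℚ < 4ℚ
    0<4 = positive⁻¹ 4ℚ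
    1≤4 : 1ℚ ≤ 4ℚ
    1≤4 = ≤-by (1ℚ + 2ℚ) (+≥0 0≤1 0≤2) refl
    0≤4^ : ∀ m → 0ℚ ≤ 4ℚ ^ m
    0≤4^ m = <⇒≤ (^>0 0<4 m)

  PQ-bound : ∀ {y} → 0ℚ ≤ y → y ≤ 2ℚ → ∀ m → ∣ P y m ∣ ≤ 4ℚ ^ m × ∣ Q y m ∣ ≤ 4ℚ ^ m
  PQ-bound 0≤y y≤2 zero    = ≤-refl , 0≤1
  PQ-bound {y} 0≤y y≤2 (suc m) with PQ-bound 0≤y y≤2 m
  ... | p , q = ≤-trans (∣∣-- p (∣∣-* (∣∣-nonNeg 0≤y y≤2) q)) (≤-by B (0≤4^ m) (l₁ B)) ,
                ≤-trans (∣∣-+ q p) (≤-by (B + B) (+≥0 (0≤4^ m) (0≤4^ m)) (l₂ B))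
    where
    B = 4ℚ ^ m
    l₁ : ∀ b → b + (1ℚ + 1ℚ) * b + b ≡ ((1ℚ + 1ℚ) + (1ℚ + 1ℚ)) * b
    l₁ = solve-∀ ringℚ
    l₂ : ∀ b → b + b + (b + b) ≡ ((1ℚ + 1ℚ) + (1ℚ + 1ℚ)) * b
    l₂ = solve-∀ ringℚ

  PQ-Lipschitz : ∀ {y δ} → 0ℚ ≤ y → y ≤ 2ℚ → 0ℚ ≤ δ → y + δ ≤ 2ℚ → ∀ m →
                 ∣ P (y + δ) m - P y m ∣ ≤ 4ℚ ^ m * δ × ∣ Q (y + δ) m - Q y m ∣ ≤ 4ℚ ^ m * δ
  PQ-Lipschitz {y} {δ} 0≤y y≤2 0≤δ yδ≤2 zero = *≥0 0≤1 0≤δ , *≥0 0≤1 0≤δ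
  PQ-Lipschitz {y} {δ} 0≤y y≤2 0≤δ yδ≤2 (suc m) with PQ-Lipschitz 0≤y y≤2 0≤δ yδ≤2 m
  ... | p , q = subst₂ (λ x b → ∣ x ∣ ≤ b) (sym (e₁ (P (y + δ) m) (P y m) y δ (Q (y + δ) m) (Q y m))) (f₁ B δ)
                  (∣∣-- p (∣∣-+ (∣∣-* (∣∣-nonNeg 0≤y y≤2) q) (∣∣-* (∣∣-nonNeg 0≤δ ≤-refl) (proj₂ (PQ-bound (+≥0 0≤y 0≤δ) yδ≤2 m))))) ,
                ≤-trans (subst (λ x → ∣ x ∣ ≤ B * δ + B * δ) (sym (e₂ (P (y + δ) m) (P y m) (Q (y + δ) m) (Q y m))) (∣∣-+ q p))
                  (≤-by (B * δ + B * δ) (+≥0 (*≥0 (0≤4^ m) 0≤δ) (*≥0 (0≤4^ m) 0≤δ)) (f₂ B δ))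
    where
    B = 4ℚ ^ m
    e₁ : ∀ p′ p y d q′ q → (p′ - (y + d) * q′) - (p - y * q) ≡ (p′ - p) - (y * (q′ - q) + d * q′)
    e₁ = solve-∀ ringℚ
    e₂ : ∀ p′ p q′ q → (q′ + p′) - (q + p) ≡ (q′ - q) + (p′ - p)
    e₂ = solve-∀ ringℚ
    f₁ : ∀ b d → b * d + ((1ℚ + 1ℚ) * (b * d) + d * b) ≡ ((1ℚ + 1ℚ) + (1ℚ + 1ℚ)) * b * d
    f₁ = solve-∀ ringℚ
    f₂ : ∀ b d → b * d + b * d + (b * d + b * d) ≡ ((1ℚ + 1ℚ) + (1ℚ + 1ℚ)) * b * d
    f₂ = solve-∀ ringℚ

  -- The range of small angles: as long as m ≤ x and x²y ≤ 1, P stays between 0 and 1, and Q grows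
  -- at most like m.
  record Initial (y : ℚ) (x m : ℕ) : Set where
    field
      P≤1 : P y m ≤ 1ℚ
      P≥  : 1ℚ - ι m * (ι x * y) ≤ P y m
      Q≥0 : 0ℚ ≤ Q y m
      Q≤m : Q y m ≤ ι m

  initial : ∀ {y} x → 0ℚ ≤ y → ι x * (ι x * y) ≤ 1ℚ → ∀ m → m ℕ.≤ x → Initial y x m
  initial {y} x 0≤y small zero _ = record
    { P≤1 = ≤-refl
    ; P≥ = ≤-reflexive (trans (cong (λ z → 1ℚ - z * (ι x * y)) fromℤ-0) (trans (cong (λ z → 1ℚ - z) (*-zeroˡ (ι x * y))) refl))
    ; Q≥0 = ≤-refl
    ; Q≤m = ≤-reflexive (sym fromℤ-0) }
  initial {y} x 0≤y small (suc m) m<x = record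
    { P≤1 = ≤-trans (≤-by (y * Q y m) (*≥0 0≤y Q≥0) (l₁ (P y m) (y * Q y m))) P≤1
    ; P≥ = ≤-trans (≤-by (y * (ι x - Q y m)) (*≥0 0≤y (diff (≤-trans Q≤m (ι-mono (ℕ.<⇒≤ m<x)))))
             (trans (cong (λ z → 1ℚ - z * (ι x * y) + y * (ι x - Q y m)) (ι-suc m)) (l₂ (ι m) (ι x) y (Q y m))))
           (+-monoˡ-≤ (- (y * Q y m)) P≥)
    ; Q≥0 = +≥0 Q≥0 P≥0
    ; Q≤m = subst (Q y m + P y m ≤_) (trans (+-comm (ι m) 1ℚ) (sym (ι-suc m))) (+-mono-≤ Q≤m P≤1) }
    where
    open Initial (initial x 0≤y small m (ℕ.<⇒≤ m<x))
    l₁ : ∀ p z → p - z + z ≡ p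
    l₁ = solve-∀ ringℚ
    l₂ : ∀ m x y q → 1ℚ - (1ℚ + m) * (x * y) + y * (x - q) ≡ (1ℚ - m * (x * y)) - y * q
    l₂ = solve-∀ ringℚ
    P≥0 : 0ℚ ≤ P y m
    P≥0 = ≤-trans (diff (≤-trans (*-monoʳ (*≥0 (ι≥0 x) 0≤y) (ι-mono (ℕ.<⇒≤ m<x))) small)) P≥

  initial-P≥0 : ∀ {y} x → 0ℚ ≤ y → ι x * (ι x * y) ≤ 1ℚ → ∀ m → m ℕ.≤ x → 0ℚ ≤ P y m
  initial-P≥0 {y} x 0≤y small m m≤x = ≤-trans (diff (≤-trans (*-monoʳ (*≥0 (ι≥0 x) 0≤y) (ι-mono m≤x)) small)) (Initial.P≥ (initial x 0≤y small m m≤x))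

  initial-Q≥1 : ∀ {y} x → 0ℚ ≤ y → ι x * (ι x * y) ≤ 1ℚ → ∀ m → suc m ℕ.≤ x → 1ℚ ≤ Q y (suc m)
  initial-Q≥1 x 0≤y small zero    le = ≤-refl
  initial-Q≥1 {y} x 0≤y small (suc m) le = ≤-trans (initial-Q≥1 x 0≤y small m (ℕ.<⇒≤ le))
    (≤-by (P y (suc m)) (initial-P≥0 x 0≤y small (suc m) (ℕ.<⇒≤ le)) refl)

  -- For y = tan² α with α acute this says Mα < π: the sines of α, 2α, ..., Mα are positive.
  Good : ℚ → ℕ → Set
  Good y M = ∀ m → 1 ℕ.≤ m → m ℕ.≤ M → 0ℚ < Q y m

  private
    scan : ∀ y M → Good y M ⊎ ∃ λ m → m ℕ.≤ M × Q y m ≤ 0ℚ × 1 ℕ.≤ m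
    scan y zero = inj₁ λ { m 1≤m m≤0 → ⊥-elim (ℕ.<-irrefl refl (ℕ.≤-trans 1≤m m≤0)) }
    scan y (suc M) with scan y M | 0ℚ <? Q y (suc M)
    ... | inj₂ (m , m≤M , Q≤0 , 1≤m) | _ = inj₂ (m , ℕ.m≤n⇒m≤1+n m≤M , Q≤0 , 1≤m)
    ... | inj₁ _ | no ¬p = inj₂ (suc M , ℕ.≤-refl , ≮⇒≥ ¬p , s≤s z≤n)
    ... | inj₁ good | yes p = inj₁ good′
      where
      good′ : Good y (suc M)
      good′ m 1≤m m≤ with ℕ.m≤n⇒m<n∨m≡n m≤
      ... | inj₁ (s≤s m≤M) = good m 1≤m m≤M
      ... | inj₂ refl = p

    -- A discrete intermediate value theorem: walking down from a failing grid point, it finds a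
    -- good one whose successor fails, together with the index at which it fails.
    search : ∀ y δ M → Good y M → ∀ k → ¬ Good (y + ι k * δ) M → ∃ λ j → Good (y + ι j * δ) M × ∃ λ m → m ℕ.≤ M × Q (y + ι j * δ + δ) m ≤ 0ℚ × 1 ℕ.≤ m
    search y δ M good zero bad = ⊥-elim (bad (subst (λ z → Good z M) (sym (trans (cong (λ z → y + z * δ) fromℤ-0) (trans (cong (λ z → y + z) (*-zeroˡ δ)) (+-identityʳ y)))) good))
    search y δ M good (suc k) bad with scan (y + ι k * δ) M
    ... | inj₂ (m , m≤M , Q≤0 , 1≤m) = search y δ M good k λ g → <⇒≱ (g m 1≤m m≤M) Q≤0
    ... | inj₁ g with scan (y + ι k * δ + δ) M
    ...   | inj₂ b = k , g , b
    ...   | inj₁ g′ = ⊥-elim (bad (subst (λ z → Good z M) (sym (trans (cong (λ z → y + z * δ) (ι-suc k)) (lemma y (ι k) δ))) g′))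
      where
      lemma : ∀ y k d → y + (1ℚ + k) * d ≡ y + k * d + d
      lemma = solve-∀ ringℚ

    Q4 : ∀ y → Q y 4 ≡ ((1ℚ + 1ℚ) + (1ℚ + 1ℚ)) * (1ℚ - y)
    Q4 = lemma
      where
      lemma : ∀ y → (((0ℚ + 1ℚ) + (1ℚ - y * 0ℚ)) + ((1ℚ - y * 0ℚ) - y * (0ℚ + 1ℚ))) + (((1ℚ - y * 0ℚ) - y * (0ℚ + 1ℚ)) - y * ((0ℚ + 1ℚ) + (1ℚ - y * 0ℚ))) ≡ ((1ℚ + 1ℚ) + (1ℚ + 1ℚ)) * (1ℚ - y)
      lemma = solve-∀ ringℚ

  good⇒<1 : ∀ {y M} → 4 ℕ.≤ M → Good y M → y < 1ℚ
  good⇒<1 {y} {M} 4≤M good with y <? 1ℚ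
  ... | yes p = p
  ... | no ¬p = ⊥-elim (<⇒≱ (subst (0ℚ <_) (Q4 y) (good 4 (s≤s z≤n) 4≤M))
      (≤-by (4ℚ * (y - 1ℚ)) (*≥0 (<⇒≤ 0<4) (diff (≮⇒≥ ¬p))) (lemma y)))
    where
    lemma : ∀ y → ((1ℚ + 1ℚ) + (1ℚ + 1ℚ)) * (1ℚ - y) + ((1ℚ + 1ℚ) + (1ℚ + 1ℚ)) * (y - 1ℚ) ≡ 0ℚ
    lemma = solve-∀ ringℚ

  -- The recurrence is Q(m + 2) = 2Q(m + 1) - (1 + y)Q(m). With the left side positive and y ≥ 0, it
  -- gives 2Q(m + 1) ≥ Q(m).
  good-halving : ∀ {y M} → 0ℚ ≤ y → Good y M → ∀ m → suc (suc m) ℕ.≤ M → ½ * Q y m ≤ Q y (suc m)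
  good-halving {y} {M} 0≤y good m le = ≤-by (½ * (y * Q y m) + ½ * Q y (suc (suc m)))
      (+≥0 (*≥0 ½≥0 (*≥0 0≤y (Qm≥0 m le))) (*≥0 ½≥0 (<⇒≤ (good (suc (suc m)) (s≤s z≤n) le))))
      (lemma y (Q y m) (P y m))
    where
    lemma : ∀ y q p → ½ * q + (½ * (y * q) + ½ * ((q + p) + (p - y * q))) ≡ q + p
    lemma = solve-∀ ringℚ
    Qm≥0 : ∀ m → suc (suc m) ℕ.≤ M → 0ℚ ≤ Q y m
    Qm≥0 zero    _  = ≤-refl
    Qm≥0 (suc m) le = <⇒≤ (good (suc m) (s≤s z≤n) (ℕ.≤-trans (ℕ.n≤1+n _) (ℕ.≤-trans (ℕ.n≤1+n _) le)))

  good-lower : ∀ {y M} → 0ℚ ≤ y → Good y M → ∀ m → suc m ℕ.< M → ½ ^ suc m ≤ Q y (suc m)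
  good-lower 0≤y good zero    _  = ≤-by ½ ½≥0 refl
  good-lower {y} 0≤y good (suc m) lt = ≤-trans (*-monoˡ ½≥0 (good-lower 0≤y good m (ℕ.<⇒≤ lt))) (good-halving 0≤y good (suc m) lt)

  record Approximation (M T : ℕ) : Set where
    field
      y     : ℚ
      y≥    : inv (ι M * ι M) ≤ y
      y≤1   : y ≤ 1ℚ
      good  : Good y M
      small : ι (suc T) * Q y M ≤ (2ℚ * 4ℚ) ^ M * 4ℚ ^ M

  -- The grid of step δ = 1/(T + 1) starts at 1/M², which is good by the small-angle estimates, and
  -- ends beyond 1, which fails because Q(4) = 4(1 - y). At the last good y before a failure, Q is
  -- O(δ) at the failing index by the Lipschitz bound.
  approximation : ∀ M T → 4 ℕ.≤ M → Approximation M T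
  approximation M@(suc M-1) T 4≤M with search y₀ δ M good₀ (suc T) bad
    where
    y₀ = inv (ι M * ι M)
    δ = inv (ι (suc T))
    0<M² : 0ℚ < ι M * ι M
    0<M² = *>0 (ι>0 M-1) (ι>0 M-1)
    good₀ : Good y₀ M
    good₀ (suc m) _ m≤M = <-≤-trans 0<1 (initial-Q≥1 M (inv≥0 0<M²) (≤-reflexive (trans (sym (*-assoc (ι M) (ι M) y₀)) (*-inv⁺ 0<M²))) m m≤M)
    bad : ¬ Good (y₀ + ι (suc T) * δ) M
    bad g = <⇒≱ (good⇒<1 4≤M g) (≤-by y₀ (inv≥0 0<M²) (trans (+-comm 1ℚ y₀) (cong (λ z → y₀ + z) (sym (*-inv⁺ (ι>0 T))))))
  ... | j , good , m , m≤M , Q≤0 , 1≤m = record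
    { y = y ; y≥ = ≤-by (ι j * δ) (*≥0 (ι≥0 j) (<⇒≤ δ>0)) refl ; y≤1 = y≤1 ; good = good ; small = small m m≤M 1≤m Q≤0 }
    where
    y₀ = inv (ι M * ι M)
    δ = inv (ι (suc T))
    δ>0 : 0ℚ < δ
    δ>0 = inv>0 (ι>0 T)
    y = y₀ + ι j * δ
    y≤1 : y ≤ 1ℚ
    y≤1 = <⇒≤ (good⇒<1 4≤M good)
    0≤y : 0ℚ ≤ y
    0≤y = +≥0 (inv≥0 (*>0 (ι>0 M-1) (ι>0 M-1))) (*≥0 (ι≥0 j) (<⇒≤ δ>0))
    y≤2 : y ≤ 2ℚ
    y≤2 = ≤-trans y≤1 (≤-by 1ℚ 0≤1 refl)
    yδ≤2 : y + δ ≤ 2ℚ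
    yδ≤2 = +-mono-≤ {y} {1ℚ} {δ} {1ℚ} y≤1 (≤-trans (inv-anti 0<1 (ι≥1 T)) (≤-reflexive inv-1))
    B = 4ℚ ^ M
    1≤8 : 1ℚ ≤ 2ℚ * 4ℚ
    1≤8 = *-mono 0≤1 (≤-by 1ℚ 0≤1 refl) 0≤1 1≤4
    near : ∀ m → m ℕ.≤ M → Q (y + δ) m ≤ 0ℚ → Q y m ≤ 4ℚ ^ m * δ
    near m m≤M Q≤0 = ≤-trans (≤-by (- Q (y + δ) m) (neg-antimono-≤ Q≤0) (flip (Q y m) (Q (y + δ) m)))
      (≤-trans (-x≤∣x∣ (Q (y + δ) m - Q y m)) (proj₂ (PQ-Lipschitz 0≤y y≤2 (<⇒≤ δ>0) yδ≤2 m)))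
      where
      flip : ∀ a b → a + - b ≡ - (b - a)
      flip = solve-∀ ringℚ
    δT : ∀ x → ι (suc T) * (x * δ) ≡ x
    δT x = trans (swap (ι (suc T)) x δ) (trans (cong (x *_) (*-inv⁺ (ι>0 T))) (*-identityʳ x))
      where
      swap : ∀ t x d → t * (x * d) ≡ x * (t * d)
      swap = solve-∀ ringℚ
    scaled : ∀ m → m ℕ.≤ M → Q (y + δ) m ≤ 0ℚ → ι (suc T) * Q y m ≤ 4ℚ ^ m
    scaled m m≤M Q≤0 = subst (ι (suc T) * Q y m ≤_) (δT (4ℚ ^ m)) (*-monoˡ (ι≥0 (suc T)) (near m m≤M Q≤0))
    small : ∀ m → m ℕ.≤ M → 1 ℕ.≤ m → Q (y + δ) m ≤ 0ℚ → ι (suc T) * Q y M ≤ (2ℚ * 4ℚ) ^ M * B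
    small (suc m) m≤M _ Q≤0 with ℕ.m≤n⇒m<n∨m≡n m≤M
    ... | inj₂ refl = ≤-trans (scaled M ℕ.≤-refl Q≤0) (subst (_≤ (2ℚ * 4ℚ) ^ M * B) (*-identityˡ B) (*-monoʳ (0≤4^ M) (1≤^ 1≤8 M)))
    -- A failure before M can occur for small T only: Q(m) is at least ½ᵐ and at most 4ᵐδ, so T + 1
    -- ≤ 8ᵐ, and the trivial bound Q(M) ≤ 4^M is good enough.
    ... | inj₁ m<M = *-mono (ι≥0 (suc T)) T≤ (<⇒≤ (good M (s≤s z≤n) ℕ.≤-refl)) (≤-trans (x≤∣x∣ (Q y M)) (proj₂ (PQ-bound 0≤y y≤2 M)))
      where
      T≤ : ι (suc T) ≤ (2ℚ * 4ℚ) ^ M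
      T≤ = begin
        ι (suc T) ≡⟨ sym (trans (cong (ι (suc T) *_) (trans (sym (^-distrib 2ℚ ½ (suc m))) (one (suc m)))) (*-identityʳ (ι (suc T)))) ⟩
        ι (suc T) * (2ℚ ^ suc m * ½ ^ suc m)            ≡⟨ swap (ι (suc T)) (2ℚ ^ suc m) (½ ^ suc m) ⟩
        2ℚ ^ suc m * (ι (suc T) * ½ ^ suc m) ≤⟨ *-monoˡ (<⇒≤ (^>0 (positive⁻¹ 2ℚ) (suc m))) (*-monoˡ (ι≥0 (suc T)) (good-lower 0≤y good m m<M)) ⟩
        2ℚ ^ suc m * (ι (suc T) * Q y (suc m))          ≤⟨ *-monoˡ (<⇒≤ (^>0 (positive⁻¹ 2ℚ) (suc m))) (scaled (suc m) m≤M Q≤0) ⟩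
        2ℚ ^ suc m * 4ℚ ^ suc m                         ≡⟨ sym (^-distrib 2ℚ 4ℚ (suc m)) ⟩
        (2ℚ * 4ℚ) ^ suc m ≤⟨ subst₂ _≤_ (*-identityʳ ((2ℚ * 4ℚ) ^ suc m)) (trans (sym (^-+ (2ℚ * 4ℚ) (suc m) (M ℕ.∸ suc m))) (cong ((2ℚ * 4ℚ) ^_) (ℕ.m+[n∸m]≡n m≤M))) (*-monoˡ (≤-trans 0≤1 (1≤^ 1≤8 (suc m))) (1≤^ 1≤8 (M ℕ.∸ suc m))) ⟩
        (2ℚ * 4ℚ) ^ M                                   ∎
        where
        open ≤-Reasoning
        swap : ∀ t x d → t * (x * d) ≡ x * (t * d)
        swap = solve-∀ ringℚ
        one : ∀ k → (2ℚ * ½) ^ k ≡ 1ℚ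
        one zero    = refl
        one (suc k) = trans (cong (2ℚ * ½ *_) (one k)) refl

-- The ring of bounded sequences modulo O(1/T).

module SeqRing where

  open import Algebra.Bundles using (CommutativeRing)
  open import Algebra.Structures using (IsCommutativeRing)
  open import Data.Nat.Base as ℕ using (ℕ; suc)
  open import Data.Product using () renaming (_,_ to ⟨_,_⟩)
  open import Data.Rational hiding (NonZero; ≢-nonZero; >-nonZero)
  open import Data.Rational.Properties
  open import Level using (0ℓ)
  open import Relation.Binary.PropositionalEquality using (_≡_; refl; sym; trans; cong; subst)
  open import Tactic.RingSolver using (solve-∀)
  open Kit

  record Close (f g : ℕ → ℚ) : Set where
    constructor close
    field
      rate  : ℚ
      close≤ : ∀ T → ι (suc T) * ∣ f T - g T ∣ ≤ rate

  close-exact : ∀ {f g} → (∀ T → f T ≡ g T) → Close f g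
  close-exact {f} {g} eq = close 0ℚ λ T → ≤-reflexive (trans (cong (λ x → ι (suc T) * ∣ x - g T ∣) (eq T))
    (trans (cong (λ x → ι (suc T) * ∣ x ∣) (+-inverseʳ (g T))) (*-zeroʳ (ι (suc T)))))

  close-sym : ∀ {f g} → Close f g → Close g f
  close-sym {f} {g} (close C le) = close C λ T → subst (λ x → ι (suc T) * x ≤ C) (trans (sym (∣-p∣≡∣p∣ (f T - g T))) (cong ∣_∣ (flip (f T) (g T)))) (le T)
    where
    flip : ∀ a b → - (a - b) ≡ b - a
    flip = solve-∀ ringℚ

  private
    combine : ∀ {x y z a b} T → ∣ z ∣ ≤ ∣ x ∣ + ∣ y ∣ → ι (suc T) * ∣ x ∣ ≤ a → ι (suc T) * ∣ y ∣ ≤ b → ι (suc T) * ∣ z ∣ ≤ a + b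
    combine {x} {y} T le p q = ≤-trans (*-monoˡ (ι≥0 (suc T)) le) (≤-trans (≤-reflexive (*-distribˡ-+ (ι (suc T)) ∣ x ∣ ∣ y ∣)) (+-mono-≤ p q))

  close-trans : ∀ {f g h} → Close f g → Close g h → Close f h
  close-trans {f} {g} {h} (close C p) (close D q) = close (C + D) λ T → combine {f T - g T} {g T - h T} T
    (subst (λ x → ∣ x ∣ ≤ ∣ f T - g T ∣ + ∣ g T - h T ∣) (split (f T) (g T) (h T)) (∣p+q∣≤∣p∣+∣q∣ (f T - g T) (g T - h T))) (p T) (q T)
    where
    split : ∀ a b c → (a - b) + (b - c) ≡ a - c
    split = solve-∀ ringℚ

  close-+ : {f f′ g g′ : ℕ → ℚ} → Close f f′ → Close g g′ → Close (λ T → f T + g T) (λ T → f′ T + g′ T)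
  close-+ {f} {f′} {g} {g′} (close C p) (close D q) = close (C + D) λ T → combine {f T - f′ T} {g T - g′ T} T
    (subst (λ x → ∣ x ∣ ≤ ∣ f T - f′ T ∣ + ∣ g T - g′ T ∣) (split (f T) (f′ T) (g T) (g′ T)) (∣p+q∣≤∣p∣+∣q∣ (f T - f′ T) (g T - g′ T))) (p T) (q T)
    where
    split : ∀ a b c d → (a - b) + (c - d) ≡ (a + c) - (b + d)
    split = solve-∀ ringℚ

  close-neg : {f f′ : ℕ → ℚ} → Close f f′ → Close (λ T → - f T) (λ T → - f′ T)
  close-neg {f} {f′} (close C p) = close C λ T → subst (λ x → ι (suc T) * x ≤ C) (trans (sym (∣-p∣≡∣p∣ (f T - f′ T))) (cong ∣_∣ (flip (f T) (f′ T)))) (p T)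
    where
    flip : ∀ a b → - (a - b) ≡ (- a) - (- b)
    flip = solve-∀ ringℚ

  -- Boundedness of the factor is what makes the O(1/T) sequences an ideal.
  close-scale : (g : ℕ → ℚ) {f f′ : ℕ → ℚ} {b : ℚ} → (∀ T → ∣ g T ∣ ≤ b) → Close f f′ → Close (λ T → g T * f T) (λ T → g T * f′ T)
  close-scale g {f} {f′} {b} g≤ (close C p) = close (b * C) λ T → begin
    ι (suc T) * ∣ g T * f T - g T * f′ T ∣     ≡⟨ cong (λ x → ι (suc T) * ∣ x ∣) (factor (g T) (f T) (f′ T)) ⟩
    ι (suc T) * ∣ g T * (f T - f′ T) ∣         ≡⟨ cong (ι (suc T) *_) (∣p*q∣≡∣p∣*∣q∣ (g T) (f T - f′ T)) ⟩
    ι (suc T) * (∣ g T ∣ * ∣ f T - f′ T ∣)     ≡⟨ swap (ι (suc T)) ∣ g T ∣ ∣ f T - f′ T ∣ ⟩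
    ∣ g T ∣ * (ι (suc T) * ∣ f T - f′ T ∣)     ≤⟨ *-mono (0≤∣p∣ (g T)) (g≤ T) (*≥0 (ι≥0 (suc T)) (0≤∣p∣ (f T - f′ T))) (p T) ⟩
    b * C                                      ∎
    where
    open ≤-Reasoning
    factor : ∀ g a b → g * a - g * b ≡ g * (a - b)
    factor = solve-∀ ringℚ
    swap : ∀ a b c → a * (b * c) ≡ b * (a * c)
    swap = solve-∀ ringℚ

  close-* : {f f′ g g′ : ℕ → ℚ} {b b′ : ℚ} → (∀ T → ∣ f T ∣ ≤ b) → (∀ T → ∣ g′ T ∣ ≤ b′) → Close f f′ → Close g g′ →
            Close (λ T → f T * g T) (λ T → f′ T * g′ T)
  close-* {f} {f′} {g} {g′} f≤ g′≤ p q = close-trans (close-scale f f≤ q)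
    (close-trans (close-exact λ T → *-comm (f T) (g′ T)) (close-trans (close-scale g′ g′≤ p) (close-exact λ T → *-comm (g′ T) (f′ T))))

  -- Bounded sequences over ℚ[√-Y T], where a sequence that is O(1/T) counts as zero:
  -- identities that hold exactly for the irrational limit of Y can be derived in this ring.
  module Sequences (Y : ℕ → ℚ) (Y≥0 : ∀ T → 0ℚ ≤ Y T) (Y≤1 : ∀ T → Y T ≤ 1ℚ) where

    record Seq : Set where
      no-eta-equality
      constructor seq
      field
        re im : ℕ → ℚ
        bound : ℚ
        re≤   : ∀ T → ∣ re T ∣ ≤ bound
        im≤   : ∀ T → ∣ im T ∣ ≤ bound

    open Seq public

    infix 4 _≈_

    record _≈_ (x y : Seq) : Set where
      constructor _,_
      field
        re-close : Close (re x) (re y)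
        im-close : Close (im x) (im y)

    exact : ∀ {x y} → (∀ T → re x T ≡ re y T) → (∀ T → im x T ≡ im y T) → x ≈ y
    exact p q = close-exact p , close-exact q

    private
      YB : ∀ T → ∣ Y T ∣ ≤ 1ℚ
      YB T = ∣∣-nonNeg (Y≥0 T) (Y≤1 T)

      1*ʳ : ∀ y a b → 1ℚ * a - y * (0ℚ * b) ≡ a
      1*ʳ = solve-∀ ringℚ
      1*ⁱ : ∀ a b → 1ℚ * b + 0ℚ * a ≡ b
      1*ⁱ = solve-∀ ringℚ
      commʳ : ∀ y a b c d → a * c - y * (b * d) ≡ c * a - y * (d * b)
      commʳ = solve-∀ ringℚ
      commⁱ : ∀ a b c d → a * d + b * c ≡ c * b + d * a
      commⁱ = solve-∀ ringℚ
      assocʳ : ∀ y a b c d e f → (a * c - y * (b * d)) * e - y * ((a * d + b * c) * f) ≡ a * (c * e - y * (d * f)) - y * (b * (c * f + d * e))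
      assocʳ = solve-∀ ringℚ
      assocⁱ : ∀ y a b c d e f → (a * c - y * (b * d)) * f + (a * d + b * c) * e ≡ a * (c * f + d * e) + b * (c * e - y * (d * f))
      assocⁱ = solve-∀ ringℚ
      distʳ : ∀ y a b c d e f → a * (c + e) - y * (b * (d + f)) ≡ (a * c - y * (b * d)) + (a * e - y * (b * f))
      distʳ = solve-∀ ringℚ
      distⁱ : ∀ a b c d e f → a * (d + f) + b * (c + e) ≡ (a * d + b * c) + (a * f + b * e)
      distⁱ = solve-∀ ringℚ

    real : (f : ℕ → ℚ) (b : ℚ) → (∀ T → ∣ f T ∣ ≤ b) → Seq
    real f b f≤ = seq f (λ _ → 0ℚ) b f≤ (λ T → ≤-trans (0≤∣p∣ (f T)) (f≤ T))

    imaginary : (f : ℕ → ℚ) (b : ℚ) → (∀ T → ∣ f T ∣ ≤ b) → Seq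
    imaginary f b f≤ = seq (λ _ → 0ℚ) f b (λ T → ≤-trans (0≤∣p∣ (f T)) (f≤ T)) f≤

    -- Sealed, so that the type checker never compares the boundedness proofs.
    abstract
      _+ₛ_ _*ₛ_ : Seq → Seq → Seq
      x +ₛ y = seq (λ T → re x T + re y T) (λ T → im x T + im y T) (bound x + bound y)
        (λ T → ∣∣-+ (re≤ x T) (re≤ y T)) (λ T → ∣∣-+ (im≤ x T) (im≤ y T))
      x *ₛ y = seq (λ T → re x T * re y T - Y T * (im x T * im y T)) (λ T → re x T * im y T + im x T * re y T)
        (bound x * bound y + bound x * bound y)
        (λ T → ∣∣-- (∣∣-* (re≤ x T) (re≤ y T)) (subst (∣ Y T * (im x T * im y T) ∣ ≤_) (*-identityˡ (bound x * bound y)) (∣∣-* (YB T) (∣∣-* (im≤ x T) (im≤ y T)))))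
        (λ T → ∣∣-+ (∣∣-* (re≤ x T) (im≤ y T)) (∣∣-* (im≤ x T) (re≤ y T)))

      -ₛ_ : Seq → Seq
      -ₛ x = seq (λ T → - re x T) (λ T → - im x T) (bound x)
        (λ T → subst (_≤ bound x) (sym (∣-p∣≡∣p∣ (re x T))) (re≤ x T)) (λ T → subst (_≤ bound x) (sym (∣-p∣≡∣p∣ (im x T))) (im≤ x T))

      0ₛ 1ₛ : Seq
      0ₛ = real (λ _ → 0ℚ) 0ℚ (λ _ → ≤-refl)
      1ₛ = real (λ _ → 1ℚ) 1ℚ (λ _ → ≤-refl)

      re-+ : ∀ x y T → re (x +ₛ y) T ≡ re x T + re y T
      re-+ x y T = refl

      re-* : ∀ x y T → re (x *ₛ y) T ≡ re x T * re y T - Y T * (im x T * im y T)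
      re-* x y T = refl

      im-+ : ∀ x y T → im (x +ₛ y) T ≡ im x T + im y T
      im-+ x y T = refl

      im-* : ∀ x y T → im (x *ₛ y) T ≡ re x T * im y T + im x T * re y T
      im-* x y T = refl

      re-0 : ∀ T → re 0ₛ T ≡ 0ℚ
      re-0 T = refl

      im-0 : ∀ T → im 0ₛ T ≡ 0ℚ
      im-0 T = refl

      re-1 : ∀ T → re 1ₛ T ≡ 1ℚ
      re-1 T = refl

      im-1 : ∀ T → im 1ₛ T ≡ 0ℚ
      im-1 T = refl

      +-congₛ : ∀ {x y u v} → x ≈ y → u ≈ v → (x +ₛ u) ≈ (y +ₛ v)
      +-congₛ (p , q) (r , s) = close-+ p r , close-+ q s

      *-congₛ : ∀ {x y u v} → x ≈ y → u ≈ v → (x *ₛ u) ≈ (y *ₛ v)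
      *-congₛ {x} {y} {u} {v} (p , q) (r , s) =
        close-+ (close-* (re≤ x) (re≤ v) p r) (close-neg (close-scale Y YB (close-* (im≤ x) (im≤ v) q s))) ,
        close-+ (close-* (re≤ x) (im≤ v) p s) (close-* (im≤ x) (re≤ v) q r)


      *-commₛ : ∀ x y → (x *ₛ y) ≈ (y *ₛ x)
      *-commₛ x y = exact (λ T → commʳ (Y T) (re x T) (im x T) (re y T) (im y T)) (λ T → commⁱ (re x T) (im x T) (re y T) (im y T))

      ≈-trans : ∀ {x y z} → x ≈ y → y ≈ z → x ≈ z
      ≈-trans (p , q) (r , s) = close-trans p r , close-trans q s

      *-idˡ : ∀ x → (1ₛ *ₛ x) ≈ x
      *-idˡ x = exact (λ T → 1*ʳ (Y T) (re x T) (im x T)) (λ T → 1*ⁱ (re x T) (im x T))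

      distribˡₛ : ∀ x y z → (x *ₛ (y +ₛ z)) ≈ ((x *ₛ y) +ₛ (x *ₛ z))
      distribˡₛ x y z = exact (λ T → distʳ (Y T) (re x T) (im x T) (re y T) (im y T) (re z T) (im z T)) (λ T → distⁱ (re x T) (im x T) (re y T) (im y T) (re z T) (im z T))

      isCommutativeRing : IsCommutativeRing _≈_ _+ₛ_ _*ₛ_ -ₛ_ 0ₛ 1ₛ
      isCommutativeRing = record
        { isRing = record
          { +-isAbelianGroup = record
            { isGroup = record
              { isMonoid = record
                { isSemigroup = record
                  { isMagma = record
                    { isEquivalence = record
                      { refl = exact (λ _ → refl) (λ _ → refl)
                      ; sym = λ (p , q) → close-sym p , close-sym q
                      ; trans = λ {x} {y} {z} → ≈-trans {x} {y} {z} }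
                    ; ∙-cong = λ {x} {y} {u} {v} → +-congₛ {x} {y} {u} {v} }
                  ; assoc = λ x y z → exact (λ T → +-assoc (re x T) (re y T) (re z T)) (λ T → +-assoc (im x T) (im y T) (im z T)) }
                ; identity = ⟨_,_⟩ (λ x → exact (λ T → +-identityˡ (re x T)) (λ T → +-identityˡ (im x T)))
                             (λ x → exact (λ T → +-identityʳ (re x T)) (λ T → +-identityʳ (im x T))) }
              ; inverse = ⟨_,_⟩ (λ x → exact (λ T → +-inverseˡ (re x T)) (λ T → +-inverseˡ (im x T)))
                          (λ x → exact (λ T → +-inverseʳ (re x T)) (λ T → +-inverseʳ (im x T)))
              ; ⁻¹-cong = λ (p , q) → close-neg p , close-neg q }
            ; comm = λ x y → exact (λ T → +-comm (re x T) (re y T)) (λ T → +-comm (im x T) (im y T)) }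
          ; *-cong = λ {x} {y} {u} {v} → *-congₛ {x} {y} {u} {v}
          ; *-assoc = λ x y z → exact (λ T → assocʳ (Y T) (re x T) (im x T) (re y T) (im y T) (re z T) (im z T)) (λ T → assocⁱ (Y T) (re x T) (im x T) (re y T) (im y T) (re z T) (im z T))
          ; *-identity = ⟨ *-idˡ , (λ x → ≈-trans {x *ₛ 1ₛ} {1ₛ *ₛ x} {x} (*-commₛ x 1ₛ) (*-idˡ x)) ⟩
          ; distrib = ⟨ distribˡₛ , (λ x y z → ≈-trans {(y +ₛ z) *ₛ x} {x *ₛ (y +ₛ z)} {(y *ₛ x) +ₛ (z *ₛ x)} (*-commₛ (y +ₛ z) x)
              (≈-trans {x *ₛ (y +ₛ z)} {(x *ₛ y) +ₛ (x *ₛ z)} {(y *ₛ x) +ₛ (z *ₛ x)} (distribˡₛ x y z)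
                (+-congₛ {x *ₛ y} {y *ₛ x} {x *ₛ z} {z *ₛ x} (*-commₛ x y) (*-commₛ x z)))) ⟩ }
        ; *-comm = *-commₛ }

    ring : CommutativeRing 0ℓ 0ℓ
    ring = record
      { Carrier = Seq ; _≈_ = _≈_ ; _+_ = _+ₛ_ ; _*_ = _*ₛ_ ; -_ = -ₛ_ ; 0# = 0ₛ ; 1# = 1ₛ
      ; isCommutativeRing = isCommutativeRing }

-- The cotangent identities at the approximate root.

module Cotangent where

  open import Algebra.Bundles using (CommutativeRing)
  open import Data.Empty using (⊥-elim)
  open import Data.Nat.Base as ℕ using (ℕ; zero; suc; NonZero; _%_; _∸_)
  import Data.Nat.Properties as ℕ
  open import Data.Product using (proj₁; proj₂) renaming (_,_ to ⟨_,_⟩)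
  open import Data.Rational hiding (NonZero; ≢-nonZero; >-nonZero)
  open import Data.Rational.Properties
  open import Relation.Binary.PropositionalEquality using (_≡_; refl; sym; trans; cong; cong₂; subst; subst₂)
  open import Relation.Nullary using (Dec; yes; no)
  open import Tactic.RingSolver using (solve-∀)
  open Kit
  open Sums
  open Mod
  open Sawtooth using (2ℚ)
  open Mesh using (_^_; ^>0)
  open Root
  open SeqRing
  open Fourier

  -- The finite-difference analogue of √y cot(mα).
  cot : ℚ → ℕ → ℚ
  cot y m = P y m * inv (Q y m)

  module Approximate (n L : ℕ) {{_ : NonZero n}} {{_ : NonZero L}} (1≤M : 1 ℕ.≤ n ℕ.* L)
    (Y : ℕ → ℚ) (y₀ K : ℚ) (0<y₀ : 0ℚ < y₀) (y₀≤Y : ∀ T → y₀ ≤ Y T) (Y≤1 : ∀ T → Y T ≤ 1ℚ)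
    (Y-good : ∀ T → Good (Y T) (n ℕ.* L)) (small-Q : ∀ T → ι (suc T) * Q (Y T) (n ℕ.* L) ≤ K) where

    private
      M : ℕ
      M = n ℕ.* L

      Y>0 : ∀ T → 0ℚ < Y T
      Y>0 T = <-≤-trans 0<y₀ (y₀≤Y T)

      Y≥0 : ∀ T → 0ℚ ≤ Y T
      Y≥0 T = <⇒≤ (Y>0 T)

    private
      Y≤2 : ∀ T → Y T ≤ 2ℚ
      Y≤2 T = ≤-trans (Y≤1 T) (≤-by 1ℚ 0≤1 refl)

      Q-lower : ∀ m → 0 ℕ.< m → m ℕ.< M → ∀ T → ½ ^ m ≤ Q (Y T) m
      Q-lower (suc m) _ m<M T = good-lower (Y≥0 T) (Y-good T) m m<M

      0<½^ : ∀ m → 0ℚ < ½ ^ m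
      0<½^ = ^>0 (positive⁻¹ ½)

      Q>0 : ∀ m → 0 ℕ.< m → m ℕ.< M → ∀ T → 0ℚ < Q (Y T) m
      Q>0 m 0<m m<M T = Y-good T m 0<m (ℕ.<⇒≤ m<M)

      invQ≤ : ∀ m → 0 ℕ.< m → m ℕ.< M → ∀ T → ∣ inv (Q (Y T) m) ∣ ≤ inv (½ ^ m)
      invQ≤ m 0<m m<M T = ∣∣-nonNeg (inv≥0 (Q>0 m 0<m m<M T)) (inv-anti (0<½^ m) (Q-lower m 0<m m<M T))

    open Sequences Y Y≥0 Y≤1
    private
      module S = CommutativeRing ring
      open S using () renaming (_+_ to _⊕_; _*_ to _⊗_)
      open import Algebra.Properties.CommutativeSemiring.Exp S.commutativeSemiring using () renaming (_^_ to _⋆_)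
      open Geometric ring using (ν)
      open RangeSum ring using () renaming (∑ to ∑ₛ)

      one : (T : ℕ) → ∣ 1ℚ ∣ ≤ 1ℚ
      one _ = ≤-refl

      I w w̄ e : Seq
      I = imaginary (λ _ → 1ℚ) 1ℚ one
      w = seq (λ _ → 1ℚ) (λ _ → 1ℚ) 1ℚ one one
      w̄ = seq (λ _ → 1ℚ) (λ _ → - 1ℚ) 1ℚ one one
      e = real (λ T → inv (1ℚ + Y T)) 1ℚ e≤
        where
        e≤ : ∀ T → ∣ inv (1ℚ + Y T) ∣ ≤ 1ℚ
        e≤ T = ∣∣-nonNeg (inv≥0 0<) (*-cancelˡ-≤ 0< (subst₂ _≤_ (sym (*-inv⁺ 0<)) (sym (*-identityʳ (1ℚ + Y T))) (≤-by (Y T) (Y≥0 T) refl)))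
          where 0< = <-≤-trans 0<1 (≤-by (Y T) (Y≥0 T) refl)

      ww̄e≈1 : w ⊗ w̄ ⊗ e ≈ S.1#
      ww̄e≈1 = exact
        (λ T → trans (re-* (w ⊗ w̄) e T) (trans (cong₂ (λ a b → a * inv (1ℚ + Y T) - Y T * (b * 0ℚ)) (re-* w w̄ T) (im-* w w̄ T))
          (trans (l₁ (Y T) (inv (1ℚ + Y T))) (trans (*-inv⁺ (<-≤-trans 0<1 (≤-by (Y T) (Y≥0 T) refl))) (sym (re-1 T))))))
        (λ T → trans (im-* (w ⊗ w̄) e T) (trans (cong₂ (λ a b → a * 0ℚ + b * inv (1ℚ + Y T)) (re-* w w̄ T) (im-* w w̄ T))
          (trans (l₂ (Y T) (inv (1ℚ + Y T))) (sym (im-1 T)))))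
        where
        l₁ : ∀ y i → (1ℚ * 1ℚ - y * (1ℚ * (- 1ℚ))) * i - y * ((1ℚ * (- 1ℚ) + 1ℚ * 1ℚ) * 0ℚ) ≡ (1ℚ + y) * i
        l₁ = solve-∀ ringℚ
        l₂ : ∀ y i → (1ℚ * 1ℚ - y * (1ℚ * (- 1ℚ))) * 0ℚ + (1ℚ * (- 1ℚ) + 1ℚ * 1ℚ) * i ≡ 0ℚ
        l₂ = solve-∀ ringℚ

      ζ : Seq
      ζ = Rotation.rotation ring w w̄ e ww̄e≈1

      w-re : ∀ m T → re (w ⋆ m) T ≡ P (Y T) m
      w-im : ∀ m T → im (w ⋆ m) T ≡ Q (Y T) m
      w-re zero    T = re-1 T
      w-re (suc m) T = trans (re-* w (w ⋆ m) T) (trans (cong₂ (λ p q → 1ℚ * p - Y T * (1ℚ * q)) (w-re m T) (w-im m T)) (l (P (Y T) m) (Q (Y T) m) (Y T)))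
        where
        l : ∀ p q y → 1ℚ * p - y * (1ℚ * q) ≡ p - y * q
        l = solve-∀ ringℚ
      w-im zero    T = im-1 T
      w-im (suc m) T = trans (im-* w (w ⋆ m) T) (trans (cong₂ (λ p q → 1ℚ * q + 1ℚ * p) (w-re m T) (w-im m T)) (l (P (Y T) m) (Q (Y T) m)))
        where
        l : ∀ p q → 1ℚ * q + 1ℚ * p ≡ q + p
        l = solve-∀ ringℚ

      w̄-re : ∀ m T → re (w̄ ⋆ m) T ≡ P (Y T) m
      w̄-im : ∀ m T → im (w̄ ⋆ m) T ≡ - Q (Y T) m
      w̄-re zero    T = re-1 T
      w̄-re (suc m) T = trans (re-* w̄ (w̄ ⋆ m) T) (trans (cong₂ (λ p q → 1ℚ * p - Y T * (- 1ℚ * q)) (w̄-re m T) (w̄-im m T)) (l (P (Y T) m) (Q (Y T) m) (Y T)))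
        where
        l : ∀ p q y → 1ℚ * p - y * (- 1ℚ * - q) ≡ p - y * q
        l = solve-∀ ringℚ
      w̄-im zero    T = im-1 T
      w̄-im (suc m) T = trans (im-* w̄ (w̄ ⋆ m) T) (trans (cong₂ (λ p q → 1ℚ * q + - 1ℚ * p) (w̄-re m T) (w̄-im m T)) (l (P (Y T) m) (Q (Y T) m)))
        where
        l : ∀ p q → 1ℚ * - q + - 1ℚ * p ≡ - (q + p)
        l = solve-∀ ringℚ

      difference : ℕ → Seq
      difference m = imaginary (λ T → 2ℚ * Q (Y T) m) (2ℚ * 4ℚ ^ m) (λ T → ∣∣-* {2ℚ} {Q (Y T) m} {2ℚ} ≤-refl (proj₂ (PQ-bound (Y≥0 T) (Y≤2 T) m)))

      w≈w̄+difference : ∀ m → w ⋆ m ≈ (w̄ ⋆ m) ⊕ difference m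
      w≈w̄+difference m = exact (λ T → trans (w-re m T) (sym (trans (re-+ (w̄ ⋆ m) (difference m) T) (trans (+-identityʳ (re (w̄ ⋆ m) T)) (w̄-re m T)))))
        (λ T → trans (w-im m T) (sym (trans (im-+ (w̄ ⋆ m) (difference m) T) (trans (cong (λ z → z + 2ℚ * Q (Y T) m) (w̄-im m T)) (l (Q (Y T) m))))))
        where
        l : ∀ q → - q + (1ℚ + 1ℚ) * q ≡ q
        l = solve-∀ ringℚ

      c-bound : ∀ m → 0 ℕ.< m → m ℕ.< M → ∀ T → ∣ cot (Y T) m ∣ ≤ 4ℚ ^ m * inv (½ ^ m)
      c-bound m 0<m m<M T = ∣∣-* (proj₁ (PQ-bound (Y≥0 T) (Y≤2 T) m)) (invQ≤ m 0<m m<M T)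

      -- The sequences are bounded only for 0 < m < M, whereas the Fourier part expects functions on
      -- all of ℕ; the default outside is 0.
      guarded : ∀ {m} → (0 ℕ.< m → m ℕ.< M → Seq) → Dec (0 ℕ.< m) → Dec (m ℕ.< M) → Seq
      guarded f (yes p) (yes q) = f p q
      guarded f (yes _) (no _)  = S.0#
      guarded f (no _)  _       = S.0#

      guarded-re : ∀ {m} (f : 0 ℕ.< m → m ℕ.< M → Seq) {g : ℕ → ℚ} → (∀ p q T → re (f p q) T ≡ g T) →
                   ∀ d d′ → 0 ℕ.< m → m ℕ.< M → ∀ T → re (guarded f d d′) T ≡ g T
      guarded-re f eq (yes p) (yes q) _ _ T = eq p q T
      guarded-re f eq (yes _) (no ¬q) _ q T = ⊥-elim (¬q q)
      guarded-re f eq (no ¬p) _       p _ T = ⊥-elim (¬p p)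

      guarded-im : ∀ {m} (f : 0 ℕ.< m → m ℕ.< M → Seq) {g : ℕ → ℚ} → (∀ p q T → im (f p q) T ≡ g T) →
                   ∀ d d′ → 0 ℕ.< m → m ℕ.< M → ∀ T → im (guarded f d d′) T ≡ g T
      guarded-im f eq (yes p) (yes q) _ _ T = eq p q T
      guarded-im f eq (yes _) (no ¬q) _ q T = ⊥-elim (¬q q)
      guarded-im f eq (no ¬p) _       p _ T = ⊥-elim (¬p p)

      c : ℕ → Seq
      c m = guarded (λ p q → real (λ T → cot (Y T) m) _ (c-bound m p q)) (0 ℕ.<? m) (m ℕ.<? M)

      c-re : ∀ m → 0 ℕ.< m → m ℕ.< M → ∀ T → re (c m) T ≡ cot (Y T) m
      c-re m = guarded-re (λ p q → real (λ T → cot (Y T) m) _ (c-bound m p q)) (λ _ _ _ → refl) (0 ℕ.<? m) (m ℕ.<? M)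

      c-im : ∀ m → 0 ℕ.< m → m ℕ.< M → ∀ T → im (c m) T ≡ 0ℚ
      c-im m = guarded-im (λ p q → real (λ T → cot (Y T) m) _ (c-bound m p q)) (λ _ _ _ → refl) (0 ℕ.<? m) (m ℕ.<? M)

      A : ℕ → Seq
      A m = (w ⋆ m) ⊕ (w̄ ⋆ m)

      A-re : ∀ m T → re (A m) T ≡ 2ℚ * P (Y T) m
      A-re m T = trans (re-+ (w ⋆ m) (w̄ ⋆ m) T) (trans (cong₂ _+_ (w-re m T) (w̄-re m T)) (l (P (Y T) m)))
        where
        l : ∀ p → p + p ≡ (1ℚ + 1ℚ) * p
        l = solve-∀ ringℚ

      A-im : ∀ m T → im (A m) T ≡ 0ℚ
      A-im m T = trans (im-+ (w ⋆ m) (w̄ ⋆ m) T) (trans (cong₂ _+_ (w-im m T) (w̄-im m T)) (+-inverseʳ (Q (Y T) m)))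

      c-difference : ∀ m → 0 ℕ.< m → m ℕ.< M → c m ⊗ difference m ≈ I ⊗ ((w ⋆ m) ⊕ (w̄ ⋆ m))
      c-difference m 0<m m<M = exact
        (λ T → trans (re-* (c m) (difference m) T) (trans (cong₂ (λ a b → a * 0ℚ - Y T * (b * (2ℚ * Q (Y T) m))) (c-re m 0<m m<M T) (c-im m 0<m m<M T))
          (trans (l₁ (cot (Y T) m) (Y T) (Q (Y T) m)) (sym (trans (re-* I (A m) T) (trans (cong₂ (λ a b → 0ℚ * a - Y T * (1ℚ * b)) (A-re m T) (A-im m T)) (l₂ (2ℚ * P (Y T) m) (Y T))))))))
        (λ T → trans (im-* (c m) (difference m) T) (trans (cong₂ (λ a b → a * (2ℚ * Q (Y T) m) + b * 0ℚ) (c-re m 0<m m<M T) (c-im m 0<m m<M T))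
          (trans (l₃ (P (Y T) m) (inv (Q (Y T) m)) (Q (Y T) m)) (trans (cong (λ o → 2ℚ * (P (Y T) m * o)) (*-inv⁺ (Q>0 m 0<m m<M T)))
          (sym (trans (im-* I (A m) T) (trans (cong₂ (λ a b → 0ℚ * b + 1ℚ * a) (A-re m T) (A-im m T)) (l₄ (P (Y T) m)))))))))
        where
        l₁ : ∀ c y q → c * 0ℚ - y * (0ℚ * ((1ℚ + 1ℚ) * q)) ≡ 0ℚ
        l₁ = solve-∀ ringℚ
        l₂ : ∀ a y → 0ℚ * a - y * (1ℚ * 0ℚ) ≡ 0ℚ
        l₂ = solve-∀ ringℚ
        l₃ : ∀ p i q → p * i * ((1ℚ + 1ℚ) * q) + 0ℚ * 0ℚ ≡ (1ℚ + 1ℚ) * (p * (q * i))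
        l₃ = solve-∀ ringℚ
        l₄ : ∀ p → 0ℚ * 0ℚ + 1ℚ * ((1ℚ + 1ℚ) * p) ≡ (1ℚ + 1ℚ) * (p * 1ℚ)
        l₄ = solve-∀ ringℚ

      c-eq : ∀ m → 0 ℕ.< m → m ℕ.< M → c m ⊗ ((ζ ⋆ m) S.- S.1#) ≈ I ⊗ ((ζ ⋆ m) ⊕ S.1#)
      c-eq m 0<m m<M = Rotation.rotation-cot ring w w̄ e ww̄e≈1 m {difference m} (w≈w̄+difference m) {c m} {I} (c-difference m 0<m m<M)

      g-bound : ∀ m → 0 ℕ.< m → m ℕ.< M → ∀ T → ∣ - (½ * (inv (Q (Y T) m) * inv (Y T))) ∣ ≤ ½ * (inv (½ ^ m) * inv y₀)
      g-bound m 0<m m<M T = subst (_≤ ½ * (inv (½ ^ m) * inv y₀)) (sym (∣-p∣≡∣p∣ (½ * (inv (Q (Y T) m) * inv (Y T)))))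
        (∣∣-* {½} {inv (Q (Y T) m) * inv (Y T)} {½} ≤-refl (∣∣-* (invQ≤ m 0<m m<M T) (∣∣-nonNeg (inv≥0 (Y>0 T)) (inv-anti 0<y₀ (y₀≤Y T)))))

      -- The inverse of `difference m`, that is of 2Q√-Y. As the square of √-Y is -Y, it equals
      -- -√-Y/(2QY), which is bounded because Y ≥ y₀ > 0 and Q ≥ ½ᵐ.
      g : ℕ → Seq
      g m = guarded (λ p q → imaginary (λ T → - (½ * (inv (Q (Y T) m) * inv (Y T)))) _ (g-bound m p q)) (0 ℕ.<? m) (m ℕ.<? M)

      g-re : ∀ m → 0 ℕ.< m → m ℕ.< M → ∀ T → re (g m) T ≡ 0ℚ
      g-re m = guarded-re (λ p q → imaginary (λ T → - (½ * (inv (Q (Y T) m) * inv (Y T)))) _ (g-bound m p q)) (λ _ _ _ → refl) (0 ℕ.<? m) (m ℕ.<? M)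

      g-im : ∀ m → 0 ℕ.< m → m ℕ.< M → ∀ T → im (g m) T ≡ - (½ * (inv (Q (Y T) m) * inv (Y T)))
      g-im m = guarded-im (λ p q → imaginary (λ T → - (½ * (inv (Q (Y T) m) * inv (Y T)))) _ (g-bound m p q)) (λ _ _ _ → refl) (0 ℕ.<? m) (m ℕ.<? M)

      κ : ℕ → Seq
      κ m = (w̄ ⋆ m) ⊗ g m

      κ-eq : ∀ m → 0 ℕ.< m → m ℕ.< M → κ m ⊗ ((ζ ⋆ m) S.- S.1#) ≈ S.1#
      κ-eq m 0<m m<M = Rotation.rotation-inverse ring w w̄ e ww̄e≈1 m {difference m} (w≈w̄+difference m) {g m} GB≈1
        where
        l₁ : ∀ y q i j → 0ℚ * 0ℚ - y * (- (½ * (i * j)) * ((1ℚ + 1ℚ) * q)) ≡ (q * i) * (y * j)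
        l₁ = solve-∀ ringℚ
        l₂ : ∀ i q → 0ℚ * ((1ℚ + 1ℚ) * q) + i * 0ℚ ≡ 0ℚ
        l₂ = solve-∀ ringℚ
        GB≈1 : g m ⊗ difference m ≈ S.1#
        GB≈1 = exact (λ T → trans (re-* (g m) (difference m) T) (trans (cong₂ (λ a b → a * 0ℚ - Y T * (b * (2ℚ * Q (Y T) m))) (g-re m 0<m m<M T) (g-im m 0<m m<M T))
            (trans (l₁ (Y T) (Q (Y T) m) (inv (Q (Y T) m)) (inv (Y T))) (trans (cong₂ _*_ (*-inv⁺ (Q>0 m 0<m m<M T)) (*-inv⁺ (Y>0 T))) (sym (re-1 T))))))
          (λ T → trans (im-* (g m) (difference m) T) (trans (cong₂ (λ a b → a * (2ℚ * Q (Y T) m) + b * 0ℚ) (g-re m 0<m m<M T) (g-im m 0<m m<M T)) (trans (l₂ (- (½ * (inv (Q (Y T) m) * inv (Y T)))) (Q (Y T) m)) (sym (im-1 T)))))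

      -- The one relation that is not exact at each T: it holds since Q(Y, M) = O(1/T), by the
      -- choice of the approximations.
      ζ^M≈1 : ζ ⋆ M ≈ S.1#
      ζ^M≈1 = Rotation.rotation-period ring w w̄ e ww̄e≈1 M {difference M} (w≈w̄+difference M) small
          where
          small : difference M ≈ S.0#
          small = close-exact (λ T → sym (re-0 T)) , close (2ℚ * K) λ T →
            subst (_≤ 2ℚ * K) (sym (trans (cong (λ x → ι (suc T) * ∣ x ∣) (trans (cong (λ z → 2ℚ * Q (Y T) M - z) (im-0 T)) (+-identityʳ (2ℚ * Q (Y T) M))))
              (trans (cong (ι (suc T) *_) (0≤p⇒∣p∣≡p (*≥0 (+≥0 0≤1 0≤1) (<⇒≤ (Y-good T M 1≤M ℕ.≤-refl))))) (swap (ι (suc T)) 2ℚ (Q (Y T) M)))))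
            (*-monoˡ (+≥0 0≤1 0≤1) (small-Q T))
            where
            swap : ∀ a b c → a * (b * c) ≡ b * (a * c)
            swap = solve-∀ ringℚ

      ∑-re : ∀ N (f : ℕ → Seq) T → re (∑ₛ N f) T ≡ ∑ N (λ i → re (f i) T)
      ∑-re zero    f T = re-0 T
      ∑-re (suc N) f T = trans (re-+ (f 0) (∑ₛ N (λ i → f (suc i))) T) (cong (λ z → re (f 0) T + z) (∑-re N (λ i → f (suc i)) T))

      ν-re : ∀ k T → re (ν k) T ≡ ι k
      ν-re zero    T = trans (re-0 T) (sym fromℤ-0)
      ν-re (suc k) T = trans (trans (re-+ S.1# (ν k) T) (cong₂ _+_ (re-1 T) (ν-re k T))) (sym (ι-suc k))

      ν-im : ∀ k T → im (ν k) T ≡ 0ℚ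
      ν-im zero    T = im-0 T
      ν-im (suc k) T = trans (im-+ S.1# (ν k) T) (cong₂ _+_ (im-1 T) (ν-im k T))

      ν*-re : ∀ k x T → re (ν k ⊗ x) T ≡ ι k * re x T
      ν*-re k x T = trans (re-* (ν k) x T) (trans (cong₂ (λ a b → a * re x T - Y T * (b * im x T)) (ν-re k T) (ν-im k T)) (l (ι k) (re x T) (Y T) (im x T)))
        where
        l : ∀ k a y b → k * a - y * (0ℚ * b) ≡ k * a
        l = solve-∀ ringℚ

      ∑∑-re : ∀ k N L T (f : ℕ → ℕ → Seq) (g : ℕ → ℕ → ℚ) → (∀ i l → l ℕ.< L → re (f i l) T ≡ g i l) →
              re (ν k ⊗ ∑ₛ N (λ i → ∑ₛ L (λ l → f i l))) T ≡ ι k * ∑ N (λ i → ∑ L (λ l → g i l))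
      ∑∑-re k N L T f g eq = trans (ν*-re k (∑ₛ N (λ i → ∑ₛ L (λ l → f i l))) T) (cong (ι k *_)
        (trans (∑-re N (λ i → ∑ₛ L (λ l → f i l)) T) (∑-cong′ N λ i → trans (∑-re L (λ l → f i l) T) (∑-cong L (eq i)))))

    antisymmetric : ∀ m → 0 ℕ.< m → m ℕ.< M → Close (λ T → cot (Y T) m + cot (Y T) (M ∸ m)) (λ _ → 0ℚ)
    antisymmetric m 0<m m<M = close-trans (close-exact λ T → sym (trans (re-+ (c m) (c m′) T) (cong₂ _+_ (c-re m 0<m m<M T) (c-re m′ 0<m′ m′<M T)))) (close-trans (_≈_.re-close vanish) (close-exact re-0))
      where
      m′ = M ∸ m
      0<m′ : 0 ℕ.< m′
      0<m′ = ℕ.m<n⇒0<n∸m m<M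
      m′<M : m′ ℕ.< M
      m′<M = ℕ.∸-monoʳ-< 0<m (ℕ.<⇒≤ m<M)
      vanish : c m ⊕ c m′ ≈ S.0#
      vanish = RootOfUnity.antisymmetry ring n L ζ I c κ ζ^M≈1 c-eq κ-eq m m′ 0<m m<M 0<m′ m′<M (ℕ.m+[n∸m]≡n (ℕ.<⇒≤ m<M))

    balanced : ∀ N (a a⁻¹ b b⁻¹ : ℕ → ℕ) →
      (∀ i → a i ℕ.* a⁻¹ i ≡ 1 mod n) → (∀ i → 0 ℕ.< a⁻¹ i) → (∀ i → a⁻¹ i ℕ.< n) →
      (∀ i → b i ℕ.* b⁻¹ i ≡ 1 mod n) → (∀ i → 0 ℕ.< b⁻¹ i) → (∀ i → b⁻¹ i ℕ.< n) →
      (∀ r → r ℕ.< n → ℕ∑ N (λ i → r ℕ.* a i % n) ≡ ℕ∑ N (λ i → r ℕ.* b i % n)) →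
      Close (λ T → ι M * ∑ N (λ i → ∑ L (λ l → cot (Y T) (l ℕ.* n ℕ.+ a⁻¹ i))))
            (λ T → ι M * ∑ N (λ i → ∑ L (λ l → cot (Y T) (l ℕ.* n ℕ.+ b⁻¹ i))))
    balanced N a a⁻¹ b b⁻¹ a-inv 0<a a<n b-inv 0<b b<n eq = close-trans (close-exact λ T → sym (unfold a⁻¹ 0<a a<n T))
      (close-trans (_≈_.re-close (RootOfUnity.equal-progressions ring n L ζ I c κ ζ^M≈1 c-eq κ-eq N a a⁻¹ b b⁻¹ a-inv 0<a a<n b-inv 0<b b<n eq))
        (close-exact (unfold b⁻¹ 0<b b<n)))
      where
      index< : ∀ m₀ l → m₀ ℕ.< n → l ℕ.< L → l ℕ.* n ℕ.+ m₀ ℕ.< M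
      index< m₀ l m₀<n l<L = ℕ.<-≤-trans (ℕ.+-monoʳ-< (l ℕ.* n) m₀<n) (ℕ.≤-trans (ℕ.≤-reflexive (ℕ.+-comm (l ℕ.* n) n)) (ℕ.≤-trans (ℕ.*-monoˡ-≤ n l<L) (ℕ.≤-reflexive (ℕ.*-comm L n))))
      unfold : ∀ d → (∀ i → 0 ℕ.< d i) → (∀ i → d i ℕ.< n) → ∀ T →
        re (ν M ⊗ ∑ₛ N (λ i → ∑ₛ L (λ l → c (l ℕ.* n ℕ.+ d i)))) T ≡ ι M * ∑ N (λ i → ∑ L (λ l → cot (Y T) (l ℕ.* n ℕ.+ d i)))
      unfold d 0<d d<n T = ∑∑-re M N L T (λ i l → c (l ℕ.* n ℕ.+ d i)) (λ i l → cot (Y T) (l ℕ.* n ℕ.+ d i))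
        (λ i l l<L → c-re (l ℕ.* n ℕ.+ d i) (ℕ.<-≤-trans (0<d i) (ℕ.m≤n+m (d i) (l ℕ.* n))) (index< (d i) l (d<n i) l<L) T)

-- Monotonicity and size of the rational cotangents.

module CotBounds where

  open import Data.Nat.Base as ℕ using (ℕ; zero; suc; s≤s; z≤n)
  import Data.Nat.Properties as ℕ
  open import Data.Rational hiding (NonZero; ≢-nonZero; >-nonZero)
  open import Data.Rational.Properties
  open import Relation.Binary.PropositionalEquality using (_≡_; refl; sym; trans; cong; cong₂; subst; subst₂)
  open import Tactic.RingSolver using (solve-∀)
  open Kit
  open Sawtooth using (2ℚ)
  open Ingham using (½≥0)
  open Root
  open Cotangent using (cot)

  module _ {y : ℚ} {M : ℕ} (0≤y : 0ℚ ≤ y) (good : Good y M) where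

    private
      Q>0 : ∀ m → suc m ℕ.≤ M → 0ℚ < Q y (suc m)
      Q>0 m = good (suc m) (s≤s z≤n)

      Q≥0 : ∀ m → m ℕ.≤ M → 0ℚ ≤ Q y m
      Q≥0 zero    _  = ≤-refl
      Q≥0 (suc m) le = <⇒≤ (Q>0 m le)

      i : ℕ → ℚ
      i m = inv (Q y m)

      -- The next pair is P′ = P - yQ, Q′ = Q + P, so PQ′ - P′Q = P² + yQ², to be divided by QQ′.
      -- Both parts are nonnegative.
      step : ∀ m → suc (suc m) ℕ.≤ M → cot y (suc m) - cot y (suc (suc m))
           ≡ i (suc m) * i (suc (suc m)) * (P y (suc m) * P y (suc m)) + y * (i (suc (suc m)) * Q y (suc m))
      step m le = begin-equality
        p * j - (p - y * q) * j′                             ≡⟨ insert ⟩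
        p * j * ((q + p) * j′) - (p - y * q) * j′ * (q * j)  ≡⟨ lemma p q j j′ y ⟩
        j * j′ * (p * p) + y * (j′ * q) * (q * j) ≡⟨ trans (cong (λ o → j * j′ * (p * p) + y * (j′ * q) * o) qj) (cong (λ z → j * j′ * (p * p) + z) (*-identityʳ (y * (j′ * q)))) ⟩
        j * j′ * (p * p) + y * (j′ * q)                      ∎
        where
        open ≤-Reasoning
        p = P y (suc m) ; q = Q y (suc m) ; j = i (suc m) ; j′ = i (suc (suc m))
        qj : q * j ≡ 1ℚ
        qj = *-inv⁺ (Q>0 m (ℕ.<⇒≤ le))
        qj′ : (q + p) * j′ ≡ 1ℚ
        qj′ = *-inv⁺ (Q>0 (suc m) le)
        lemma : ∀ p q j k y → p * j * ((q + p) * k) - (p - y * q) * k * (q * j) ≡ j * k * (p * p) + y * (k * q) * (q * j)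
        lemma = solve-∀ ringℚ
        insert : p * j - (p - y * q) * j′ ≡ p * j * ((q + p) * j′) - (p - y * q) * j′ * (q * j)
        insert = trans (sym (cong₂ _-_ (*-identityʳ (p * j)) (*-identityʳ ((p - y * q) * j′)))) (cong₂ (λ o o′ → p * j * o - (p - y * q) * j′ * o′) (sym qj′) (sym qj))

    cot-1 : cot y 1 ≡ 1ℚ
    cot-1 = trans (cong₂ (λ a b → a * inv b) (l y) (refl {x = 1ℚ})) (trans (*-identityˡ (inv 1ℚ)) (sym (inv-unique {1ℚ} {1ℚ} 0<1 refl)))
      where
      l : ∀ y → 1ℚ - y * 0ℚ ≡ 1ℚ
      l = solve-∀ ringℚ

    cot-decreasing : ∀ m → suc (suc m) ℕ.≤ M → 0ℚ ≤ cot y (suc m) - cot y (suc (suc m))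
    cot-decreasing m le = subst (0ℚ ≤_) (sym (step m le)) (+≥0 (*≥0 (*≥0 (inv≥0 (Q>0 m (ℕ.<⇒≤ le))) (inv≥0 (Q>0 (suc m) le))) (sq≥0 (P y (suc m))))
      (*≥0 0≤y (*≥0 (inv≥0 (Q>0 (suc m) le)) (<⇒≤ (Q>0 m (ℕ.<⇒≤ le))))))

    cot≤1 : ∀ m → suc m ℕ.≤ M → cot y (suc m) ≤ 1ℚ
    cot≤1 zero    le = ≤-reflexive cot-1
    cot≤1 (suc m) le = ≤-trans (≤-by (cot y (suc m) - cot y (suc (suc m))) (cot-decreasing m le) (l (cot y (suc (suc m))) (cot y (suc m)))) (cot≤1 m (ℕ.<⇒≤ le))
      where
      l : ∀ a b → a + (b - a) ≡ b
      l = solve-∀ ringℚ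

    private
      P≤Q : ∀ m → suc m ℕ.≤ M → P y (suc m) ≤ Q y (suc m)
      P≤Q m le = subst₂ _≤_ (trans (*-assoc (P y (suc m)) (i (suc m)) (Q y (suc m))) (trans (cong (P y (suc m) *_) (trans (*-comm (i (suc m)) (Q y (suc m))) (*-inv⁺ (Q>0 m le)))) (*-identityʳ (P y (suc m))))) (*-identityˡ (Q y (suc m)))
        (*-monoʳ (<⇒≤ (Q>0 m le)) (cot≤1 m le))

      -- The part yQ/Q′ of `step` alone suffices: P ≤ Q gives Q′ = Q + P ≤ 2Q.
      half-step : ∀ m → suc (suc m) ℕ.≤ M → ½ * y ≤ cot y (suc m) - cot y (suc (suc m))
      half-step m le = subst (½ * y ≤_) (sym (step m le)) (≤-by (i (suc m) * i (suc (suc m)) * (P y (suc m) * P y (suc m)) + y * (½ * (j * (q - p))))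
          (+≥0 (*≥0 (*≥0 (inv≥0 (Q>0 m (ℕ.<⇒≤ le))) (inv≥0 (Q>0 (suc m) le))) (sq≥0 p)) (*≥0 0≤y (*≥0 ½≥0 (*≥0 (inv≥0 (Q>0 (suc m) le)) (diff (P≤Q m (ℕ.<⇒≤ le)))))))
          (trans (cong (λ o → o + (X + y * (½ * (j * (q - p))))) (trans (sym (*-identityʳ (½ * y))) (cong (½ * y *_) (sym qj)))) (lemma y q p j X)))
        where
        p = P y (suc m) ; q = Q y (suc m) ; j = i (suc (suc m))
        X = i (suc m) * i (suc (suc m)) * (P y (suc m) * P y (suc m))
        qj : (q + p) * j ≡ 1ℚ
        qj = *-inv⁺ (Q>0 (suc m) le)
        lemma : ∀ y q p j x → ½ * y * ((q + p) * j) + (x + y * (½ * (j * (q - p)))) ≡ x + y * (j * q)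
        lemma = solve-∀ ringℚ

      cot≤ : ∀ k → suc k ℕ.≤ M → cot y (suc k) ≤ 1ℚ - ι k * (½ * y)
      cot≤ zero    le = ≤-reflexive (trans cot-1 (sym (trans (cong (λ z → 1ℚ - z * (½ * y)) fromℤ-0) (trans (cong (λ z → 1ℚ - z) (*-zeroˡ (½ * y))) refl))))
      cot≤ (suc k) le = ≤-trans (≤-by (cot y (suc k) - cot y (suc (suc k)) - ½ * y) (diff (half-step k le)) (l₁ (cot y (suc (suc k))) (cot y (suc k)) (½ * y)))
        (≤-trans (+-monoˡ-≤ (- (½ * y)) (cot≤ k (ℕ.<⇒≤ le))) (≤-reflexive (trans (l₂ (ι k) (½ * y)) (cong (λ z → 1ℚ - z * (½ * y)) (sym (ι-suc k))))))
        where
        l₁ : ∀ a b h → a + (b - a - h) ≡ b - h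
        l₁ = solve-∀ ringℚ
        l₂ : ∀ k h → 1ℚ - k * h - h ≡ 1ℚ - (1ℚ + k) * h
        l₂ = solve-∀ ringℚ

    -- Starting from 1, the cotangent loses at least y/2 at each of k steps, and it ends no lower
    -- than -1, because Q + P is positive there. This is weaker than the true order 1/M² of y, but M
    -- may be taken as large as desired.
    root-small : ∀ k → M ≡ suc (suc k) → ι k * y ≤ 2ℚ + 2ℚ
    root-small k refl = ≤-by (2ℚ * (1ℚ - ι k * (½ * y) - cot y (suc k)) + 2ℚ * (1ℚ + cot y (suc k)))
        (+≥0 (*≥0 (+≥0 0≤1 0≤1) (diff (cot≤ k (ℕ.n≤1+n (suc k))))) (*≥0 (+≥0 0≤1 0≤1) cot≥-1)) (lemma (ι k) y (cot y (suc k)))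
      where
      lemma : ∀ k y c → k * y + ((1ℚ + 1ℚ) * (1ℚ - k * (½ * y) - c) + (1ℚ + 1ℚ) * (1ℚ + c)) ≡ (1ℚ + 1ℚ) + (1ℚ + 1ℚ)
      lemma = solve-∀ ringℚ
      cot≥-1 : 0ℚ ≤ 1ℚ + cot y (suc k)
      cot≥-1 = subst (0ℚ ≤_) (trans (*-distribʳ-+ (i (suc k)) (Q y (suc k)) (P y (suc k))) (cong (_+ cot y (suc k)) (*-inv⁺ (Q>0 k (ℕ.n≤1+n (suc k))))))
        (*≥0 (<⇒≤ (Q>0 (suc k) ℕ.≤-refl)) (inv≥0 (Q>0 k (ℕ.n≤1+n (suc k)))))

    private
      -- 1/m exceeds the cotangent by Δ/(mQ). By `Δ-step` it grows by (1 + m)yQ, which is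
      -- nonnegative, and at most x²y in the range of small angles.
      Δ : ℕ → ℚ
      Δ m = Q y m - ι m * P y m

      Δ-step : ∀ m → Δ (suc m) ≡ Δ m + (1ℚ + ι m) * (y * Q y m)
      Δ-step m = trans (cong (λ z → Q y m + P y m - z * (P y m - y * Q y m)) (ι-suc m)) (lemma (Q y m) (P y m) (ι m) y)
        where
        lemma : ∀ q p m y → q + p - (1ℚ + m) * (p - y * q) ≡ q - m * p + (1ℚ + m) * (y * q)
        lemma = solve-∀ ringℚ

      Δ-0 : Δ 0 ≡ 0ℚ
      Δ-0 = trans (cong (λ z → 0ℚ - z * 1ℚ) fromℤ-0) refl

      Δ≥0 : ∀ m → m ℕ.≤ M → 0ℚ ≤ Δ m
      Δ≥0 zero    le = ≤-reflexive (sym Δ-0)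
      Δ≥0 (suc m) le = subst (0ℚ ≤_) (sym (Δ-step m)) (+≥0 (Δ≥0 m (ℕ.<⇒≤ le)) (*≥0 (+≥0 0≤1 (ι≥0 m)) (*≥0 0≤y (Q≥0 m (ℕ.<⇒≤ le)))))

      gap : ∀ m → suc m ℕ.≤ M → inv (ι (suc m)) - cot y (suc m) ≡ inv (ι (suc m)) * i (suc m) * Δ (suc m)
      gap m le = begin-equality
        I - p * j                        ≡⟨ insert ⟩
        I * (q * j) - p * j * (μ * I)    ≡⟨ lemma I q j p μ ⟩
        I * j * (q - μ * p)              ∎
        where
        open ≤-Reasoning
        I = inv (ι (suc m)) ; p = P y (suc m) ; q = Q y (suc m) ; j = i (suc m) ; μ = ι (suc m)
        qj : q * j ≡ 1ℚ
        qj = *-inv⁺ (Q>0 m le)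
        mI : μ * I ≡ 1ℚ
        mI = *-inv⁺ (ι>0 m)
        lemma : ∀ I q j p μ → I * (q * j) - p * j * (μ * I) ≡ I * j * (q - μ * p)
        lemma = solve-∀ ringℚ
        insert : I - p * j ≡ I * (q * j) - p * j * (μ * I)
        insert = trans (sym (cong₂ _-_ (*-identityʳ I) (*-identityʳ (p * j)))) (cong₂ (λ o o′ → I * o - p * j * o′) (sym qj) (sym mI))

    cot≤inv : ∀ m → suc m ℕ.≤ M → 0ℚ ≤ inv (ι (suc m)) - cot y (suc m)
    cot≤inv m le = subst (0ℚ ≤_) (sym (gap m le)) (*≥0 (*≥0 (inv≥0 (ι>0 m)) (inv≥0 (Q>0 m le))) (Δ≥0 (suc m) le))

    module _ (x : ℕ) (x≤M : x ℕ.≤ M) (small : ι x * (ι x * y) ≤ 1ℚ) where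

      cot≥0 : ∀ m → suc m ℕ.≤ x → 0ℚ ≤ cot y (suc m)
      cot≥0 m le = *≥0 (initial-P≥0 x 0≤y small (suc m) le) (inv≥0 (Q>0 m (ℕ.≤-trans le x≤M)))

      private
        Δ≤ : ∀ m → m ℕ.≤ x → Δ m ≤ ι m * (ι x * (ι x * y))
        Δ≤ zero    le = ≤-reflexive (trans Δ-0 (sym (trans (cong (_* (ι x * (ι x * y))) fromℤ-0) (*-zeroˡ (ι x * (ι x * y))))))
        Δ≤ (suc m) le = begin
          Δ (suc m)                                             ≡⟨ Δ-step m ⟩
          Δ m + (1ℚ + ι m) * (y * Q y m) ≤⟨ +-mono-≤ (Δ≤ m (ℕ.<⇒≤ le)) (*-mono (+≥0 0≤1 (ι≥0 m)) (subst (_≤ ι x) (ι-suc m) (ι-mono le)) (*≥0 0≤y (Initial.Q≥0 init))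
                                                                     (≤-trans (*-monoˡ 0≤y (≤-trans (Initial.Q≤m init) (ι-mono (ℕ.<⇒≤ le)))) (≤-reflexive (*-comm y (ι x))))) ⟩
          ι m * (ι x * (ι x * y)) + ι x * (ι x * y) ≡⟨ trans (l (ι m) (ι x * (ι x * y))) (cong (_* (ι x * (ι x * y))) (sym (ι-suc m))) ⟩
          ι (suc m) * (ι x * (ι x * y))                         ∎
          where
          open ≤-Reasoning
          init = initial x 0≤y small m (ℕ.<⇒≤ le)
          l : ∀ m z → m * z + z ≡ (1ℚ + m) * z
          l = solve-∀ ringℚ

      inv-cot : ∀ m → suc m ℕ.≤ x → inv (ι (suc m)) - cot y (suc m) ≤ ι x * (ι x * y)
      inv-cot m le = subst (_≤ X) (sym (gap m (ℕ.≤-trans le x≤M))) (begin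
        I * j * Δ (suc m)          ≤⟨ *-monoˡ (*≥0 I≥0 j≥0) (Δ≤ (suc m) le) ⟩
        I * j * (ι (suc m) * X)    ≤⟨ *-monoʳ (*≥0 (ι≥0 (suc m)) X≥0) (subst (I * j ≤_) (*-identityʳ I) (*-monoˡ I≥0 j≤1)) ⟩
        I * (ι (suc m) * X) ≡⟨ trans (sym (*-assoc I (ι (suc m)) X)) (trans (cong (_* X) (trans (*-comm I (ι (suc m))) (*-inv⁺ (ι>0 m)))) (*-identityˡ X)) ⟩
        X                          ∎)
        where
        open ≤-Reasoning
        X = ι x * (ι x * y)
        I = inv (ι (suc m)) ; j = i (suc m)
        I≥0 = inv≥0 (ι>0 m)
        j≥0 = inv≥0 (Q>0 m (ℕ.≤-trans le x≤M))
        X≥0 : 0ℚ ≤ X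
        X≥0 = *≥0 (ι≥0 x) (*≥0 (ι≥0 x) 0≤y)
        j≤1 : j ≤ 1ℚ
        j≤1 = ≤-trans (inv-anti 0<1 (initial-Q≥1 x 0≤y small m le)) (≤-reflexive (sym (inv-unique {1ℚ} {1ℚ} 0<1 refl)))

-- From cotangent sums to the series of h(m)/m.

module HarmonicMean where

  open import Data.Empty using (⊥-elim)
  open import Data.Nat.Base as ℕ using (ℕ; zero; suc; s≤s; z≤n; NonZero; _%_; _/_; _∸_)
  open import Data.Nat.Divisibility using (_∣_; divides; m%n≡0⇒n∣m)
  open import Data.Nat.DivMod using (m%n<n; m%n≤n; m≡m%n+[m/n]*n; m<n⇒m%n≡m; [m+kn]%n≡m%n; n%n≡0; m*n%n≡0)
  import Data.Nat.Properties as ℕ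
  import Data.Nat.Tactic.RingSolver as ℕR
  open import Data.Product using (∃; _×_; _,_; proj₁; proj₂)
  open import Data.Rational hiding (NonZero; ≢-nonZero; >-nonZero; _/_)
  open import Data.Rational.Properties
  open import Data.Sum using (inj₁; inj₂)
  open import Relation.Binary.PropositionalEquality using (_≡_; refl; sym; trans; cong; cong₂; subst)
  open import Relation.Nullary using (Dec; yes; no)
  open import Tactic.RingSolver using (solve-∀)
  open Kit
  open Sums using (ℕ∑)
  open Mod
  open Sawtooth using (2ℚ)
  open Mean using (∑-kill)
  open Root
  open SeqRing using (Close)
  open Cotangent
  open CotBounds

  ∑-telescope : ∀ N (g : ℕ → ℚ) → ∑ N (λ i → g i - g (suc i)) ≡ g 0 - g N
  ∑-telescope zero    g = sym (+-inverseʳ (g 0))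
  ∑-telescope (suc N) g = trans (cong (λ z → g 0 - g 1 + z) (∑-telescope N (λ i → g (suc i)))) (lemma (g 0) (g 1) (g (suc N)))
    where
    lemma : ∀ a b c → a - b + (b - c) ≡ a - c
    lemma = solve-∀ ringℚ

  -- For a given x only finitely many O(1/T) relations are used, so one rate, and then one T, serves
  -- them all.
  uniform : ∀ K (F : ℕ → ℕ → ℚ) → (∀ j → j ℕ.< K → ∃ λ C → ∀ T → F j T ≤ C) →
            ∃ λ D → 0ℚ ≤ D × (∀ j → j ℕ.< K → ∀ T → F j T ≤ D)
  uniform zero    F bounded = 0ℚ , ≤-refl , λ j ()
  uniform (suc K) F bounded with uniform K F (λ j j<K → bounded j (ℕ.m<n⇒m<1+n j<K)) | bounded K ℕ.≤-refl
  ... | D , 0≤D , D≥ | C , C≥ = D + ∣ C ∣ , +≥0 0≤D (0≤∣p∣ C) , all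
    where
    all : ∀ j → j ℕ.< suc K → ∀ T → F j T ≤ D + ∣ C ∣
    all j (s≤s j≤K) T with ℕ.m≤n⇒m<n∨m≡n j≤K
    ... | inj₁ j<K  = ≤-trans (D≥ j j<K T) (≤-by ∣ C ∣ (0≤∣p∣ C) refl)
    ... | inj₂ refl = ≤-trans (≤-trans (C≥ T) (x≤∣x∣ C)) (≤-by D 0≤D (+-comm ∣ C ∣ D))

  module _ (n : ℕ) {{_ : NonZero n}} where

    ∑-residue : ∀ L α (f : ℕ → ℚ) → α ℕ.< n → ∑ (n ℕ.* L) (λ m → ⟦ m % n ℕ.≟ α ⟧ * f m) ≡ ∑ L (λ l → f (l ℕ.* n ℕ.+ α))
    ∑-residue L α f α<n = begin-equality
      ∑ (n ℕ.* L) F                                   ≡⟨ cong (λ M → ∑ M F) (ℕ.*-comm n L) ⟩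
      ∑ (L ℕ.* n) F                                   ≡⟨ ∑-blocks L n F ⟩
      ∑ L (λ l → ∑ n (λ r → F (l ℕ.* n ℕ.+ r)))       ≡⟨ ∑-cong′ L (λ l → trans
          (∑-δ n α α<n λ r r<n r≢α → ∑-kill (f (l ℕ.* n ℕ.+ r)) (⟦⟧-no ((l ℕ.* n ℕ.+ r) % n ℕ.≟ α) λ e → r≢α (trans (sym (reduce l r r<n)) e)))
          (trans (cong (_* f (l ℕ.* n ℕ.+ α)) (⟦⟧-yes ((l ℕ.* n ℕ.+ α) % n ℕ.≟ α) (reduce l α α<n))) (*-identityˡ (f (l ℕ.* n ℕ.+ α))))) ⟩
      ∑ L (λ l → f (l ℕ.* n ℕ.+ α))                   ∎
      where
      open ≤-Reasoning
      F : ℕ → ℚ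
      F m = ⟦ m % n ℕ.≟ α ⟧ * f m
      reduce : ∀ l r → r ℕ.< n → (l ℕ.* n ℕ.+ r) % n ≡ r
      reduce l r r<n = trans (cong (_% n) (ℕ.+-comm (l ℕ.* n) r)) (trans ([m+kn]%n≡m%n r l n) (m<n⇒m%n≡m r<n))

    complement⇒ : ∀ m {α} → 0 ℕ.< α → α ℕ.< n → (m ℕ.+ α) % n ≡ 0 → m % n ≡ n ∸ α
    complement⇒ m {α} 0<α α<n eq = go (m%n≡0⇒n∣m (m % n ℕ.+ α) n (trans (+-mod n {c = α} (%-mod n m) refl) eq))
      where
      go : n ∣ m % n ℕ.+ α → m % n ≡ n ∸ α
      go (divides zero e) = ⊥-elim (ℕ.<-irrefl (sym (ℕ.m+n≡0⇒n≡0 (m % n) e)) 0<α)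
      go (divides 1 e) = trans (sym (ℕ.m+n∸n≡m (m % n) α)) (cong (_∸ α) (trans e (ℕ.*-identityˡ n)))
      go (divides (suc (suc k)) e) = ⊥-elim (ℕ.<-irrefl e (ℕ.<-≤-trans (ℕ.+-mono-< (m%n<n m n) α<n) (ℕ.+-monoʳ-≤ n (ℕ.m≤m+n n (k ℕ.* n)))))

    complement⇐ : ∀ m {α} → 0 ℕ.< α → α ℕ.< n → m % n ≡ n ∸ α → (m ℕ.+ α) % n ≡ 0
    complement⇐ m {α} 0<α α<n eq = trans (sym (+-mod n {c = α} (%-mod n m) refl)) (trans (cong (λ z → (z ℕ.+ α) % n) eq) (trans (cong (_% n) (ℕ.m∸n+n≡m (ℕ.<⇒≤ α<n))) (n%n≡0 n)))

    -- (-a)(-α) = aα, with n - 1 for -1 and n - α for -α. Adding c = (n - 1)aα completes both sides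
    -- to multiples of n.
    negated-inverse : ∀ a α → α ℕ.≤ n → a ℕ.* α ≡ 1 mod n → (n ∸ 1) ℕ.* a ℕ.* (n ∸ α) ≡ 1 mod n
    negated-inverse a α α≤n aα≡1 = begin
      X % n                                  ≡⟨ sym ([m+kn]%n≡m%n X c n) ⟩
      (X ℕ.+ c ℕ.* n) % n                    ≡⟨ cong (λ k → (X ℕ.+ c ℕ.* k) % n) (sym n≡) ⟩
      (X ℕ.+ c ℕ.* suc n′) % n               ≡⟨ cong (_% n) (trans (cong (X ℕ.+_) (ℕ.*-suc c n′)) (sym (ℕ.+-assoc X c (c ℕ.* n′)))) ⟩
      (X ℕ.+ c ℕ.+ c ℕ.* n′) % n             ≡⟨ +-mod n {c = c ℕ.* n′} (trans X+c (sym aα+c)) refl ⟩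
      (a ℕ.* α ℕ.+ c ℕ.+ c ℕ.* n′) % n ≡⟨ cong (_% n) (trans (ℕ.+-assoc (a ℕ.* α) c (c ℕ.* n′)) (cong (a ℕ.* α ℕ.+_) (trans (sym (ℕ.*-suc c n′)) (cong (c ℕ.*_) n≡)))) ⟩
      (a ℕ.* α ℕ.+ c ℕ.* n) % n              ≡⟨ [m+kn]%n≡m%n (a ℕ.* α) c n ⟩
      (a ℕ.* α) % n                          ≡⟨ aα≡1 ⟩
      1 % n                                  ∎
      where
      open Relation.Binary.PropositionalEquality.≡-Reasoning
      n′ = n ∸ 1
      n≡ : suc n′ ≡ n
      n≡ = ℕ.m+[n∸m]≡n (ℕ.>-nonZero⁻¹ n)
      X = n′ ℕ.* a ℕ.* (n ∸ α)
      c = n′ ℕ.* a ℕ.* α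
      X+c : (X ℕ.+ c) % n ≡ 0
      X+c = trans (cong (_% n) (trans (sym (ℕ.*-distribˡ-+ (n′ ℕ.* a) (n ∸ α) α)) (cong (n′ ℕ.* a ℕ.*_) (ℕ.m∸n+n≡m α≤n)))) (m*n%n≡0 (n′ ℕ.* a) n)
      aα+c : (a ℕ.* α ℕ.+ c) % n ≡ 0
      aα+c = trans (cong (_% n) (trans (shape a α n′) (cong (a ℕ.* α ℕ.*_) n≡))) (m*n%n≡0 (a ℕ.* α) n)
        where
        shape : ∀ a α k → a ℕ.* α ℕ.+ k ℕ.* a ℕ.* α ≡ a ℕ.* α ℕ.* (1 ℕ.+ k)
        shape = ℕR.solve-∀

  module Odd (n : ℕ) {{_ : NonZero n}} (N : ℕ) (α : ℕ → ℕ) (0<α : ∀ i → 0 ℕ.< α i) (α<n : ∀ i → α i ℕ.< n) where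

    -- The class of -αᵢ is tested by n ∣ m + αᵢ; this form makes oddness a matter of sums, without
    -- truncated subtraction.
    h : ℕ → ℚ
    h m = ∑ N (λ i → ⟦ m % n ℕ.≟ α i ⟧ - ⟦ (m ℕ.+ α i) % n ℕ.≟ 0 ⟧)

    h≤ : ∀ m → ∣ h m ∣ ≤ ι N
    h≤ m = subst (∣ h m ∣ ≤_) (trans (∑-const N 1ℚ) (*-identityʳ (ι N))) (∑-abs N λ i _ → unit (m % n ℕ.≟ α i) ((m ℕ.+ α i) % n ℕ.≟ 0))
      where
      unit : ∀ {A B : Set} (d : Dec A) (e : Dec B) → ∣ ⟦ d ⟧ - ⟦ e ⟧ ∣ ≤ 1ℚ
      unit (yes _) (yes _) = 0≤1
      unit (yes _) (no _)  = ≤-refl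
      unit (no _)  (yes _) = ≤-refl
      unit (no _)  (no _)  = 0≤1

    h-cong : ∀ {m m′} → m ≡ m′ mod n → h m ≡ h m′
    h-cong {m} {m′} eq = ∑-cong′ N λ i → cong₂ _-_
      (⟦⟧-cong (m % n ℕ.≟ α i) (m′ % n ℕ.≟ α i) (trans (sym eq)) (trans eq))
      (⟦⟧-cong ((m ℕ.+ α i) % n ℕ.≟ 0) ((m′ ℕ.+ α i) % n ℕ.≟ 0) (trans (sym (+-mod n {c = α i} eq refl))) (trans (+-mod n {c = α i} eq refl)))

    h-complement : ∀ m → h m ≡ ∑ N (λ i → ⟦ m % n ℕ.≟ α i ⟧ - ⟦ m % n ℕ.≟ n ∸ α i ⟧)
    h-complement m = ∑-cong′ N λ i → cong (λ z → ⟦ m % n ℕ.≟ α i ⟧ - z)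
      (⟦⟧-cong ((m ℕ.+ α i) % n ℕ.≟ 0) (m % n ℕ.≟ n ∸ α i) (complement⇒ n m (0<α i) (α<n i)) (complement⇐ n m (0<α i) (α<n i)))

    h-0 : h 0 ≡ 0ℚ
    h-0 = ∑-zero N λ i _ → trans (cong₂ _-_ (⟦⟧-no (0 % n ℕ.≟ α i) λ e → ℕ.<-irrefl (trans (sym (m<n⇒m%n≡m (ℕ.>-nonZero⁻¹ n))) e) (0<α i))
      (⟦⟧-no (α i % n ℕ.≟ 0) λ e → ℕ.<-irrefl (trans (sym e) (m<n⇒m%n≡m (α<n i))) (0<α i))) refl

    h-odd : ∀ m m′ → (m ℕ.+ m′) % n ≡ 0 → h m′ ≡ - h m
    h-odd m m′ m+m′≡0 = trans (∑-cong′ N λ i → trans (cong₂ _-_ (swap₁ i) (swap₂ i)) (flip ⟦ (m ℕ.+ α i) % n ℕ.≟ 0 ⟧ ⟦ m % n ℕ.≟ α i ⟧))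
      (∑-neg N λ i → ⟦ m % n ℕ.≟ α i ⟧ - ⟦ (m ℕ.+ α i) % n ℕ.≟ 0 ⟧)
      where
      zeroed : ∀ {z} → z % n ≡ 0 → z ≡ 0 mod n
      zeroed e = trans e (sym (m<n⇒m%n≡m (ℕ.>-nonZero⁻¹ n)))
      flip : ∀ a b → a - b ≡ - (b - a)
      flip = solve-∀ ringℚ
      swap₁ : ∀ i → ⟦ m′ % n ℕ.≟ α i ⟧ ≡ ⟦ (m ℕ.+ α i) % n ℕ.≟ 0 ⟧
      swap₁ i = ⟦⟧-cong (m′ % n ℕ.≟ α i) ((m ℕ.+ α i) % n ℕ.≟ 0) to from
        where
        to : m′ % n ≡ α i → (m ℕ.+ α i) % n ≡ 0
        to e = trans (cong (λ z → (m ℕ.+ z) % n) (sym e)) (trans (+-mod n {m} refl (%-mod n m′)) m+m′≡0)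
        from : (m ℕ.+ α i) % n ≡ 0 → m′ % n ≡ α i
        from e = trans (sym (trans (+-mod n {m ℕ.+ α i} {0} {m′} (zeroed e) refl) refl)) (trans (cong (_% n) (shape m (α i) m′)) (trans (+-mod n {m ℕ.+ m′} {0} {α i} (zeroed m+m′≡0) refl) (m<n⇒m%n≡m (α<n i))))
          where
          shape : ∀ m a m′ → m ℕ.+ a ℕ.+ m′ ≡ m ℕ.+ m′ ℕ.+ a
          shape = ℕR.solve-∀
      swap₂ : ∀ i → ⟦ (m′ ℕ.+ α i) % n ℕ.≟ 0 ⟧ ≡ ⟦ m % n ℕ.≟ α i ⟧
      swap₂ i = ⟦⟧-cong ((m′ ℕ.+ α i) % n ℕ.≟ 0) (m % n ℕ.≟ α i) to from
        where
        from : m % n ≡ α i → (m′ ℕ.+ α i) % n ≡ 0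
        from e = trans (cong (λ z → (m′ ℕ.+ z) % n) (sym e)) (trans (+-mod n {m′} refl (%-mod n m)) (trans (cong (_% n) (ℕ.+-comm m′ m)) m+m′≡0))
        to : (m′ ℕ.+ α i) % n ≡ 0 → m % n ≡ α i
        to e = trans (sym (trans (+-mod n {m′ ℕ.+ α i} {0} {m} (zeroed e) refl) refl)) (trans (cong (_% n) (shape m (α i) m′)) (trans (+-mod n {m ℕ.+ m′} {0} {α i} (zeroed m+m′≡0) refl) (m<n⇒m%n≡m (α<n i))))
          where
          shape : ∀ m a m′ → m′ ℕ.+ a ℕ.+ m ≡ m ℕ.+ m′ ℕ.+ a
          shape = ℕR.solve-∀

    Cs : ℚ
    Cs = ι n * ι N

    Cs≥0 : 0ℚ ≤ Cs
    Cs≥0 = *≥0 (ι≥0 n) (ι≥0 N)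

    private
      period-sum : ∑ n h ≡ 0ℚ
      period-sum = trans (∑-cong′ n h-complement) (trans (∑-swap n N _) (∑-zero N λ i _ → trans (∑-- n (λ m → ⟦ m % n ℕ.≟ α i ⟧) (λ m → ⟦ m % n ℕ.≟ n ∸ α i ⟧))
        (trans (cong₂ _-_ (one (α i) (α<n i)) (one (n ∸ α i) (ℕ.∸-monoʳ-< (0<α i) (ℕ.<⇒≤ (α<n i))))) refl)))
        where
        one : ∀ β → β ℕ.< n → ∑ n (λ m → ⟦ m % n ℕ.≟ β ⟧) ≡ 1ℚ
        one β β<n = trans (∑-δ n β β<n λ m m<n m≢β → ⟦⟧-no (m % n ℕ.≟ β) λ e → m≢β (trans (sym (m<n⇒m%n≡m m<n)) e)) (⟦⟧-yes (β % n ℕ.≟ β) (m<n⇒m%n≡m β<n))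

    -- Over a full period αᵢ and -αᵢ are met once each and cancel. What is left is a part of one
    -- period, with values at most N.
    partial-sums : ∀ x → ∣ ∑ x h ∣ ≤ Cs
    partial-sums x = subst (λ z → ∣ z ∣ ≤ Cs) (sym reduce) (≤-trans (∑-abs (x % n) λ j _ → h≤ (q ℕ.* n ℕ.+ j))
        (≤-trans (≤-reflexive (∑-const (x % n) (ι N))) (*-monoʳ (ι≥0 N) (ι-mono (m%n≤n x n)))))
      where
      q = x / n
      block : ∀ l → ∑ n (λ r → h (l ℕ.* n ℕ.+ r)) ≡ 0ℚ
      block l = trans (∑-cong′ n λ r → h-cong {l ℕ.* n ℕ.+ r} {r} (trans (cong (_% n) (ℕ.+-comm (l ℕ.* n) r)) ([m+kn]%n≡m%n r l n))) period-sum
      reduce : ∑ x h ≡ ∑ (x % n) (λ j → h (q ℕ.* n ℕ.+ j))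
      reduce = trans (cong (λ z → ∑ z h) (trans (m≡m%n+[m/n]*n x n) (ℕ.+-comm (x % n) (q ℕ.* n)))) (trans (∑-split (q ℕ.* n) (x % n) h)
        (trans (cong (_+ ∑ (x % n) (λ j → h (q ℕ.* n ℕ.+ j))) (trans (∑-blocks q n h) (∑-zero q λ l _ → block l))) (+-identityˡ (∑ (x % n) (λ j → h (q ℕ.* n ℕ.+ j))))))

    module Estimate (L x : ℕ) (y ε : ℚ) (0≤y : 0ℚ ≤ y) (good : Good y (n ℕ.* L)) (x<M : 2 ℕ.* suc x ℕ.< n ℕ.* L)
      (small : ι (suc x) * (ι (suc x) * y) ≤ 1ℚ) (0≤ε : 0ℚ ≤ ε)
      (anti : ∀ j → j ℕ.< suc x → ∣ cot y (suc j) + cot y (n ℕ.* L ∸ suc j) ∣ ≤ ε)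
      (total : ∣ ∑ (n ℕ.* L) (λ m → h m * cot y m) ∣ ≤ ε) where

      private
        M = n ℕ.* L
        c : ℕ → ℚ
        c = cot y
        f : ℕ → ℚ
        f m = h m * c m
        x₁ = suc x
        R′ = M ∸ (2 ℕ.* x₁)
        R = suc R′
        size : suc x ℕ.+ (R ℕ.+ x) ≡ M
        size = trans (shape x R′) (ℕ.m+[n∸m]≡n (ℕ.<⇒≤ x<M))
          where
          shape : ∀ x r → suc x ℕ.+ (suc r ℕ.+ x) ≡ 2 ℕ.* suc x ℕ.+ r
          shape = ℕR.solve-∀
        x₁≤M : x₁ ℕ.≤ M
        x₁≤M = ℕ.≤-trans (ℕ.m≤n*m x₁ 2) (ℕ.<⇒≤ x<M)
        U V Err S₂ : ℚ
        U = ∑ x (λ j → h (suc j) * c (suc j))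
        Err = ∑ x (λ j → h (suc j) * (c (suc j) + c (M ∸ suc j)))
        S₂ = ∑ R (λ j → f (suc x ℕ.+ j))
        V = ∑ x (λ j → h (suc j) * inv (ι (suc j)))

        M∸ : ∀ j → j ℕ.< x → suc x ℕ.+ (R ℕ.+ (x ∸ suc j)) ≡ M ∸ suc j
        M∸ j j<x = sym (trans (cong (_∸ suc j) (sym size)) (trans (cong (λ z → suc x ℕ.+ (R ℕ.+ z) ∸ suc j) (sym (ℕ.m∸n+n≡m j<x)))
          (trans (cong (_∸ suc j) (shape (suc x) R (x ∸ suc j) (suc j))) (ℕ.m+n∸n≡m (suc x ℕ.+ (R ℕ.+ (x ∸ suc j))) (suc j)))))
          where
          shape : ∀ a r b k → a ℕ.+ (r ℕ.+ (b ℕ.+ k)) ≡ a ℕ.+ (r ℕ.+ b) ℕ.+ k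
          shape = ℕR.solve-∀

        <M : ∀ j → j ℕ.< suc x → suc j ℕ.≤ M
        <M j j<x = ℕ.≤-trans j<x x₁≤M

        -- The last x indices are the reflections of 1, ..., x. Both h and the cotangent change sign
        -- under m ↦ M - m, the latter up to an error, so this part repeats `U` instead of
        -- cancelling it.
        S₃ : ∑ x (λ j → f (suc x ℕ.+ (R ℕ.+ j))) ≡ U - Err
        S₃ = begin-equality
          ∑ x (λ j → f (suc x ℕ.+ (R ℕ.+ j))) ≡⟨ ∑-permute x _ (λ j → x ∸ suc j) (λ j → x ∸ suc j) rev< rev< rev-rev rev-rev ⟩
          ∑ x (λ j → f (suc x ℕ.+ (R ℕ.+ (x ∸ suc j)))) ≡⟨ ∑-cong x (λ j j<x → trans (cong f (M∸ j j<x)) (trans (cong (_* c (M ∸ suc j)) (h-odd (suc j) (M ∸ suc j) (trans (cong (_% n) (ℕ.m+[n∸m]≡n (<M j (ℕ.m<n⇒m<1+n j<x)))) (trans (cong (_% n) (ℕ.*-comm n L)) (m*n%n≡0 L n))))) (split (h (suc j)) (c (suc j)) (c (M ∸ suc j))))) ⟩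
          ∑ x (λ j → h (suc j) * c (suc j) - h (suc j) * (c (suc j) + c (M ∸ suc j))) ≡⟨ ∑-- x _ _ ⟩
          U - Err                                                      ∎
          where
          open ≤-Reasoning
          split : ∀ h c d → - h * d ≡ h * c - h * (c + d)
          split = solve-∀ ringℚ
          rev< : ∀ j → j ℕ.< x → x ∸ suc j ℕ.< x
          rev< j j<x = ℕ.∸-monoʳ-< (s≤s z≤n) j<x
          rev-rev : ∀ j → j ℕ.< x → x ∸ suc (x ∸ suc j) ≡ j
          rev-rev j j<x = trans (cong (x ∸_) (sym (ℕ.+-∸-assoc 1 j<x))) (ℕ.m∸[m∸n]≡n (ℕ.<⇒≤ j<x))

        decompose : ∑ M f ≡ U + (S₂ + (U - Err))
        decompose = trans (cong (λ z → ∑ z f) (sym size)) (trans (∑-split (suc x) (R ℕ.+ x) f) (cong₂ _+_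
          (trans (cong (_+ U) (∑-kill (c 0) h-0)) (+-identityˡ U))
          (trans (∑-split R x (λ i → f (suc x ℕ.+ i))) (cong (λ z → S₂ + z) S₃))))

        g₀ = c (suc x)
        g₀≥0 : 0ℚ ≤ g₀
        g₀≥0 = cot≥0 0≤y good x₁ x₁≤M small x ℕ.≤-refl
        g₀≤ : g₀ ≤ inv (ι x₁)
        g₀≤ = ≤-by (inv (ι x₁) - g₀) (cot≤inv 0≤y good x x₁≤M) (l g₀ (inv (ι x₁)))
          where
          l : ∀ a b → a + (b - a) ≡ b
          l = solve-∀ ringℚ

        -- Summation by parts: the cotangent decreases from g₀ to about -g₀ over the middle range,
        -- so its variation telescopes. Since g₀ ≤ 1/(x + 1), this part is O(1/x).
        S₂≤ : ∣ S₂ ∣ ≤ (Cs + Cs) * (2ℚ * g₀ + g₀ + 2ℚ * ε)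
        S₂≤ = ≤-trans (abel-bound R′ (λ j → h (suc x ℕ.+ j)) g (λ i → g i - g (suc i)) (Cs + Cs) (+≥0 Cs≥0 Cs≥0) shifted decreasing)
          (*-monoˡ (+≥0 Cs≥0 Cs≥0) (subst (λ z → ∣ g R′ ∣ + z ≤ 2ℚ * g₀ + g₀ + 2ℚ * ε) (sym (∑-telescope R′ g))
            (≤-trans (+-monoʳ-≤ ∣ g R′ ∣ (+-monoʳ-≤ (g 0) (-x≤∣x∣ (g R′)))) (≤-trans (≤-reflexive (cong (λ z → ∣ g R′ ∣ + (z + ∣ g R′ ∣)) g0≡))
              (≤-trans (+-mono-≤ gR≤ (+-monoʳ-≤ g₀ gR≤)) (≤-reflexive (l g₀ ε)))))))
          where
          g : ℕ → ℚ
          g j = c (suc x ℕ.+ j)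
          g0≡ : g 0 ≡ g₀
          g0≡ = cong c (ℕ.+-identityʳ (suc x))
          l : ∀ g e → (g + e) + (g + (g + e)) ≡ (1ℚ + 1ℚ) * g + g + (1ℚ + 1ℚ) * e
          l = solve-∀ ringℚ
          shifted : ∀ i → ∣ ∑ i (λ j → h (suc x ℕ.+ j)) ∣ ≤ Cs + Cs
          shifted i = subst (λ z → ∣ z ∣ ≤ Cs + Cs) (trans (cong (_- ∑ (suc x) h) (∑-split (suc x) i h)) (l′ (∑ (suc x) h) (∑ i (λ j → h (suc x ℕ.+ j))))) (∣∣-- (partial-sums (suc x ℕ.+ i)) (partial-sums (suc x)))
            where
            l′ : ∀ a b → a + b - a ≡ b
            l′ = solve-∀ ringℚ
          decreasing : ∀ i → i ℕ.< R′ → ∣ g i - g (suc i) ∣ ≤ g i - g (suc i)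
          decreasing i i<R′ = ≤-reflexive (0≤p⇒∣p∣≡p (subst (λ z → 0ℚ ≤ g i - c z) (sym (ℕ.+-suc (suc x) i)) (cot-decreasing 0≤y good (x ℕ.+ i)
            (ℕ.≤-trans (s≤s (s≤s (ℕ.+-monoʳ-≤ x (ℕ.<⇒≤ i<R′)))) (ℕ.≤-trans (ℕ.m≤m+n (suc (suc (x ℕ.+ R′))) x) (ℕ.≤-reflexive (trans (shape x R′) size)))))))
            where
            shape : ∀ x r → suc (suc (x ℕ.+ r)) ℕ.+ x ≡ suc x ℕ.+ (suc r ℕ.+ x)
            shape = ℕR.solve-∀
          gR : g R′ ≡ c (M ∸ suc x)
          gR = cong c (sym (trans (cong (_∸ suc x) (trans (sym size) (shape x R′))) (ℕ.m+n∸n≡m (suc x ℕ.+ R′) (suc x))))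
            where
            shape : ∀ x r → suc x ℕ.+ (suc r ℕ.+ x) ≡ suc x ℕ.+ r ℕ.+ suc x
            shape = ℕR.solve-∀
          gR≤ : ∣ g R′ ∣ ≤ g₀ + ε
          gR≤ = subst (λ z → ∣ z ∣ ≤ g₀ + ε) (trans (cancel g₀ (c (M ∸ suc x))) (sym gR))
            (≤-trans (∣∣-- (anti x ℕ.≤-refl) (∣∣-nonNeg g₀≥0 ≤-refl)) (≤-reflexive (+-comm ε g₀)))
            where
            cancel : ∀ a b → a + b - a ≡ b
            cancel = solve-∀ ringℚ

        Err≤ : ∣ Err ∣ ≤ ι x * (ι N * ε)
        Err≤ = ≤-trans (∑-abs x λ j j<x → ∣∣-* (h≤ (suc j)) (anti j (ℕ.m<n⇒m<1+n j<x))) (≤-reflexive (∑-const x (ι N * ε)))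

        2U : 2ℚ * U ≡ ∑ M f - S₂ + Err
        2U = sym (trans (cong (λ z → z - S₂ + Err) decompose) (l U S₂ Err))
          where
          l : ∀ u s e → u + (s + (u - e)) - s + e ≡ (1ℚ + 1ℚ) * u
          l = solve-∀ ringℚ

        U≤ : ∣ U ∣ ≤ ε + (Cs + Cs) * (2ℚ * g₀ + g₀ + 2ℚ * ε) + ι x * (ι N * ε)
        U≤ = ≤-trans (subst (∣ U ∣ ≤_) (sym (trans (∣p*q∣≡∣p∣*∣q∣ 2ℚ U) (two ∣ U ∣))) (≤-by ∣ U ∣ (0≤∣p∣ U) refl))
          (subst (λ z → ∣ z ∣ ≤ ε + (Cs + Cs) * (2ℚ * g₀ + g₀ + 2ℚ * ε) + ι x * (ι N * ε)) (sym 2U) (∣∣-+ (∣∣-- total S₂≤) Err≤))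
          where
          two : ∀ x → (1ℚ + 1ℚ) * x ≡ x + x
          two = solve-∀ ringℚ

        X : ℚ
        X = ι x₁ * (ι x₁ * y)

        -- Replacing each cotangent by 1/m costs at most `X` per term.
        V≤ : ∣ V ∣ ≤ ∣ U ∣ + ι x * (ι N * X)
        V≤ = subst (λ z → ∣ z ∣ ≤ ∣ U ∣ + ι x * (ι N * X)) V≡ (∣∣-+ {U} ≤-refl (≤-trans (∑-abs x λ j j<x → ∣∣-* (h≤ (suc j))
              (∣∣-nonNeg (cot≤inv 0≤y good j (<M j (ℕ.m<n⇒m<1+n j<x))) (inv-cot 0≤y good x₁ x₁≤M small j (ℕ.m<n⇒m<1+n j<x)))) (≤-reflexive (∑-const x (ι N * X)))))
          where
          V≡ : U + ∑ x (λ j → h (suc j) * (inv (ι (suc j)) - c (suc j))) ≡ V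
          V≡ = trans (sym (∑-+ x (λ j → h (suc j) * c (suc j)) (λ j → h (suc j) * (inv (ι (suc j)) - c (suc j))))) (∑-cong′ x λ j → l (h (suc j)) (c (suc j)) (inv (ι (suc j))))
            where
            l : ∀ h c i → h * c + h * (i - c) ≡ h * i
            l = solve-∀ ringℚ

      G : ℚ
      G = ι x + (2ℚ + 2ℚ) * Cs * ι x + ι x * (ι x * ι N)

      -- `G` gathers all the coefficients of ε, and x²X controls the passage from the cotangent to
      -- 1/m. The remaining main term is the middle range, 6·Cs·xg₀ with xg₀ ≤ 1.
      estimate : ε * G ≤ 1ℚ → ι x * (ι x * X) ≤ 1ℚ → ι x * ∣ V ∣ ≤ 1ℚ + (2ℚ * 2ℚ + 2ℚ) * Cs + ι N
      estimate εG≤1 xX≤1 = begin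
        ι x * ∣ V ∣                                            ≤⟨ *-monoˡ (ι≥0 x) (≤-trans V≤ (+-monoˡ-≤ (ι x * (ι N * X)) U≤)) ⟩
        ι x * (ε + (Cs + Cs) * (2ℚ * g₀ + g₀ + 2ℚ * ε) + ι x * (ι N * ε) + ι x * (ι N * X)) ≡⟨ collect (ι x) ε Cs g₀ (ι N) X ⟩
        ε * G + (2ℚ * 2ℚ + 2ℚ) * Cs * (ι x * g₀) + ι N * (ι x * (ι x * X)) ≤⟨ +-mono-≤ (+-mono-≤ εG≤1 (*-monoˡ 6Cs≥0 xg≤1)) (*-monoˡ (ι≥0 N) xX≤1) ⟩
        1ℚ + (2ℚ * 2ℚ + 2ℚ) * Cs * 1ℚ + ι N * 1ℚ ≡⟨ cong₂ (λ a b → 1ℚ + a + b) (*-identityʳ ((2ℚ * 2ℚ + 2ℚ) * Cs)) (*-identityʳ (ι N)) ⟩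
        1ℚ + (2ℚ * 2ℚ + 2ℚ) * Cs + ι N                         ∎
        where
        open ≤-Reasoning
        6Cs≥0 : 0ℚ ≤ (2ℚ * 2ℚ + 2ℚ) * Cs
        6Cs≥0 = *≥0 (nonNegative⁻¹ (2ℚ * 2ℚ + 2ℚ)) Cs≥0
        xg≤1 : ι x * g₀ ≤ 1ℚ
        xg≤1 = ≤-trans (*-mono (ι≥0 x) (ι-mono (ℕ.n≤1+n x)) g₀≥0 g₀≤) (≤-reflexive (*-inv⁺ (ι>0 x)))
        collect : ∀ x e c g n X → x * (e + (c + c) * ((1ℚ + 1ℚ) * g + g + (1ℚ + 1ℚ) * e) + x * (n * e) + x * (n * X))
          ≡ e * (x + ((1ℚ + 1ℚ) + (1ℚ + 1ℚ)) * c * x + x * (x * n)) + ((1ℚ + 1ℚ) * (1ℚ + 1ℚ) + (1ℚ + 1ℚ)) * c * (x * g) + n * (x * (x * X))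
        collect = solve-∀ ringℚ

  -- Σ h(m)/m over m ≤ x is O(1/x) for the odd function h, if h annihilates the sawtooth.
  module Balanced (n : ℕ) {{_ : NonZero n}} (N : ℕ) (a α : ℕ → ℕ) (0<α : ∀ i → 0 ℕ.< α i) (α<n : ∀ i → α i ℕ.< n)
    (inverse : ∀ i → a i ℕ.* α i ≡ 1 mod n)
    (balance : ∀ r → r ℕ.< n → ℕ∑ N (λ i → r ℕ.* a i % n) ≡ ℕ∑ N (λ i → r ℕ.* ((n ∸ 1) ℕ.* a i) % n)) where

    open Odd n N α 0<α α<n

    bound : ℚ
    bound = 1ℚ + (2ℚ * 2ℚ + 2ℚ) * Cs + ι N

    -- L and the approximation to the root are chosen anew for each x, but `bound` depends on n and
    -- N only.
    mean-bound : ∀ x → ι x * ∣ ∑ x (λ m → h (suc m) * inv (ι (suc m))) ∣ ≤ bound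
    mean-bound x = Estimate.estimate L x y ε 0≤y good x<M small 0≤ε anti total εG≤1 xX≤1
      where
      x₁ = suc x
      -- By `root-small`, (M - 2)y ≤ 4; with q = 4x₁⁴ ≤ M - 2 this becomes x₁⁴y ≤ 1. The extra 4x₁
      -- in L provides the room for q ≤ M - 2 and for 2x₁ < M.
      q = 4 ℕ.* (x₁ ℕ.* (x₁ ℕ.* (x₁ ℕ.* x₁)))
      L = q ℕ.+ (4 ℕ.* x₁)
      M = n ℕ.* L
      instance
        L≢0 : NonZero L
        L≢0 = ℕ.>-nonZero (ℕ.<-≤-trans (s≤s z≤n) (ℕ.m≤n+m (4 ℕ.* x₁) q))
      4≤L : 4 ℕ.≤ L
      4≤L = ℕ.≤-trans (ℕ.m≤m*n 4 x₁) (ℕ.m≤n+m (4 ℕ.* x₁) q)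
      L≤M : L ℕ.≤ M
      L≤M = ℕ.m≤n*m L n
      4≤M : 4 ℕ.≤ M
      4≤M = ℕ.≤-trans 4≤L L≤M
      x<M : 2 ℕ.* suc x ℕ.< M
      x<M = ℕ.<-≤-trans (ℕ.*-monoˡ-< x₁ {2} {4} (s≤s (s≤s (s≤s z≤n)))) (ℕ.≤-trans (ℕ.m≤n+m (4 ℕ.* x₁) q) L≤M)
      module A (T : ℕ) = Approximation (approximation M T 4≤M)
      0<M² : 0ℚ < ι M * ι M
      0<M² = *>0 0<M 0<M
        where
        0<M : 0ℚ < ι M
        0<M = <-≤-trans 0<1 (subst (_≤ ι M) fromℤ-1 (ι-mono (ℕ.≤-trans (s≤s z≤n) 4≤M)))
      open Approximate n L (ℕ.≤-trans (s≤s z≤n) 4≤M) (λ T → A.y T) (inv (ι M * ι M)) _ (inv>0 0<M²) (λ T → A.y≥ T) (λ T → A.y≤1 T) (λ T → A.good T) (λ T → A.small T)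
      β : ℕ → ℕ
      β i = n ∸ α i
      balance-close : Close (λ T → ι M * ∑ N (λ i → ∑ L (λ l → cot (A.y T) (l ℕ.* n ℕ.+ α i)))) (λ T → ι M * ∑ N (λ i → ∑ L (λ l → cot (A.y T) (l ℕ.* n ℕ.+ β i))))
      balance-close = balanced N a α (λ i → (n ∸ 1) ℕ.* a i) β inverse 0<α α<n (λ i → negated-inverse n (a i) (α i) (ℕ.<⇒≤ (α<n i)) (inverse i))
        (λ i → ℕ.m<n⇒0<n∸m (α<n i)) (λ i → ℕ.∸-monoʳ-< (0<α i) (ℕ.<⇒≤ (α<n i))) balance
      sum≡ : ∀ y → ∑ M (λ m → h m * cot y m) ≡ ∑ N (λ i → ∑ L (λ l → cot y (l ℕ.* n ℕ.+ α i))) - ∑ N (λ i → ∑ L (λ l → cot y (l ℕ.* n ℕ.+ β i)))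
      sum≡ y = begin-equality
        ∑ M (λ m → h m * cot y m)
          ≡⟨ ∑-cong′ M (λ m → trans (cong (_* cot y m) (h-complement m)) (trans (∑-*ʳ N (cot y m) _) (∑-cong′ N λ i → dist ⟦ m % n ℕ.≟ α i ⟧ ⟦ m % n ℕ.≟ β i ⟧ (cot y m)))) ⟩
        ∑ M (λ m → ∑ N (λ i → ⟦ m % n ℕ.≟ α i ⟧ * cot y m - ⟦ m % n ℕ.≟ β i ⟧ * cot y m))
          ≡⟨ ∑-swap M N (λ m i → ⟦ m % n ℕ.≟ α i ⟧ * cot y m - ⟦ m % n ℕ.≟ β i ⟧ * cot y m) ⟩
        ∑ N (λ i → ∑ M (λ m → ⟦ m % n ℕ.≟ α i ⟧ * cot y m - ⟦ m % n ℕ.≟ β i ⟧ * cot y m))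
          ≡⟨ ∑-cong′ N (λ i → trans (∑-- M (λ m → ⟦ m % n ℕ.≟ α i ⟧ * cot y m) (λ m → ⟦ m % n ℕ.≟ β i ⟧ * cot y m)) (cong₂ _-_ (∑-residue n L (α i) (cot y) (α<n i)) (∑-residue n L (β i) (cot y) (ℕ.∸-monoʳ-< (0<α i) (ℕ.<⇒≤ (α<n i)))))) ⟩
        ∑ N (λ i → ∑ L (λ l → cot y (l ℕ.* n ℕ.+ α i)) - ∑ L (λ l → cot y (l ℕ.* n ℕ.+ β i)))
          ≡⟨ ∑-- N _ _ ⟩
        ∑ N (λ i → ∑ L (λ l → cot y (l ℕ.* n ℕ.+ α i))) - ∑ N (λ i → ∑ L (λ l → cot y (l ℕ.* n ℕ.+ β i))) ∎
        where
        open ≤-Reasoning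
        dist : ∀ a b c → (a - b) * c ≡ a * c - b * c
        dist = solve-∀ ringℚ
      F : ℕ → ℕ → ℚ
      F zero    T = ι (suc T) * ∣ ∑ M (λ m → h m * cot (A.y T) m) ∣
      F (suc j) T = ι (suc T) * ∣ cot (A.y T) (suc j) + cot (A.y T) (M ∸ suc j) ∣
      rates : ∃ λ D → 0ℚ ≤ D × (∀ j → j ℕ.< suc (suc x) → ∀ T → F j T ≤ D)
      rates = uniform (suc (suc x)) F each
        where
        each : ∀ j → j ℕ.< suc (suc x) → ∃ λ C → ∀ T → F j T ≤ C
        each zero _ = Close.rate balance-close , λ T → ≤-trans (*-monoˡ (ι≥0 (suc T)) (bigger T)) (Close.close≤ balance-close T)
          where
          factor : ∀ m a b → m * a - m * b ≡ m * (a - b)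
          factor = solve-∀ ringℚ
          bigger : ∀ T → ∣ ∑ M (λ m → h m * cot (A.y T) m) ∣ ≤ ∣ ι M * ∑ N (λ i → ∑ L (λ l → cot (A.y T) (l ℕ.* n ℕ.+ α i))) - ι M * ∑ N (λ i → ∑ L (λ l → cot (A.y T) (l ℕ.* n ℕ.+ β i))) ∣
          bigger T = subst (λ z → ∣ S ∣ ≤ ∣ z ∣) (sym (trans (factor (ι M) Sα Sβ) (cong (ι M *_) (sym (sum≡ (A.y T))))))
            (subst (∣ S ∣ ≤_) (sym (∣p*q∣≡∣p∣*∣q∣ (ι M) S)) (subst (_≤ ∣ ι M ∣ * ∣ S ∣) (*-identityˡ ∣ S ∣) (*-monoʳ (0≤∣p∣ S) (≤-trans (subst (_≤ ι M) fromℤ-1 (ι-mono (ℕ.≤-trans (s≤s z≤n) 4≤M))) (x≤∣x∣ (ι M))))))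
            where
            S = ∑ M (λ m → h m * cot (A.y T) m)
            Sα = ∑ N (λ i → ∑ L (λ l → cot (A.y T) (l ℕ.* n ℕ.+ α i)))
            Sβ = ∑ N (λ i → ∑ L (λ l → cot (A.y T) (l ℕ.* n ℕ.+ β i)))
        each (suc j) (s≤s j<) = Close.rate close-j , λ T → subst (λ z → ι (suc T) * ∣ z ∣ ≤ Close.rate close-j) (+-identityʳ (cot (A.y T) (suc j) + cot (A.y T) (M ∸ suc j))) (Close.close≤ close-j T)
          where
          close-j = antisymmetric (suc j) (s≤s z≤n) (ℕ.≤-<-trans j< (ℕ.≤-<-trans (ℕ.m≤n*m x₁ 2) x<M))
      D = proj₁ rates
      G : ℚ
      G = ι x + (2ℚ + 2ℚ) * Cs * ι x + ι x * (ι x * ι N)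
      -- Chosen last: D and G depend on x but not on T, so ε = D/(T + 1) can be brought below 1/G.
      T = proj₁ (archimedean (D * G))
      y = A.y T
      good = A.good T
      0≤y : 0ℚ ≤ y
      0≤y = ≤-trans (inv≥0 0<M²) (A.y≥ T)
      ε : ℚ
      ε = D * inv (ι (suc T))
      0≤ε : 0ℚ ≤ ε
      0≤ε = *≥0 (proj₁ (proj₂ rates)) (inv≥0 (ι>0 T))
      anti : ∀ j → j ℕ.< suc x → ∣ cot y (suc j) + cot y (M ∸ suc j) ∣ ≤ ε
      anti j j< = ≤-inv (ι>0 T) (proj₂ (proj₂ rates) (suc j) (s≤s j<) T)
      total : ∣ ∑ M (λ m → h m * cot y m) ∣ ≤ ε
      total = ≤-inv (ι>0 T) (proj₂ (proj₂ rates) 0 (s≤s z≤n) T)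
      εG≤1 : ε * G ≤ 1ℚ
      εG≤1 = subst (_≤ 1ℚ) (swap D G (inv (ι (suc T)))) (subst (D * G * inv (ι (suc T)) ≤_) (*-inv⁺ (ι>0 T)) (*-monoʳ (inv≥0 (ι>0 T)) (≤-trans (proj₂ (archimedean (D * G))) (ι-mono (ℕ.n≤1+n T)))))
        where
        swap : ∀ a b c → a * b * c ≡ a * c * b
        swap = solve-∀ ringℚ
      x⁴y≤1 : ι x₁ * (ι x₁ * (ι x₁ * (ι x₁ * y))) ≤ 1ℚ
      x⁴y≤1 = *-cancelˡ-≤ (positive⁻¹ (2ℚ + 2ℚ)) (≤-trans (≤-reflexive (sym qy)) (≤-trans (*-monoʳ 0≤y (ι-mono q≤k)) (≤-trans (root-small 0≤y good k M≡) (≤-reflexive (sym (*-identityʳ (2ℚ + 2ℚ)))))))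
        where
        k = M ∸ 2
        M≡ : M ≡ suc (suc k)
        M≡ = sym (ℕ.m+[n∸m]≡n (ℕ.≤-trans (s≤s (s≤s z≤n)) 4≤M))
        q≤k : q ℕ.≤ k
        q≤k = ℕ.≤-trans (ℕ.≤-reflexive (sym (ℕ.m+n∸n≡m q 2))) (ℕ.∸-monoˡ-≤ 2 (ℕ.≤-trans (ℕ.+-monoʳ-≤ q (ℕ.≤-trans (s≤s (s≤s z≤n)) (ℕ.m≤m*n 4 x₁))) L≤M))
        four : 2ℚ + 2ℚ ≡ ι 4
        four = sym (trans (ι-+ 2 2) (cong₂ _+_ two two))
          where
          two : ι 2 ≡ 2ℚ
          two = trans (ι-suc 1) (cong (λ z → 1ℚ + z) fromℤ-1)
        qy : ι q * y ≡ (2ℚ + 2ℚ) * (ι x₁ * (ι x₁ * (ι x₁ * (ι x₁ * y))))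
        qy = trans (cong (_* y) (trans (ι-* 4 (x₁ ℕ.* (x₁ ℕ.* (x₁ ℕ.* x₁)))) (cong₂ _*_ (sym four) (trans (ι-* x₁ (x₁ ℕ.* (x₁ ℕ.* x₁))) (cong (ι x₁ *_) (trans (ι-* x₁ (x₁ ℕ.* x₁)) (cong (ι x₁ *_) (ι-* x₁ x₁)))))))) (l (2ℚ + 2ℚ) (ι x₁) y)
          where
          l : ∀ f x y → f * (x * (x * (x * x))) * y ≡ f * (x * (x * (x * (x * y))))
          l = solve-∀ ringℚ
      x₁²y≥0 : 0ℚ ≤ ι x₁ * (ι x₁ * y)
      x₁²y≥0 = *≥0 (ι≥0 x₁) (*≥0 (ι≥0 x₁) 0≤y)
      small : ι x₁ * (ι x₁ * y) ≤ 1ℚ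
      small = ≤-trans (≤-trans (shrink x₁²y≥0) (*-monoˡ (ι≥0 x₁) (shrink x₁²y≥0))) x⁴y≤1
        where
        shrink : ∀ {z} → 0ℚ ≤ z → z ≤ ι x₁ * z
        shrink {z} 0≤z = subst (_≤ ι x₁ * z) (*-identityˡ z) (*-monoʳ 0≤z (ι≥1 x))
      xX≤1 : ι x * (ι x * (ι x₁ * (ι x₁ * y))) ≤ 1ℚ
      xX≤1 = ≤-trans (*-mono (ι≥0 x) x≤x₁ (*≥0 (ι≥0 x) x₁²y≥0) (*-monoʳ x₁²y≥0 x≤x₁)) x⁴y≤1
        where
        x≤x₁ : ι x ≤ ι x₁
        x≤x₁ = ι-mono (ℕ.n≤1+n x)

-- The function h of a balanced family of units vanishes.

module OddVanish where

  open import Data.Nat.Base as ℕ using (ℕ; zero; suc; NonZero; _%_; _∸_)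
  open import Data.Nat.Coprimality using (Coprime; coprime?)
  open import Data.Nat.DivMod using (m%n<n; m<n⇒m%n≡m)
  import Data.Nat.Divisibility
  import Data.Nat.Properties as ℕ
  import Data.Nat.Tactic.RingSolver as ℕR
  open import Data.Product using (_,_; proj₁; proj₂)
  open import Data.Rational hiding (NonZero; ≢-nonZero; >-nonZero; _/_)
  open import Data.Rational.Properties
  open import Relation.Binary.PropositionalEquality using (_≡_; refl; sym; trans; cong; cong₂; subst; module ≡-Reasoning)
  open import Relation.Nullary using (Dec; yes; no; ¬_)
  open Kit
  open Sums using (ℕ∑)
  open Mod
  open Sawtooth using (2ℚ)
  open HarmonicMean
  open Vanish

  module UnitFamily (n : ℕ) {{_ : NonZero n}} (1<n : 1 ℕ.< n) (N : ℕ) (a α : ℕ → ℕ)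
    (0<α : ∀ i → 0 ℕ.< α i) (α<n : ∀ i → α i ℕ.< n) (inverse : ∀ i → a i ℕ.* α i ≡ 1 mod n)
    (balance : ∀ r → ℕ∑ N (λ i → r ℕ.* a i % n) ≡ ℕ∑ N (λ i → r ℕ.* ((n ∸ 1) ℕ.* a i) % n)) where

    open Odd n N α 0<α α<n public using (h; h-cong; Cs; Cs≥0)
    open Balanced n N a α 0<α α<n inverse (λ r _ → balance r) using (bound)

    private
      0%n : 0 % n ≡ 0
      0%n = m<n⇒m%n≡m (ℕ.>-nonZero⁻¹ n)

      scaled-zero : ∀ c {z} → z % n ≡ 0 → (c ℕ.* z) % n ≡ 0
      scaled-zero c {z} e = trans (*-mod n {c} {c} {z} {0} refl (trans e (sym 0%n))) (trans (cong (_% n) (ℕ.*-zeroʳ c)) 0%n)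

      cancelled : ∀ {k k′} m → k ℕ.* k′ ≡ 1 mod n → k ℕ.* (k′ ℕ.* m) ≡ m mod n
      cancelled {k} {k′} m kk′ = trans (cong (_% n) (sym (ℕ.*-assoc k k′ m))) (trans (*-mod n {c = m} kk′ refl) (cong (_% n) (ℕ.*-identityˡ m)))

      support : ∀ m → ¬ Coprime m n → h m ≡ 0ℚ
      support m ¬cop = ∑-zero N λ i _ → trans (cong₂ _-_
        (⟦⟧-no (m % n ℕ.≟ α i) λ e → ¬cop (invertible⇒coprime n {m} {a i} (trans (cong (_% n) (ℕ.*-comm m (a i)))
          (trans (*-mod n {a i} {a i} {m} {α i} refl (trans e (sym (m<n⇒m%n≡m (α<n i))))) (inverse i)))))
        (⟦⟧-no ((m ℕ.+ α i) % n ℕ.≟ 0) λ e → ¬cop (invertible⇒coprime n {m} {(n ∸ 1) ℕ.* a i} (trans (cong (_% n) (ℕ.*-comm m ((n ∸ 1) ℕ.* a i)))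
          (trans (*-mod n {(n ∸ 1) ℕ.* a i} {(n ∸ 1) ℕ.* a i} {m} {n ∸ α i} refl (trans (complement⇒ n m (0<α i) (α<n i) e) (sym (m<n⇒m%n≡m (ℕ.∸-monoʳ-< (0<α i) (ℕ.<⇒≤ (α<n i)))))))
            (negated-inverse n (a i) (α i) (ℕ.<⇒≤ (α<n i)) (inverse i))))))) refl

      module Scaled (k k′ : ℕ) (kk′ : k ℕ.* k′ ≡ 1 mod n) where

        k′k : k′ ℕ.* k ≡ 1 mod n
        k′k = trans (cong (_% n) (ℕ.*-comm k′ k)) kk′

        a′ α′ : ℕ → ℕ
        a′ i = k ℕ.* a i
        α′ i = k′ ℕ.* α i % n

        α′<n : ∀ i → α′ i ℕ.< n
        α′<n i = m%n<n (k′ ℕ.* α i) n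

        kα′ : ∀ i → k ℕ.* α′ i ≡ α i mod n
        kα′ i = trans (*-mod n {k} refl (%-mod n (k′ ℕ.* α i))) (cancelled {k} {k′} (α i) kk′)

        0<α′ : ∀ i → 0 ℕ.< α′ i
        0<α′ i = ℕ.n≢0⇒n>0 λ e → ℕ.<-irrefl (sym (trans (sym (m<n⇒m%n≡m (α<n i))) (trans (sym (kα′ i)) (trans (cong (λ z → (k ℕ.* z) % n) e) (scaled-zero k 0%n))))) (0<α i)

        inverse′ : ∀ i → a′ i ℕ.* α′ i ≡ 1 mod n
        inverse′ i = begin
          (k ℕ.* a i ℕ.* α′ i) % n     ≡⟨ cong (_% n) (shape k (a i) (α′ i)) ⟩
          (a i ℕ.* (k ℕ.* α′ i)) % n   ≡⟨ *-mod n {a i} refl (kα′ i) ⟩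
          (a i ℕ.* α i) % n            ≡⟨ inverse i ⟩
          1 % n                        ∎
          where
          open ≡-Reasoning
          shape : ∀ k a b → k ℕ.* a ℕ.* b ≡ a ℕ.* (k ℕ.* b)
          shape = ℕR.solve-∀

        balance′ : ∀ r → ℕ∑ N (λ i → r ℕ.* a′ i % n) ≡ ℕ∑ N (λ i → r ℕ.* ((n ∸ 1) ℕ.* a′ i) % n)
        balance′ r = trans (ℕ∑-cong N λ i → cong (_% n) (sym (ℕ.*-assoc r k (a i))))
          (trans (balance (r ℕ.* k)) (ℕ∑-cong N λ i → cong (_% n) (shape r k (n ∸ 1) (a i))))
          where
          shape : ∀ r k m a → r ℕ.* k ℕ.* (m ℕ.* a) ≡ r ℕ.* (m ℕ.* (k ℕ.* a))
          shape = ℕR.solve-∀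
          ℕ∑-cong : ∀ N {f g : ℕ → ℕ} → (∀ i → f i ≡ g i) → ℕ∑ N f ≡ ℕ∑ N g
          ℕ∑-cong zero    e = refl
          ℕ∑-cong (suc N) e = cong₂ ℕ._+_ (e 0) (ℕ∑-cong N λ i → e (suc i))

        open Odd n N α′ 0<α′ α′<n public using (partial-sums) renaming (h to h′)
        open Balanced n N a′ α′ 0<α′ α′<n inverse′ (λ r _ → balance′ r) public using (mean-bound)

        -- Dilating by a unit k replaces the family αᵢ by αᵢ/k, and aᵢ by k aᵢ, which is again
        -- balanced. The bounds at k = 1 thus hold for every unit, with constants that depend on n
        -- and N only.
        h-scaled : ∀ m → h (k ℕ.* m) ≡ h′ m
        h-scaled m = ∑-cong′ N λ i → cong₂ _-_
          (⟦⟧-cong ((k ℕ.* m) % n ℕ.≟ α i) (m % n ℕ.≟ α′ i)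
            (λ e → trans (sym (cancelled {k′} {k} m k′k)) (*-mod n {k′} {k′} {k ℕ.* m} {α i} refl (trans e (sym (m<n⇒m%n≡m (α<n i))))))
            (λ e → trans (*-mod n {k} {k} {m} {α′ i} refl (trans e (sym (m<n⇒m%n≡m (α′<n i))))) (trans (kα′ i) (m<n⇒m%n≡m (α<n i)))))
          (⟦⟧-cong ((k ℕ.* m ℕ.+ α i) % n ℕ.≟ 0) ((m ℕ.+ α′ i) % n ℕ.≟ 0)
            (λ e → trans (+-mod n {m} {k′ ℕ.* (k ℕ.* m)} (sym (cancelled {k′} {k} m k′k)) (%-mod n (k′ ℕ.* α i)))
              (trans (cong (_% n) (sym (ℕ.*-distribˡ-+ k′ (k ℕ.* m) (α i)))) (scaled-zero k′ e)))
            (λ e → trans (+-mod n {k ℕ.* m} refl (sym (kα′ i))) (trans (cong (_% n) (sym (ℕ.*-distribˡ-+ k m (α′ i)))) (scaled-zero k e))))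

      bound≥0 : 0ℚ ≤ bound
      bound≥0 = +≥0 (+≥0 0≤1 (*≥0 (nonNegative⁻¹ (2ℚ * 2ℚ + 2ℚ)) Cs≥0)) (ι≥0 N)

      C : ℚ
      C = Cs + bound

      Cs≤C : Cs ≤ C
      Cs≤C = ≤-by bound bound≥0 refl

      bound≤C : bound ≤ C
      bound≤C = ≤-by Cs Cs≥0 (+-comm bound Cs)

      0≤C : 0ℚ ≤ C
      0≤C = +≥0 Cs≥0 bound≥0

      degenerate : ∀ k → ¬ Coprime k n → ∀ m → h (k ℕ.* m) ≡ 0ℚ
      degenerate k ¬cop m = support (k ℕ.* m) λ cop → ¬cop λ { (d∣k , d∣n) → cop (Data.Nat.Divisibility.∣m⇒∣m*n m d∣k , d∣n) }

      partial : ∀ k i → ∣ ∑ i (λ m → h (k ℕ.* m)) ∣ ≤ C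
      partial k i = go (coprime? k n)
        where
        go : Dec (Coprime k n) → ∣ ∑ i (λ m → h (k ℕ.* m)) ∣ ≤ C
        go (no ¬cop) = subst (λ z → ∣ z ∣ ≤ C) (sym (∑-zero i λ m _ → degenerate k ¬cop m)) 0≤C
        go (yes cop) = subst (λ z → ∣ z ∣ ≤ C) (sym (∑-cong′ i S.h-scaled)) (≤-trans (S.partial-sums i) Cs≤C)
          where
          invertible = coprime⇒invertible n cop
          module S = Scaled k (proj₁ invertible) (proj₂ invertible)

      mean : ∀ k x → ι x * ∣ ∑ x (λ m → h (k ℕ.* suc m) * inv (ι (suc m))) ∣ ≤ C
      mean k x = go (coprime? k n)
        where
        go : Dec (Coprime k n) → ι x * ∣ ∑ x (λ m → h (k ℕ.* suc m) * inv (ι (suc m))) ∣ ≤ C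
        go (no ¬cop) = subst (_≤ C) (sym (trans (cong (λ z → ι x * ∣ z ∣) (∑-zero x λ m _ → trans (cong (_* inv (ι (suc m))) (degenerate k ¬cop (suc m))) (*-zeroˡ (inv (ι (suc m)))))) (*-zeroʳ (ι x)))) 0≤C
        go (yes cop) = subst (λ z → ι x * ∣ z ∣ ≤ C) (sym (∑-cong′ x λ m → cong (_* inv (ι (suc m))) (S.h-scaled (suc m)))) (≤-trans (S.mean-bound x) bound≤C)
          where
          invertible = coprime⇒invertible n cop
          module S = Scaled k (proj₁ invertible) (proj₂ invertible)

    odd-vanishing : ∀ m → h m ≡ 0ℚ
    odd-vanishing = NonVanishing.vanishing n 1<n h (λ m → h-cong (%-mod n m)) support C 0≤C partial mean

-- Matching the members of a balanced family in pairs.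

module Matching where

  open import Data.Empty using (⊥-elim)
  open import Data.Fin using (Fin; zero; suc; punchIn; punchOut)
  open import Data.Fin.Properties using (_≟_; punchIn-punchOut; punchOut-punchIn; punchInᵢ≢i)
  open import Data.Nat.Base as ℕ using (ℕ; zero; suc)
  import Data.Nat.Properties as ℕ
  open import Data.Product using (∃; _,_; proj₁; proj₂)
  open import Data.Sum using (_⊎_; inj₁; inj₂; [_,_]′)
  import Data.Sum as Sum
  open import Relation.Binary.PropositionalEquality using (_≡_; refl; sym; trans; cong)
  open import Relation.Nullary using (Dec; yes; no)

  -- A bijection between two copies of Fin d and Fin N, kept as two embeddings with a function that
  -- locates each index.
  record Pairing {N : ℕ} (d : ℕ) (Opp : Fin N → Fin N → Set) : Set where
    field
      σ σ′ : Fin d → Fin N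
      ν    : Fin N → Fin d ⊎ Fin d
      ν-σ  : ∀ i → ν (σ i) ≡ inj₁ i
      ν-σ′ : ∀ i → ν (σ′ i) ≡ inj₂ i
      σ-ν  : ∀ k → [ σ , σ′ ]′ (ν k) ≡ k
      opp  : ∀ i → Opp (σ i) (σ′ i)

  open Pairing

  module _ {N d : ℕ} {Opp : Fin (suc (suc N)) → Fin (suc (suc N)) → Set} (j : Fin (suc N)) (0-j : Opp zero (suc j))
    (P : Pairing d (λ i k → Opp (suc (punchIn j i)) (suc (punchIn j k)))) where

    private
      τ τ′ : Fin (suc d) → Fin (suc (suc N))
      τ zero     = zero
      τ (suc i)  = suc (punchIn j (σ P i))
      τ′ zero    = suc j
      τ′ (suc i) = suc (punchIn j (σ′ P i))

      locate : (k : Fin (suc N)) → Dec (j ≡ k) → Fin (suc d) ⊎ Fin (suc d)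
      locate k (yes _)  = inj₂ zero
      locate k (no j≢k) = Sum.map suc suc (ν P (punchOut j≢k))

      locate-old : ∀ i x (dec : Dec (j ≡ punchIn j i)) → ν P i ≡ x → locate (punchIn j i) dec ≡ Sum.map suc suc x
      locate-old i x (yes e)  _    = ⊥-elim (punchInᵢ≢i j i (sym e))
      locate-old i x (no j≢k) refl = cong (λ z → Sum.map suc suc (ν P z)) (punchOut-punchIn j)

      locate-new : (dec : Dec (j ≡ j)) → locate j dec ≡ inj₂ zero
      locate-new (yes _)  = refl
      locate-new (no j≢j) = ⊥-elim (j≢j refl)

      τ-map : ∀ x → [ τ , τ′ ]′ (Sum.map suc suc x) ≡ suc (punchIn j ([ σ P , σ′ P ]′ x))
      τ-map (inj₁ _) = refl
      τ-map (inj₂ _) = refl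

      τ-locate : ∀ k (dec : Dec (j ≡ k)) → [ τ , τ′ ]′ (locate k dec) ≡ suc k
      τ-locate k (yes refl) = refl
      τ-locate k (no j≢k)   = trans (τ-map (ν P (punchOut j≢k)))
        (cong suc (trans (cong (punchIn j) (σ-ν P (punchOut j≢k))) (punchIn-punchOut j≢k)))

    extend : Pairing (suc d) Opp
    extend .σ  = τ
    extend .σ′ = τ′
    extend .ν zero    = inj₁ zero
    extend .ν (suc k) = locate k (j ≟ k)
    extend .ν-σ zero     = refl
    extend .ν-σ (suc i)  = locate-old (σ P i) (inj₁ i) (j ≟ _) (ν-σ P i)
    extend .ν-σ′ zero    = locate-new (j ≟ j)
    extend .ν-σ′ (suc i) = locate-old (σ′ P i) (inj₂ i) (j ≟ _) (ν-σ′ P i)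
    extend .σ-ν zero    = refl
    extend .σ-ν (suc k) = τ-locate k (j ≟ k)
    extend .opp zero    = 0-j
    extend .opp (suc i) = opp P i

  module _ {X : Set} (Opp : X → X → Set) (Balanced : ∀ {N} → (Fin N → X) → Set)
    (partner : ∀ {N} (f : Fin (suc (suc N)) → X) → Balanced f → ∃ λ j → Opp (f zero) (f (suc j)))
    (remove : ∀ {N} (f : Fin (suc (suc N)) → X) j → Balanced f → Opp (f zero) (f (suc j)) → Balanced (λ i → f (suc (punchIn j i)))) where

    -- Index 0 is matched first at every stage, so that σ zero is zero by computation; the
    -- coordinates of the Cayley isomorphism rely on this.
    match : ∀ d {N} → N ≡ d ℕ.+ d → (f : Fin N → X) → Balanced f → Pairing d (λ i j → Opp (f i) (f j))
    match zero    {zero}  eq f bal = record { σ = λ () ; σ′ = λ () ; ν = λ () ; ν-σ = λ () ; ν-σ′ = λ () ; σ-ν = λ () ; opp = λ () }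
    match zero    {suc N} () f bal
    match (suc d) {zero}  () f bal
    match (suc d) {suc zero} eq f bal = ⊥-elim (ℕ.1+n≢0 (sym (trans (ℕ.suc-injective eq) (ℕ.+-suc d d))))
    match (suc d) {suc (suc N)} eq f bal = extend j p (match d (ℕ.suc-injective (trans (ℕ.suc-injective eq) (ℕ.+-suc d d))) _ (remove f j bal p))
      where
      j = proj₁ (partner f bal)
      p = proj₂ (partner f bal)

-- Units whose function h vanishes cancel in pairs modulo n.

module UnitPairing where

  open import Data.Empty using (⊥-elim)
  open import Data.Fin using (Fin; zero; suc; punchIn)
  open import Data.Fin.Properties using (any?)
  open import Data.Nat.Base as ℕ using (ℕ; zero; suc; s≤s; z≤n; NonZero; _%_; _∸_)
  open import Data.Nat.Coprimality using (Coprime; coprime-divisor) renaming (sym to coprime-sym)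
  open import Data.Nat.DivMod using (m%n<n; m<n⇒m%n≡m; n%1≡0)
  open import Data.Nat.Divisibility using (_∣_; ∣⇒≤; m%n≡0⇒n∣m; ∣-refl)
  import Data.Nat.Properties as ℕ
  import Data.Nat.Tactic.RingSolver as ℕR
  open import Data.Product using (∃; _×_; _,_; proj₁; proj₂)
  open import Data.Rational hiding (NonZero; ≢-nonZero; >-nonZero; _/_)
  open import Data.Rational.Properties
  open import Data.Unit using (⊤; tt)
  open import Algebra.Properties.CommutativeMonoid.Sum +-0-commutativeMonoid using (sum; sum-remove)
  open import Relation.Binary.PropositionalEquality using (_≡_; refl; sym; trans; cong; cong₂; subst; module ≡-Reasoning)
  open import Relation.Nullary using (Dec; yes; no; ¬_)
  open import Tactic.RingSolver using (solve-∀)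
  open Kit
  open Sums using (ℕ∑)
  open Mod
  open HarmonicMean
  open OddVanish
  open Matching

  Unit : (n : ℕ) → ℕ → Set
  Unit n x = x ℕ.< n × Coprime x n

  module _ (n : ℕ) {{_ : NonZero n}} where

    -- The contribution of one unit to h, so `Neutral` says that h vanishes.
    charge : ℕ → ℕ → ℚ
    charge x m = ⟦ m % n ℕ.≟ x ⟧ - ⟦ (m ℕ.+ x) % n ℕ.≟ 0 ⟧

    Neutral : ∀ {N} → (Fin N → ℕ) → Set
    Neutral f = (∀ m → sum (λ i → charge (f i) m) ≡ 0ℚ) × (∀ i → Unit n (f i))

    Opposite : ℕ → ℕ → Set
    Opposite x y = (x ℕ.+ y) % n ≡ 0

    module _ (2<n : 2 ℕ.< n) where

      private
        instance
          1<n : ℕ.NonTrivial n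
          1<n = ℕ.n>1⇒nonTrivial (ℕ.<-trans (s≤s (s≤s z≤n)) 2<n)

        unit>0 : ∀ {x} → Unit n x → 0 ℕ.< x
        unit>0 {zero}  (_ , cop) = ⊥-elim (ℕ.<-irrefl (sym (cop {n} (Data.Nat.Divisibility._∣0 n , ∣-refl))) (ℕ.<-trans (s≤s (s≤s z≤n)) 2<n))
        unit>0 {suc x} _ = s≤s z≤n

        not-self-opposite : ∀ {x} → Unit n x → ¬ Opposite x x
        not-self-opposite {x} (_ , cop) e = ℕ.<⇒≱ 2<n (∣⇒≤ (coprime-divisor (coprime-sym cop) (subst (n ∣_) (double x) (m%n≡0⇒n∣m (x ℕ.+ x) n e))))
          where
          double : ∀ x → x ℕ.+ x ≡ x ℕ.* 2
          double = ℕR.solve-∀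

        sum-nonNeg : ∀ {N} (f : Fin N → ℚ) → (∀ i → 0ℚ ≤ f i) → 0ℚ ≤ sum f
        sum-nonNeg {zero}  f f≥0 = ≤-refl
        sum-nonNeg {suc N} f f≥0 = +≥0 (f≥0 zero) (sum-nonNeg (λ i → f (suc i)) (λ i → f≥0 (suc i)))

        -- Evaluate at m = f zero. The element itself contributes 1, not being its own negative, so
        -- a total of 0 needs a negative contribution, and only an opposite element makes one.
        partner : ∀ {N} (f : Fin (suc (suc N)) → ℕ) → Neutral f → ∃ λ j → Opposite (f zero) (f (suc j))
        partner f (neutral , units) = go (any? λ j → (x ℕ.+ f (suc j)) % n ℕ.≟ 0)
          where
          x = f zero
          own : charge x x ≡ 1ℚ
          own = cong₂ _-_ (⟦⟧-yes (x % n ℕ.≟ x) (m<n⇒m%n≡m (proj₁ (units zero)))) (⟦⟧-no ((x ℕ.+ x) % n ℕ.≟ 0) (not-self-opposite (units zero)))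
          go : Dec (∃ λ j → Opposite x (f (suc j))) → ∃ λ j → Opposite x (f (suc j))
          go (yes found) = found
          go (no none)   = ⊥-elim (<⇒≱ 0<1 (≤-trans (≤-by (sum rest) (sum-nonNeg rest rest≥0) (trans (cong (_+ sum rest) (sym own)) (neutral x))) ≤-refl))
            where
            rest : Fin _ → ℚ
            rest j = charge (f (suc j)) x
            rest≥0 : ∀ j → 0ℚ ≤ rest j
            rest≥0 j = subst (λ z → 0ℚ ≤ ⟦ x % n ℕ.≟ f (suc j) ⟧ - z) (sym (⟦⟧-no ((x ℕ.+ f (suc j)) % n ℕ.≟ 0) λ e → none (j , e)))
              (≤-trans (⟦⟧≥0 (x % n ℕ.≟ f (suc j))) (≤-reflexive (minus-0 ⟦ x % n ℕ.≟ f (suc j) ⟧)))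
              where
              minus-0 : ∀ z → z ≡ z - 0ℚ
              minus-0 = solve-∀ ringℚ

        opposite-charges : ∀ {x y} → Unit n x → Unit n y → Opposite x y → ∀ m → charge x m + charge y m ≡ 0ℚ
        opposite-charges {x} {y} ux uy opp m = trans (cong (charge x m +_) (cong₂ _-_ (sym at-y) (sym (trans (⟦⟧-cong (m % n ℕ.≟ x) ((m ℕ.+ y) % n ℕ.≟ 0)
                (λ e → complement⇐ n m (unit>0 uy) (proj₁ uy) (trans e x≡)) (λ e → trans (complement⇒ n m (unit>0 uy) (proj₁ uy) e) (sym x≡))) refl))))
            (cancel ⟦ m % n ℕ.≟ x ⟧ ⟦ (m ℕ.+ x) % n ℕ.≟ 0 ⟧)
          where
          cancel : ∀ a b → a - b + (b - a) ≡ 0ℚ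
          cancel = solve-∀ ringℚ
          x≡ : x ≡ n ∸ y
          x≡ = trans (sym (m<n⇒m%n≡m (proj₁ ux))) (complement⇒ n x (unit>0 uy) (proj₁ uy) opp)
          y≡ : y ≡ n ∸ x
          y≡ = trans (sym (m<n⇒m%n≡m (proj₁ uy))) (complement⇒ n y (unit>0 ux) (proj₁ ux) (trans (cong (_% n) (ℕ.+-comm y x)) opp))
          at-y : ⟦ (m ℕ.+ x) % n ℕ.≟ 0 ⟧ ≡ ⟦ m % n ℕ.≟ y ⟧
          at-y = ⟦⟧-cong ((m ℕ.+ x) % n ℕ.≟ 0) (m % n ℕ.≟ y)
            (λ e → trans (complement⇒ n m (unit>0 ux) (proj₁ ux) e) (sym y≡)) (λ e → complement⇐ n m (unit>0 ux) (proj₁ ux) (trans e y≡))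

        remove : ∀ {N} (f : Fin (suc (suc N)) → ℕ) j → Neutral f → Opposite (f zero) (f (suc j)) → Neutral (λ i → f (suc (punchIn j i)))
        remove f j (neutral , units) opp = (λ m → begin
            sum (rest m)                                       ≡⟨ sym (+-identityˡ (sum (rest m))) ⟩
            0ℚ + sum (rest m) ≡⟨ cong (_+ sum (rest m)) (sym (opposite-charges (units zero) (units (suc j)) opp m)) ⟩
            charge (f zero) m + charge (f (suc j)) m + sum (rest m) ≡⟨ +-assoc (charge (f zero) m) (charge (f (suc j)) m) (sum (rest m)) ⟩
            charge (f zero) m + (charge (f (suc j)) m + sum (rest m)) ≡⟨ cong (charge (f zero) m +_) (sym (sum-remove {i = j} (λ i → charge (f (suc i)) m))) ⟩
            sum (λ i → charge (f i) m)                         ≡⟨ neutral m ⟩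
            0ℚ                                                 ∎) , λ i → units (suc (punchIn j i))
          where
          open ≡-Reasoning
          rest : ℕ → Fin _ → ℚ
          rest m i = charge (f (suc (punchIn j i))) m

      neutral-match : ∀ e {N} → suc (suc N) ≡ suc e ℕ.+ suc e → (f : Fin (suc (suc N)) → ℕ) → Neutral f →
                      ∃ λ (P : Pairing (suc e) (λ i j → Opposite (f i) (f j))) → Pairing.σ P zero ≡ zero
      neutral-match e eq f neutral = match Opposite Neutral partner remove (suc e) eq f neutral , refl

  -- The geometry indexes by Fin, the analysis by ℕ. Repeating the last member keeps the hypotheses
  -- true at every index, and sums over `suc N` indices do not see the repetition.
  clamp : ∀ {N} → ℕ → Fin (suc N)
  clamp {zero}  _       = zero
  clamp {suc N} zero    = zero
  clamp {suc N} (suc i) = suc (clamp i)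

  ∑-clamp : ∀ {N} (f : Fin (suc N) → ℚ) → ∑ (suc N) (λ i → f (clamp i)) ≡ sum f
  ∑-clamp {zero}  f = refl
  ∑-clamp {suc N} f = cong (f zero +_) (∑-clamp (λ i → f (suc i)))

  pairing : (n : ℕ) {{_ : NonZero n}} (e : ℕ) {N : ℕ} → suc (suc N) ≡ suc e ℕ.+ suc e → (a : Fin (suc (suc N)) → ℕ) → (∀ i → Coprime (a i) n) →
            (∀ r → ℕ∑ (suc (suc N)) (λ i → r ℕ.* a (clamp i) % n) ≡ ℕ∑ (suc (suc N)) (λ i → r ℕ.* ((n ∸ 1) ℕ.* a (clamp i)) % n)) →
            ∃ λ (P : Pairing (suc e) (λ i j → (a i ℕ.+ a j) % n ≡ 0)) → Pairing.σ P zero ≡ zero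
  -- For n = 1 and n = 2 every unit is its own negative, so h is identically zero and gives no
  -- information; but there any two units cancel.
  pairing 1 e eq a coprime balance = match (λ x y → (x ℕ.+ y) % 1 ≡ 0) (λ _ → ⊤) (λ f _ → zero , n%1≡0 (f zero ℕ.+ f (suc zero))) (λ _ _ _ _ → tt) (suc e) eq a tt , refl
  pairing 2 e eq a coprime balance = match (λ x y → (x ℕ.+ y) % 2 ≡ 0) (λ f → ∀ i → f i % 2 ≡ 1)
      (λ f odd → zero , +-mod 2 {f zero} {1} {f (suc zero)} {1} (odd zero) (odd (suc zero))) (λ f j odd _ i → odd (suc (punchIn j i))) (suc e) eq a
      (λ i → odd (a i % 2) refl (m%n<n (a i) 2) (coprime i)) , refl
    where
    odd : ∀ {x} y → x % 2 ≡ y → y ℕ.< 2 → Coprime x 2 → y ≡ 1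
    odd {x} zero e _ cop with cop (m%n≡0⇒n∣m x 2 e , ∣-refl)
    ... | ()
    odd 1 _ _ _ = refl
    odd (suc (suc y)) _ (s≤s (s≤s ())) _
  pairing n@(suc (suc (suc _))) e {N} eq a coprime balance = weaken (neutral-match n 2<n e eq α (neutral , units))
    where
    1<n : 1 ℕ.< n
    1<n = s≤s (s≤s z≤n)
    2<n : 2 ℕ.< n
    2<n = s≤s (s≤s (s≤s z≤n))
    α : Fin (suc (suc N)) → ℕ
    α i = proj₁ (coprime⇒invertible n (coprime i)) % n
    α<n : ∀ i → α i ℕ.< n
    α<n i = m%n<n (proj₁ (coprime⇒invertible n (coprime i))) n
    inverse : ∀ i → a i ℕ.* α i ≡ 1 mod n
    inverse i = trans (*-mod n {a i} {a i} {α i} {proj₁ (coprime⇒invertible n (coprime i))} refl (%-mod n (proj₁ (coprime⇒invertible n (coprime i))))) (proj₂ (coprime⇒invertible n (coprime i)))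
    units : ∀ i → Unit n (α i)
    units i = α<n i , invertible⇒coprime n {α i} {a i} (trans (cong (_% n) (ℕ.*-comm (α i) (a i))) (inverse i))
    0<α : ∀ i → 0 ℕ.< α i
    0<α i = ℕ.n≢0⇒n>0 λ e → ℕ.1+n≢0 (sym (trans (sym (cong (_% n) (ℕ.*-zeroʳ (a i)))) (trans (cong (λ z → (a i ℕ.* z) % n) (sym e)) (inverse i))))
    neutral : ∀ m → sum (λ i → charge n (α i) m) ≡ 0ℚ
    neutral m = trans (sym (∑-clamp (λ i → charge n (α i) m))) (UnitFamily.odd-vanishing n 1<n (suc (suc N)) (λ i → a (clamp i)) (λ i → α (clamp i))
      (λ i → 0<α (clamp i)) (λ i → α<n (clamp i)) (λ i → inverse (clamp i)) balance m)
    -- The pairing is found among the inverses α and carried back by aᵢ + aⱼ ≡ aᵢaⱼ(αᵢ + αⱼ).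
    opposite : ∀ i j → Opposite n (α i) (α j) → (a i ℕ.+ a j) % n ≡ 0
    opposite i j e = begin
      (a i ℕ.+ a j) % n ≡⟨ cong (_% n) (trans (ℕ.+-comm (a i) (a j)) (sym (cong₂ ℕ._+_ (ℕ.*-identityʳ (a j)) (ℕ.*-identityʳ (a i))))) ⟩
      (a j ℕ.* 1 ℕ.+ a i ℕ.* 1) % n ≡⟨ sym (+-mod n {a j ℕ.* (a i ℕ.* α i)} {a j ℕ.* 1} {a i ℕ.* (a j ℕ.* α j)} {a i ℕ.* 1} (*-mod n {a j} {a j} {a i ℕ.* α i} {1} refl (inverse i)) (*-mod n {a i} {a i} {a j ℕ.* α j} {1} refl (inverse j))) ⟩
      (a j ℕ.* (a i ℕ.* α i) ℕ.+ a i ℕ.* (a j ℕ.* α j)) % n        ≡⟨ cong (_% n) (factor (a i) (a j) (α i) (α j)) ⟩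
      (a i ℕ.* a j ℕ.* (α i ℕ.+ α j)) % n                          ≡⟨ *-mod n {a i ℕ.* a j} {a i ℕ.* a j} {α i ℕ.+ α j} {0} refl e ⟩
      (a i ℕ.* a j ℕ.* 0) % n                                      ≡⟨ cong (_% n) (ℕ.*-zeroʳ (a i ℕ.* a j)) ⟩
      0                                                            ∎
      where
      open ≡-Reasoning
      factor : ∀ a b x y → b ℕ.* (a ℕ.* x) ℕ.+ a ℕ.* (b ℕ.* y) ≡ a ℕ.* b ℕ.* (x ℕ.+ y)
      factor = ℕR.solve-∀
    weaken : (∃ λ (P : Pairing (suc e) (λ i j → Opposite n (α i) (α j))) → Pairing.σ P zero ≡ zero) →
             ∃ λ (P : Pairing (suc e) (λ i j → (a i ℕ.+ a j) % n ≡ 0)) → Pairing.σ P zero ≡ zero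
    weaken (P , eq₀) = record { σ = σ ; σ′ = σ′ ; ν = ν ; ν-σ = ν-σ ; ν-σ′ = ν-σ′ ; σ-ν = σ-ν ; opp = λ i → opposite (σ i) (σ′ i) (opp i) } , eq₀
      where open Pairing P

-- Sums over finite index sets, for ℤ and ℚ at once.

module FinSum where

  open import Algebra.Bundles using (CommutativeRing)
  open import Data.Fin using (Fin; zero; suc; punchIn; inject₁; fromℕ; _↑ˡ_; _↑ʳ_)
  open import Data.Fin.Permutation using (Permutation; _⟨$⟩ʳ_)
  open import Data.Fin.Properties using (punchInᵢ≢i)
  import Data.Integer.Properties as ℤ
  open import Data.Nat.Base as ℕ using (ℕ; zero; suc)
  import Data.Rational.Properties as ℚ
  open import Level using (0ℓ)
  open import Relation.Binary.PropositionalEquality as ≡ using (_≡_; _≢_)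
  open import Defs using (sumℤ; sumℚ)

  module _ (R : CommutativeRing 0ℓ 0ℓ) where
    open CommutativeRing R hiding (zero)

    module FinSums (S : ∀ {n} → (Fin n → Carrier) → Carrier) (S-empty : ∀ (f : Fin 0 → Carrier) → S f ≡ 0#)
      (S-suc : ∀ {n} (f : Fin (suc n) → Carrier) → S f ≡ f zero + S (λ i → f (suc i))) where

      open import Algebra.Properties.CommutativeMonoid.Sum +-commutativeMonoid
      open import Algebra.Properties.Semiring.Sum semiring using (*-distribˡ-sum; *-distribʳ-sum)
      open import Relation.Binary.Reasoning.Setoid setoid

      private
        S≡ : ∀ {n} (f : Fin n → Carrier) → S f ≡ sum f
        S≡ {zero}  f = S-empty f
        S≡ {suc n} f = ≡.trans (S-suc f) (≡.cong (f zero +_) (S≡ (λ i → f (suc i))))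

        via : ∀ {m n} (f : Fin m → Carrier) (g : Fin n → Carrier) → sum f ≈ sum g → S f ≈ S g
        via f g eq = trans (reflexive (S≡ f)) (trans eq (reflexive (≡.sym (S≡ g))))

      S-cong : ∀ {n} {f g : Fin n → Carrier} → (∀ i → f i ≈ g i) → S f ≈ S g
      S-cong {f = f} {g} eq = via f g (sum-cong-≋ eq)

      S-+ : ∀ {n} (f g : Fin n → Carrier) → S (λ i → f i + g i) ≈ S f + S g
      S-+ f g = trans (reflexive (S≡ (λ i → f i + g i))) (trans (∑-distrib-+ f g) (reflexive (≡.sym (≡.cong₂ _+_ (S≡ f) (S≡ g)))))

      S-*ˡ : ∀ {n} x (f : Fin n → Carrier) → x * S f ≈ S (λ i → x * f i)
      S-*ˡ x f = trans (reflexive (≡.cong (x *_) (S≡ f))) (trans (*-distribˡ-sum x f) (reflexive (≡.sym (S≡ (λ i → x * f i)))))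

      S-*ʳ : ∀ {n} x (f : Fin n → Carrier) → S f * x ≈ S (λ i → f i * x)
      S-*ʳ x f = trans (reflexive (≡.cong (_* x) (S≡ f))) (trans (*-distribʳ-sum x f) (reflexive (≡.sym (S≡ (λ i → f i * x)))))

      S-comm : ∀ {m n} (f : Fin m → Fin n → Carrier) → S (λ i → S (λ j → f i j)) ≈ S (λ j → S (λ i → f i j))
      S-comm f = begin
        S (λ i → S (λ j → f i j))         ≈⟨ S-cong (λ i → reflexive (S≡ (λ j → f i j))) ⟩
        S (λ i → sum (λ j → f i j))       ≈⟨ via (λ i → sum (λ j → f i j)) (λ j → sum (λ i → f i j)) (∑-comm f) ⟩
        S (λ j → sum (λ i → f i j))       ≈⟨ S-cong (λ j → reflexive (≡.sym (S≡ (λ i → f i j)))) ⟩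
        S (λ j → S (λ i → f i j))         ∎

      S-remove : ∀ {n} (j : Fin (suc n)) f → S f ≈ f j + S (λ i → f (punchIn j i))
      S-remove j f = trans (reflexive (S≡ f)) (trans (sum-remove {i = j} f) (+-congˡ (reflexive (≡.sym (S≡ (λ i → f (punchIn j i)))))))

      S-permute : ∀ {m n} (f : Fin n → Carrier) (π : Permutation m n) → S f ≈ S (λ i → f (π ⟨$⟩ʳ i))
      S-permute f π = via f (λ i → f (π ⟨$⟩ʳ i)) (sum-permute f π)

      S-last : ∀ {n} (f : Fin (suc n) → Carrier) → S f ≈ S (λ i → f (inject₁ i)) + f (fromℕ n)
      S-last f = trans (reflexive (S≡ f)) (trans (sum-init-last f) (+-congʳ (reflexive (≡.sym (S≡ (λ i → f (inject₁ i)))))))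

      S-zero : ∀ {n} {f : Fin n → Carrier} → (∀ i → f i ≈ 0#) → S f ≈ 0#
      S-zero {n} eq = trans (S-cong eq) (trans (reflexive (S≡ (λ _ → 0#))) (sum-replicate-zero n))

      S-single : ∀ {n} (j : Fin n) {f : Fin n → Carrier} → (∀ i → i ≢ j → f i ≈ 0#) → S f ≈ f j
      S-single {suc n} j {f} eq = trans (S-remove j f) (trans (+-congˡ (S-zero λ i → eq (punchIn j i) (punchInᵢ≢i j i))) (+-identityʳ (f j)))

      S-split : ∀ m {n} (f : Fin (m ℕ.+ n) → Carrier) → S f ≈ S (λ i → f (i ↑ˡ n)) + S (λ j → f (m ↑ʳ j))
      S-split zero    f = trans (sym (+-identityˡ (S f))) (+-congʳ (reflexive (≡.sym (S-empty _))))
      S-split (suc m) {n} f = begin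
        S f                                                     ≈⟨ reflexive (S-suc f) ⟩
        f zero + S (λ i → f (suc i))                            ≈⟨ +-congˡ (S-split m (λ i → f (suc i))) ⟩
        f zero + (S (λ i → f (suc (i ↑ˡ n))) + S (λ j → f (suc (m ↑ʳ j)))) ≈⟨ sym (+-assoc _ _ _) ⟩
        f zero + S (λ i → f (suc (i ↑ˡ n))) + S (λ j → f (suc (m ↑ʳ j))) ≈⟨ +-congʳ (reflexive (≡.sym (S-suc (λ i → f (i ↑ˡ n))))) ⟩
        S (λ i → f (i ↑ˡ n)) + S (λ j → f (suc m ↑ʳ j))         ∎

      S-bilinear : ∀ {m n} (x : Fin m → Carrier) (A : Fin n → Carrier) (p : Fin m → Fin n → Carrier) →
                   S (λ i → x i * S (λ j → A j * p i j)) ≈ S (λ j → A j * S (λ i → x i * p i j))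
      S-bilinear x A p = begin
        S (λ i → x i * S (λ j → A j * p i j))         ≈⟨ S-cong (λ i → S-*ˡ (x i) (λ j → A j * p i j)) ⟩
        S (λ i → S (λ j → x i * (A j * p i j)))       ≈⟨ S-comm (λ i j → x i * (A j * p i j)) ⟩
        S (λ j → S (λ i → x i * (A j * p i j)))       ≈⟨ S-cong (λ j → S-cong λ i → swap (x i) (A j) (p i j)) ⟩
        S (λ j → S (λ i → A j * (x i * p i j)))       ≈⟨ S-cong (λ j → sym (S-*ˡ (A j) (λ i → x i * p i j))) ⟩
        S (λ j → A j * S (λ i → x i * p i j))         ∎
        where
        swap : ∀ x a p → x * (a * p) ≈ a * (x * p)
        swap x a p = trans (sym (*-assoc x a p)) (trans (*-congʳ (*-comm x a)) (*-assoc a x p))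

      -- The common form of two facts: functionals combine linearly, and affine maps commute with
      -- affine combinations (all t i equal to 1).
      S-affine : ∀ {m n} (c : Carrier) (A : Fin n → Carrier) (x t : Fin m → Carrier) (p : Fin m → Fin n → Carrier) →
                 S (λ i → x i * (c * t i + S (λ j → A j * p i j))) ≈ c * S (λ i → x i * t i) + S (λ j → A j * S (λ i → x i * p i j))
      S-affine c A x t p = begin
        S (λ i → x i * (c * t i + S (λ j → A j * p i j))) ≈⟨ S-cong (λ i → trans (distribˡ (x i) _ _) (+-congʳ (swap (x i) c (t i)))) ⟩
        S (λ i → c * (x i * t i) + x i * S (λ j → A j * p i j)) ≈⟨ S-+ (λ i → c * (x i * t i)) (λ i → x i * S (λ j → A j * p i j)) ⟩
        S (λ i → c * (x i * t i)) + S (λ i → x i * S (λ j → A j * p i j)) ≈⟨ +-cong (sym (S-*ˡ c (λ i → x i * t i))) (S-bilinear x A p) ⟩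
        c * S (λ i → x i * t i) + S (λ j → A j * S (λ i → x i * p i j))             ∎
        where
        swap : ∀ x a p → x * (a * p) ≈ a * (x * p)
        swap x a p = trans (sym (*-assoc x a p)) (trans (*-congʳ (*-comm x a)) (*-assoc a x p))

  module Sℤ = FinSums ℤ.+-*-commutativeRing sumℤ (λ _ → ≡.refl) (λ _ → ≡.refl)
  module Sℚ = FinSums ℚ.+-*-commutativeRing sumℚ (λ _ → ≡.refl) (λ _ → ≡.refl)

-- Passing between integral and rational points.

module Rationals where

  open import Data.Fin using (Fin; zero; suc)
  import Data.Integer.Base as ℤ
  open import Data.Integer.Base using (ℤ; +_)
  import Data.Integer.Properties as ℤ
  open import Data.Nat.Base as ℕ using (ℕ; zero; suc)
  import Data.Nat.Properties as ℕ
  open import Data.Product using (∃; _,_)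
  open import Data.Rational
  open import Data.Rational.Properties
  open import Relation.Binary.PropositionalEquality using (_≡_; refl; sym; trans; cong; cong₂; subst)
  open import Tactic.RingSolver using (solve-∀)
  open import Defs using (ℤ→ℚ; sumℤ; sumℚ; Pt; QPt; combℤ; AffIndep)
  open FinSum
  open Kit using (ringℚ; fromℤ; fromℤ≡/1; fromℤ-+; fromℤ-*; fromℤ-injective; fromℤ≥1; ι>0)

  private
    via : ∀ {x y} i → fromℤ i ≡ x → x ≡ y → ℤ→ℚ i ≡ y
    via i p q = trans (sym (fromℤ≡/1 i)) (trans p q)

  ℤ→ℚ-+ : ∀ i j → ℤ→ℚ (i ℤ.+ j) ≡ ℤ→ℚ i + ℤ→ℚ j
  ℤ→ℚ-+ i j = via (i ℤ.+ j) (fromℤ-+ i j) (cong₂ _+_ (fromℤ≡/1 i) (fromℤ≡/1 j))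

  ℤ→ℚ-* : ∀ i j → ℤ→ℚ (i ℤ.* j) ≡ ℤ→ℚ i * ℤ→ℚ j
  ℤ→ℚ-* i j = via (i ℤ.* j) (fromℤ-* i j) (cong₂ _*_ (fromℤ≡/1 i) (fromℤ≡/1 j))

  ℤ→ℚ-injective : ∀ {i j} → ℤ→ℚ i ≡ ℤ→ℚ j → i ≡ j
  ℤ→ℚ-injective {i} {j} e = fromℤ-injective (trans (fromℤ≡/1 i) (trans e (sym (fromℤ≡/1 j))))

  ℤ→ℚ-sum : ∀ {n} (f : Fin n → ℤ) → ℤ→ℚ (sumℤ f) ≡ sumℚ (λ i → ℤ→ℚ (f i))
  ℤ→ℚ-sum {zero}  f = refl
  ℤ→ℚ-sum {suc n} f = trans (ℤ→ℚ-+ (f zero) (sumℤ λ i → f (suc i))) (cong (λ z → ℤ→ℚ (f zero) + z) (ℤ→ℚ-sum λ i → f (suc i)))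

  ℤ→ℚ-dot : ∀ {n} (f g : Fin n → ℤ) → ℤ→ℚ (sumℤ λ i → f i ℤ.* g i) ≡ sumℚ (λ i → ℤ→ℚ (f i) * ℤ→ℚ (g i))
  ℤ→ℚ-dot f g = trans (ℤ→ℚ-sum λ i → f i ℤ.* g i) (Sℚ.S-cong λ i → ℤ→ℚ-* (f i) (g i))

  ℤ→ℚ>0 : ∀ n → 0ℚ < ℤ→ℚ (+ suc n)
  ℤ→ℚ>0 n = subst (0ℚ <_) (fromℤ≡/1 (+ suc n)) (ι>0 n)

  ℤ→ℚ≥1 : ∀ {i} → 0ℚ < ℤ→ℚ i → + 1 ℤ.≤ i
  ℤ→ℚ≥1 {i} pos = fromℤ≥1 (subst (0ℚ <_) (sym (fromℤ≡/1 i)) pos)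

  affIndep-ℤ : ∀ {n m} {p : Fin n → Pt m} → AffIndep p → (c : Fin n → ℤ) → sumℤ c ≡ + 0 → (∀ s → combℤ c p s ≡ + 0) → ∀ i → c i ≡ + 0
  affIndep-ℤ {p = p} indep c sum0 comb0 i = ℤ→ℚ-injective (indep (λ i → ℤ→ℚ (c i)) (trans (sym (ℤ→ℚ-sum c)) (cong ℤ→ℚ sum0))
    (λ s → trans (sym (ℤ→ℚ-dot c (λ i → p i s))) (cong ℤ→ℚ (comb0 s))) i)

  clear-one : ∀ (x : ℚ) → ∃ λ D → ∃ λ z → ℤ→ℚ (+ suc D) * x ≡ ℤ→ℚ z
  clear-one x = denominator-1 x , ↥ x , (begin-equality
      ℤ→ℚ (+ suc (denominator-1 x)) * x            ≡⟨ cong (ℤ→ℚ (↧ x) *_) (sym (↥p/↧p≡p x)) ⟩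
      ℤ→ℚ (↧ x) * (↥ x / ↧ₙ x)                     ≡⟨ *-comm (ℤ→ℚ (↧ x)) (↥ x / ↧ₙ x) ⟩
      (↥ x / ↧ₙ x) * ℤ→ℚ (↧ x)                     ≡⟨ cancel (↥ x) (denominator-1 x) ⟩
      ℤ→ℚ (↥ x)                                    ∎)
    where
    open ≤-Reasoning
    open ℚ using (denominator-1)
    cancel : ∀ p d → (p / suc d) * (+ suc d / 1) ≡ p / 1
    cancel p d = toℚᵘ-injective (ℚᵘ.≃-trans (toℚᵘ-homo-* (p / suc d) (+ suc d / 1))
      (ℚᵘ.≃-trans (ℚᵘ.*-cong (toℚᵘ-fromℚᵘ (ℚᵘ.mkℚᵘ p d)) (toℚᵘ-fromℚᵘ (ℚᵘ.mkℚᵘ (+ suc d) 0)))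
      (ℚᵘ.≃-trans (ℚᵘ.*≡* {ℚᵘ.mkℚᵘ p d ℚᵘ.* ℚᵘ.mkℚᵘ (+ suc d) 0} {ℚᵘ.mkℚᵘ p 0} (shape p d)) (ℚᵘ.≃-sym (toℚᵘ-fromℚᵘ (ℚᵘ.mkℚᵘ p 0))))))
      where
      import Data.Rational.Unnormalised as ℚᵘ
      import Data.Rational.Unnormalised.Properties as ℚᵘ
      shape : ∀ p d → p ℤ.* + suc d ℤ.* + 1 ≡ p ℤ.* + (suc d ℕ.* 1)
      shape p d = trans (ℤ.*-identityʳ (p ℤ.* + suc d)) (cong (λ k → p ℤ.* + k) (sym (ℕ.*-identityʳ (suc d))))

  -- A common denominator D turns a statement on an affine function at x into one on its
  -- homogenisation at the integral point (Dx, D).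
  clear : ∀ {m} (x : QPt m) → ∃ λ D → ∃ λ (z : Pt m) → ∀ s → ℤ→ℚ (+ suc D) * x s ≡ ℤ→ℚ (z s)
  clear {zero}  x = 0 , (λ ()) , λ ()
  clear {suc m} x with clear-one (x zero) | clear (λ s → x (suc s))
  ... | D , z , eq | D′ , z′ , eq′ = D′ ℕ.+ D ℕ.* suc D′ , (λ { zero → + suc D′ ℤ.* z ; (suc s) → + suc D ℤ.* z′ s }) ,
      λ { zero    → trans (cong (_* x zero) (ℤ→ℚ-* (+ suc D) (+ suc D′))) (trans (shape₁ (ℤ→ℚ (+ suc D)) (ℤ→ℚ (+ suc D′)) (x zero)) (trans (cong (ℤ→ℚ (+ suc D′) *_) eq) (sym (ℤ→ℚ-* (+ suc D′) z))))
        ; (suc s) → trans (cong (_* x (suc s)) (ℤ→ℚ-* (+ suc D) (+ suc D′))) (trans (*-assoc (ℤ→ℚ (+ suc D)) (ℤ→ℚ (+ suc D′)) (x (suc s))) (trans (cong (ℤ→ℚ (+ suc D) *_) (eq′ s)) (sym (ℤ→ℚ-* (+ suc D) (z′ s))))) }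
    where
    shape₁ : ∀ a b x → a * b * x ≡ b * (a * x)
    shape₁ = solve-∀ ringℚ

-- Integral coordinates given by a basic facet.

module Frame where

  open import Data.Empty using (⊥-elim)
  open import Data.Fin using (Fin; zero; suc; punchIn; punchOut; inject₁; fromℕ)
  open import Data.Fin.Permutation using (Permutation; permutation; _⟨$⟩ʳ_)
  open import Data.Fin.Properties using (_≟_; any?; ¬∀⟶∃¬; injective⇒≤; punchIn-punchOut; punchOut-injective)
  open import Data.Integer.Base using (ℤ; +_; _+_; _*_; _-_; -_)
  open import Data.Integer.Properties using (+-identityʳ; +-identityˡ; *-comm; *-zeroˡ; *-zeroʳ; *-identityˡ; *-identityʳ; i-j≡0⇒i≡j)
  open import Data.Integer.Tactic.RingSolver using (solve-∀)
  open import Data.Nat.Base as ℕ using (ℕ; zero; suc)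
  import Data.Nat.Properties as ℕ
  open import Data.Product using (∃; _×_; _,_; proj₁; proj₂)
  open import Function.Definitions using (Injective)
  open import Relation.Binary.PropositionalEquality using (_≡_; _≢_; refl; sym; trans; cong; cong₂; module ≡-Reasoning)
  open import Relation.Nullary using (Dec; yes; no; ¬_)
  open import Defs
  open FinSum
  open Sℤ

  unitVec-same : ∀ {r} (i : Fin r) → unitVec i i ≡ + 1
  unitVec-same i with i ≟ i
  ... | yes _  = refl
  ... | no i≢i = ⊥-elim (i≢i refl)

  unitVec-other : ∀ {r} {i t : Fin r} → i ≢ t → unitVec i t ≡ + 0
  unitVec-other {i = i} {t} i≢t with i ≟ t
  ... | yes e = ⊥-elim (i≢t e)
  ... | no _  = refl

  unitVec-sym : ∀ {r} (i t : Fin r) → unitVec i t ≡ unitVec t i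
  unitVec-sym i t = go (i ≟ t)
    where
    go : Dec (i ≡ t) → unitVec i t ≡ unitVec t i
    go (yes refl) = refl
    go (no i≢t)   = trans (unitVec-other i≢t) (sym (unitVec-other λ e → i≢t (sym e)))

  sum-unitVec : ∀ {n} (f : Fin n → ℤ) j → sumℤ (λ i → f i * unitVec i j) ≡ f j
  sum-unitVec f j = trans (S-single j λ i i≢j → trans (cong (f i *_) (unitVec-other i≢j)) (*-zeroʳ (f i)))
    (trans (cong (f j *_) (unitVec-same j)) (*-identityʳ (f j)))

  injective⇒surjective : ∀ {k} (f : Fin k → Fin k) → Injective _≡_ _≡_ f → ∀ y → ∃ λ x → f x ≡ y
  injective⇒surjective {suc k} f inj y with any? (λ x → f x ≟ y)
  ... | yes found = found
  ... | no missed = ⊥-elim (ℕ.1+n≰n (injective⇒≤ {f = λ x → punchOut {i = y} {j = f x} λ e → missed (x , sym e)}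
    λ {i} {j} e → inj (punchOut-injective (λ e → missed (i , sym e)) (λ e → missed (j , sym e)) e)))

  -- By the pigeonhole principle. It singles out the one basis vector that is not an edge of the
  -- facet.
  missing-index : ∀ {k} (ι : Fin k → Fin (suc k)) → Injective _≡_ _≡_ ι →
                  ∃ λ j → (∀ i → ι i ≢ j) × ∃ λ (π : Permutation k k) → ∀ i → punchIn j (π ⟨$⟩ʳ i) ≡ ι i
  missing-index {k} ι inj = j , avoids , permutation f g f-g g-f , λ i → punchIn-punchOut (λ e → avoids i (sym e))
    where
    exists : ∃ λ j → ¬ (∃ λ i → ι i ≡ j)
    exists = ¬∀⟶∃¬ (suc k) _ (λ j → any? λ i → ι i ≟ j) λ all → ℕ.1+n≰n (injective⇒≤ {f = λ j → proj₁ (all j)}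
      λ {x} {y} e → trans (sym (proj₂ (all x))) (trans (cong ι e) (proj₂ (all y))))
    j = proj₁ exists
    avoids : ∀ i → ι i ≢ j
    avoids i e = proj₂ exists (i , e)
    f : Fin k → Fin k
    f i = punchOut {i = j} {j = ι i} λ e → avoids i (sym e)
    f-inj : Injective _≡_ _≡_ f
    f-inj {x} {y} e = inj (punchOut-injective (λ e → avoids x (sym e)) (λ e → avoids y (sym e)) e)
    g : Fin k → Fin k
    g y = proj₁ (injective⇒surjective f f-inj y)
    f-g : ∀ y → f (g y) ≡ y
    f-g y = proj₂ (injective⇒surjective f f-inj y)
    g-f : ∀ x → g (f x) ≡ x
    g-f x = f-inj (f-g (f x))

  -- The integral affine functional z ↦ c + Σ ℓ z, homogenised: it takes the value c t + Σ ℓ z at (z, t).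
  record Functional (m : ℕ) : Set where
    constructor functional
    field
      const  : ℤ
      linear : Pt m

    _⟨_,_⟩ : Pt m → ℤ → ℤ
    _⟨_,_⟩ z t = const * t + sumℤ (λ s → linear s * z s)

  open Functional public

  lin : ∀ {m n} → (Fin n → ℤ) → (Fin n → Functional m) → Functional m
  lin x f = functional (sumℤ λ i → x i * const (f i)) (λ s → sumℤ λ i → x i * linear (f i) s)

  lin-value : ∀ {m n} (x : Fin n → ℤ) (f : Fin n → Functional m) z t → lin x f ⟨ z , t ⟩ ≡ sumℤ (λ i → x i * (f i ⟨ z , t ⟩))
  lin-value x f z t = sym (begin
    sumℤ (λ i → x i * (const (f i) * t + sumℤ (λ s → linear (f i) s * z s))) ≡⟨ S-cong (λ i → cong (x i *_) (cong₂ _+_ (*-comm (const (f i)) t) (S-cong λ s → *-comm (linear (f i) s) (z s)))) ⟩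
    sumℤ (λ i → x i * (t * const (f i) + sumℤ (λ s → z s * linear (f i) s)))  ≡⟨ S-affine t z x (λ i → const (f i)) (λ i → linear (f i)) ⟩
    t * sumℤ (λ i → x i * const (f i)) + sumℤ (λ s → z s * sumℤ (λ i → x i * linear (f i) s)) ≡⟨ cong₂ _+_ (*-comm t _) (S-cong λ s → *-comm (z s) _) ⟩
    lin x f ⟨ z , t ⟩                                                          ∎)
    where open ≡-Reasoning

  value-cong : ∀ {m} (f : Functional m) {z z′ t} → (∀ s → z s ≡ z′ s) → f ⟨ z , t ⟩ ≡ f ⟨ z′ , t ⟩
  value-cong f {t = t} eq = cong (λ y → const f * t + y) (S-cong λ s → cong (linear f s *_) (eq s))

  value-scale : ∀ {m} (f : Functional m) c z t → f ⟨ (λ s → c * z s) , c * t ⟩ ≡ c * (f ⟨ z , t ⟩)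
  value-scale f c z t = trans (cong₂ _+_ (swap (const f) c t) (trans (S-cong λ s → swap (linear f s) c (z s)) (sym (S-*ˡ c λ s → linear f s * z s))))
    (dist c (const f * t) _)
    where
    swap : ∀ a b x → a * (b * x) ≡ b * (a * x)
    swap = solve-∀
    dist : ∀ c a b → c * a + c * b ≡ c * (a + b)
    dist = solve-∀

  module LatticeBasis {m} (b : Fin m → Pt m) (basis : IsLatticeBasis b) where

    private
      B : Fin m → Fin m → ℤ
      B t = proj₁ (proj₁ basis (unitVec t))

    -- The rows of the inverse matrix: its entry t is the x-th coordinate of the t-th standard
    -- vector.
    dual : Fin m → Pt m
    dual x t = B t x

    β : Fin m → Pt m → ℤ
    β x z = sumℤ (λ t → dual x t * z t)

    β-expand : ∀ z s → sumℤ (λ x → β x z * b x s) ≡ z s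
    β-expand z s = begin
      sumℤ (λ x → β x z * b x s) ≡⟨ S-cong (λ x → trans (*-comm (β x z) (b x s)) (cong (b x s *_) (S-cong λ t → *-comm (B t x) (z t)))) ⟩
      sumℤ (λ x → b x s * sumℤ (λ t → z t * B t x))  ≡⟨ S-bilinear (λ x → b x s) z (λ x t → B t x) ⟩
      sumℤ (λ t → z t * sumℤ (λ x → b x s * B t x)) ≡⟨ S-cong (λ t → cong (z t *_) (trans (S-cong λ x → *-comm (b x s) (B t x)) (proj₂ (proj₁ basis (unitVec t)) s))) ⟩
      sumℤ (λ t → z t * unitVec t s)                 ≡⟨ sum-unitVec z s ⟩
      z s                                            ∎
      where open ≡-Reasoning

    β-dual : ∀ x y → β x (b y) ≡ unitVec y x
    β-dual x y = i-j≡0⇒i≡j (β x (b y)) (unitVec y x) (proj₂ basis (λ x → β x (b y) - unitVec y x) (λ s → begin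
      sumℤ (λ x → (β x (b y) - unitVec y x) * b x s)  ≡⟨ S-cong (λ x → dist (β x (b y)) (unitVec y x) (b x s)) ⟩
      sumℤ (λ x → β x (b y) * b x s + - (+ 1) * (b x s * unitVec y x)) ≡⟨ S-+ (λ x → β x (b y) * b x s) (λ x → - (+ 1) * (b x s * unitVec y x)) ⟩
      sumℤ (λ x → β x (b y) * b x s) + sumℤ (λ x → - (+ 1) * (b x s * unitVec y x)) ≡⟨ cong₂ _+_ (β-expand (b y) s) (sym (S-*ˡ (- (+ 1)) λ x → b x s * unitVec y x)) ⟩
      b y s + - (+ 1) * sumℤ (λ x → b x s * unitVec y x) ≡⟨ cong (λ v → b y s + - (+ 1) * v) (trans (S-cong λ x → cong (b x s *_) (unitVec-sym y x)) (sum-unitVec (λ x → b x s) y)) ⟩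
      b y s + - (+ 1) * b y s                         ≡⟨ cancel (b y s) ⟩
      + 0                                             ∎) x)
      where
      open ≡-Reasoning
      dist : ∀ a b c → (a - b) * c ≡ a * c + - (+ 1) * (c * b)
      dist = solve-∀
      cancel : ∀ a → a + - (+ 1) * a ≡ + 0
      cancel = solve-∀

    β-affine : ∀ {n} x z (c : Fin n → ℤ) p y q → (∀ s → z s ≡ combℤ c p s + y * q s) → β x z ≡ sumℤ (λ i → c i * β x (p i)) + y * β x q
    β-affine x z c p y q eq = begin
      sumℤ (λ t → B t x * z t) ≡⟨ S-cong (λ t → trans (cong (B t x *_) (eq t)) (dist (B t x) (combℤ c p t) y (q t))) ⟩
      sumℤ (λ t → B t x * combℤ c p t + y * (B t x * q t)) ≡⟨ S-+ (λ t → B t x * combℤ c p t) (λ t → y * (B t x * q t)) ⟩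
      sumℤ (λ t → B t x * combℤ c p t) + sumℤ (λ t → y * (B t x * q t)) ≡⟨ cong₂ _+_ (sym (S-bilinear c (dual x) p)) (sym (S-*ˡ y λ t → B t x * q t)) ⟩
      sumℤ (λ i → c i * β x (p i)) + y * β x q                                     ∎
      where
      open ≡-Reasoning
      dist : ∀ b u y q → b * (u + y * q) ≡ b * u + y * (b * q)
      dist = solve-∀

  -- Each integral (z, t) is a unique integral combination of the facet's vertices, with
  -- coefficients of sum t, and of `normal`; `coords` states the uniqueness. `L` is the signed
  -- lattice height over the facet.
  record AffineFrame {k} (w : Fin (suc k) → Pt (suc k)) : Set where
    field
      normal : Pt (suc k)
      Q      : Fin (suc k) → Functional (suc k)
      L      : Functional (suc k)
      total  : ∀ z t → sumℤ (λ l → Q l ⟨ z , t ⟩) ≡ t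
      expand : ∀ z t s → combℤ (λ l → Q l ⟨ z , t ⟩) w s + (L ⟨ z , t ⟩) * normal s ≡ z s
      coords : ∀ z t x y → sumℤ x ≡ t → (∀ s → combℤ x w s + y * normal s ≡ z s) → (∀ l → Q l ⟨ z , t ⟩ ≡ x l) × L ⟨ z , t ⟩ ≡ y

  snoc : ∀ {A : Set} {k} → (Fin k → A) → A → Fin (suc k) → A
  snoc {k = zero}  f x _       = x
  snoc {k = suc k} f x zero    = f zero
  snoc {k = suc k} f x (suc i) = snoc (λ i → f (suc i)) x i

  snoc-inject₁ : ∀ {A : Set} {k} (f : Fin k → A) x i → snoc f x (inject₁ i) ≡ f i
  snoc-inject₁ {k = suc k} f x zero    = refl
  snoc-inject₁ {k = suc k} f x (suc i) = snoc-inject₁ (λ i → f (suc i)) x i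

  snoc-fromℕ : ∀ {A : Set} {k} (f : Fin k → A) x → snoc f x (fromℕ k) ≡ x
  snoc-fromℕ {k = zero}  f x = refl
  snoc-fromℕ {k = suc k} f x = snoc-fromℕ (λ i → f (suc i)) x

  initial-or-last : ∀ {k} (P : Fin (suc k) → Set) → (∀ i → P (inject₁ i)) → P (fromℕ k) → ∀ l → P l
  initial-or-last {zero}  P init last zero    = last
  initial-or-last {suc k} P init last zero    = init zero
  initial-or-last {suc k} P init last (suc l) = initial-or-last (λ l → P (suc l)) (λ i → init (suc i)) last l

  module _ {k} (w : Fin (suc k) → Pt (suc k)) (basic : IsBasic w) where

    private
      m = suc k
      b = proj₁ (proj₂ basic)
      ι = proj₁ (proj₂ (proj₂ basic))
      inj = proj₁ (proj₂ (proj₂ (proj₂ basic)))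
      b-ι = proj₂ (proj₂ (proj₂ (proj₂ (proj₂ basic))))
      open LatticeBasis b (proj₁ (proj₂ (proj₂ (proj₂ (proj₂ basic)))))
      missing = missing-index ι inj
      j = proj₁ missing
      p = w (fromℕ k)

      shift : Pt m → ℤ → Pt m
      shift z t s = z s - t * p s

      centred : Fin m → Functional m
      centred x = functional (- β x p) (dual x)

      degree : Functional m
      degree = functional (+ 1) (λ _ → + 0)

      q-last : Functional m
      q-last = lin {n = suc k} (λ { zero → + 1 ; (suc i) → - (+ 1) }) (λ { zero → degree ; (suc i) → centred (ι i) })

      frame-Q : Fin m → Functional m
      frame-Q = snoc (λ i → centred (ι i)) q-last

      centred-value : ∀ x z t → centred x ⟨ z , t ⟩ ≡ β x (shift z t)
      centred-value x z t = sym (begin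
        sumℤ (λ s → dual x s * (z s - t * p s))                         ≡⟨ S-cong (λ s → dist (dual x s) (z s) t (p s)) ⟩
        sumℤ (λ s → dual x s * z s + - t * (dual x s * p s))            ≡⟨ S-+ (λ s → dual x s * z s) (λ s → - t * (dual x s * p s)) ⟩
        sumℤ (λ s → dual x s * z s) + sumℤ (λ s → - t * (dual x s * p s)) ≡⟨ cong (λ v → sumℤ (λ s → dual x s * z s) + v) (sym (S-*ˡ (- t) λ s → dual x s * p s)) ⟩
        sumℤ (λ s → dual x s * z s) + - t * β x p                       ≡⟨ swap (sumℤ (λ s → dual x s * z s)) t (β x p) ⟩
        centred x ⟨ z , t ⟩                                             ∎)
        where
        open ≡-Reasoning
        dist : ∀ d z t p → d * (z - t * p) ≡ d * z + - t * (d * p)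
        dist = solve-∀
        swap : ∀ a t b → a + - t * b ≡ - b * t + a
        swap = solve-∀

      last-value : ∀ z t → q-last ⟨ z , t ⟩ ≡ t - sumℤ (λ i → centred (ι i) ⟨ z , t ⟩)
      last-value z t = trans (lin-value {n = suc k} (λ { zero → + 1 ; (suc i) → - (+ 1) }) (λ { zero → degree ; (suc i) → centred (ι i) }) z t)
        (cong₂ _+_ (trans (*-identityˡ (degree ⟨ z , t ⟩)) (trans (cong₂ _+_ (*-identityˡ t) (S-zero λ s → *-zeroˡ (z s))) (+-identityʳ t)))
          (trans (sym (S-*ˡ (- (+ 1)) λ i → centred (ι i) ⟨ z , t ⟩)) (minus (sumℤ λ i → centred (ι i) ⟨ z , t ⟩))))
        where
        minus : ∀ a → - (+ 1) * a ≡ - a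
        minus = solve-∀

      inject₁-value : ∀ i z t → frame-Q (inject₁ i) ⟨ z , t ⟩ ≡ centred (ι i) ⟨ z , t ⟩
      inject₁-value i z t = cong (_⟨ z , t ⟩) (snoc-inject₁ (λ i → centred (ι i)) q-last i)

      fromℕ-value : ∀ z t → frame-Q (fromℕ k) ⟨ z , t ⟩ ≡ t - sumℤ (λ i → centred (ι i) ⟨ z , t ⟩)
      fromℕ-value z t = trans (cong (_⟨ z , t ⟩) (snoc-fromℕ (λ i → centred (ι i)) q-last)) (last-value z t)

      split-basis : ∀ (F : Fin m → ℤ) → sumℤ F ≡ F j + sumℤ (λ i → F (ι i))
      split-basis F = trans (S-remove j F) (cong (λ v → F j + v) (trans (S-permute (λ i → F (punchIn j i)) (proj₁ (proj₂ (proj₂ missing)))) (S-cong λ i → cong F (proj₂ (proj₂ (proj₂ missing)) i))))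

      comb-shift : ∀ (x : Fin m → ℤ) s → combℤ x w s ≡ combℤ (λ i → x (inject₁ i)) (λ i → b (ι i)) s + sumℤ x * p s
      comb-shift x s = begin
        combℤ x w s                                                              ≡⟨ S-last (λ l → x l * w l s) ⟩
        sumℤ (λ i → x (inject₁ i) * w (inject₁ i) s) + x (fromℕ k) * p s ≡⟨ cong (λ v → v + x (fromℕ k) * p s) (trans (S-cong λ i → trans (cong (x (inject₁ i) *_) (w≡ i)) (dist (x (inject₁ i)) (b (ι i) s) (p s))) (S-+ (λ i → x (inject₁ i) * b (ι i) s) (λ i → x (inject₁ i) * p s))) ⟩
        C + sumℤ (λ i → x (inject₁ i) * p s) + x (fromℕ k) * p s ≡⟨ cong (λ v → C + v + x (fromℕ k) * p s) (sym (S-*ʳ (p s) λ i → x (inject₁ i))) ⟩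
        C + sumℤ (λ i → x (inject₁ i)) * p s + x (fromℕ k) * p s ≡⟨ factor C (sumℤ λ i → x (inject₁ i)) (p s) (x (fromℕ k)) ⟩
        C + (sumℤ (λ i → x (inject₁ i)) + x (fromℕ k)) * p s                     ≡⟨ cong (λ v → C + v * p s) (sym (S-last x)) ⟩
        C + sumℤ x * p s                                                         ∎
        where
        open ≡-Reasoning
        C = combℤ (λ i → x (inject₁ i)) (λ i → b (ι i)) s
        restore : ∀ a b → a ≡ a - b + b
        restore = solve-∀
        w≡ : ∀ i → w (inject₁ i) s ≡ b (ι i) s + p s
        w≡ i = trans (restore (w (inject₁ i) s) (p s)) (cong (λ u → u s + p s) (sym (b-ι i)))
        dist : ∀ x b p → x * (b + p) ≡ x * b + x * p
        dist = solve-∀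
        factor : ∀ c a p l → c + a * p + l * p ≡ c + (a + l) * p
        factor = solve-∀

      frame-total : ∀ z t → sumℤ (λ l → frame-Q l ⟨ z , t ⟩) ≡ t
      frame-total z t = trans (S-last (λ l → frame-Q l ⟨ z , t ⟩)) (trans (cong₂ _+_ (S-cong λ i → inject₁-value i z t) (fromℕ-value z t)) (cancel (sumℤ λ i → centred (ι i) ⟨ z , t ⟩) t))
        where
        cancel : ∀ a t → a + (t - a) ≡ t
        cancel = solve-∀

      frame-expand : ∀ z t s → combℤ (λ l → frame-Q l ⟨ z , t ⟩) w s + (centred j ⟨ z , t ⟩) * b j s ≡ z s
      frame-expand z t s = begin
        combℤ (λ l → frame-Q l ⟨ z , t ⟩) w s + (centred j ⟨ z , t ⟩) * b j s
          ≡⟨ cong₂ _+_ (comb-shift (λ l → frame-Q l ⟨ z , t ⟩) s) (cong (_* b j s) (centred-value j z t)) ⟩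
        combℤ (λ i → frame-Q (inject₁ i) ⟨ z , t ⟩) (λ i → b (ι i)) s + sumℤ (λ l → frame-Q l ⟨ z , t ⟩) * p s + β j d * b j s
          ≡⟨ cong₂ (λ u v → u + v * p s + β j d * b j s) (S-cong λ i → cong (_* b (ι i) s) (trans (inject₁-value i z t) (centred-value (ι i) z t))) (frame-total z t) ⟩
        sumℤ (λ i → β (ι i) d * b (ι i) s) + t * p s + β j d * b j s
          ≡⟨ swap (sumℤ λ i → β (ι i) d * b (ι i) s) (t * p s) (β j d * b j s) ⟩
        β j d * b j s + sumℤ (λ i → β (ι i) d * b (ι i) s) + t * p s
          ≡⟨ cong (λ v → v + t * p s) (trans (sym (split-basis λ x → β x d * b x s)) (β-expand d s)) ⟩
        z s - t * p s + t * p s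
          ≡⟨ restore (z s) (t * p s) ⟩
        z s ∎
        where
        open ≡-Reasoning
        d = shift z t
        swap : ∀ a b c → a + b + c ≡ c + a + b
        swap = solve-∀
        restore : ∀ a b → a - b + b ≡ a
        restore = solve-∀

      module _ (z : Pt m) (t : ℤ) (x : Fin m → ℤ) (y : ℤ) (sum-x : sumℤ x ≡ t) (rep : ∀ s → combℤ x w s + y * b j s ≡ z s) where

        shifted : ∀ s → shift z t s ≡ combℤ (λ i → x (inject₁ i)) (λ i → b (ι i)) s + y * b j s
        shifted s = trans (cong₂ _-_ (trans (sym (rep s)) (cong (λ v → v + y * b j s) (trans (comb-shift x s) (cong (λ v → C + v * p s) sum-x)))) refl) (cancel C (t * p s) (y * b j s))
          where
          C = combℤ (λ i → x (inject₁ i)) (λ i → b (ι i)) s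
          cancel : ∀ c a b → c + a + b - a ≡ c + b
          cancel = solve-∀

        β-shift : ∀ u → β u (shift z t) ≡ sumℤ (λ i → x (inject₁ i) * unitVec (ι i) u) + y * unitVec j u
        β-shift u = trans (β-affine u (shift z t) (λ i → x (inject₁ i)) (λ i → b (ι i)) y (b j) shifted)
          (cong₂ (λ a c → a + y * c) (S-cong λ i → cong (x (inject₁ i) *_) (β-dual u (ι i))) (β-dual u j))

        coord-ι : ∀ i → centred (ι i) ⟨ z , t ⟩ ≡ x (inject₁ i)
        coord-ι i = trans (centred-value (ι i) z t) (trans (β-shift (ι i)) (trans (cong₂ _+_
          (trans (S-single i λ i′ i′≢i → trans (cong (x (inject₁ i′) *_) (unitVec-other λ e → i′≢i (inj e))) (*-zeroʳ (x (inject₁ i′)))) (trans (cong (x (inject₁ i) *_) (unitVec-same (ι i))) (*-identityʳ (x (inject₁ i)))))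
          (trans (cong (y *_) (unitVec-other λ e → proj₁ (proj₂ missing) i (sym e))) (*-zeroʳ y))) (+-identityʳ (x (inject₁ i)))))

        coord-j : centred j ⟨ z , t ⟩ ≡ y
        coord-j = trans (centred-value j z t) (trans (β-shift j) (trans (cong₂ _+_
          (S-zero λ i → trans (cong (x (inject₁ i) *_) (unitVec-other (proj₁ (proj₂ missing) i))) (*-zeroʳ (x (inject₁ i))))
          (trans (cong (y *_) (unitVec-same j)) (*-identityʳ y))) (+-identityˡ y)))

        coord-all : ∀ l → frame-Q l ⟨ z , t ⟩ ≡ x l
        coord-all = initial-or-last (λ l → frame-Q l ⟨ z , t ⟩ ≡ x l) (λ i → trans (inject₁-value i z t) (coord-ι i))
          (trans (fromℕ-value z t) (trans (cong₂ _-_ (trans (sym sum-x) (S-last x)) (S-cong coord-ι)) (cancel (sumℤ λ i → x (inject₁ i)) (x (fromℕ k)))))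
          where
          cancel : ∀ a b → a + b - a ≡ b
          cancel = solve-∀

    abstract
      -- The edges from the last vertex p, with the remaining basis vector as `normal`, form a
      -- lattice basis. The coordinates of z - tp in it are `L` and all coefficients but the one at
      -- p, which is then fixed by the sum t.
      frame : AffineFrame w
      frame = record
        { normal = b j
        ; Q      = frame-Q
        ; L      = centred j
        ; total  = frame-total
        ; expand = frame-expand
        ; coords = λ z t x y sum-x rep → coord-all z t x y sum-x rep , coord-j z t x y sum-x rep
        }

-- The cyclic quotient of the lattice by the vertex lattice.

module Simplex where

  open import Data.Empty using (⊥-elim)
  open import Data.Fin using (Fin; zero; suc; punchIn; punchOut)
  open import Data.Fin.Properties using (_≟_; punchIn-punchOut)
  open import Data.Integer.Base using (ℤ; +_; -[1+_]; _+_; _*_; _-_; -_)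
  open import Data.Integer.Properties using (*-zeroˡ; *-identityˡ; +-identityʳ)
  open import Data.Integer.Tactic.RingSolver using (solve-∀)
  open import Data.Nat.Base as ℕ using (ℕ; zero; suc)
  open import Data.Product using (∃; _×_; _,_; proj₁; proj₂)
  open import Relation.Binary.PropositionalEquality using (_≡_; _≢_; refl; sym; trans; cong; cong₂; subst; module ≡-Reasoning)
  open import Relation.Nullary using (Dec; yes; no)
  open import Defs
  open FinSum
  open Rationals using (affIndep-ℤ)
  open Frame
  open Sℤ

  -- ℤ^m is spanned by the vertices and Γ, and nΓ = Σ aᵢ vᵢ: modulo the vertex lattice, ℤ^m is cyclic of order n.
  record CyclicQuotient {m} (v : Fin (suc m) → Pt m) : Set where
    field
      n-1    : ℕ
      a      : Fin (suc m) → ℤ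
      a-zero : a zero ≡ + 1
      a-sum  : sumℤ a ≡ + 0
      Γ      : Pt m
      nΓ     : ∀ s → + suc n-1 * Γ s ≡ combℤ a v s
      q      : Fin (suc m) → Functional m
      L      : Functional m
      q-zero : ∀ z t → q zero ⟨ z , t ⟩ ≡ + 0
      total  : ∀ z t → sumℤ (λ i → q i ⟨ z , t ⟩) ≡ t
      expand : ∀ z t s → combℤ (λ i → q i ⟨ z , t ⟩) v s + (L ⟨ z , t ⟩) * Γ s ≡ z s
      coords : ∀ z t x y → x zero ≡ + 0 → sumℤ x ≡ t → (∀ s → combℤ x v s + y * Γ s ≡ z s) → (∀ i → q i ⟨ z , t ⟩ ≡ x i) × L ⟨ z , t ⟩ ≡ y

  module _ {k} (v : Fin (suc (suc k)) → Pt (suc k)) (indep : AffIndep v) (basic : IsBasic (λ i → v (suc i))) where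

    private
      m = suc k
      open module F = AffineFrame (frame (λ i → v (suc i)) basic) using (Q; normal)

      -- The signed lattice distance of the first vertex from the opposite facet. As that facet is
      -- basic, its absolute value n is the normalised volume of the simplex.
      height : ℤ
      height = F.L ⟨ v zero , + 1 ⟩

      a : Fin (suc m) → ℤ
      a zero    = + 1
      a (suc i) = - (Q i ⟨ v zero , + 1 ⟩)

      a-sum : sumℤ a ≡ + 0
      a-sum = trans (cong (λ x → + 1 + x) (trans (S-cong λ i → minus (Q i ⟨ v zero , + 1 ⟩)) (trans (sym (S-*ˡ (- (+ 1)) λ i → Q i ⟨ v zero , + 1 ⟩)) (cong (- (+ 1) *_) (F.total (v zero) (+ 1)))))) refl
        where
        minus : ∀ x → - x ≡ - (+ 1) * x
        minus = solve-∀

      relation : ∀ s → combℤ a v s ≡ height * normal s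
      relation s = begin
        + 1 * v zero s + sumℤ (λ i → - (Q i ⟨ v zero , + 1 ⟩) * v (suc i) s) ≡⟨ cong₂ _+_ (*-identityˡ (v zero s)) (trans (S-cong λ i → minus (Q i ⟨ v zero , + 1 ⟩) (v (suc i) s)) (sym (S-*ˡ (- (+ 1)) λ i → (Q i ⟨ v zero , + 1 ⟩) * v (suc i) s))) ⟩
        v zero s + - (+ 1) * C                     ≡⟨ cong (λ x → x + - (+ 1) * C) (sym (F.expand (v zero) (+ 1) s)) ⟩
        C + height * normal s + - (+ 1) * C        ≡⟨ cancel C (height * normal s) ⟩
        height * normal s                          ∎
        where
        open ≡-Reasoning
        C = combℤ (λ i → Q i ⟨ v zero , + 1 ⟩) (λ i → v (suc i)) s
        minus : ∀ x y → - x * y ≡ - (+ 1) * (x * y)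
        minus = solve-∀
        cancel : ∀ c h → c + h + - (+ 1) * c ≡ h
        cancel = solve-∀

      -- Otherwise `a` would be an affine dependence of the vertices, with coefficient 1 at the
      -- first.
      height≢0 : height ≢ + 0
      height≢0 h≡0 = 1≢0 (affIndep-ℤ {p = v} indep a a-sum (λ s → trans (relation s) (trans (cong (_* normal s) h≡0) (*-zeroˡ (normal s)))) zero)
        where
        1≢0 : + 1 ≢ + 0
        1≢0 ()

      signed : ∀ h → h ≢ + 0 → ∃ λ n → ∃ λ ε → h ≡ + suc n * ε × ε * ε ≡ + 1
      signed (+ zero)   h≢0 = ⊥-elim (h≢0 refl)
      signed (+ suc n)  h≢0 = n , + 1 , one (+ suc n) , refl
        where
        one : ∀ x → x ≡ x * + 1
        one = solve-∀
      signed (-[1+ n ]) h≢0 = n , - (+ 1) , minus (+ suc n) , refl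
        where
        minus : ∀ x → - x ≡ x * - (+ 1)
        minus = solve-∀

      n-1 = proj₁ (signed height height≢0)
      ε   = proj₁ (proj₂ (signed height height≢0))
      h≡  = proj₁ (proj₂ (proj₂ (signed height height≢0)))
      ε²  = proj₂ (proj₂ (proj₂ (signed height height≢0)))

      Γ : Pt m
      Γ s = ε * normal s

      q : Fin (suc m) → Functional m
      q zero    = functional (+ 0) (λ _ → + 0)
      q (suc i) = Q i

      L : Functional m
      L = lin {n = 1} (λ _ → ε) (λ _ → F.L)

      q-zero : ∀ z t → q zero ⟨ z , t ⟩ ≡ + 0
      q-zero z t = cong₂ _+_ (*-zeroˡ t) (S-zero λ s → *-zeroˡ (z s))

      L-value : ∀ z t → L ⟨ z , t ⟩ ≡ ε * (F.L ⟨ z , t ⟩)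
      L-value z t = trans (lin-value {n = 1} (λ _ → ε) (λ _ → F.L) z t) (+-identityʳ _)

      cancel-ε : ∀ x y → ε * x * (ε * y) ≡ x * y
      cancel-ε x y = trans (shape ε x y) (trans (cong (_* (x * y)) ε²) (*-identityˡ (x * y)))
        where
        shape : ∀ e x y → e * x * (e * y) ≡ e * e * (x * y)
        shape = solve-∀

    cyclicQuotient : CyclicQuotient v
    cyclicQuotient = record
      { n-1 = n-1 ; a = a ; a-zero = refl ; a-sum = a-sum ; Γ = Γ ; q = q ; L = L ; q-zero = q-zero
      ; nΓ = λ s → trans (reassoc (+ suc n-1) ε (normal s)) (trans (cong (_* normal s) (sym h≡)) (sym (relation s)))
      ; total = λ z t → trans (cong₂ _+_ (q-zero z t) (F.total z t)) (zero+ t)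
      ; expand = λ z t s → trans (cong₂ _+_ (trans (cong (λ x → x * v zero s + combℤ (λ i → Q i ⟨ z , t ⟩) (λ i → v (suc i)) s) (q-zero z t)) (zero* (v zero s) (combℤ (λ i → Q i ⟨ z , t ⟩) (λ i → v (suc i)) s)))
          (trans (cong (_* Γ s) (L-value z t)) (cancel-ε (F.L ⟨ z , t ⟩) (normal s)))) (F.expand z t s)
      ; coords = coords
      }
      where
      reassoc : ∀ a b c → a * (b * c) ≡ a * b * c
      reassoc = solve-∀
      zero+ : ∀ t → + 0 + t ≡ t
      zero+ = solve-∀
      zero* : ∀ a b → + 0 * a + b ≡ b
      zero* = solve-∀
      coords : ∀ z t x y → x zero ≡ + 0 → sumℤ x ≡ t → (∀ s → combℤ x v s + y * Γ s ≡ z s) → (∀ i → q i ⟨ z , t ⟩ ≡ x i) × L ⟨ z , t ⟩ ≡ y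
      coords z t x y x₀ sum-x rep = (λ { zero → trans (q-zero z t) (sym x₀) ; (suc i) → proj₁ below i }) ,
        trans (L-value z t) (trans (cong (ε *_) (proj₂ below)) (trans (reassoc ε ε y) (trans (cong (_* y) ε²) (*-identityˡ y))))
        where
        shape : ∀ y e b → e * y * b ≡ y * (e * b)
        shape = solve-∀
        below = F.coords z t (λ i → x (suc i)) (ε * y) (trans (sym (zero+ (sumℤ λ i → x (suc i)))) (trans (cong (_+ sumℤ (λ i → x (suc i))) (sym x₀)) sum-x))
          (λ s → trans (cong₂ _+_ (trans (sym (zero* (v zero s) (combℤ (λ i → x (suc i)) (λ i → v (suc i)) s))) (cong (λ u → u * v zero s + combℤ (λ i → x (suc i)) (λ i → v (suc i)) s) (sym x₀))) (shape y ε (normal s))) (rep s))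

  module Divisibility {k} (v : Fin (suc (suc k)) → Pt (suc k)) (basic : ∀ j → IsBasic (λ i → v (punchIn j i))) (C : CyclicQuotient v) where

    open CyclicQuotient C

    n : ℤ
    n = + suc n-1

    -- If n c = r aⱼ, the lattice vector rΓ - c vⱼ lies in the span of the basic facet j, so its coordinates r aᵢ / n are integers.
    divides-multiplier : ∀ j r c → r * a j ≡ n * c → ∃ λ c′ → r ≡ n * c′
    divides-multiplier j r c raⱼ = go (j ≟ zero)
      where
      module F = AffineFrame (frame (λ i → v (punchIn j i)) (basic j))
      z : Pt (suc k)
      z s = r * Γ s - c * v j s
      x : Fin (suc k) → ℤ
      x l = r * a (punchIn j l)
      sum-x : sumℤ x ≡ n * (- c)
      sum-x = trans (sym (S-*ˡ r λ l → a (punchIn j l))) (trans (cong (r *_) (solve-for-rest (a j) (sumℤ λ l → a (punchIn j l)) (trans (sym (S-remove j a)) a-sum)))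
        (trans (neg r (a j)) (trans (cong -_ raⱼ) (neg′ n c))))
        where
        solve-for-rest : ∀ a b → a + b ≡ + 0 → b ≡ - a
        solve-for-rest a b e = trans (shape a b) (trans (cong (_- a) e) (zero- a))
          where
          zero- : ∀ a → + 0 - a ≡ - a
          zero- = solve-∀
          shape : ∀ a b → b ≡ a + b - a
          shape = solve-∀
        neg : ∀ r a → r * - a ≡ - (r * a)
        neg = solve-∀
        neg′ : ∀ n c → - (n * c) ≡ n * - c
        neg′ = solve-∀
      rep : ∀ s → combℤ x (λ i → v (punchIn j i)) s + + 0 * F.normal s ≡ n * z s
      rep s = begin
        combℤ x w s + + 0 * F.normal s                       ≡⟨ drop (combℤ x w s) (F.normal s) ⟩
        combℤ x w s                                          ≡⟨ add-sub (combℤ x w s) (r * a j * v j s) ⟩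
        r * a j * v j s + combℤ x w s - r * a j * v j s      ≡⟨ cong (λ u → u - r * a j * v j s) (sym (S-remove j λ i → r * a i * v i s)) ⟩
        sumℤ (λ i → r * a i * v i s) - r * a j * v j s ≡⟨ cong₂ _-_ (trans (S-cong λ i → assoc r (a i) (v i s)) (sym (S-*ˡ r λ i → a i * v i s))) (cong (_* v j s) raⱼ) ⟩
        r * combℤ a v s - n * c * v j s                      ≡⟨ cong (λ u → r * u - n * c * v j s) (sym (nΓ s)) ⟩
        r * (n * Γ s) - n * c * v j s                        ≡⟨ factor r n (Γ s) c (v j s) ⟩
        n * z s                                              ∎
        where
        open ≡-Reasoning
        w : Fin (suc k) → Pt (suc k)
        w i = v (punchIn j i)
        drop : ∀ a b → a + + 0 * b ≡ a
        drop = solve-∀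
        add-sub : ∀ a b → a ≡ b + a - b
        add-sub = solve-∀
        assoc : ∀ a b c → a * b * c ≡ a * (b * c)
        assoc = solve-∀
        factor : ∀ r n g c v → r * (n * g) - n * c * v ≡ n * (r * g - c * v)
        factor = solve-∀
      quotient : ∀ l → r * a (punchIn j l) ≡ n * (F.Q l ⟨ z , - c ⟩)
      quotient l = trans (sym (proj₁ (F.coords (λ s → n * z s) (n * - c) x (+ 0) sum-x rep) l)) (value-scale (F.Q l) n z (- c))
      one : ∀ x → x ≡ x * + 1
      one = solve-∀
      go : Dec (j ≡ zero) → ∃ λ c′ → r ≡ n * c′
      go (yes refl) = c , trans (one r) (trans (cong (r *_) (sym a-zero)) raⱼ)
      -- The first vertex lies on facet j, and its coordinate is r a₀/n = r/n, because a₀ = 1.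
      go (no j≢0)   = F.Q (punchOut j≢0) ⟨ z , - c ⟩ , trans (one r) (trans (cong (r *_) (sym a-zero)) (subst (λ i → r * a i ≡ n * (F.Q (punchOut j≢0) ⟨ z , - c ⟩)) (punchIn-punchOut j≢0) (quotient (punchOut j≢0))))

-- Empty interiors force balanced residues.

module Balance where

  open import Data.Empty using (⊥; ⊥-elim)
  open import Data.Fin using (Fin; zero; suc; punchIn)
  open import Data.Integer.Base as ℤ using (ℤ; +_; -[1+_]; _+_; _*_; _-_; -_)
  open import Data.Integer.DivMod using (_/ℕ_; _%ℕ_; a≡a%ℕn+[a/ℕn]*n)
  import Data.Integer.Properties as ℤ
  open import Data.Integer.Tactic.RingSolver using (solve-∀)
  open import Data.Nat.Base as ℕ using (ℕ; zero; suc; s≤s; z≤n; _%_; _/_; _∸_)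
  open import Data.Nat.Coprimality using (Coprime)
  open import Data.Nat.Divisibility using (divides)
  open import Data.Nat.DivMod using (m≡m%n+[m/n]*n; m*n%n≡0; m%n<n)
  import Data.Nat.Properties as ℕ
  import Data.Nat.Tactic.RingSolver as ℕR
  open import Data.Product using (∃; _×_; _,_; proj₁; proj₂)
  import Data.Rational as ℚ
  import Data.Rational.Properties as ℚ
  open import Relation.Binary.PropositionalEquality using (_≡_; _≢_; refl; sym; trans; cong; cong₂; subst; module ≡-Reasoning)
  open import Relation.Nullary using (Dec; yes; no)
  import Tactic.RingSolver as ℚR
  open import Defs
  open Kit using (ringℚ; inv; inv>0; *-inv⁺; *>0)
  open Sums using (ℕ∑)
  open Mod
  open HarmonicMean using (complement⇒)
  open UnitPairing using (clamp)
  open FinSum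
  open Rationals
  open Frame
  open Simplex
  open Sℤ

  ℕ∑-clamp : ∀ {N} (f : Fin (suc N) → ℕ) → + ℕ∑ (suc N) (λ i → f (clamp i)) ≡ sumℤ (λ i → + f i)
  ℕ∑-clamp {zero}  f = refl
  ℕ∑-clamp {suc N} f = cong (λ z → + f zero + z) (ℕ∑-clamp (λ i → f (suc i)))

  sum-pos : ∀ {N} (f : Fin (suc N) → ℕ) → (∀ i → 0 ℕ.< f i) → ∃ λ F → sumℤ (λ i → + f i) ≡ + suc F
  sum-pos {N} f f>0 with f zero | f>0 zero
  ... | suc f₀ | _ = f₀ ℕ.+ proj₁ (natural (λ i → f (suc i))) , cong (λ z → + suc f₀ + z) (proj₂ (natural (λ i → f (suc i))))
    where
    natural : ∀ {n} (g : Fin n → ℕ) → ∃ λ G → sumℤ (λ i → + g i) ≡ + G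
    natural {zero}  g = 0 , refl
    natural {suc n} g = g zero ℕ.+ proj₁ (natural (λ i → g (suc i))) , cong (λ z → + g zero + z) (proj₂ (natural (λ i → g (suc i))))

  sum-const : ∀ {n} x → sumℤ {n} (λ _ → x) ≡ + n * x
  sum-const {zero}  x = sym (ℤ.*-zeroˡ x)
  sum-const {suc n} x = trans (cong (λ z → x + z) (sum-const {n} x)) (sym (ℤ.suc-* (+ n) x))

  positive-factor : ∀ {n F} T → + suc F ≡ + suc n * T → ∃ λ t → T ≡ + suc t
  positive-factor {n} (+ zero) e = ⊥-elim (absurd (trans e (ℤ.*-zeroʳ (+ suc n))))
    where
    absurd : ∀ {F} → + suc F ≡ + 0 → ⊥
    absurd ()
  positive-factor (+ suc t)  e = t , refl
  positive-factor (-[1+ t ]) ()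

  module _ (e : ℕ) (v : Fin (suc (suc (e ℕ.+ e))) → Pt (suc (e ℕ.+ e))) (basic : ∀ j → IsBasic (λ i → v (punchIn j i)))
    (C : CyclicQuotient v) (empty : NoInteriorPoints e v) where

    private
      open CyclicQuotient C
      open Divisibility v basic C using (divides-multiplier)

      nℕ : ℕ
      nℕ = suc n-1

      n : ℤ
      n = + nℕ

      N m : ℕ
      m = suc (e ℕ.+ e)
      N = suc m

      natural-multiple : ∀ {r c} → + r ≡ n * c → r ≡ nℕ ℕ.* ℤ.∣ c ∣
      natural-multiple {c = c} eq = trans (cong ℤ.∣_∣ eq) (ℤ.abs-* n c)

      -- The lattice point x = rΓ - Σ cᵢvᵢ satisfies nx = Σ fᵢvᵢ. Since Σ aᵢ = 0, the sum of the fᵢ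
      -- is a multiple nt, and x lies in Int(tΔ) with barycentric weights fᵢ/(nt). By hypothesis t
      -- cannot be below d.
      degree-bound : ∀ r (f : Fin N → ℕ) (c : Fin N → ℤ) → (∀ i → r * a i ≡ + f i + n * c i) → (∀ i → 0 ℕ.< f i) →
                     ∃ λ t → sumℤ (λ i → + f i) ≡ n * + t × suc e ℕ.≤ t
      degree-bound r f c eq f>0 = suc t , sum-f′ , ℕ.≰⇒> λ t≤e → empty (suc t) (s≤s z≤n) t≤e x (weights , weights>0 , weights-sum , weights-comb)
        where
        remainder : ∀ i → + f i ≡ r * a i + - n * c i
        remainder i = trans (shape (+ f i) n (c i)) (cong (λ z → z + - n * c i) (sym (eq i)))
          where
          shape : ∀ f n c → f ≡ f + n * c + - n * c
          shape = solve-∀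
        x : Pt m
        x s = r * Γ s - combℤ c v s
        sum-f : sumℤ (λ i → + f i) ≡ n * - sumℤ c
        sum-f = begin
          sumℤ (λ i → + f i)                             ≡⟨ trans (S-cong remainder) (S-+ (λ i → r * a i) (λ i → - n * c i)) ⟩
          sumℤ (λ i → r * a i) + sumℤ (λ i → - n * c i)  ≡⟨ sym (cong₂ _+_ (S-*ˡ r a) (S-*ˡ (- n) c)) ⟩
          r * sumℤ a + - n * sumℤ c                      ≡⟨ cong (λ z → r * z + - n * sumℤ c) a-sum ⟩
          r * + 0 + - n * sumℤ c                         ≡⟨ shape r n (sumℤ c) ⟩
          n * - sumℤ c                                   ∎
          where
          open ≡-Reasoning
          shape : ∀ r n c → r * + 0 + - n * c ≡ n * - c
          shape = solve-∀
        degree : ∃ λ t → - sumℤ c ≡ + suc t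
        degree = positive-factor {n-1} (- sumℤ c) (trans (sym (proj₂ (sum-pos f f>0))) sum-f)
        t = proj₁ degree
        sum-f′ : sumℤ (λ i → + f i) ≡ n * + suc t
        sum-f′ = trans sum-f (cong (n *_) (proj₂ degree))
        nx : ∀ s → sumℤ (λ i → + f i * v i s) ≡ n * x s
        nx s = begin
          sumℤ (λ i → + f i * v i s) ≡⟨ S-cong (λ i → trans (cong (_* v i s) (remainder i)) (dist r (a i) n (c i) (v i s))) ⟩
          sumℤ (λ i → r * (a i * v i s) + - n * (c i * v i s)) ≡⟨ S-+ (λ i → r * (a i * v i s)) (λ i → - n * (c i * v i s)) ⟩
          sumℤ (λ i → r * (a i * v i s)) + sumℤ (λ i → - n * (c i * v i s)) ≡⟨ sym (cong₂ _+_ (S-*ˡ r λ i → a i * v i s) (S-*ˡ (- n) λ i → c i * v i s)) ⟩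
          r * combℤ a v s + - n * combℤ c v s                                    ≡⟨ cong (λ z → r * z + - n * combℤ c v s) (sym (nΓ s)) ⟩
          r * (n * Γ s) + - n * combℤ c v s                                      ≡⟨ factor r n (Γ s) (combℤ c v s) ⟩
          n * x s                                                                ∎
          where
          open ≡-Reasoning
          dist : ∀ r a n c v → (r * a + - n * c) * v ≡ r * (a * v) + - n * (c * v)
          dist = solve-∀
          factor : ∀ r n g c → r * (n * g) + - n * c ≡ n * (r * g - c)
          factor = solve-∀
        D I : ℚ.ℚ
        D = ℤ→ℚ n ℚ.* ℤ→ℚ (+ suc t)
        I = inv D
        D>0 : ℚ.0ℚ ℚ.< D
        D>0 = *>0 (ℤ→ℚ>0 n-1) (ℤ→ℚ>0 t)
        weights : Fin N → ℚ.ℚ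
        weights i = ℤ→ℚ (+ f i) ℚ.* I
        f>0′ : ∀ k → 0 ℕ.< k → ℚ.0ℚ ℚ.< ℤ→ℚ (+ k)
        f>0′ (suc k) _ = ℤ→ℚ>0 k
        weights>0 : ∀ i → ℚ.0ℚ ℚ.< weights i
        weights>0 i = *>0 (f>0′ (f i) (f>0 i)) (inv>0 D>0)
        weights-sum : sumℚ weights ≡ ℚ.1ℚ
        weights-sum = begin
          sumℚ weights                          ≡⟨ sym (Sℚ.S-*ʳ I λ i → ℤ→ℚ (+ f i)) ⟩
          sumℚ (λ i → ℤ→ℚ (+ f i)) ℚ.* I        ≡⟨ cong (ℚ._* I) (sym (ℤ→ℚ-sum λ i → + f i)) ⟩
          ℤ→ℚ (sumℤ λ i → + f i) ℚ.* I          ≡⟨ cong (λ z → ℤ→ℚ z ℚ.* I) sum-f′ ⟩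
          ℤ→ℚ (n * + suc t) ℚ.* I               ≡⟨ cong (ℚ._* I) (ℤ→ℚ-* n (+ suc t)) ⟩
          D ℚ.* I                               ≡⟨ *-inv⁺ D>0 ⟩
          ℚ.1ℚ                                  ∎
          where open ≡-Reasoning
        weights-comb : ∀ s → ℕ→ℚ (suc t) ℚ.* combℚ weights (λ i → toQ (v i)) s ≡ ℤ→ℚ (x s)
        weights-comb s = begin
          K ℚ.* sumℚ (λ i → ℤ→ℚ (+ f i) ℚ.* I ℚ.* V i) ≡⟨ cong (K ℚ.*_) (trans (Sℚ.S-cong λ i → swap (ℤ→ℚ (+ f i)) I (V i)) (sym (Sℚ.S-*ʳ I λ i → ℤ→ℚ (+ f i) ℚ.* V i))) ⟩
          K ℚ.* (sumℚ (λ i → ℤ→ℚ (+ f i) ℚ.* V i) ℚ.* I) ≡⟨ cong (λ z → K ℚ.* (z ℚ.* I)) (trans (sym (ℤ→ℚ-dot (λ i → + f i) (λ i → v i s))) (trans (cong ℤ→ℚ (nx s)) (ℤ→ℚ-* n (x s)))) ⟩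
          K ℚ.* (ℤ→ℚ n ℚ.* X ℚ.* I)                         ≡⟨ collect K (ℤ→ℚ n) X I ⟩
          ℤ→ℚ n ℚ.* K ℚ.* I ℚ.* X                           ≡⟨ trans (cong (ℚ._* X) (*-inv⁺ D>0)) (ℚ.*-identityˡ X) ⟩
          X                                                 ∎
          where
          open ≡-Reasoning
          K = ℤ→ℚ (+ suc t)
          X = ℤ→ℚ (x s)
          V : Fin N → ℚ.ℚ
          V i = ℤ→ℚ (v i s)
          swap : ∀ f i v → f ℚ.* i ℚ.* v ≡ f ℚ.* v ℚ.* i
          swap = ℚR.solve-∀ ringℚ
          collect : ∀ k n x i → k ℚ.* (n ℚ.* x ℚ.* i) ≡ n ℚ.* k ℚ.* i ℚ.* x
          collect = ℚR.solve-∀ ringℚ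

    residue : Fin N → ℕ
    residue i = a i %ℕ nℕ

    private
      a≡ : ∀ i → a i ≡ + residue i + (a i /ℕ nℕ) * n
      a≡ i = a≡a%ℕn+[a/ℕn]*n (a i) nℕ

      division : ∀ x → + x ≡ + (x % nℕ) + + (x / nℕ) * n
      division x = trans (cong +_ (m≡m%n+[m/n]*n x nℕ)) (cong (λ z → + (x % nℕ) + z) (ℤ.pos-* (x / nℕ) nℕ))

    -- If d divides both aᵢ and n = ud, then n divides u aᵢ, so n divides u by `divides-multiplier`,
    -- which forces d = 1.
    residue-coprime : ∀ i → Coprime (residue i) nℕ
    residue-coprime i {d} (divides w A≡ , divides u n≡) = go (divides-multiplier i (+ u) (+ w + + u * (a i /ℕ nℕ)) multiple)
      where
      multiple : + u * a i ≡ n * (+ w + + u * (a i /ℕ nℕ))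
      multiple = begin
        + u * a i ≡⟨ cong (+ u *_) (trans (a≡ i) (cong (λ z → z + (a i /ℕ nℕ) * n) (trans (cong +_ A≡) (ℤ.pos-* w d)))) ⟩
        + u * (+ w * + d + (a i /ℕ nℕ) * n)               ≡⟨ shape (+ u) (+ w) (+ d) (a i /ℕ nℕ) n ⟩
        + w * (+ u * + d) + + u * (a i /ℕ nℕ) * n ≡⟨ cong (λ z → + w * z + + u * (a i /ℕ nℕ) * n) (trans (sym (ℤ.pos-* u d)) (cong +_ (sym n≡))) ⟩
        + w * n + + u * (a i /ℕ nℕ) * n                   ≡⟨ factor (+ w) n (+ u * (a i /ℕ nℕ)) ⟩
        n * (+ w + + u * (a i /ℕ nℕ))                     ∎
        where
        open ≡-Reasoning
        shape : ∀ u w d q n → u * (w * d + q * n) ≡ w * (u * d) + u * q * n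
        shape = solve-∀
        factor : ∀ w n x → w * n + x * n ≡ n * (w + x)
        factor = solve-∀
      go : (∃ λ c → + u ≡ n * c) → d ≡ 1
      go (c , eq) = ℕ.m*n≡1⇒m≡1 d ℤ.∣ c ∣ (sym (ℕ.*-cancelˡ-≡ 1 (d ℕ.* ℤ.∣ c ∣) u {{ℕ.≢-nonZero u≢0}}
          (trans (ℕ.*-identityʳ u) (trans (natural-multiple {u} {c} eq) (trans (cong (ℕ._* ℤ.∣ c ∣) n≡) (ℕ.*-assoc u d ℤ.∣ c ∣))))))
        where
        u≢0 : u ≢ 0
        u≢0 refl = ℕ.1+n≢0 n≡

    module _ (r : ℕ) where
      private
        F F′ : Fin N → ℕ
        F i  = r ℕ.* residue i % nℕ
        F′ i = r ℕ.* ((nℕ ∸ 1) ℕ.* residue i) % nℕ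

        c c′ : Fin N → ℤ
        c i  = + (r ℕ.* residue i / nℕ) + + r * (a i /ℕ nℕ)
        c′ i = + (r ℕ.* (n-1 ℕ.* residue i) / nℕ) - + r * + residue i - + r * (a i /ℕ nℕ)

        eq : ∀ i → + r * a i ≡ + F i + n * c i
        eq i = begin
          + r * a i                                                  ≡⟨ cong (+ r *_) (a≡ i) ⟩
          + r * (A + k * n)                                          ≡⟨ dist (+ r) A (k * n) ⟩
          + r * A + + r * (k * n) ≡⟨ cong (λ z → z + + r * (k * n)) (trans (sym (ℤ.pos-* r (residue i))) (division (r ℕ.* residue i))) ⟩
          + F i + + (r ℕ.* residue i / nℕ) * n + + r * (k * n)       ≡⟨ shape (+ F i) (+ (r ℕ.* residue i / nℕ)) n (+ r) k ⟩
          + F i + n * c i                                            ∎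
          where
          open ≡-Reasoning
          A = + residue i
          k = a i /ℕ nℕ
          dist : ∀ r a b → r * (a + b) ≡ r * a + r * b
          dist = solve-∀
          shape : ∀ f q n r k → f + q * n + r * (k * n) ≡ f + n * (q + r * k)
          shape = solve-∀

        eq′ : ∀ i → - + r * a i ≡ + F′ i + n * c′ i
        eq′ i = begin
          - + r * a i                                                ≡⟨ cong (- + r *_) (a≡ i) ⟩
          - + r * (A + k * n)                                        ≡⟨ expand′ (+ r) A k (+ n-1) ⟩
          + r * (+ n-1 * A) + n * (- (+ r * A) - + r * k) ≡⟨ cong (λ z → z + n * (- (+ r * A) - + r * k)) (trans (sym (trans (ℤ.pos-* r (n-1 ℕ.* residue i)) (cong (+ r *_) (ℤ.pos-* n-1 (residue i))))) (division (r ℕ.* (n-1 ℕ.* residue i)))) ⟩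
          + F′ i + + Q′ * n + n * (- (+ r * A) - + r * k)            ≡⟨ shape (+ F′ i) (+ Q′) n (+ r) A k ⟩
          + F′ i + n * c′ i                                          ∎
          where
          open ≡-Reasoning
          A = + residue i
          k = a i /ℕ nℕ
          Q′ = r ℕ.* (n-1 ℕ.* residue i) / nℕ
          expand′ : ∀ r a k p → - r * (a + k * (+ 1 + p)) ≡ r * (p * a) + (+ 1 + p) * (- (r * a) - r * k)
          expand′ = solve-∀
          shape : ∀ f q n r a k → f + q * n + n * (- (r * a) - r * k) ≡ f + n * (q - r * a - r * k)
          shape = solve-∀

        zero-case : r % nℕ ≡ 0 → ∀ x → r ℕ.* x % nℕ ≡ 0
        zero-case r≡0 x = *-mod nℕ {r} {0} {x} {x} r≡0 refl

        module _ (r≢0 : r % nℕ ≢ 0) where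

          F>0 : ∀ i → 0 ℕ.< F i
          F>0 i = ℕ.n≢0⇒n>0 λ F≡0 → r≢0 (multiple (divides-multiplier i (+ r) (c i) (trans (eq i) (trans (cong (λ z → + z + n * c i) F≡0) (ℤ.+-identityˡ (n * c i))))))
            where
            multiple : (∃ λ c → + r ≡ n * c) → r % nℕ ≡ 0
            multiple (c , e) = trans (cong (_% nℕ) (trans (natural-multiple {r} {c} e) (ℕ.*-comm nℕ ℤ.∣ c ∣))) (m*n%n≡0 ℤ.∣ c ∣ nℕ)

          F′≡ : ∀ i → F′ i ≡ nℕ ∸ F i
          F′≡ i = complement⇒ nℕ (r ℕ.* (n-1 ℕ.* residue i)) (F>0 i) (m%n<n (r ℕ.* residue i) nℕ)
            (trans (+-mod nℕ {r ℕ.* (n-1 ℕ.* residue i)} {r ℕ.* (n-1 ℕ.* residue i)} {F i} {r ℕ.* residue i} refl (%-mod nℕ (r ℕ.* residue i)))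
              (trans (cong (_% nℕ) (shape r n-1 (residue i))) (m*n%n≡0 (r ℕ.* residue i) nℕ)))
            where
            shape : ∀ r p x → r ℕ.* (p ℕ.* x) ℕ.+ r ℕ.* x ≡ r ℕ.* x ℕ.* (1 ℕ.+ p)
            shape = ℕR.solve-∀

          F′>0 : ∀ i → 0 ℕ.< F′ i
          F′>0 i = subst (0 ℕ.<_) (sym (F′≡ i)) (ℕ.m<n⇒0<n∸m (m%n<n (r ℕ.* residue i) nℕ))

          -- The sums for r and -r are nt and nt′ with t, t′ ≥ d. The residues add up to n in each
          -- of the 2d places, so t + t′ = 2d, and both equal d.
          sums-agree : sumℤ (λ i → + F i) ≡ sumℤ (λ i → + F′ i)
          sums-agree = go (degree-bound (+ r) F c eq F>0) (degree-bound (- + r) F′ c′ eq′ F′>0)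
            where
            go : (∃ λ t → sumℤ (λ i → + F i) ≡ n * + t × suc e ℕ.≤ t) → (∃ λ t → sumℤ (λ i → + F′ i) ≡ n * + t × suc e ℕ.≤ t) → sumℤ (λ i → + F i) ≡ sumℤ (λ i → + F′ i)
            go (t , sum-t , d≤t) (t′ , sum-t′ , d≤t′) = trans sum-t (trans (cong (λ z → n * + z) t≡t′) (sym sum-t′))
              where
              t+t′ : t ℕ.+ t′ ≡ N
              t+t′ = ℤ.+-injective (ℤ.*-cancelˡ-≡ n (+ (t ℕ.+ t′)) (+ N) (begin
                n * (+ t + + t′)                                ≡⟨ ℤ.*-distribˡ-+ n (+ t) (+ t′) ⟩
                n * + t + n * + t′                              ≡⟨ sym (cong₂ _+_ sum-t sum-t′) ⟩
                sumℤ (λ i → + F i) + sumℤ (λ i → + F′ i)        ≡⟨ sym (S-+ (λ i → + F i) (λ i → + F′ i)) ⟩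
                sumℤ (λ i → + (F i ℕ.+ F′ i)) ≡⟨ S-cong (λ i → cong +_ (trans (cong (F i ℕ.+_) (F′≡ i)) (ℕ.m+[n∸m]≡n (ℕ.<⇒≤ (m%n<n (r ℕ.* residue i) nℕ))))) ⟩
                sumℤ {N} (λ i → n)                              ≡⟨ sum-const {N} n ⟩
                + N * n                                         ≡⟨ ℤ.*-comm (+ N) n ⟩
                n * + N                                         ∎))
                where open ≡-Reasoning
              N≡ : N ≡ suc e ℕ.+ suc e
              N≡ = cong suc (sym (ℕ.+-suc e e))
              half : ∀ {t t′} → suc e ℕ.≤ t′ → t ℕ.+ t′ ≡ N → t ℕ.≤ suc e
              half {t} {t′} d≤ e≡ = ℕ.+-cancelʳ-≤ (suc e) t (suc e) (ℕ.≤-trans (ℕ.+-monoʳ-≤ t d≤) (ℕ.≤-reflexive (trans e≡ N≡)))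
              t≡t′ : t ≡ t′
              t≡t′ = trans (ℕ.≤-antisym (half d≤t′ t+t′) d≤t) (ℕ.≤-antisym d≤t′ (half d≤t (trans (ℕ.+-comm t′ t) t+t′)))

      balance : ℕ∑ N (λ i → r ℕ.* residue (clamp i) % nℕ) ≡ ℕ∑ N (λ i → r ℕ.* ((nℕ ∸ 1) ℕ.* residue (clamp i)) % nℕ)
      balance = ℤ.+-injective (trans (ℕ∑-clamp F) (trans (go (r % nℕ ℕ.≟ 0)) (sym (ℕ∑-clamp F′))))
        where
        go : Dec (r % nℕ ≡ 0) → sumℤ (λ i → + F i) ≡ sumℤ (λ i → + F′ i)
        go (yes r≡0) = S-cong λ i → cong +_ (trans (zero-case r≡0 (residue i)) (sym (zero-case r≡0 (n-1 ℕ.* residue i))))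
        go (no r≢0)  = sums-agree r≢0

-- The isomorphism onto the Cayley polytope.

module Cayley where

  open import Data.Empty using (⊥; ⊥-elim)
  open import Data.Fin using (Fin; zero; suc; splitAt; join; _↑ˡ_; _↑ʳ_)
  open import Data.Fin.Permutation using (Permutation; permutation; _⟨$⟩ʳ_; _⟨$⟩ˡ_; inverseˡ)
  open import Data.Fin.Properties using (_≟_; splitAt-↑ˡ; splitAt-↑ʳ; join-splitAt; splitAt-join)
  open import Data.Integer.Base as ℤ using (ℤ; +_; _+_; _*_; _-_; -_)
  import Data.Integer.Properties as ℤ
  open import Data.Integer.Tactic.RingSolver using (solve-∀)
  open import Data.Nat.Base as ℕ using (ℕ; zero; suc)
  open import Data.Product using (∃; _×_; _,_; proj₁; proj₂)
  import Data.Rational as ℚ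
  import Data.Rational.Properties as ℚ
  open import Data.Sum using (inj₁; inj₂; [_,_]′)
  open import Data.Vec.Functional using (_++_)
  open import Data.Vec.Functional.Properties using (lookup-++ˡ; lookup-++ʳ)
  open import Relation.Binary.PropositionalEquality using (_≡_; _≢_; refl; sym; trans; cong; cong₂; subst; module ≡-Reasoning)
  open import Relation.Nullary using (Dec; yes; no; ¬_)
  import Tactic.RingSolver as ℚR
  open import Defs
  open Kit using (ringℚ; inv; *-inv; *-cancelˡ-≡)
  open Matching
  open FinSum
  open Rationals
  open Frame
  open Simplex
  open Sℤ

  split-cases : ∀ m {n} (P : Fin (m ℕ.+ n) → Set) → (∀ i → P (i ↑ˡ n)) → (∀ j → P (m ↑ʳ j)) → ∀ k → P k
  split-cases m {n} P left right k = subst P (join-splitAt m n k) (go (splitAt m k))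
    where
    go : ∀ x → P (join m n x)
    go (inj₁ i) = left i
    go (inj₂ j) = right j

  applyℚ-toQ : ∀ {m M} (φ : AffMap m M) z t → applyℚ φ (toQ z) t ≡ ℤ→ℚ (applyℤ φ z t)
  applyℚ-toQ φ z t = sym (trans (ℤ→ℚ-+ (AffMap.c φ t) (sumℤ λ j → AffMap.A φ t j * z j)) (cong (λ x → ℤ→ℚ (AffMap.c φ t) ℚ.+ x) (ℤ→ℚ-dot (AffMap.A φ t) z)))

  applyℚ-cong : ∀ {m M} (φ : AffMap m M) {x y} → x ≋ℚ y → ∀ t → applyℚ φ x t ≡ applyℚ φ y t
  applyℚ-cong φ eq t = cong (λ x → ℤ→ℚ (AffMap.c φ t) ℚ.+ x) (Sℚ.S-cong λ j → cong (ℤ→ℚ (AffMap.A φ t j) ℚ.*_) (eq j))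

  applyℚ-comb : ∀ {m M n} (φ : AffMap m M) (μ : Fin n → ℚ.ℚ) (p : Fin n → QPt m) → sumℚ μ ≡ ℚ.1ℚ →
                ∀ t → applyℚ φ (combℚ μ p) t ≡ combℚ μ (λ i → applyℚ φ (p i)) t
  applyℚ-comb φ μ p sum-μ t = sym (begin
    sumℚ (λ i → μ i ℚ.* (c ℚ.+ sumℚ (λ j → A j ℚ.* p i j))) ≡⟨ Sℚ.S-cong (λ i → cong (λ x → μ i ℚ.* (x ℚ.+ sumℚ (λ j → A j ℚ.* p i j))) (sym (ℚ.*-identityʳ c))) ⟩
    sumℚ (λ i → μ i ℚ.* (c ℚ.* ℚ.1ℚ ℚ.+ sumℚ (λ j → A j ℚ.* p i j)))  ≡⟨ Sℚ.S-affine c A μ (λ _ → ℚ.1ℚ) p ⟩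
    c ℚ.* sumℚ (λ i → μ i ℚ.* ℚ.1ℚ) ℚ.+ R ≡⟨ cong (λ x → c ℚ.* x ℚ.+ R) (trans (Sℚ.S-cong λ i → ℚ.*-identityʳ (μ i)) sum-μ) ⟩
    c ℚ.* ℚ.1ℚ ℚ.+ R                                                  ≡⟨ cong (ℚ._+ R) (ℚ.*-identityʳ c) ⟩
    c ℚ.+ R                                                           ∎)
    where
    open ≡-Reasoning
    c = ℤ→ℚ (AffMap.c φ t)
    A : Fin _ → ℚ.ℚ
    A j = ℤ→ℚ (AffMap.A φ t j)
    R = sumℚ (λ j → A j ℚ.* sumℚ (λ i → μ i ℚ.* p i j))

  -- Affine maps preserve convex combinations, so it is enough to match the vertices.
  mapsOnto-permuted : ∀ {m M N K} (φ : AffMap m M) (v : Fin N → Pt m) (w : Fin K → Pt M) (π : Permutation K N) →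
                      (∀ k t → w k t ≡ applyℤ φ (v (π ⟨$⟩ʳ k)) t) → MapsOnto φ v w
  mapsOnto-permuted φ v w π w≡ y = onto , into
    where
    image : ∀ (μ : Fin _ → ℚ.ℚ) → sumℚ μ ≡ ℚ.1ℚ → ∀ t → applyℚ φ (combℚ μ (λ i → toQ (v i))) t ≡ combℚ (λ k → μ (π ⟨$⟩ʳ k)) (λ k → toQ (w k)) t
    image μ sum-μ t = trans (applyℚ-comb φ μ (λ i → toQ (v i)) sum-μ t) (trans (Sℚ.S-permute (λ i → μ i ℚ.* applyℚ φ (toQ (v i)) t) π)
      (Sℚ.S-cong λ k → cong (μ (π ⟨$⟩ʳ k) ℚ.*_) (trans (applyℚ-toQ φ (v (π ⟨$⟩ʳ k)) t) (cong ℤ→ℚ (sym (w≡ k t))))))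
    into : (x : QPt _) → InConv (λ i → toQ (v i)) x → applyℚ φ x ≋ℚ y → InConv (λ j → toQ (w j)) y
    into x (μ , μ≥0 , sum-μ , comb-μ) φx≡y = (λ k → μ (π ⟨$⟩ʳ k)) , (λ k → μ≥0 (π ⟨$⟩ʳ k)) , trans (sym (Sℚ.S-permute μ π)) sum-μ ,
      λ t → trans (sym (image μ sum-μ t)) (trans (applyℚ-cong φ comb-μ t) (φx≡y t))
    onto : InConv (λ j → toQ (w j)) y → ∃ λ (x : QPt _) → InConv (λ i → toQ (v i)) x × applyℚ φ x ≋ℚ y
    onto (ν , ν≥0 , sum-ν , comb-ν) = combℚ μ (λ i → toQ (v i)) , (μ , (λ i → ν≥0 (π ⟨$⟩ˡ i)) , sum-μ , λ _ → refl) ,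
      λ t → trans (image μ sum-μ t) (trans (Sℚ.S-cong λ k → cong (λ x → x ℚ.* ℤ→ℚ (w k t)) (μ-π k)) (comb-ν t))
      where
      μ : Fin _ → ℚ.ℚ
      μ i = ν (π ⟨$⟩ˡ i)
      μ-π : ∀ k → μ (π ⟨$⟩ʳ k) ≡ ν k
      μ-π k = cong ν (inverseˡ π)
      sum-μ : sumℚ μ ≡ ℚ.1ℚ
      sum-μ = trans (Sℚ.S-permute μ π) (trans (Sℚ.S-cong μ-π) sum-ν)

  module _ {N d : ℕ} {Opp : Fin N → Fin N → Set} (P : Pairing d Opp) where

    open Pairing P

    private
      to : Fin (d ℕ.+ d) → Fin N
      to k = [ σ , σ′ ]′ (splitAt d k)

      from : Fin N → Fin (d ℕ.+ d)
      from i = join d d (ν i)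

      to-from : ∀ i → to (from i) ≡ i
      to-from i = trans (cong [ σ , σ′ ]′ (splitAt-join d d (ν i))) (σ-ν i)

      from-to : ∀ k → from (to k) ≡ k
      from-to k = trans (cong (join d d) (ν-to (splitAt d k))) (join-splitAt d d k)
        where
        ν-to : ∀ x → ν ([ σ , σ′ ]′ x) ≡ x
        ν-to (inj₁ i) = ν-σ i
        ν-to (inj₂ i) = ν-σ′ i

    arrangement : Permutation (d ℕ.+ d) N
    arrangement = permutation to from to-from from-to

    arrangement-σ : ∀ i → arrangement ⟨$⟩ʳ (i ↑ˡ d) ≡ σ i
    arrangement-σ i = cong [ σ , σ′ ]′ (splitAt-↑ˡ d i d)

    arrangement-σ′ : ∀ i → arrangement ⟨$⟩ʳ (d ↑ʳ i) ≡ σ′ i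
    arrangement-σ′ i = cong [ σ , σ′ ]′ (splitAt-↑ʳ d d i)

    sum-pairs : ∀ (f : Fin N → ℤ) → sumℤ f ≡ sumℤ (λ i → f (σ i) + f (σ′ i))
    sum-pairs f = trans (S-permute f arrangement) (trans (S-split d (λ k → f (arrangement ⟨$⟩ʳ k)))
      (trans (cong₂ _+_ (S-cong λ i → cong f (arrangement-σ i)) (S-cong λ i → cong f (arrangement-σ′ i))) (sym (S-+ (λ i → f (σ i)) (λ i → f (σ′ i))))))

    pair-cases : ∀ (R : Fin N → Set) → (∀ i → R (σ i)) → (∀ i → R (σ′ i)) → ∀ k → R k
    pair-cases R left right k = subst R (σ-ν k) (go (ν k))
      where
      go : ∀ x → R ([ σ , σ′ ]′ x)
      go (inj₁ i) = left i
      go (inj₂ i) = right i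

    unitVec-σσ : ∀ i j → unitVec (σ i) (σ j) ≡ unitVec i j
    unitVec-σσ i j = go (i ≟ j)
      where
      go : Dec (i ≡ j) → unitVec (σ i) (σ j) ≡ unitVec i j
      go (yes refl) = trans (unitVec-same (σ i)) (sym (unitVec-same i))
      go (no i≢j)   = trans (unitVec-other λ e → i≢j (inj₁-injective (trans (sym (ν-σ i)) (trans (cong ν e) (ν-σ j))))) (sym (unitVec-other i≢j))
        where
        inj₁-injective : ∀ {x y : Fin d} → inj₁ {B = Fin d} x ≡ inj₁ y → x ≡ y
        inj₁-injective refl = refl

    unitVec-σ′σ′ : ∀ i j → unitVec (σ′ i) (σ′ j) ≡ unitVec i j
    unitVec-σ′σ′ i j = go (i ≟ j)
      where
      go : Dec (i ≡ j) → unitVec (σ′ i) (σ′ j) ≡ unitVec i j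
      go (yes refl) = trans (unitVec-same (σ′ i)) (sym (unitVec-same i))
      go (no i≢j)   = trans (unitVec-other λ e → i≢j (inj₂-injective (trans (sym (ν-σ′ i)) (trans (cong ν e) (ν-σ′ j))))) (sym (unitVec-other i≢j))
        where
        inj₂-injective : ∀ {x y : Fin d} → inj₂ {A = Fin d} x ≡ inj₂ y → x ≡ y
        inj₂-injective refl = refl

    σ≢σ′ : ∀ i j → σ i ≢ σ′ j
    σ≢σ′ i j e = apart (trans (sym (ν-σ i)) (trans (cong ν e) (ν-σ′ j)))
      where
      apart : ∀ {x y : Fin d} → inj₁ x ≢ inj₂ y
      apart ()

  module _ {e m : ℕ} (v : Fin (suc m) → Pt m) (indep : AffIndep v) (C : CyclicQuotient v) where

    private
      d : ℕ
      d = suc e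

      open CyclicQuotient C

      n : ℤ
      n = + suc n-1

    module Construction (P : Pairing d (λ i j → ∃ λ s → a i + a j ≡ n * s)) (σ-zero : Pairing.σ P zero ≡ zero) where

      open Pairing P

      private
        slope : Fin d → ℤ
        slope i = proj₁ (opp i)

        slope-eq : ∀ i → a (σ i) + a (σ′ i) ≡ n * slope i
        slope-eq i = proj₂ (opp i)

        slope-sum : sumℤ slope ≡ + 0
        slope-sum = ℤ.*-cancelˡ-≡ n (sumℤ slope) (+ 0) (trans (S-*ˡ n slope) (trans (S-cong λ i → sym (slope-eq i)) (trans (sym (sum-pairs P a)) (trans a-sum (sym (ℤ.*-zeroʳ n))))))

        coefficient : Fin d → Fin 3 → ℤ
        coefficient i zero          = + 1
        coefficient i (suc zero)    = + 1
        coefficient i (suc (suc _)) = slope i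

        summand : Fin d → Fin 3 → Functional m
        summand i zero          = q (σ i)
        summand i (suc zero)    = q (σ′ i)
        summand i (suc (suc _)) = L

        -- The barycentric coordinate at vertex k is q k + (a k / n)L. Summed over a pair, the
        -- fractions combine to the integer `slope`, which makes `X` integral. `Y` completes these
        -- to coordinates on the lattice; at index 0, where q (σ zero) is zero, it takes `L`.
        X Y : Fin d → Functional m
        X i = lin (coefficient i) (summand i)
        Y zero    = L
        Y (suc i) = q (σ (suc i))

        Φ : Fin (d ℕ.+ d) → Functional m
        Φ = X ++ Y

        Φ-X : ∀ i → Φ (i ↑ˡ d) ≡ X i
        Φ-X i = lookup-++ˡ X Y i

        Φ-Y : ∀ i → Φ (d ↑ʳ i) ≡ Y i
        Φ-Y i = lookup-++ʳ X Y i

        X-value : ∀ i z t → X i ⟨ z , t ⟩ ≡ q (σ i) ⟨ z , t ⟩ + q (σ′ i) ⟨ z , t ⟩ + slope i * (L ⟨ z , t ⟩)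
        X-value i z t = trans (lin-value (coefficient i) (summand i) z t) (shape (q (σ i) ⟨ z , t ⟩) (q (σ′ i) ⟨ z , t ⟩) (slope i) (L ⟨ z , t ⟩))
          where
          shape : ∀ a b s l → + 1 * a + (+ 1 * b + (s * l + + 0)) ≡ a + b + s * l
          shape = solve-∀

      φ : AffMap m (d ℕ.+ d)
      φ = record { c = λ t → const (Φ t) ; A = λ t → linear (Φ t) }

      private
        applyℤ-Φ : ∀ z t → applyℤ φ z t ≡ Φ t ⟨ z , + 1 ⟩
        applyℤ-Φ z t = cong (λ x → x + sumℤ (λ j → linear (Φ t) j * z j)) (sym (ℤ.*-identityʳ (const (Φ t))))

        X-sum : ∀ z t → sumℤ (λ i → X i ⟨ z , t ⟩) ≡ t
        X-sum z t = begin
          sumℤ (λ i → X i ⟨ z , t ⟩)                                              ≡⟨ S-cong (λ i → X-value i z t) ⟩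
          sumℤ (λ i → q (σ i) ⟨ z , t ⟩ + q (σ′ i) ⟨ z , t ⟩ + slope i * ℓ) ≡⟨ S-+ (λ i → q (σ i) ⟨ z , t ⟩ + q (σ′ i) ⟨ z , t ⟩) (λ i → slope i * ℓ) ⟩
          sumℤ (λ i → q (σ i) ⟨ z , t ⟩ + q (σ′ i) ⟨ z , t ⟩) + sumℤ (λ i → slope i * ℓ) ≡⟨ cong₂ _+_ (trans (sym (sum-pairs P λ i → q i ⟨ z , t ⟩)) (total z t)) (sym (S-*ʳ ℓ slope)) ⟩
          t + sumℤ slope * ℓ                                                      ≡⟨ cong (λ x → t + x * ℓ) slope-sum ⟩
          t + + 0 * ℓ                                                             ≡⟨ shape t ℓ ⟩
          t                                                                       ∎
          where
          open ≡-Reasoning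
          ℓ = L ⟨ z , t ⟩
          shape : ∀ t l → t + + 0 * l ≡ t
          shape = solve-∀

        cleared : ∀ D x z → (∀ s → ℤ→ℚ D ℚ.* x s ≡ ℤ→ℚ (z s)) → ∀ t → ℤ→ℚ D ℚ.* applyℚ φ x t ≡ ℤ→ℚ (Φ t ⟨ z , D ⟩)
        cleared D x z eq t = begin
          Dℚ ℚ.* (c ℚ.+ sumℚ (λ j → A j ℚ.* x j))              ≡⟨ ℚ.*-distribˡ-+ Dℚ c (sumℚ (λ j → A j ℚ.* x j)) ⟩
          Dℚ ℚ.* c ℚ.+ Dℚ ℚ.* sumℚ (λ j → A j ℚ.* x j) ≡⟨ cong₂ ℚ._+_ (trans (ℚ.*-comm Dℚ c) (sym (ℤ→ℚ-* (const (Φ t)) D))) (linear-part D x z eq (linear (Φ t))) ⟩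
          ℤ→ℚ (const (Φ t) * D) ℚ.+ ℤ→ℚ (sumℤ λ j → linear (Φ t) j * z j) ≡⟨ sym (ℤ→ℚ-+ (const (Φ t) * D) (sumℤ λ j → linear (Φ t) j * z j)) ⟩
          ℤ→ℚ (Φ t ⟨ z , D ⟩)                                  ∎
          where
          open ≡-Reasoning
          Dℚ = ℤ→ℚ D
          c = ℤ→ℚ (const (Φ t))
          A : Fin m → ℚ.ℚ
          A j = ℤ→ℚ (linear (Φ t) j)
          linear-part : ∀ D (x : QPt m) z → (∀ s → ℤ→ℚ D ℚ.* x s ≡ ℤ→ℚ (z s)) → (l : Pt m) → ℤ→ℚ D ℚ.* sumℚ (λ j → ℤ→ℚ (l j) ℚ.* x j) ≡ ℤ→ℚ (sumℤ λ j → l j * z j)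
          linear-part D x z eq l = trans (Sℚ.S-*ˡ (ℤ→ℚ D) λ j → ℤ→ℚ (l j) ℚ.* x j) (trans (Sℚ.S-cong λ j → trans (swap (ℤ→ℚ D) (ℤ→ℚ (l j)) (x j)) (cong (ℤ→ℚ (l j) ℚ.*_) (eq j))) (sym (ℤ→ℚ-dot l z)))
            where
            swap : ∀ a b c → a ℚ.* (b ℚ.* c) ≡ b ℚ.* (a ℚ.* c)
            swap = ℚR.solve-∀ ringℚ

        into-H : (x : QPt m) → InH d (applyℚ φ x)
        into-H x = *-cancelˡ-≡ (ℤ→ℚ>0 D) (begin
          Dℚ ℚ.* sumℚ (λ (i : Fin d) → applyℚ φ x (i ↑ˡ d))               ≡⟨ Sℚ.S-*ˡ Dℚ (λ (i : Fin d) → applyℚ φ x (i ↑ˡ d)) ⟩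
          sumℚ (λ (i : Fin d) → Dℚ ℚ.* applyℚ φ x (i ↑ˡ d)) ≡⟨ Sℚ.S-cong (λ i → trans (cleared (+ suc D) x z eq (i ↑ˡ d)) (cong (λ f → ℤ→ℚ (f ⟨ z , + suc D ⟩)) (Φ-X i))) ⟩
          sumℚ (λ i → ℤ→ℚ (X i ⟨ z , + suc D ⟩))                ≡⟨ sym (ℤ→ℚ-sum λ i → X i ⟨ z , + suc D ⟩) ⟩
          ℤ→ℚ (sumℤ λ i → X i ⟨ z , + suc D ⟩)                  ≡⟨ cong ℤ→ℚ (X-sum z (+ suc D)) ⟩
          Dℚ                                                    ≡⟨ sym (ℚ.*-identityʳ Dℚ) ⟩
          Dℚ ℚ.* ℚ.1ℚ                                           ∎)
          where
          open ≡-Reasoning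
          D = proj₁ (clear x)
          Dℚ = ℤ→ℚ (+ suc D)
          z = proj₁ (proj₂ (clear x))
          eq = proj₂ (proj₂ (clear x))

        -- `Y` gives L = 0 and q (σ i) = 0, with `q-zero` at index 0; then `X` leaves q (σ′ i) = 0,
        -- and `expand` rebuilds z.
        kernel : ∀ z → (∀ t → Φ t ⟨ z , + 0 ⟩ ≡ + 0) → ∀ s → z s ≡ + 0
        kernel z Φ≡0 s = trans (sym (expand z (+ 0) s)) (trans (cong₂ _+_ (S-zero λ k → trans (cong (_* v k s) (q≡0 k)) (ℤ.*-zeroˡ (v k s))) (trans (cong (_* Γ s) L≡0) (ℤ.*-zeroˡ (Γ s)))) refl)
          where
          at : ∀ f t → Φ t ≡ f → f ⟨ z , + 0 ⟩ ≡ + 0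
          at f t refl = Φ≡0 t
          L≡0 : L ⟨ z , + 0 ⟩ ≡ + 0
          L≡0 = at L (d ↑ʳ zero) (Φ-Y zero)
          σ≡0 : ∀ i → q (σ i) ⟨ z , + 0 ⟩ ≡ + 0
          σ≡0 zero    = trans (cong (λ i → q i ⟨ z , + 0 ⟩) σ-zero) (q-zero z (+ 0))
          σ≡0 (suc i) = at (q (σ (suc i))) (d ↑ʳ suc i) (Φ-Y (suc i))
          σ′≡0 : ∀ i → q (σ′ i) ⟨ z , + 0 ⟩ ≡ + 0
          σ′≡0 i = trans (isolate (q (σ′ i) ⟨ z , + 0 ⟩) (slope i)) (trans (sym (cong₂ (λ x y → x + q (σ′ i) ⟨ z , + 0 ⟩ + slope i * y) (σ≡0 i) L≡0))
            (trans (sym (X-value i z (+ 0))) (at (X i) (i ↑ˡ d) (Φ-X i))))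
            where
            isolate : ∀ b s → b ≡ + 0 + b + s * + 0
            isolate = solve-∀
          q≡0 : ∀ k → q k ⟨ z , + 0 ⟩ ≡ + 0
          q≡0 = pair-cases P (λ k → q k ⟨ z , + 0 ⟩ ≡ + 0) σ≡0 σ′≡0

        injective : (x y : QPt m) → applyℚ φ x ≋ℚ applyℚ φ y → x ≋ℚ y
        injective x y φx≡φy s = equal (x s) (y s) (*-cancelˡ-≡ (ℤ→ℚ>0 D) (trans (eq s) (trans (cong ℤ→ℚ (kernel z vanish s)) (sym (ℚ.*-zeroʳ Dℚ)))))
          where
          u : QPt m
          u s = x s ℚ.- y s
          D = proj₁ (clear u)
          Dℚ = ℤ→ℚ (+ suc D)
          z = proj₁ (proj₂ (clear u))
          eq = proj₂ (proj₂ (clear u))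
          equal : ∀ a b → a ℚ.- b ≡ ℚ.0ℚ → a ≡ b
          equal a b e = trans (shape a b) (trans (cong (ℚ._+ b) e) (ℚ.+-identityˡ b))
            where
            shape : ∀ a b → a ≡ a ℚ.- b ℚ.+ b
            shape = ℚR.solve-∀ ringℚ
          vanish : ∀ t → Φ t ⟨ z , + 0 ⟩ ≡ + 0
          vanish t = ℤ→ℚ-injective (begin
            ℤ→ℚ (const (Φ t) * + 0 + sumℤ (λ j → l j * z j))     ≡⟨ cong ℤ→ℚ (shape (const (Φ t)) (sumℤ λ j → l j * z j)) ⟩
            ℤ→ℚ (sumℤ (λ j → l j * z j))                         ≡⟨ ℤ→ℚ-dot l z ⟩
            sumℚ (λ j → ℤ→ℚ (l j) ℚ.* ℤ→ℚ (z j)) ≡⟨ Sℚ.S-cong (λ j → trans (cong (ℤ→ℚ (l j) ℚ.*_) (sym (eq j))) (dist (ℤ→ℚ (l j)) Dℚ (x j) (y j))) ⟩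
            sumℚ (λ j → Dℚ ℚ.* (ℤ→ℚ (l j) ℚ.* x j) ℚ.+ ℚ.- Dℚ ℚ.* (ℤ→ℚ (l j) ℚ.* y j)) ≡⟨ Sℚ.S-+ (λ j → Dℚ ℚ.* (ℤ→ℚ (l j) ℚ.* x j)) (λ j → ℚ.- Dℚ ℚ.* (ℤ→ℚ (l j) ℚ.* y j)) ⟩
            sumℚ (λ j → Dℚ ℚ.* (ℤ→ℚ (l j) ℚ.* x j)) ℚ.+ sumℚ (λ j → ℚ.- Dℚ ℚ.* (ℤ→ℚ (l j) ℚ.* y j)) ≡⟨ sym (cong₂ ℚ._+_ (Sℚ.S-*ˡ Dℚ λ j → ℤ→ℚ (l j) ℚ.* x j) (Sℚ.S-*ˡ (ℚ.- Dℚ) λ j → ℤ→ℚ (l j) ℚ.* y j)) ⟩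
            Dℚ ℚ.* Sx ℚ.+ ℚ.- Dℚ ℚ.* Sy                          ≡⟨ cong (λ w → Dℚ ℚ.* w ℚ.+ ℚ.- Dℚ ℚ.* Sy) Sx≡Sy ⟩
            Dℚ ℚ.* Sy ℚ.+ ℚ.- Dℚ ℚ.* Sy                          ≡⟨ cancel Dℚ Sy ⟩
            ℚ.0ℚ                                                 ∎)
            where
            open ≡-Reasoning
            l = linear (Φ t)
            Sx = sumℚ (λ j → ℤ→ℚ (l j) ℚ.* x j)
            Sy = sumℚ (λ j → ℤ→ℚ (l j) ℚ.* y j)
            Sx≡Sy : Sx ≡ Sy
            Sx≡Sy = trans (isolate c Sx) (trans (cong (λ w → ℚ.- c ℚ.+ w) (φx≡φy t)) (sym (isolate c Sy)))
              where
              c = ℤ→ℚ (const (Φ t))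
              isolate : ∀ c s → s ≡ ℚ.- c ℚ.+ (c ℚ.+ s)
              isolate = ℚR.solve-∀ ringℚ
            shape : ∀ c s → c * + 0 + s ≡ s
            shape = solve-∀
            dist : ∀ l d x y → l ℚ.* (d ℚ.* (x ℚ.- y)) ≡ d ℚ.* (l ℚ.* x) ℚ.+ ℚ.- d ℚ.* (l ℚ.* y)
            dist = ℚR.solve-∀ ringℚ
            cancel : ∀ d s → d ℚ.* s ℚ.+ ℚ.- d ℚ.* s ≡ ℚ.0ℚ
            cancel = ℚR.solve-∀ ringℚ

        module Preimage (y : Pt (d ℕ.+ d)) (y∈H : InH d (toQ y)) where

          ℓ : ℤ
          ℓ = y (d ↑ʳ zero)

          -- The coefficients at the vertices σ i and σ′ i: the former are read off from the `Y`
          -- part of y, the latter solved for from the `X` part.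
          ξ ξ′ : Fin d → ℤ
          ξ zero    = + 0
          ξ (suc i) = y (d ↑ʳ suc i)
          ξ′ i = y (i ↑ˡ d) - ξ i - slope i * ℓ

          x : Fin (suc m) → ℤ
          x k = [ ξ , ξ′ ]′ (ν k)

          x-σ : ∀ i → x (σ i) ≡ ξ i
          x-σ i = cong [ ξ , ξ′ ]′ (ν-σ i)

          x-σ′ : ∀ i → x (σ′ i) ≡ ξ′ i
          x-σ′ i = cong [ ξ , ξ′ ]′ (ν-σ′ i)

          sum-y : sumℤ (λ (i : Fin d) → y (i ↑ˡ d)) ≡ + 1
          sum-y = ℤ→ℚ-injective (trans (ℤ→ℚ-sum λ (i : Fin d) → y (i ↑ˡ d)) y∈H)

          sum-x : sumℤ x ≡ + 1
          sum-x = begin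
            sumℤ x                                              ≡⟨ sum-pairs P x ⟩
            sumℤ (λ i → x (σ i) + x (σ′ i)) ≡⟨ S-cong (λ i → trans (cong₂ _+_ (x-σ i) (x-σ′ i)) (shape (ξ i) (y (i ↑ˡ d)) (slope i) ℓ)) ⟩
            sumℤ (λ (i : Fin d) → y (i ↑ˡ d) + slope i * - ℓ)             ≡⟨ S-+ (λ (i : Fin d) → y (i ↑ˡ d)) (λ i → slope i * - ℓ) ⟩
            sumℤ (λ (i : Fin d) → y (i ↑ˡ d)) + sumℤ (λ i → slope i * - ℓ) ≡⟨ cong₂ _+_ sum-y (trans (sym (S-*ʳ (- ℓ) slope)) (trans (cong (_* - ℓ) slope-sum) (ℤ.*-zeroˡ (- ℓ)))) ⟩
            + 1                                                 ∎
            where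
            open ≡-Reasoning
            shape : ∀ x y s l → x + (y - x - s * l) ≡ y + s * - l
            shape = solve-∀

          z : Pt m
          z s = combℤ x v s + ℓ * Γ s

          found : (∀ i → q i ⟨ z , + 1 ⟩ ≡ x i) × L ⟨ z , + 1 ⟩ ≡ ℓ
          found = coords z (+ 1) x ℓ (trans (cong x (sym σ-zero)) (x-σ zero)) sum-x (λ _ → refl)

          image : ∀ t → applyℤ φ z t ≡ y t
          image t = trans (applyℤ-Φ z t) (split-cases d (λ t → Φ t ⟨ z , + 1 ⟩ ≡ y t) left right t)
            where
            left : ∀ i → Φ (i ↑ˡ d) ⟨ z , + 1 ⟩ ≡ y (i ↑ˡ d)
            left i = trans (cong (_⟨ z , + 1 ⟩) (Φ-X i)) (trans (X-value i z (+ 1)) (trans (cong₂ (λ u w → u + w + slope i * (L ⟨ z , + 1 ⟩)) (trans (proj₁ found (σ i)) (x-σ i)) (trans (proj₁ found (σ′ i)) (x-σ′ i)))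
              (trans (cong (λ w → ξ i + ξ′ i + slope i * w) (proj₂ found)) (shape (ξ i) (y (i ↑ˡ d)) (slope i) ℓ))))
              where
              shape : ∀ x y s l → x + (y - x - s * l) + s * l ≡ y
              shape = solve-∀
            right : ∀ i → Φ (d ↑ʳ i) ⟨ z , + 1 ⟩ ≡ y (d ↑ʳ i)
            right zero    = trans (cong (_⟨ z , + 1 ⟩) (Φ-Y zero)) (proj₂ found)
            right (suc i) = trans (cong (_⟨ z , + 1 ⟩) (Φ-Y (suc i))) (trans (proj₁ found (σ (suc i))) (x-σ (suc i)))

        -- n times the barycentric coordinates.
        barycentric : ∀ j k → n * (q k ⟨ v j , + 1 ⟩) + a k * (L ⟨ v j , + 1 ⟩) ≡ n * unitVec k j
        barycentric j k = ℤ.i-j≡0⇒i≡j _ _ (affIndep-ℤ {p = v} indep c sum-c comb-c k)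
          where
          ℓ = L ⟨ v j , + 1 ⟩
          qⱼ : Fin (suc m) → ℤ
          qⱼ k = q k ⟨ v j , + 1 ⟩
          c : Fin (suc m) → ℤ
          c k = n * qⱼ k + a k * ℓ - n * unitVec k j
          general : ∀ (f : Fin (suc m) → ℤ) → sumℤ (λ k → c k * f k) ≡ n * sumℤ (λ k → qⱼ k * f k) + ℓ * sumℤ (λ k → a k * f k) + - n * f j
          general f = begin
            sumℤ (λ k → c k * f k)
              ≡⟨ S-cong (λ k → dist n (qⱼ k) (a k) ℓ (unitVec k j) (f k)) ⟩
            sumℤ (λ k → n * (qⱼ k * f k) + ℓ * (a k * f k) + - n * (f k * unitVec k j))
              ≡⟨ S-+ (λ k → n * (qⱼ k * f k) + ℓ * (a k * f k)) (λ k → - n * (f k * unitVec k j)) ⟩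
            sumℤ (λ k → n * (qⱼ k * f k) + ℓ * (a k * f k)) + sumℤ (λ k → - n * (f k * unitVec k j))
              ≡⟨ cong₂ _+_ (trans (S-+ (λ k → n * (qⱼ k * f k)) (λ k → ℓ * (a k * f k))) (sym (cong₂ _+_ (S-*ˡ n λ k → qⱼ k * f k) (S-*ˡ ℓ λ k → a k * f k)))) (trans (sym (S-*ˡ (- n) λ k → f k * unitVec k j)) (cong (- n *_) (sum-unitVec f j))) ⟩
            n * sumℤ (λ k → qⱼ k * f k) + ℓ * sumℤ (λ k → a k * f k) + - n * f j ∎
            where
            open ≡-Reasoning
            dist : ∀ n q a l u f → (n * q + a * l - n * u) * f ≡ n * (q * f) + l * (a * f) + - n * (f * u)
            dist = solve-∀
          sum-c : sumℤ c ≡ + 0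
          sum-c = begin
            sumℤ c                                                     ≡⟨ S-cong (λ k → sym (ℤ.*-identityʳ (c k))) ⟩
            sumℤ (λ k → c k * + 1)                                     ≡⟨ general (λ _ → + 1) ⟩
            n * sumℤ (λ k → qⱼ k * + 1) + ℓ * sumℤ (λ k → a k * + 1) + - n * + 1 ≡⟨ cong₂ (λ u w → n * u + ℓ * w + - n * + 1) (trans (S-cong λ k → ℤ.*-identityʳ (qⱼ k)) (total (v j) (+ 1))) (trans (S-cong λ k → ℤ.*-identityʳ (a k)) a-sum) ⟩
            n * + 1 + ℓ * + 0 + - n * + 1                              ≡⟨ shape n ℓ ⟩
            + 0                                                        ∎
            where
            open ≡-Reasoning
            shape : ∀ n l → n * + 1 + l * + 0 + - n * + 1 ≡ + 0
            shape = solve-∀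
          comb-c : ∀ s → combℤ c v s ≡ + 0
          comb-c s = begin
            combℤ c v s                                                ≡⟨ general (λ k → v k s) ⟩
            n * combℤ qⱼ v s + ℓ * combℤ a v s + - n * v j s ≡⟨ cong₂ (λ u w → n * combℤ qⱼ v s + ℓ * u + - n * w) (sym (nΓ s)) (sym (expand (v j) (+ 1) s)) ⟩
            n * combℤ qⱼ v s + ℓ * (n * Γ s) + - n * (combℤ qⱼ v s + ℓ * Γ s) ≡⟨ shape n (combℤ qⱼ v s) ℓ (Γ s) ⟩
            + 0                                                        ∎
            where
            open ≡-Reasoning
            shape : ∀ n q l g → n * q + l * (n * g) + - n * (q + l * g) ≡ + 0
            shape = solve-∀

        -- Multiplied by n, the `slope` term splits into the shares a (σ i) L and a (σ′ i) L, and
        -- `barycentric` applies to each vertex of the pair.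
        X-vertex : ∀ i j → X i ⟨ v j , + 1 ⟩ ≡ unitVec (σ i) j + unitVec (σ′ i) j
        X-vertex i j = ℤ.*-cancelˡ-≡ n _ _ (begin
          n * (X i ⟨ v j , + 1 ⟩)                                      ≡⟨ cong (n *_) (X-value i (v j) (+ 1)) ⟩
          n * (q₁ + q₂ + slope i * ℓ)                                  ≡⟨ dist n q₁ q₂ (slope i) ℓ ⟩
          n * q₁ + n * q₂ + n * slope i * ℓ                            ≡⟨ cong (λ x → n * q₁ + n * q₂ + x * ℓ) (sym (slope-eq i)) ⟩
          n * q₁ + n * q₂ + (a (σ i) + a (σ′ i)) * ℓ                   ≡⟨ regroup (n * q₁) (n * q₂) (a (σ i)) (a (σ′ i)) ℓ ⟩
          n * q₁ + a (σ i) * ℓ + (n * q₂ + a (σ′ i) * ℓ)               ≡⟨ cong₂ _+_ (barycentric j (σ i)) (barycentric j (σ′ i)) ⟩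
          n * unitVec (σ i) j + n * unitVec (σ′ i) j                   ≡⟨ sym (ℤ.*-distribˡ-+ n (unitVec (σ i) j) (unitVec (σ′ i) j)) ⟩
          n * (unitVec (σ i) j + unitVec (σ′ i) j)                     ∎)
          where
          open ≡-Reasoning
          ℓ = L ⟨ v j , + 1 ⟩
          q₁ = q (σ i) ⟨ v j , + 1 ⟩
          q₂ = q (σ′ i) ⟨ v j , + 1 ⟩
          dist : ∀ n a b s l → n * (a + b + s * l) ≡ n * a + n * b + n * s * l
          dist = solve-∀
          regroup : ∀ x y a b l → x + y + (a + b) * l ≡ x + a * l + (y + b * l)
          regroup = solve-∀

        X-σ : ∀ i j → applyℤ φ (v (σ j)) (i ↑ˡ d) ≡ unitVec j i
        X-σ i j = trans (applyℤ-Φ (v (σ j)) (i ↑ˡ d)) (trans (cong (_⟨ v (σ j) , + 1 ⟩) (Φ-X i)) (trans (X-vertex i (σ j))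
          (trans (cong₂ _+_ (trans (unitVec-σσ P i j) (unitVec-sym i j)) (unitVec-other λ e → σ≢σ′ P j i (sym e))) (ℤ.+-identityʳ (unitVec j i)))))

        X-σ′ : ∀ i j → applyℤ φ (v (σ′ j)) (i ↑ˡ d) ≡ unitVec j i
        X-σ′ i j = trans (applyℤ-Φ (v (σ′ j)) (i ↑ˡ d)) (trans (cong (_⟨ v (σ′ j) , + 1 ⟩) (Φ-X i)) (trans (X-vertex i (σ′ j))
          (trans (cong₂ _+_ (unitVec-other (σ≢σ′ P i j)) (trans (unitVec-σ′σ′ P i j) (unitVec-sym i j))) (ℤ.+-identityˡ (unitVec j i)))))

      start end : Fin d → Pt d
      start i t = applyℤ φ (v (σ i)) (d ↑ʳ t)
      end i t   = applyℤ φ (v (σ′ i)) (d ↑ʳ t)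

      private
        vertex : ∀ k t → cayleyVerts start end k t ≡ applyℤ φ (v (arrangement P ⟨$⟩ʳ k)) t
        vertex = split-cases d (λ k → ∀ t → cayleyVerts start end k t ≡ applyℤ φ (v (arrangement P ⟨$⟩ʳ k)) t)
          (λ i t → trans (cong (λ p → p t) (lookup-++ˡ (λ i → unitVec i ++ start i) (λ i → unitVec i ++ end i) i))
            (trans (split-cases d (λ t → (unitVec i ++ start i) t ≡ applyℤ φ (v (σ i)) t)
              (λ j → trans (lookup-++ˡ (unitVec i) (start i) j) (sym (X-σ j i))) (λ j → lookup-++ʳ (unitVec i) (start i) j) t)
              (cong (λ k → applyℤ φ (v k) t) (sym (arrangement-σ P i)))))
          (λ i t → trans (cong (λ p → p t) (lookup-++ʳ (λ i → unitVec i ++ start i) (λ i → unitVec i ++ end i) i))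
            (trans (split-cases d (λ t → (unitVec i ++ end i) t ≡ applyℤ φ (v (σ′ i)) t)
              (λ j → trans (lookup-++ˡ (unitVec i) (end i) j) (sym (X-σ′ j i))) (λ j → lookup-++ʳ (unitVec i) (end i) j) t)
              (cong (λ k → applyℤ φ (v k) t) (sym (arrangement-σ′ P i)))))

        -- Both endpoints have the same first d coordinates eᵢ; equal last coordinates would make φ
        -- identify two vertices of the simplex.
        distinct : ∀ i → ¬ (∀ t → start i t ≡ end i t)
        distinct i same = contradiction (ℤ.*-cancelˡ-≡ n (+ 1) (+ 0) (begin
          n * + 1                                                    ≡⟨ cong (n *_) (sym (unitVec-same (σ i))) ⟩
          n * unitVec (σ i) (σ i)                                    ≡⟨ sym (barycentric (σ i) (σ i)) ⟩
          n * (q (σ i) ⟨ v (σ i) , + 1 ⟩) + a (σ i) * (L ⟨ v (σ i) , + 1 ⟩) ≡⟨ cong₂ (λ x y → n * x + a (σ i) * y) (value-cong (q (σ i)) v≡) (value-cong L v≡) ⟩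
          n * (q (σ i) ⟨ v (σ′ i) , + 1 ⟩) + a (σ i) * (L ⟨ v (σ′ i) , + 1 ⟩) ≡⟨ barycentric (σ′ i) (σ i) ⟩
          n * unitVec (σ i) (σ′ i)                                   ≡⟨ cong (n *_) (unitVec-other (σ≢σ′ P i i)) ⟩
          n * + 0                                                    ∎))
          where
          open ≡-Reasoning
          contradiction : + 1 ≡ + 0 → ⊥
          contradiction ()
          v≡ : ∀ s → v (σ i) s ≡ v (σ′ i) s
          v≡ s = ℤ→ℚ-injective (injective (toQ (v (σ i))) (toQ (v (σ′ i))) (λ t → trans (applyℚ-toQ φ (v (σ i)) t)
            (trans (cong ℤ→ℚ (split-cases d (λ t → applyℤ φ (v (σ i)) t ≡ applyℤ φ (v (σ′ i)) t) (λ j → trans (X-σ j i) (sym (X-σ′ j i))) same t)) (sym (applyℚ-toQ φ (v (σ′ i)) t)))) s)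

        segment : ∀ i → AffIndep (seg (start i) (end i))
        segment i w sum-w comb-w = λ { zero → w₀≡0 ; (suc zero) → trans w₁≡ (cong ℚ.-_ w₀≡0) }
          where
          w₀ = w zero
          w₁ = w (suc zero)
          w₁≡ : w₁ ≡ ℚ.- w₀
          w₁≡ = trans (shape w₀ w₁) (trans (cong (ℚ._+ ℚ.- w₀) sum-w) (ℚ.+-identityˡ (ℚ.- w₀)))
            where
            shape : ∀ a b → b ≡ a ℚ.+ (b ℚ.+ ℚ.0ℚ) ℚ.+ ℚ.- a
            shape = ℚR.solve-∀ ringℚ
          go : Dec (w₀ ≡ ℚ.0ℚ) → w₀ ≡ ℚ.0ℚ
          go (yes w₀≡0) = w₀≡0
          go (no w₀≢0)  = ⊥-elim (distinct i λ t → ℤ→ℚ-injective (equal (ℤ→ℚ (start i t)) (ℤ→ℚ (end i t))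
              (trans (cong (λ x → w₀ ℚ.* ℤ→ℚ (start i t) ℚ.+ (x ℚ.* ℤ→ℚ (end i t) ℚ.+ ℚ.0ℚ)) (sym w₁≡)) (comb-w t))))
            where
            equal : ∀ x y → w₀ ℚ.* x ℚ.+ (ℚ.- w₀ ℚ.* y ℚ.+ ℚ.0ℚ) ≡ ℚ.0ℚ → x ≡ y
            equal x y e = begin
              x                                              ≡⟨ restore x y ⟩
              ℚ.1ℚ ℚ.* (x ℚ.- y) ℚ.+ y                       ≡⟨ cong (λ u → u ℚ.* (x ℚ.- y) ℚ.+ y) (sym (*-inv w₀≢0)) ⟩
              w₀ ℚ.* inv w₀ ℚ.* (x ℚ.- y) ℚ.+ y              ≡⟨ cong (ℚ._+ y) (regroup w₀ (inv w₀) x y) ⟩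
              inv w₀ ℚ.* (w₀ ℚ.* x ℚ.+ (ℚ.- w₀ ℚ.* y ℚ.+ ℚ.0ℚ)) ℚ.+ y ≡⟨ cong (λ u → inv w₀ ℚ.* u ℚ.+ y) e ⟩
              inv w₀ ℚ.* ℚ.0ℚ ℚ.+ y                          ≡⟨ trans (cong (ℚ._+ y) (ℚ.*-zeroʳ (inv w₀))) (ℚ.+-identityˡ y) ⟩
              y                                              ∎
              where
              open ≡-Reasoning
              restore : ∀ x y → x ≡ ℚ.1ℚ ℚ.* (x ℚ.- y) ℚ.+ y
              restore = ℚR.solve-∀ ringℚ
              regroup : ∀ w i x y → w ℚ.* i ℚ.* (x ℚ.- y) ≡ i ℚ.* (w ℚ.* x ℚ.+ (ℚ.- w ℚ.* y ℚ.+ ℚ.0ℚ))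
              regroup = ℚR.solve-∀ ringℚ
          w₀≡0 : w₀ ≡ ℚ.0ℚ
          w₀≡0 = go (w₀ ℚ.≟ ℚ.0ℚ)

      cayley : IsCayleyOfSegments d v
      cayley = start , end , segment , φ , (into-H , injective , λ y y∈H → Preimage.z y y∈H , Preimage.image y y∈H) ,
        mapsOnto-permuted φ v (cayleyVerts start end) (arrangement P) vertex

-- Cayley polytopes of segments have no early interior points.

module Converse where

  open import Data.Empty using (⊥-elim)
  open import Data.Fin using (Fin; zero; suc; _↑ˡ_; _↑ʳ_)
  open import Data.Fin.Properties using (any?)
  open import Data.Integer.Base as ℤ using (ℤ; +_)
  import Data.Integer.Properties as ℤ
  open import Data.Nat.Base as ℕ using (ℕ; zero; suc)
  import Data.Nat.Properties as ℕ
  open import Data.Product using (∃; _×_; _,_; proj₁; proj₂)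
  open import Data.Rational
  open import Data.Rational.Properties
  open import Data.Vec.Functional using (_++_)
  open import Data.Vec.Functional.Properties using (lookup-++ˡ; lookup-++ʳ)
  open import Relation.Binary.PropositionalEquality using (_≡_; refl; sym; trans; cong; cong₂; subst; module ≡-Reasoning)
  open import Relation.Nullary using (Dec; yes; no)
  open import Tactic.RingSolver using (solve-∀)
  open import Defs
  open Kit using (ringℚ; +≥0; *≥0; *>0; 0<1)
  open FinSum
  open Rationals
  open Frame using (unitVec-same; unitVec-other)
  open Cayley using (applyℚ-comb; applyℚ-cong)
  open Sℚ

  ℤ→ℚ-unitVec≥0 : ∀ {r} (i t : Fin r) → 0ℚ ≤ ℤ→ℚ (unitVec i t)
  ℤ→ℚ-unitVec≥0 i t = go (i Data.Fin.Properties.≟ t)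
    where
    go : Dec (i ≡ t) → 0ℚ ≤ ℤ→ℚ (unitVec i t)
    go (yes refl) = subst (λ z → 0ℚ ≤ ℤ→ℚ z) (sym (unitVec-same i)) (<⇒≤ 0<1)
    go (no i≢t)   = subst (λ z → 0ℚ ≤ ℤ→ℚ z) (sym (unitVec-other i≢t)) ≤-refl

  sum≥0 : ∀ {n} (f : Fin n → ℚ) → (∀ i → 0ℚ ≤ f i) → 0ℚ ≤ sumℚ f
  sum≥0 {zero}  f f≥0 = ≤-refl
  sum≥0 {suc n} f f≥0 = +≥0 (f≥0 zero) (sum≥0 (λ i → f (suc i)) (λ i → f≥0 (suc i)))

  sum>0 : ∀ {n} (f : Fin n → ℚ) → (∀ i → 0ℚ ≤ f i) → ∀ j → 0ℚ < f j → 0ℚ < sumℚ f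
  sum>0 {suc n} f f≥0 j fⱼ>0 = subst (0ℚ <_) (sym (S-remove j f)) (<-≤-trans fⱼ>0 (subst (_≤ f j + R) (+-identityʳ (f j)) (+-monoʳ-≤ (f j) (sum≥0 (λ i → f (Data.Fin.punchIn j i)) (λ i → f≥0 _)))))
    where R = sumℚ (λ i → f (Data.Fin.punchIn j i))

  -- The combination with coefficients ρ only serves to show that g is not identically zero; a
  -- strictly positive combination then sees a positive value.
  weighted-sum>0 : ∀ {n} (g ρ μ : Fin n → ℚ) → (∀ i → 0ℚ ≤ g i) → sumℚ (λ i → ρ i * g i) ≡ 1ℚ → (∀ i → 0ℚ < μ i) → 0ℚ < sumℚ (λ i → μ i * g i)
  weighted-sum>0 g ρ μ g≥0 sum≡1 μ>0 = go (any? λ i → 0ℚ <? g i)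
    where
    go : Dec (∃ λ i → 0ℚ < g i) → 0ℚ < sumℚ (λ i → μ i * g i)
    go (yes (j , gⱼ>0)) = sum>0 (λ i → μ i * g i) (λ i → *≥0 (<⇒≤ (μ>0 i)) (g≥0 i)) j (*>0 (μ>0 j) gⱼ>0)
    go (no none)        = ⊥-elim (<-irrefl (trans (sym (S-zero λ i → trans (cong (ρ i *_) (≤-antisym (≮⇒≥ λ pos → none (i , pos)) (g≥0 i))) (*-zeroʳ (ρ i)))) sum≡1) 0<1)

  sum-ones : ∀ {n} (f : Fin n → ℤ) → (∀ i → + 1 ℤ.≤ f i) → + n ℤ.≤ sumℤ f
  sum-ones {zero}  f f≥1 = ℤ.≤-refl
  sum-ones {suc n} f f≥1 = ℤ.+-mono-≤ (f≥1 zero) (sum-ones (λ i → f (suc i)) (λ i → f≥1 (suc i)))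

  module _ {m d} (v : Fin (suc m) → Pt m) (a b : Fin d → Pt d) (φ : AffMap m (d ℕ.+ d)) (iso : IsLatticeIsoOntoH m d d φ)
    (maps : MapsOnto φ v (cayleyVerts a b)) where

    private
      w : Fin (d ℕ.+ d) → Pt (d ℕ.+ d)
      w = cayleyVerts a b

      head : ∀ i (k : Fin (d ℕ.+ d)) → ℚ
      head i k = toQ (w k) (i ↑ˡ d)

      head-a : ∀ i j → head i (j ↑ˡ d) ≡ ℤ→ℚ (unitVec j i)
      head-a i j = cong ℤ→ℚ (trans (cong (λ p → p (i ↑ˡ d)) (lookup-++ˡ (λ i → unitVec i ++ a i) (λ i → unitVec i ++ b i) j)) (lookup-++ˡ (unitVec j) (a j) i))

      head-b : ∀ i j → head i (d ↑ʳ j) ≡ ℤ→ℚ (unitVec j i)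
      head-b i j = cong ℤ→ℚ (trans (cong (λ p → p (i ↑ˡ d)) (lookup-++ʳ (λ i → unitVec i ++ a i) (λ i → unitVec i ++ b i) j)) (lookup-++ˡ (unitVec j) (b j) i))

      head≥0 : ∀ i k → 0ℚ ≤ head i k
      head≥0 i = Cayley.split-cases d (λ k → 0ℚ ≤ head i k) (λ j → subst (0ℚ ≤_) (sym (head-a i j)) (ℤ→ℚ-unitVec≥0 j i)) (λ j → subst (0ℚ ≤_) (sym (head-b i j)) (ℤ→ℚ-unitVec≥0 j i))

      point-mass : ∀ {N M} (p : Fin N → Pt M) j → InConv (λ i → toQ (p i)) (toQ (p j))
      point-mass p j = (λ i → ℤ→ℚ (unitVec j i)) , (λ i → ℤ→ℚ-unitVec≥0 j i) ,
        trans (S-single j λ i i≢j → cong ℤ→ℚ (unitVec-other λ e → i≢j (sym e))) (cong ℤ→ℚ (unitVec-same j)) ,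
        λ t → trans (S-single j λ i i≢j → trans (cong (λ z → ℤ→ℚ z * toQ (p i) t) (unitVec-other λ e → i≢j (sym e))) (*-zeroˡ (toQ (p i) t)))
          (trans (cong (λ z → ℤ→ℚ z * toQ (p j) t) (unitVec-same j)) (*-identityˡ (toQ (p j) t)))

      level : Fin d → Fin (suc m) → ℚ
      level i j = applyℚ φ (toQ (v j)) (i ↑ˡ d)

      level≥0 : ∀ i j → 0ℚ ≤ level i j
      level≥0 i j = from-conv (proj₂ (maps (applyℚ φ (toQ (v j)))) (toQ (v j)) (point-mass v j) (λ _ → refl))
        where
        from-conv : InConv (λ k → toQ (w k)) (applyℚ φ (toQ (v j))) → 0ℚ ≤ level i j
        from-conv (μ , μ≥0 , _ , comb-μ) = subst (0ℚ ≤_) (comb-μ (i ↑ˡ d)) (sum≥0 (λ k → μ k * head i k) (λ k → *≥0 (μ≥0 k) (head≥0 i k)))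

      -- The Cayley vertex eᵢ × aᵢ is the image of some point of the simplex, and its i-th
      -- coordinate is 1.
      attained : ∀ i → ∃ λ (ρ : Fin (suc m) → ℚ) → sumℚ (λ j → ρ j * level i j) ≡ 1ℚ
      attained i = from-conv (proj₁ (maps (toQ (w (i ↑ˡ d)))) (point-mass w (i ↑ˡ d)))
        where
        from-conv : (∃ λ x → InConv (λ j → toQ (v j)) x × applyℚ φ x ≋ℚ toQ (w (i ↑ˡ d))) → ∃ λ (ρ : Fin (suc m) → ℚ) → sumℚ (λ j → ρ j * level i j) ≡ 1ℚ
        from-conv (x , (ρ , _ , sum-ρ , comb-ρ) , φx≡) = ρ , (begin
          sumℚ (λ j → ρ j * level i j)                        ≡⟨ sym (applyℚ-comb φ ρ (λ j → toQ (v j)) sum-ρ (i ↑ˡ d)) ⟩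
          applyℚ φ (combℚ ρ (λ j → toQ (v j))) (i ↑ˡ d)       ≡⟨ applyℚ-cong φ comb-ρ (i ↑ˡ d) ⟩
          applyℚ φ x (i ↑ˡ d)                                 ≡⟨ φx≡ (i ↑ˡ d) ⟩
          head i (i ↑ˡ d)                                     ≡⟨ trans (head-a i i) (cong ℤ→ℚ (unitVec-same i)) ⟩
          1ℚ                                                  ∎)
          where open ≡-Reasoning

    -- Each of the d integral functionals k cᵢ + Aᵢ x is positive on Int(kΔ), and they add up to k.
    interior-multiple-bound : ∀ k x → 1 ℕ.≤ k → InIntMultiple k v x → d ℕ.≤ k
    interior-multiple-bound (suc k-1) x _ (μ , μ>0 , sum-μ , comb-μ) = ℤ.drop‿+≤+ (subst (+ d ℤ.≤_) G-sum (sum-ones G (λ i → ℤ→ℚ≥1 (G>0 i))))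
      where
      k = suc k-1
      K = ℤ→ℚ (+ k)
      y : QPt m
      y = combℚ μ (λ j → toQ (v j))
      G : Fin d → ℤ
      G i = + k ℤ.* AffMap.c φ (i ↑ˡ d) ℤ.+ sumℤ (λ t → AffMap.A φ (i ↑ˡ d) t ℤ.* x t)
      G≡ : ∀ i → ℤ→ℚ (G i) ≡ K * applyℚ φ y (i ↑ˡ d)
      G≡ i = begin
        ℤ→ℚ (G i) ≡⟨ ℤ→ℚ-+ (+ k ℤ.* AffMap.c φ (i ↑ˡ d)) (sumℤ λ t → AffMap.A φ (i ↑ˡ d) t ℤ.* x t) ⟩
        ℤ→ℚ (+ k ℤ.* AffMap.c φ (i ↑ˡ d)) + ℤ→ℚ (sumℤ λ t → AffMap.A φ (i ↑ˡ d) t ℤ.* x t) ≡⟨ cong₂ _+_ (ℤ→ℚ-* (+ k) (AffMap.c φ (i ↑ˡ d))) (ℤ→ℚ-dot (AffMap.A φ (i ↑ˡ d)) x) ⟩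
        K * c + sumℚ (λ t → A t * toQ x t) ≡⟨ cong (λ z → K * c + z) (trans (S-cong λ t → trans (cong (A t *_) (sym (comb-μ t))) (swap (A t) K (y t))) (sym (S-*ˡ K λ t → A t * y t))) ⟩
        K * c + K * sumℚ (λ t → A t * y t)                     ≡⟨ sym (*-distribˡ-+ K c (sumℚ λ t → A t * y t)) ⟩
        K * applyℚ φ y (i ↑ˡ d)                                ∎
        where
        open ≡-Reasoning
        c = ℤ→ℚ (AffMap.c φ (i ↑ˡ d))
        A : Fin m → ℚ
        A t = ℤ→ℚ (AffMap.A φ (i ↑ˡ d) t)
        swap : ∀ a k y → a * (k * y) ≡ k * (a * y)
        swap = solve-∀ ringℚ
      G>0 : ∀ i → 0ℚ < ℤ→ℚ (G i)
      G>0 i = subst (0ℚ <_) (sym (G≡ i)) (*>0 (ℤ→ℚ>0 k-1) (subst (0ℚ <_) (sym (applyℚ-comb φ μ (λ j → toQ (v j)) sum-μ (i ↑ˡ d)))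
        (weighted-sum>0 (level i) (proj₁ (attained i)) μ (level≥0 i) (proj₂ (attained i)) μ>0)))
      G-sum : sumℤ G ≡ + k
      G-sum = ℤ→ℚ-injective (begin
        ℤ→ℚ (sumℤ G)                                      ≡⟨ ℤ→ℚ-sum G ⟩
        sumℚ (λ i → ℤ→ℚ (G i))                            ≡⟨ S-cong G≡ ⟩
        sumℚ (λ (i : Fin d) → K * applyℚ φ y (i ↑ˡ d))    ≡⟨ sym (S-*ˡ K λ (i : Fin d) → applyℚ φ y (i ↑ˡ d)) ⟩
        K * sumℚ (λ (i : Fin d) → applyℚ φ y (i ↑ˡ d))    ≡⟨ trans (cong (K *_) (proj₁ iso y)) (*-identityʳ K) ⟩
        K                                                 ∎)
        where open ≡-Reasoning

-- The equivalence.

open import Defs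
open import Data.Nat using (ℕ; suc; _+_)
open import Data.Fin using (Fin; punchIn)
open import Data.Product using (_×_)
open import Function.Bundles using (_⇔_)
open import Data.Fin using (zero)
open import Data.Integer.Base as ℤ using (ℤ; +_)
open import Data.Integer.DivMod using (_/ℕ_; a≡a%ℕn+[a/ℕn]*n)
import Data.Integer.Properties as ℤ
open import Data.Integer.Tactic.RingSolver using (solve-∀)
open import Data.Nat.Base using (_%_)
open import Data.Nat.Divisibility using (divides; m%n≡0⇒n∣m; _∣_)
import Data.Nat.Properties as ℕ
open import Data.Product using (∃; _,_)
open import Function.Bundles using (mk⇔)
open import Relation.Binary.PropositionalEquality using (_≡_; sym; trans; cong; cong₂; module ≡-Reasoning)
open Matching
open UnitPairing using (pairing)
open Simplex
open Balance
open Cayley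
open Converse

module _ (e : ℕ) (v : Fin (suc (suc (e + e))) → Pt (suc (e + e))) (indep : AffIndep v)
  (basic : (j : Fin (suc (suc (e + e)))) → IsBasic (λ i → v (punchIn j i))) (empty : NoInteriorPoints e v) where

  private
    C : CyclicQuotient v
    C = cyclicQuotient v indep (basic zero)

    open CyclicQuotient C

    A : Fin (suc (suc (e + e))) → ℕ
    A = residue e v basic C empty

    opposite : ∀ i j → (A i + A j) % suc n-1 ≡ 0 → ∃ λ s → a i ℤ.+ a j ≡ + suc n-1 ℤ.* s
    opposite i j A≡0 = go (m%n≡0⇒n∣m (A i + A j) (suc n-1) A≡0)
      where
      n : ℤ
      n = + suc n-1
      go : suc n-1 ∣ A i + A j → ∃ λ s → a i ℤ.+ a j ≡ n ℤ.* s
      go (divides k eq) = + k ℤ.+ (a i /ℕ suc n-1) ℤ.+ (a j /ℕ suc n-1) , (begin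
        a i ℤ.+ a j ≡⟨ cong₂ ℤ._+_ (a≡a%ℕn+[a/ℕn]*n (a i) (suc n-1)) (a≡a%ℕn+[a/ℕn]*n (a j) (suc n-1)) ⟩
        (+ A i ℤ.+ (a i /ℕ suc n-1) ℤ.* n) ℤ.+ (+ A j ℤ.+ (a j /ℕ suc n-1) ℤ.* n) ≡⟨ regroup (+ A i) (+ A j) (a i /ℕ suc n-1) (a j /ℕ suc n-1) n ⟩
        + (A i + A j) ℤ.+ ((a i /ℕ suc n-1) ℤ.+ (a j /ℕ suc n-1)) ℤ.* n ≡⟨ cong (λ z → z ℤ.+ ((a i /ℕ suc n-1) ℤ.+ (a j /ℕ suc n-1)) ℤ.* n) (trans (cong +_ eq) (ℤ.pos-* k (suc n-1))) ⟩
        + k ℤ.* n ℤ.+ ((a i /ℕ suc n-1) ℤ.+ (a j /ℕ suc n-1)) ℤ.* n                  ≡⟨ factor (+ k) (a i /ℕ suc n-1) (a j /ℕ suc n-1) n ⟩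
        n ℤ.* (+ k ℤ.+ (a i /ℕ suc n-1) ℤ.+ (a j /ℕ suc n-1))                        ∎)
        where
        open ≡-Reasoning
        regroup : ∀ x y p q n → (x ℤ.+ p ℤ.* n) ℤ.+ (y ℤ.+ q ℤ.* n) ≡ (x ℤ.+ y) ℤ.+ (p ℤ.+ q) ℤ.* n
        regroup = solve-∀
        factor : ∀ k p q n → k ℤ.* n ℤ.+ (p ℤ.+ q) ℤ.* n ≡ n ℤ.* (k ℤ.+ p ℤ.+ q)
        factor = solve-∀

    paired : ∃ λ (P : Pairing (suc e) (λ i j → (A i + A j) % suc n-1 ≡ 0)) → Pairing.σ P zero ≡ zero
    paired = pairing (suc n-1) e (cong suc (sym (ℕ.+-suc e e))) A (residue-coprime e v basic C empty) (balance e v basic C empty)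

  segments : IsCayleyOfSegments (suc e) v
  segments = go paired
    where
    go : (∃ λ (P : Pairing (suc e) (λ i j → (A i + A j) % suc n-1 ≡ 0)) → Pairing.σ P zero ≡ zero) → IsCayleyOfSegments (suc e) v
    go (P , σ-zero) = Construction.cayley v indep C (record { σ = σ ; σ′ = σ′ ; ν = ν ; ν-σ = ν-σ ; ν-σ′ = ν-σ′ ; σ-ν = σ-ν ; opp = λ i → opposite (σ i) (σ′ i) (opp i) }) σ-zero
      where open Pairing P

theorem1p6 : (e : ℕ) → (v : Fin (suc (suc (e + e))) → Pt (suc (e + e))) →
    AffIndep v →
    ((j : Fin (suc (suc (e + e)))) → IsBasic (λ i → v (punchIn j i))) →
    (NoInteriorPoints e v ⇔ IsCayleyOfSegments (suc e) v)
theorem1p6 e v indep basic = mk⇔ (segments e v indep basic)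
  λ { (a , b , _ , φ , iso , maps) k 1≤k k≤e x interior → ℕ.<⇒≱ (interior-multiple-bound v a b φ iso maps k x 1≤k interior) k≤e }
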